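{- Let $(\vartheta_0,k)$ be one of the pairs $(0.729,2)$, $(0.616,3)$, $(0.554,4)$, $(0.515,5)$, and suppose that some $\vartheta>\vartheta_0$ satisfies both conditions (A) and (B) below. Let $\mathcal H=\{h_i\}_{i=1}^k$ be an admissible $k$-tuple and let $r\ne 0$ be a fixed integer with $r\notin\mathcal H$. Then there are infinitely many integers $n$ such that either (i) $n+\mathcal H=\{n+h_i\}_{i=1}^k$ contains at least two primes, or (ii) $n+h_i$ is prime for some $h_i\in\mathcal H$ and $\lambda(n+r)=-1$.
   Context: A $k$-tuple $\mathcal H=\{h_i\}_{i=1}^k$ of integers $0\le h_1<\dots<h_k$ is admissible if for every prime $p$ its elements do not occupy all residue classes modulo $p$. $\Omega(n)$ is the number of prime factors of $n$ counted with multiplicity and $\lambda(n)=(-1)^{\Omega(n)}$. Condition (A) (level of distribution $\vartheta$ of primes): for every $\varepsilon>0$, $A>0$, $\sum_{q\le N^{\vartheta-\varepsilon}}\max_{a:(a,q)=1}\bigl|\sum_{p\le N,\,p\equiv a\ (\mathrm{mod}\ q)}\log p-\frac{N}{\varphi(q)}\bigr|\ll_{\varepsilon,A}\frac{N}{(\log N)^A}$ ($p$ ranging over primes). Condition (B): for every $\varepsilon>0$, $A>0$, $\sum_{q\le N^{\vartheta-\varepsilon}}\max_{y\le N}\max_a\bigl|\sum_{n\le y,\,n\equiv a\ (\mathrm{mod}\ q)}\lambda(n)\bigr|\ll_{\varepsilon,A}\frac{N}{(\log N)^A}$. -}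

module Defs where

open import Axiom.ExcludedMiddle using (ExcludedMiddle)
open import Data.Fin.Base as Fin using (Fin)
open import Data.Integer.Base as ℤ using (ℤ; +_)
open import Data.List.Base using (List; []; _∷_; map; filter; foldr; length; upTo)
open import Data.List.Membership.Propositional using (_∉_)
open import Data.Nat.Base as ℕ using (ℕ; zero; suc; _!)
open import Data.Nat.Coprimality using (Coprime; coprime?)
open import Data.Nat.Divisibility using (_∣_; _∣?_)
import Data.Nat.Properties as ℕ
open import Data.Nat.Primality using (Prime; prime?)
open import Data.Nat.Primality.Factorisation using (factorise; factors)
open import Data.Product.Base using (∃; ∃₂; ∃-syntax; _×_; _,_)
open import Data.Rational.Base as ℚ using (ℚ; 0ℚ; 1ℚ)
import Data.Rational.Properties as ℚ
open import Data.Rational.Solver using (module +-*-Solver)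
open import Function.Base using (_∘_)
open import Level using (0ℓ)
open import Relation.Binary.Core using (Rel)
open import Relation.Binary.PropositionalEquality
  using (_≡_; refl; sym; trans; cong; cong₂; subst)
open import Relation.Nullary using (¬_; Dec; yes; no)
open import Relation.Nullary.Decidable using (_×-dec_)

------------------------------------------------------------------------
-- Real numbers: Cauchy sequences of rationals, with equality _≈_

IsCauchy : (ℕ → ℚ) → Set
IsCauchy s = ∀ ε → 0ℚ ℚ.< ε →
  ∃[ N ] ∀ m n → N ℕ.≤ m → N ℕ.≤ n → ℚ.∣ s m ℚ.- s n ∣ ℚ.< ε

record ℝ : Set where
  constructor mkℝ
  field
    approx : ℕ → ℚ
    cauchy : IsCauchy approx

open ℝ public

private
  half-pos : ∀ {ε} → 0ℚ ℚ.< ε → 0ℚ ℚ.< ℚ.½ ℚ.* ε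
  half-pos {ε} ε>0 = ℚ.positive⁻¹ (ℚ.½ ℚ.* ε)
    {{ℚ.pos*pos⇒pos ℚ.½ ε {{ℚ.positive ε>0}}}}

  half+half : ∀ ε → ℚ.½ ℚ.* ε ℚ.+ ℚ.½ ℚ.* ε ≡ ε
  half+half ε = trans (sym (ℚ.*-distribʳ-+ ε ℚ.½ ℚ.½)) (ℚ.*-identityˡ ε)

  const-cauchy : ∀ q → IsCauchy (λ _ → q)
  const-cauchy q ε ε>0 = 0 , λ _ _ _ _ →
    subst (ℚ._< ε) (sym (cong ℚ.∣_∣ (ℚ.+-inverseʳ q))) ε>0

  neg-cauchy : ∀ {s} → IsCauchy s → IsCauchy (λ n → ℚ.- s n)
  neg-cauchy {s} cs ε ε>0 with cs ε ε>0
  ... | N , h = N , λ m n N≤m N≤n → subst (ℚ._< ε) (eq (s m) (s n)) (h m n N≤m N≤n)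
    where
    eq : ∀ a b → ℚ.∣ a ℚ.- b ∣ ≡ ℚ.∣ ℚ.- a ℚ.- ℚ.- b ∣
    eq a b = trans (sym (ℚ.∣-p∣≡∣p∣ (a ℚ.- b)))
                   (cong ℚ.∣_∣ (ℚ.neg-distrib-+ a (ℚ.- b)))

  +-cauchy : ∀ {s t} → IsCauchy s → IsCauchy t → IsCauchy (λ n → s n ℚ.+ t n)
  +-cauchy {s} {t} cs ct ε ε>0
    with cs (ℚ.½ ℚ.* ε) (half-pos ε>0) | ct (ℚ.½ ℚ.* ε) (half-pos ε>0)
  ... | M , f | N , g = M ℕ.⊔ N , λ m n p q → begin-strict
    ℚ.∣ (s m ℚ.+ t m) ℚ.- (s n ℚ.+ t n) ∣
      ≡⟨ cong ℚ.∣_∣ (rearrange (s m) (t m) (s n) (t n)) ⟩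
    ℚ.∣ (s m ℚ.- s n) ℚ.+ (t m ℚ.- t n) ∣
      ≤⟨ ℚ.∣p+q∣≤∣p∣+∣q∣ (s m ℚ.- s n) (t m ℚ.- t n) ⟩
    ℚ.∣ s m ℚ.- s n ∣ ℚ.+ ℚ.∣ t m ℚ.- t n ∣
      <⟨ ℚ.+-mono-< (f m n (ℕ.m⊔n≤o⇒m≤o M N p) (ℕ.m⊔n≤o⇒m≤o M N q))
                    (g m n (ℕ.m⊔n≤o⇒n≤o M N p) (ℕ.m⊔n≤o⇒n≤o M N q)) ⟩
    ℚ.½ ℚ.* ε ℚ.+ ℚ.½ ℚ.* ε
      ≡⟨ half+half ε ⟩
    ε ∎
    where
    open ℚ.≤-Reasoning
    rearrange : ∀ a b c d → (a ℚ.+ b) ℚ.- (c ℚ.+ d) ≡ (a ℚ.- c) ℚ.+ (b ℚ.- d)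
    rearrange = solve 4
      (λ a b c d → (a :+ b) :- (c :+ d) := (a :- c) :+ (b :- d)) refl
      where open +-*-Solver

  bounded : ∀ {s} → IsCauchy s →
    ∃₂ λ B N → 0ℚ ℚ.< B × (∀ n → N ℕ.≤ n → ℚ.∣ s n ∣ ℚ.≤ B)
  bounded {s} cs with cs 1ℚ (ℚ.positive⁻¹ 1ℚ)
  ... | N , h = 1ℚ ℚ.+ ℚ.∣ s N ∣ , N , pos , bd
    where
    pos : 0ℚ ℚ.< 1ℚ ℚ.+ ℚ.∣ s N ∣
    pos = ℚ.+-mono-<-≤ (ℚ.positive⁻¹ 1ℚ) (ℚ.0≤∣p∣ (s N))
    split : ∀ a b → a ≡ (a ℚ.- b) ℚ.+ b
    split = solve 2 (λ a b → a := (a :- b) :+ b) refl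
      where open +-*-Solver
    bd : ∀ n → N ℕ.≤ n → ℚ.∣ s n ∣ ℚ.≤ 1ℚ ℚ.+ ℚ.∣ s N ∣
    bd n N≤n = begin
      ℚ.∣ s n ∣                             ≡⟨ cong ℚ.∣_∣ (split (s n) (s N)) ⟩
      ℚ.∣ (s n ℚ.- s N) ℚ.+ s N ∣           ≤⟨ ℚ.∣p+q∣≤∣p∣+∣q∣ (s n ℚ.- s N) (s N) ⟩
      ℚ.∣ s n ℚ.- s N ∣ ℚ.+ ℚ.∣ s N ∣
        ≤⟨ ℚ.+-monoˡ-≤ ℚ.∣ s N ∣ (ℚ.<⇒≤ (h n N N≤n ℕ.≤-refl)) ⟩
      1ℚ ℚ.+ ℚ.∣ s N ∣                      ∎
      where open ℚ.≤-Reasoning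

  divide : ∀ D ε → 0ℚ ℚ.< D → 0ℚ ℚ.< ε → ∃[ δ ] 0ℚ ℚ.< δ × D ℚ.* δ ≡ ε
  divide D ε D>0 ε>0 = D⁻¹ ℚ.* ε , ℚ.positive⁻¹ (D⁻¹ ℚ.* ε) {{δ-pos}} ,
    trans (sym (ℚ.*-assoc D D⁻¹ ε))
      (trans (cong (ℚ._* ε) (ℚ.*-inverseʳ D {{D≢0}})) (ℚ.*-identityˡ ε))
    where
    D≢0 : ℚ.NonZero D
    D≢0 = ℚ.pos⇒nonZero D {{ℚ.positive D>0}}
    D⁻¹ : ℚ
    D⁻¹ = (ℚ.1/ D) {{D≢0}}
    δ-pos : ℚ.Positive (D⁻¹ ℚ.* ε)
    δ-pos = ℚ.pos*pos⇒pos D⁻¹ {{ℚ.1/pos⇒pos D {{ℚ.positive D>0}}}}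
                          ε {{ℚ.positive ε>0}}

  scale : ∀ E δ a b → 0ℚ ℚ.< E → ℚ.∣ a ∣ ℚ.≤ E → ℚ.∣ b ∣ ℚ.< δ →
          ℚ.∣ a ℚ.* b ∣ ℚ.< E ℚ.* δ
  scale E δ a b E>0 a≤E b<δ = begin-strict
    ℚ.∣ a ℚ.* b ∣          ≡⟨ ℚ.∣p*q∣≡∣p∣*∣q∣ a b ⟩
    ℚ.∣ a ∣ ℚ.* ℚ.∣ b ∣    ≤⟨ ℚ.*-monoʳ-≤-nonNeg ℚ.∣ b ∣ {{ℚ.∣-∣-nonNeg b}} a≤E ⟩
    E ℚ.* ℚ.∣ b ∣          <⟨ ℚ.*-monoʳ-<-pos E {{ℚ.positive E>0}} b<δ ⟩
    E ℚ.* δ                ∎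
    where open ℚ.≤-Reasoning

  rearrange-* : ∀ a b c d →
    a ℚ.* b ℚ.- c ℚ.* d ≡ a ℚ.* (b ℚ.- d) ℚ.+ d ℚ.* (a ℚ.- c)
  rearrange-* a b c d = trans (telescope (a ℚ.* b) (a ℚ.* d) (c ℚ.* d))
    (sym (cong₂ ℚ._+_ (distrib a b d)
      (trans (distrib d a c) (cong₂ ℚ._-_ (ℚ.*-comm d a) (ℚ.*-comm d c)))))
    where
    telescope : ∀ x y z → x ℚ.- z ≡ (x ℚ.- y) ℚ.+ (y ℚ.- z)
    telescope = solve 3 (λ x y z → x :- z := (x :- y) :+ (y :- z)) refl
      where open +-*-Solver
    distrib : ∀ a b c → a ℚ.* (b ℚ.- c) ≡ a ℚ.* b ℚ.- a ℚ.* c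
    distrib a b c = trans (ℚ.*-distribˡ-+ a b (ℚ.- c))
                          (cong (a ℚ.* b ℚ.+_) (sym (ℚ.neg-distribʳ-* a c)))

  *-close : ∀ B C δ a b c d → 0ℚ ℚ.< B → 0ℚ ℚ.< C →
    ℚ.∣ a ∣ ℚ.≤ B → ℚ.∣ d ∣ ℚ.≤ C → ℚ.∣ a ℚ.- c ∣ ℚ.< δ → ℚ.∣ b ℚ.- d ∣ ℚ.< δ →
    ℚ.∣ a ℚ.* b ℚ.- c ℚ.* d ∣ ℚ.< (B ℚ.+ C) ℚ.* δ
  *-close B C δ a b c d B>0 C>0 a≤B d≤C ac bd = begin-strict
    ℚ.∣ a ℚ.* b ℚ.- c ℚ.* d ∣
      ≡⟨ cong ℚ.∣_∣ (rearrange-* a b c d) ⟩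
    ℚ.∣ a ℚ.* (b ℚ.- d) ℚ.+ d ℚ.* (a ℚ.- c) ∣
      ≤⟨ ℚ.∣p+q∣≤∣p∣+∣q∣ (a ℚ.* (b ℚ.- d)) (d ℚ.* (a ℚ.- c)) ⟩
    ℚ.∣ a ℚ.* (b ℚ.- d) ∣ ℚ.+ ℚ.∣ d ℚ.* (a ℚ.- c) ∣
      <⟨ ℚ.+-mono-< (scale B δ a (b ℚ.- d) B>0 a≤B bd)
                    (scale C δ d (a ℚ.- c) C>0 d≤C ac) ⟩
    B ℚ.* δ ℚ.+ C ℚ.* δ
      ≡⟨ sym (ℚ.*-distribʳ-+ δ B C) ⟩
    (B ℚ.+ C) ℚ.* δ ∎
    where open ℚ.≤-Reasoning

  *-cauchy : ∀ {s t} → IsCauchy s → IsCauchy t → IsCauchy (λ n → s n ℚ.* t n)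
  *-cauchy {s} {t} cs ct ε ε>0 =
    let
      (B , K , B>0 , s≤B) = bounded {s} cs
      (C , L , C>0 , t≤C) = bounded {t} ct
      (δ , δ>0 , eq)      = divide (B ℚ.+ C) ε (ℚ.+-mono-< B>0 C>0) ε>0
      (P , f)             = cs δ δ>0
      (Q , g)             = ct δ δ>0
    in (K ℕ.⊔ L) ℕ.⊔ (P ℕ.⊔ Q) , λ m n p q →
      let
        P⊔Q≤m = ℕ.m⊔n≤o⇒n≤o (K ℕ.⊔ L) (P ℕ.⊔ Q) p
        P⊔Q≤n = ℕ.m⊔n≤o⇒n≤o (K ℕ.⊔ L) (P ℕ.⊔ Q) q
        K≤m   = ℕ.m⊔n≤o⇒m≤o K L (ℕ.m⊔n≤o⇒m≤o (K ℕ.⊔ L) (P ℕ.⊔ Q) p)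
        L≤n   = ℕ.m⊔n≤o⇒n≤o K L (ℕ.m⊔n≤o⇒m≤o (K ℕ.⊔ L) (P ℕ.⊔ Q) q)
      in subst (ℚ.∣ s m ℚ.* t m ℚ.- s n ℚ.* t n ∣ ℚ.<_) eq
        (*-close B C δ (s m) (t m) (s n) (t n) B>0 C>0 (s≤B m K≤m) (t≤C n L≤n)
          (f m n (ℕ.m⊔n≤o⇒m≤o P Q P⊔Q≤m) (ℕ.m⊔n≤o⇒m≤o P Q P⊔Q≤n))
          (g m n (ℕ.m⊔n≤o⇒n≤o P Q P⊔Q≤m) (ℕ.m⊔n≤o⇒n≤o P Q P⊔Q≤n)))

infix  4 _≈_ _<_ _≤_
infixl 6 _+_ _-_
infixl 7 _*_
infix  8 -_
infixr 8 _^ℕ_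

_+_ _*_ : ℝ → ℝ → ℝ
x + y = mkℝ (λ n → approx x n ℚ.+ approx y n)
            (+-cauchy {approx x} {approx y} (cauchy x) (cauchy y))
x * y = mkℝ (λ n → approx x n ℚ.* approx y n)
            (*-cauchy {approx x} {approx y} (cauchy x) (cauchy y))

-_ : ℝ → ℝ
- x = mkℝ (λ n → ℚ.- approx x n) (neg-cauchy {approx x} (cauchy x))

_-_ : ℝ → ℝ → ℝ
x - y = x + (- y)

fromℚ : ℚ → ℝ
fromℚ q = mkℝ (λ _ → q) (const-cauchy q)

fromℤ : ℤ → ℝ
fromℤ z = fromℚ (z ℚ./ 1)

fromℕ : ℕ → ℝ
fromℕ n = fromℤ (+ n)

0ℝ 1ℝ : ℝ
0ℝ = fromℕ 0
1ℝ = fromℕ 1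

_≈_ _<_ _≤_ : Rel ℝ 0ℓ
x ≈ y = ∀ ε → 0ℚ ℚ.< ε →
  ∃[ N ] ∀ n → N ℕ.≤ n → ℚ.∣ approx x n ℚ.- approx y n ∣ ℚ.< ε
x < y = ∃[ ε ] 0ℚ ℚ.< ε ×
  (∃[ N ] ∀ n → N ℕ.≤ n → approx x n ℚ.+ ε ℚ.≤ approx y n)
x ≤ y = ¬ (y < x)

sum : List ℝ → ℝ
sum = foldr _+_ 0ℝ

_^ℕ_ : ℝ → ℕ → ℝ
x ^ℕ zero  = 1ℝ
x ^ℕ suc n = x * (x ^ℕ n)

------------------------------------------------------------------------
-- Arithmetic functions

Ω : ℕ → ℕ
Ω zero      = 0
Ω n@(suc _) = length (factors (factorise n))

liouville : ℕ → ℤ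
liouville n = ℤ.-1ℤ ℤ.^ Ω n

φ : ℕ → ℕ
φ q = length (filter (λ a → coprime? a q) (upTo q))

_≡_[mod_] : ℕ → ℕ → ℕ → Set
m ≡ n [mod q ] = q ∣ ℕ.∣ m - n ∣

_≡?_[mod_] : ∀ m n q → Dec (m ≡ n [mod q ])
m ≡? n [mod q ] = q ∣? ℕ.∣ m - n ∣

[1⋯_] : ℕ → List ℕ
[1⋯ n ] = map suc (upTo n)

------------------------------------------------------------------------
-- Classical real analysis

module _ (em : ExcludedMiddle 0ℓ) where

  infix  4 _⟶_ _≪_
  infixl 6 _⊔_
  infixl 7 _/_
  infixr 8 _^_
  infix  9 _⁻¹

  -- An element satisfying P, or the default value if there is none.  In
  -- every use below P determines its element uniquely (up to _≈_ on ℝ),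
  -- so this is definite description.
  choose : {A : Set} → A → (A → Set) → A
  choose default P with em {P = ∃ P}
  ... | yes (x , _) = x
  ... | no  _       = default

  ∣_∣ : ℝ → ℝ
  ∣ x ∣ with em {P = x < 0ℝ}
  ... | yes _ = - x
  ... | no  _ = x

  _⊔_ : ℝ → ℝ → ℝ
  x ⊔ y with em {P = x ≤ y}
  ... | yes _ = y
  ... | no  _ = x

  -- Only applied to lists of non-negative reals, so that starting the
  -- fold from 0 does no harm.
  max : List ℝ → ℝ
  max = foldr _⊔_ 0ℝ

  ⌊_⌋ : ℝ → ℕ
  ⌊ x ⌋ = choose 0 (λ n → fromℕ n ≤ x × x < fromℕ (suc n))

  _⁻¹ : ℝ → ℝ
  x ⁻¹ = choose 0ℝ (λ y → x * y ≈ 1ℝ)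

  _/_ : ℝ → ℝ → ℝ
  x / y = x * (y ⁻¹)

  _⟶_ : (ℕ → ℝ) → ℝ → Set
  s ⟶ l = ∀ ε → 0ℝ < ε → ∃[ N ] ∀ n → N ℕ.≤ n → ∣ s n - l ∣ < ε

  lim : (ℕ → ℝ) → ℝ
  lim s = choose 0ℝ (s ⟶_)

  exp : ℝ → ℝ
  exp x = lim (λ n → sum (map (λ k → (x ^ℕ k) / fromℕ (k !)) (upTo n)))

  log : ℝ → ℝ
  log x = choose 0ℝ (λ y → exp y ≈ x)

  -- The real power x ^ y for a base x > 0.
  _^_ : ℝ → ℝ → ℝ
  x ^ y = exp (y * log x)

  _≪_ : (ℕ → ℝ) → (ℕ → ℝ) → Set
  f ≪ g = ∃₂ λ C N₀ → ∀ N → N₀ ℕ.≤ N → ∣ f N ∣ ≤ C * g N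

  ----------------------------------------------------------------------
  -- Levels of distribution.  A maximum over residues a modulo q is taken
  -- over the representatives 0 ≤ a < q.

  primeLogSum : (N q a : ℕ) → ℝ
  primeLogSum N q a =
    sum (map (log ∘ fromℕ)
      (filter (λ p → prime? p ×-dec p ≡? a [mod q ]) [1⋯ N ]))

  liouvilleSum : (y q a : ℕ) → ℝ
  liouvilleSum y q a =
    sum (map (fromℤ ∘ liouville) (filter (λ n → n ≡? a [mod q ]) [1⋯ y ]))

  PrimesHaveLevel : ℝ → Set
  PrimesHaveLevel ϑ = ∀ ε A → 0ℝ < ε → 0ℝ < A →
    (λ N → sum (map (λ q →
               max (map (λ a → ∣ primeLogSum N q a - fromℕ N / fromℕ (φ q) ∣)
                        (filter (λ a → coprime? a q) (upTo q))))
             [1⋯ ⌊ fromℕ N ^ (ϑ - ε) ⌋ ]))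
      ≪ (λ N → fromℕ N / (log (fromℕ N) ^ A))

  LiouvilleHasLevel : ℝ → Set
  LiouvilleHasLevel ϑ = ∀ ε A → 0ℝ < ε → 0ℝ < A →
    (λ N → sum (map (λ q →
               max (map (λ y →
                 max (map (λ a → ∣ liouvilleSum y q a ∣) (upTo q)))
               [1⋯ N ]))
             [1⋯ ⌊ fromℕ N ^ (ϑ - ε) ⌋ ]))
      ≪ (λ N → fromℕ N / (log (fromℕ N) ^ A))

------------------------------------------------------------------------
-- Tuples

IsIncreasing : ∀ {k} → (Fin k → ℕ) → Set
IsIncreasing h = ∀ {i j} → i Fin.< j → h i ℕ.< h j

Admissible : ∀ {k} → (Fin k → ℕ) → Set
Admissible h = ∀ p → Prime p → ¬ (∀ a → ∃[ i ] h i ≡ a [mod p ])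

IsPrime : ℤ → Set
IsPrime z = ∃[ p ] z ≡ + p × Prime p

-- z is a positive integer with λ(z) = -1 (positivity is automatic, as
-- liouville 0 ≡ 1).
HasLiouville-1 : ℤ → Set
HasLiouville-1 z = ∃[ m ] z ≡ + m × liouville m ≡ ℤ.-1ℤ

AtLeastTwoPrimes : ∀ {k} → (Fin k → ℕ) → ℤ → Set
AtLeastTwoPrimes h n =
  ∃₂ λ i j → i Fin.< j × IsPrime (n ℤ.+ + h i) × IsPrime (n ℤ.+ + h j)

InfinitelyMany : (ℤ → Set) → Set
InfinitelyMany P = ∀ (ns : List ℤ) → ∃[ n ] n ∉ ns × P n

levelPairs : List (ℚ × ℕ)
levelPairs =
    (+ 729 ℚ./ 1000 , 2)
  ∷ (+ 616 ℚ./ 1000 , 3)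
  ∷ (+ 554 ℚ./ 1000 , 4)
  ∷ (+ 515 ℚ./ 1000 , 5)
  ∷ []

{-# OPTIONS --safe #-}
module Submission where

-- If the conclusion fails for all large n, then 2 ∑ᵢ 1_ℙ(n + hᵢ) ≤ 1 + λ(n + r) for these n.  This is averaged
-- with the weights Λ(n)² of a Selberg sieve for the n ≤ N in a residue class modulo W = D! for which all n + hᵢ are
-- coprime to W.  By (B) the average of λ is negligible, and by (A) the averages of 1_ℙ(n + hᵢ) are quadratic forms
-- in the coefficients y of the sieve.  The sieve is diagonalised in advance: Λ = ∑ y(r) ∏_{p ∣ r} (g(p) − (1 + g(p)) ι(p))
-- with orthogonal terms, so the main terms are sums of squares over squarefree numbers free of small primes.  For y a
-- step function of log r with jumps at the powers of a fixed T they are bounded by binomial sums 𝒰 and 𝒱, since the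
-- sums of 1 / m over the rough m in (T^a, T^(a + 1)] are all nearly equal: no prime number theorem is needed.  With
-- N = T^J a contradiction follows from 2 k 𝒱 > J 𝒰, which is verified numerically for linear y.  The sieve estimates
-- take place in ℚ, with the real logarithm replaced by rational approximations using H(N) − 1 ≤ log N ≤ H(N).

open import Algebra.Bundles using (CommutativeRing)
import Algebra.Solver.Ring as RingSolver
import Algebra.Solver.Ring.AlmostCommutativeRing as ACR
open import Axiom.ExcludedMiddle using (ExcludedMiddle)
import Data.Bool.Base as Bool
open import Data.Empty using (⊥; ⊥-elim)
open import Data.Fin.Base as Fin using (Fin)
import Data.Fin.Properties as Fin
open import Data.Integer.Base as Z using (-[1+_]; ℤ)
import Data.Integer.Properties as Z
open import Data.List.Base using (List; []; _∷_; allFin; applyUpTo; filter; foldr; length; map; upTo)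
open import Data.List.Membership.Propositional using (_∈_; _∉_)
open import Data.List.Membership.Propositional.Properties using (∈-filter⁺; ∈-filter⁻; ∈-map⁺; ∈-map⁻; ∈-upTo⁺; ∈-upTo⁻)
open import Data.List.Properties using (length-filter; length-map; length-tabulate; length-upTo)
open import Data.List.Relation.Binary.Sublist.Propositional using ([]; _∷_; _∷ʳ_; _⊆_)
open import Data.List.Relation.Unary.All as All using (All; []; _∷_)
open import Data.List.Relation.Unary.AllPairs using ([]; _∷_)
open import Data.List.Relation.Unary.Any using (here; there)
open import Data.List.Relation.Unary.Unique.Propositional using (Unique)
open import Data.List.Relation.Unary.Unique.Propositional.Properties using (allFin⁺; map⁺)
open import Data.Maybe.Base using (Maybe; just; nothing)
open import Data.Nat.Base as N using (NonTrivial; NonZero; _!; suc; s≤s; zero; z≤n; ℕ)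
open import Data.Nat.Coprimality as Coprime using (Coprime; coprime-Bézout; coprime-divisor; coprime?)
open import Data.Nat.DivMod as N using (m%n<n; m≡m%n+[m/n]*n)
open import Data.Nat.Divisibility
open import Data.Nat.GCD using (module Bézout)
open import Data.Nat.ListAction using (product)
open import Data.Nat.Primality
import Data.Nat.Properties as N
open import Data.Nat.Solver using (module +-*-Solver)
open import Data.Nat.Tactic.RingSolver using (solve-∀)
open import Data.Product.Base using (_,_; _×_; proj₁; proj₂; ∃; ∃-syntax)
open import Data.Rational.Base as Q using (ℚ)
import Data.Rational.Properties as Q
open import Data.Sum.Base using ([_,_]′; _⊎_; inj₁; inj₂)
open import Data.Unit.Base using (tt; ⊤)
open import Defs as R using (0ℝ; 1ℝ; Admissible; AtLeastTwoPrimes; HasLiouville-1; IsIncreasing; IsPrime; [1⋯_]; _≈_; _≡?_[mod_]; _≡_[mod_]; fromℕ; fromℤ; liouville; mkℝ; Ω; φ; ℝ) renaming (approx to at; fromℚ to ρ)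
open import Function.Base using (_∘_; id)
open import Level using (0ℓ)
open import Relation.Binary.Bundles using (Poset)
open import Relation.Binary.Definitions using (tri<; tri>; tri≈)
open import Relation.Binary.PropositionalEquality
open import Relation.Nullary using (Dec; no; yes; ¬_)
open import Relation.Nullary.Decidable using (_×-dec_)
open import Relation.Unary using (Decidable; Pred)

-- The inequality 2 ∑ᵢ 1_ℙ ≤ 1 + λ holds because two primes are excluded and a single prime forces
-- λ(n + r) = 1. So a weighted mean of more than 1/2 primes among the n + hᵢ gives a contradiction,
-- where a bare pigeonhole argument would need more than 1. Let h be the sum of 1 / m over the rough
-- m in one cell, known only to lie between h⁻ and h⁺. The sum of squares for all n is about h^k 𝒰
-- and carries the factor log N φ(W) / W, about J h; the one for primes is about h^(k + 1) 𝒱. Both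
-- sides have degree k + 1 in h, so that only h⁺ / h⁻ matters. This ratio tends to 1 when T grows
-- with D fixed, while a large D tames the Euler products. The constants come from R = T^M and R² W
-- ≤ N^ϑ₀ with W ≤ T, which follows from (2 M + 1) / J ≤ ϑ₀. In 𝒰 and 𝒱 weakly and strictly
-- increasing chains of cells stand for iterated integrals, and M must be large because the margin
-- at ϑ₀ is small.

infix  4 _≤_ _<_
infixl 6 _+_ _-_
infixl 7 _*_
infix  8 -_

-- Rational arithmetic and a ring solver with integer coefficients

opaque
  int : ℤ → ℚ
  int z = z Q./ 1

  _+_ _*_ : ℚ → ℚ → ℚ
  _+_ = Q._+_
  _*_ = Q._*_

  -_ : ℚ → ℚ
  -_ = Q.-_

  _≤_ _<_ : ℚ → ℚ → Set
  _≤_ = Q._≤_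
  _<_ = Q._<_

  -- The default `inv 0` = 0 makes `inv` multiplicative on all of ℕ and keeps it between 0 and 1.
  inv : ℕ → ℚ
  inv zero = int (Z.+ 0)
  inv (suc n) = Z.+ 1 Q./ suc n

nat : ℕ → ℚ
nat n = int (Z.+ n)

0# 1# : ℚ
0# = nat 0
1# = nat 1

_-_ : ℚ → ℚ → ℚ
x - y = x + - y

opaque
  unfolding int _+_ _*_ -_ inv _≤_ _<_

  private
    mk : ℤ → ℚ
    mk z = Q.mkℚ z 0 (Coprime.sym (Coprime.1-coprimeTo _))

    -- The quotient z / 1 is normalised by a gcd and does not reduce for a variable z. The literal
    -- fraction with denominator 1 does, and the homomorphism laws can be read off from it.
    int≡ : ∀ z → int z ≡ mk z
    int≡ z = Q.↥p/↧p≡p (mk z)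

  int-+ : ∀ a b → int (a Z.+ b) ≡ int a + int b
  int-+ a b rewrite int≡ a | int≡ b | Z.*-identityʳ a | Z.*-identityʳ b = refl

  int-* : ∀ a b → int (a Z.* b) ≡ int a * int b
  int-* a b rewrite int≡ a | int≡ b = refl

  int-neg : ∀ a → int (Z.- a) ≡ - int a
  int-neg a = trans (int≡ (Z.- a)) (trans (aux a) (cong Q.-_ (sym (int≡ a))))
    where
    aux : ∀ a → mk (Z.- a) ≡ Q.- mk a
    aux (Z.+ zero) = refl
    aux (Z.+ suc n) = refl
    aux -[1+ n ] = refl

  +-*-commutativeRing : CommutativeRing 0ℓ 0ℓ
  +-*-commutativeRing = record
    { Carrier = ℚ ; _≈_ = _≡_ ; _+_ = _+_ ; _*_ = _*_ ; -_ = -_ ; 0# = 0# ; 1# = 1#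
    ; isCommutativeRing = Q.+-*-isCommutativeRing }

  +-assoc : ∀ x y z → x + y + z ≡ x + (y + z)
  +-assoc = Q.+-assoc
  +-comm : ∀ x y → x + y ≡ y + x
  +-comm = Q.+-comm
  +-identityˡ : ∀ x → 0# + x ≡ x
  +-identityˡ = Q.+-identityˡ
  +-identityʳ : ∀ x → x + 0# ≡ x
  +-identityʳ = Q.+-identityʳ
  +-inverseʳ : ∀ x → x + - x ≡ 0#
  +-inverseʳ = Q.+-inverseʳ
  *-assoc : ∀ x y z → x * y * z ≡ x * (y * z)
  *-assoc = Q.*-assoc
  *-comm : ∀ x y → x * y ≡ y * x
  *-comm = Q.*-comm
  *-identityˡ : ∀ x → 1# * x ≡ x
  *-identityˡ = Q.*-identityˡ
  *-identityʳ : ∀ x → x * 1# ≡ x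
  *-identityʳ = Q.*-identityʳ
  *-distribˡ : ∀ x y z → x * (y + z) ≡ x * y + x * z
  *-distribˡ = Q.*-distribˡ-+
  *-distribʳ : ∀ x y z → (y + z) * x ≡ y * x + z * x
  *-distribʳ = Q.*-distribʳ-+
  *-zeroˡ : ∀ x → 0# * x ≡ 0#
  *-zeroˡ = Q.*-zeroˡ
  *-zeroʳ : ∀ x → x * 0# ≡ 0#
  *-zeroʳ = Q.*-zeroʳ

  ≤-refl : ∀ {x} → x ≤ x
  ≤-refl = Q.≤-refl
  ≤-trans : ∀ {x y z} → x ≤ y → y ≤ z → x ≤ z
  ≤-trans = Q.≤-trans
  ≤-antisym : ∀ {x y} → x ≤ y → y ≤ x → x ≡ y
  ≤-antisym = Q.≤-antisym
  ≤-total : ∀ x y → x ≤ y ⊎ y ≤ x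
  ≤-total = Q.≤-total
  _≤?_ : ∀ x y → Dec (x ≤ y)
  _≤?_ = Q._≤?_
  <⇒≤ : ∀ {x y} → x < y → x ≤ y
  <⇒≤ = Q.<⇒≤
  ≰⇒> : ∀ {x y} → ¬ (x ≤ y) → y < x
  ≰⇒> = Q.≰⇒>
  <⇒≱ : ∀ {x y} → x < y → ¬ (y ≤ x)
  <⇒≱ x<y y≤x = Q.<-irrefl refl (Q.<-≤-trans x<y y≤x)
  <-≤-trans : ∀ {x y z} → x < y → y ≤ z → x < z
  <-≤-trans = Q.<-≤-trans
  ≤-<-trans : ∀ {x y z} → x ≤ y → y < z → x < z
  ≤-<-trans = Q.≤-<-trans
  +-mono-≤ : ∀ {x y u v} → x ≤ y → u ≤ v → x + u ≤ y + v
  +-mono-≤ = Q.+-mono-≤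
  +-mono-<-≤ : ∀ {x y u v} → x < y → u ≤ v → x + u < y + v
  +-mono-<-≤ = Q.+-mono-<-≤
  *-monoˡ-≤ : ∀ {c x y} → 0# ≤ c → x ≤ y → c * x ≤ c * y
  *-monoˡ-≤ {c} 0≤c x≤y = Q.*-monoˡ-≤-nonNeg c {{Q.nonNegative 0≤c}} x≤y
  *-monoˡ-< : ∀ {c x y} → 0# < c → x < y → c * x < c * y
  *-monoˡ-< {c} 0<c x<y = Q.*-monoʳ-<-pos c {{Q.positive 0<c}} x<y
  *-cancelˡ-≤ : ∀ {c x y} → 0# < c → c * x ≤ c * y → x ≤ y
  *-cancelˡ-≤ {c} 0<c le = Q.*-cancelˡ-≤-pos c {{Q.positive 0<c}} le

  nat-mono : ∀ {m n} → m N.≤ n → nat m ≤ nat n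
  nat-mono {m} {n} m≤n rewrite int≡ (Z.+ m) | int≡ (Z.+ n) =
    Q.*≤* (Z.*-monoʳ-≤-nonNeg (Z.+ 1) (Z.+≤+ m≤n))

  nat-cancel : ∀ {m n} → nat m ≤ nat n → m N.≤ n
  nat-cancel {m} {n} le rewrite int≡ (Z.+ m) | int≡ (Z.+ n) with le
  ... | Q.*≤* le' rewrite Z.*-identityʳ (Z.+ m) | Z.*-identityʳ (Z.+ n) = Z.drop‿+≤+ le'

  nat*inv : ∀ n → nat (suc n) * inv (suc n) ≡ 1#
  nat*inv n = Q.toℚᵘ-injective (begin
      Q.toℚᵘ (nat (suc n) Q.* (Z.+ 1 Q./ suc n))
        ≈⟨ Q.toℚᵘ-homo-* (nat (suc n)) (Z.+ 1 Q./ suc n) ⟩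
      Q.toℚᵘ (nat (suc n)) ℚᵘ.* Q.toℚᵘ (Z.+ 1 Q./ suc n)
        ≈⟨ ℚᵘ.*-cong (Q.toℚᵘ-fromℚᵘ (ℚᵘ.mkℚᵘ (Z.+ suc n) 0)) (Q.toℚᵘ-fromℚᵘ (ℚᵘ.mkℚᵘ (Z.+ 1) n)) ⟩
      ℚᵘ.mkℚᵘ (Z.+ suc n) 0 ℚᵘ.* ℚᵘ.mkℚᵘ (Z.+ 1) n
        ≈⟨ ℚᵘ.*≡* (cong Z.+_ (eq n)) ⟩
      Q.toℚᵘ 1# ∎)
    where
    import Data.Rational.Unnormalised.Base as ℚᵘ
    import Data.Rational.Unnormalised.Properties as ℚᵘ
    open import Relation.Binary.Reasoning.Setoid ℚᵘ.≃-setoid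
    eq : ∀ n → suc n N.* 1 N.* 1 ≡ suc (n N.+ 0 N.+ 0)
    eq n = trans (N.*-identityʳ _) (trans (N.*-identityʳ _) (cong suc (sym (trans (N.+-identityʳ _) (N.+-identityʳ _)))))

  0<1 : 0# < 1#
  0<1 = Q.positive⁻¹ 1#

  ∣_∣ : ℚ → ℚ
  ∣_∣ = Q.∣_∣

  ∣-∣-cases : ∀ x → (0# ≤ x → ∣ x ∣ ≡ x)
  ∣-∣-cases x = Q.0≤p⇒∣p∣≡p

  ∣-∣-triangle : ∀ x y → ∣ x + y ∣ ≤ ∣ x ∣ + ∣ y ∣
  ∣-∣-triangle = Q.∣p+q∣≤∣p∣+∣q∣

  ∣-∣-* : ∀ x y → ∣ x * y ∣ ≡ ∣ x ∣ * ∣ y ∣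
  ∣-∣-* = Q.∣p*q∣≡∣p∣*∣q∣

  ∣-∣-neg : ∀ x → ∣ - x ∣ ≡ ∣ x ∣
  ∣-∣-neg = Q.∣-p∣≡∣p∣

  0≤∣-∣ : ∀ x → 0# ≤ ∣ x ∣
  0≤∣-∣ = Q.0≤∣p∣

  -- Not the least integer above x: the absolute value of the numerator bounds x because the
  -- denominator is at least 1.
  ceiling : ℚ → ℕ
  ceiling x = Z.∣ Q.↥ x ∣

  ≤-ceiling : ∀ x → x ≤ nat (ceiling x)
  ≤-ceiling (Q.mkℚ (Z.+ n) d c) rewrite int≡ (Z.+ n) =
    Q.*≤* (subst₂ Z._≤_ (sym (Z.*-identityʳ (Z.+ n))) (Z.pos-* n (suc d)) (Z.+≤+ (N.m≤m*n n (suc d))))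
  ≤-ceiling (Q.mkℚ -[1+ n ] d c) rewrite int≡ (Z.+ suc n) =
    Q.*≤* (subst₂ Z._≤_ (sym (Z.*-identityʳ -[1+ n ])) (Z.pos-* (suc n) (suc d)) Z.-≤+)

open CommutativeRing +-*-commutativeRing public using (ring)

+-*-ACR : ACR.AlmostCommutativeRing 0ℓ 0ℓ
+-*-ACR = record
  { Carrier = ℚ ; _≈_ = _≡_ ; _+_ = _+_ ; _*_ = _*_ ; -_ = -_ ; 0# = 0# ; 1# = 1#
  ; isAlmostCommutativeRing = record
    { isCommutativeSemiring = record
       { isSemiring = record
         { isSemiringWithoutAnnihilatingZero = record
           { +-isCommutativeMonoid = record
              { isMonoid = record
                { isSemigroup = record
                  { isMagma = record { isEquivalence = isEquivalence ; ∙-cong = cong₂ _+_ }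
                  ; assoc = +-assoc }
                ; identity = +-identityˡ , +-identityʳ }
              ; comm = +-comm }
           ; *-cong = cong₂ _*_
           ; *-assoc = *-assoc
           ; *-identity = *-identityˡ , *-identityʳ
           ; distrib = *-distribˡ , *-distribʳ }
         ; zero = *-zeroˡ , *-zeroʳ }
       ; *-comm = *-comm }
    ; -‿cong = cong (λ x → - x)
    ; -‿*-distribˡ = neg-*
    ; -‿+-comm = neg-+ } }
  where
  open import Data.Product.Base using (_,_)
  opaque
    unfolding _+_ _*_ -_
    neg-* : ∀ x y → - x * y ≡ - (x * y)
    neg-* x y = sym (Q.neg-distribˡ-* x y)
    neg-+ : ∀ x y → - x + - y ≡ - (x + y)
    neg-+ x y = sym (Q.neg-distrib-+ x y)

-- The solver computes with integer coefficients, whose equality is decided by evaluation, and maps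
-- only the result to ℚ.
intMorphism : (CommutativeRing.rawRing Z.+-*-commutativeRing) ACR.-Raw-AlmostCommutative⟶ +-*-ACR
intMorphism = record
  { ⟦_⟧ = int ; +-homo = int-+ ; *-homo = int-* ; -‿homo = int-neg
  ; 0-homo = refl ; 1-homo = refl }

private
  coeff? : (a b : ℤ) → Maybe (int a ≡ int b)
  coeff? a b with a Z.≟ b
  ... | yes p = just (cong int p)
  ... | no  _ = nothing

module Solver = RingSolver (CommutativeRing.rawRing Z.+-*-commutativeRing) +-*-ACR intMorphism coeff?
open Solver public using (solve; con; _:=_; _:+_; _:*_; _:-_; :-_)

#_ : ∀ {n} → ℕ → Solver.Polynomial n
# k = con (Z.+ k)

infix 9 #_


≡⇒≤ : ∀ {x y} → x ≡ y → x ≤ y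
≡⇒≤ refl = ≤-refl

≤-poset : Poset 0ℓ 0ℓ 0ℓ
≤-poset = record { Carrier = ℚ ; _≈_ = _≡_ ; _≤_ = _≤_ ; isPartialOrder = record
  { isPreorder = record { isEquivalence = isEquivalence ; reflexive = ≡⇒≤ ; trans = ≤-trans }
  ; antisym = ≤-antisym } }

module ≤-Reasoning where
  open import Relation.Binary.Reasoning.PartialOrder ≤-poset public
    hiding (step-≈; step-≈-⟩; step-≈-⟨; step-≈˘)

infixr 5 _·_ _◂_ _◃_

_·_ : {A : Set} {x y z : A} → x ≡ y → y ≡ z → x ≡ z
_·_ = trans

_◂_ : ∀ {x y z} → x ≤ y → y ≤ z → x ≤ z
_◂_ = ≤-trans

_◃_ : ∀ {m n o} → m N.≤ n → n N.≤ o → m N.≤ o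
_◃_ = N.≤-trans

≤-add : ∀ {x y} d → 0# ≤ d → x + d ≡ y → x ≤ y
≤-add {x} {y} d 0≤d eq = subst₂ _≤_ (+-identityʳ x) eq (+-mono-≤ (≤-refl {x}) 0≤d)

0≤y-x : ∀ {x y} → x ≤ y → 0# ≤ y - x
0≤y-x {x} {y} le = subst (_≤ y - x) (+-inverseʳ x) (+-mono-≤ le (≤-refl { - x}))

0≤y-x⇒x≤y : ∀ {x y} → 0# ≤ y - x → x ≤ y
0≤y-x⇒x≤y {x} {y} le = ≤-add (y - x) le (solve 2 (λ x y → x :+ (y :- x) := y) refl x y)

0≤1 : 0# ≤ 1#
0≤1 = <⇒≤ 0<1

+-nonneg : ∀ {x y} → 0# ≤ x → 0# ≤ y → 0# ≤ x + y
+-nonneg {x} {y} p q = subst (_≤ x + y) (+-identityʳ 0#) (+-mono-≤ p q)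

*-nonneg : ∀ {x y} → 0# ≤ x → 0# ≤ y → 0# ≤ x * y
*-nonneg {x} {y} p q = subst (_≤ x * y) (*-zeroʳ x) (*-monoˡ-≤ p q)

*-monoʳ-≤ : ∀ {c x y} → 0# ≤ c → x ≤ y → x * c ≤ y * c
*-monoʳ-≤ {c} {x} {y} p q = subst₂ _≤_ (*-comm c x) (*-comm c y) (*-monoˡ-≤ p q)

*-mono-≤ : ∀ {a b c d} → 0# ≤ a → 0# ≤ c → a ≤ b → c ≤ d → a * c ≤ b * d
*-mono-≤ 0≤a 0≤c a≤b c≤d = *-monoʳ-≤ 0≤c a≤b ◂ *-monoˡ-≤ (0≤a ◂ a≤b) c≤d

neg-mono-≤ : ∀ {x y} → x ≤ y → - y ≤ - x
neg-mono-≤ {x} {y} p = ≤-add (y - x) (0≤y-x p) (solve 2 (λ x y → :- y :+ (y :- x) := :- x) refl x y)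

sq-nonneg : ∀ x → 0# ≤ x * x
sq-nonneg x with ≤-total 0# x
... | inj₁ p = *-nonneg p p
... | inj₂ p = subst (0# ≤_) (solve 1 (λ x → (:- x) :* (:- x) := x :* x) refl x) (*-nonneg q q)
  where
  q : 0# ≤ - x
  q = subst (_≤ - x) (solve 0 (:- # 0 := # 0) refl) (neg-mono-≤ p)

nat-+ : ∀ m n → nat (m N.+ n) ≡ nat m + nat n
nat-+ m n = int-+ (Z.+ m) (Z.+ n)

nat-* : ∀ m n → nat (m N.* n) ≡ nat m * nat n
nat-* m n = cong int (Z.pos-* m n) · int-* (Z.+ m) (Z.+ n)

nat-suc : ∀ n → nat (suc n) ≡ nat n + 1#
nat-suc n = nat-+ 1 n · +-comm 1# (nat n)

0≤nat : ∀ n → 0# ≤ nat n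
0≤nat n = nat-mono N.z≤n

nat-∸ : ∀ {m n} → n N.≤ m → nat (m N.∸ n) ≡ nat m - nat n
nat-∸ {m} {n} n≤m = solve 2 (λ a b → a := (a :+ b) :- b) refl (nat (m N.∸ n)) (nat n) ·
  cong (_- nat n) (sym (nat-+ (m N.∸ n) n) · cong nat (N.m∸n+n≡m n≤m))

<-suc : ∀ n → 0# < nat (suc n)
<-suc n = <-≤-trans 0<1 (nat-mono (N.s≤s N.z≤n))

natinv : ∀ n .{{_ : N.NonZero n}} → nat n * inv n ≡ 1#
natinv (suc n) = nat*inv n

invnat : ∀ n .{{_ : N.NonZero n}} → inv n * nat n ≡ 1#
invnat n = *-comm (inv n) (nat n) · natinv n

0<nat : ∀ n .{{_ : N.NonZero n}} → 0# < nat n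
0<nat (suc n) = <-suc n

*-cancel-≡ : ∀ {c x y} → 0# < c → c * x ≡ c * y → x ≡ y
*-cancel-≡ p eq = ≤-antisym (*-cancelˡ-≤ p (≡⇒≤ eq)) (*-cancelˡ-≤ p (≡⇒≤ (sym eq)))

opaque
  unfolding inv
  inv-zero : inv 0 ≡ 0#
  inv-zero = refl

0≤inv : ∀ n → 0# ≤ inv n
0≤inv zero = ≡⇒≤ (sym inv-zero)
0≤inv (suc n) = *-cancelˡ-≤ (<-suc n)
  (subst₂ _≤_ (sym (*-zeroʳ (nat (suc n)))) (sym (natinv (suc n))) 0≤1)

inv-unique : ∀ n .{{_ : N.NonZero n}} {x} → nat n * x ≡ 1# → x ≡ inv n
inv-unique n eq = *-cancel-≡ (0<nat n) (eq · sym (natinv n))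

inv-* : ∀ m n → inv (m N.* n) ≡ inv m * inv n
inv-* zero n = inv-zero · sym (cong (_* inv n) inv-zero · *-zeroˡ (inv n))
inv-* (suc m) zero = cong inv (N.*-zeroʳ (suc m)) ·
  inv-zero · sym (cong (inv (suc m) *_) inv-zero · *-zeroʳ (inv (suc m)))
inv-* (suc m) (suc n) = sym (inv-unique (suc m N.* suc n) (begin
  nat (suc m N.* suc n) * (inv (suc m) * inv (suc n)) ≡⟨ cong (_* (inv (suc m) * inv (suc n))) (nat-* (suc m) (suc n)) ⟩
  nat (suc m) * nat (suc n) * (inv (suc m) * inv (suc n)) ≡⟨ solve 4 (λ a b c d → a :* b :* (c :* d) := (a :* c) :* (b :* d)) refl (nat (suc m)) (nat (suc n)) (inv (suc m)) (inv (suc n)) ⟩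
  (nat (suc m) * inv (suc m)) * (nat (suc n) * inv (suc n)) ≡⟨ cong₂ _*_ (natinv (suc m)) (natinv (suc n)) ⟩
  1# * 1# ≡⟨ *-identityˡ 1# ⟩
  1# ∎))
  where open ≡-Reasoning

inv-1 : inv 1 ≡ 1#
inv-1 = sym (inv-unique 1 (*-identityˡ 1#))

inv-anti : ∀ {m n} .{{_ : N.NonZero m}} → m N.≤ n → inv n ≤ inv m
inv-anti {m} {suc n} m≤n = *-cancelˡ-≤ (0<nat m) (*-cancelˡ-≤ (<-suc n) (subst₂ _≤_
  (sym (*-identityʳ (nat m)) · (cong (nat m *_) (sym (natinv (suc n))) ·
    solve 3 (λ a b c → a :* (b :* c) := b :* (a :* c)) refl (nat m) (nat (suc n)) (inv (suc n))))
  (sym (*-identityʳ (nat (suc n))) · cong (nat (suc n) *_) (sym (natinv m)))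
  (nat-mono m≤n)))
inv-anti {m} {zero} m≤n = subst (_≤ inv m) (sym inv-zero) (0≤inv m)

inv≤1 : ∀ n → inv n ≤ 1#
inv≤1 zero = subst (_≤ 1#) (sym inv-zero) 0≤1
inv≤1 (suc n) = subst (inv (suc n) ≤_) inv-1 (inv-anti (N.s≤s N.z≤n))

∣-∣≤ : ∀ {x b} → x ≤ b → - x ≤ b → ∣ x ∣ ≤ b
∣-∣≤ {x} {b} p q with ≤-total 0# x
... | inj₁ 0≤x = subst (_≤ b) (sym (∣-∣-cases x 0≤x)) p
... | inj₂ x≤0 = subst (_≤ b) (sym (∣-∣-cases (- x) 0≤-x) · ∣-∣-neg x) q
  where
  0≤-x : 0# ≤ - x
  0≤-x = subst (_≤ - x) (solve 0 (:- # 0 := # 0) refl) (neg-mono-≤ x≤0)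

x≤∣x∣ : ∀ x → x ≤ ∣ x ∣
x≤∣x∣ x with ≤-total 0# x
... | inj₁ 0≤x = ≡⇒≤ (sym (∣-∣-cases x 0≤x))
... | inj₂ x≤0 = x≤0 ◂ 0≤∣-∣ x

-x≤∣x∣ : ∀ x → - x ≤ ∣ x ∣
-x≤∣x∣ x = subst (- x ≤_) (∣-∣-neg x) (x≤∣x∣ (- x))

∣-∣-nonneg : ∀ {x} → 0# ≤ x → ∣ x ∣ ≡ x
∣-∣-nonneg {x} = ∣-∣-cases x

ind : {P : Set} → Dec P → ℚ
ind (yes _) = 1#
ind (no  _) = 0#

0≤ind : {P : Set} (d : Dec P) → 0# ≤ ind d
0≤ind (yes _) = 0≤1
0≤ind (no  _) = ≤-refl

ind≤1 : {P : Set} (d : Dec P) → ind d ≤ 1#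
ind≤1 (yes _) = ≤-refl
ind≤1 (no  _) = 0≤1

ind-mono : {P Q : Set} (d : Dec P) (e : Dec Q) → (P → Q) → ind d ≤ ind e
ind-mono (yes p) (yes q) f = ≤-refl
ind-mono (yes p) (no ¬q) f with () ← ¬q (f p)
ind-mono (no ¬p) e f = 0≤ind e

ind-cong : {P Q : Set} (d : Dec P) (e : Dec Q) → (P → Q) → (Q → P) → ind d ≡ ind e
ind-cong d e f g = ≤-antisym (ind-mono d e f) (ind-mono e d g)

ind-yes : {P : Set} (d : Dec P) → P → ind d ≡ 1#
ind-yes (yes _) _ = refl
ind-yes (no ¬p) p with () ← ¬p p

ind-no : {P : Set} (d : Dec P) → ¬ P → ind d ≡ 0#
ind-no (yes p) ¬p with () ← ¬p p
ind-no (no _) _ = refl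

infixr 8 _^_
_^_ : ℚ → ℕ → ℚ
x ^ zero = 1#
x ^ suc n = x * x ^ n

^-nonneg : ∀ {x} n → 0# ≤ x → 0# ≤ x ^ n
^-nonneg zero    p = 0≤1
^-nonneg (suc n) p = *-nonneg p (^-nonneg n p)

^-mono : ∀ {x y} n → 0# ≤ x → x ≤ y → x ^ n ≤ y ^ n
^-mono zero    p q = ≤-refl
^-mono (suc n) p q = *-mono-≤ p (^-nonneg n p) q (^-mono n p q)

1≤^ : ∀ {x} n → 1# ≤ x → 1# ≤ x ^ n
1≤^ zero    p = ≤-refl
1≤^ {x} (suc n) p = subst (_≤ x * x ^ n) (*-identityˡ 1#) (*-mono-≤ 0≤1 0≤1 p (1≤^ n p))

^-+ : ∀ x m n → x ^ (m N.+ n) ≡ x ^ m * x ^ n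
^-+ x zero    n = sym (*-identityˡ _)
^-+ x (suc m) n = cong (x *_) (^-+ x m n) · sym (*-assoc x (x ^ m) (x ^ n))

^-distrib : ∀ x y n → (x * y) ^ n ≡ x ^ n * y ^ n
^-distrib x y zero = sym (*-identityˡ 1#)
^-distrib x y (suc n) = cong (x * y *_) (^-distrib x y n) ·
  solve 4 (λ a b c d → a :* b :* (c :* d) := a :* c :* (b :* d)) refl x y (x ^ n) (y ^ n)

nat-^ : ∀ m n → nat (m N.^ n) ≡ nat m ^ n
nat-^ m zero = refl
nat-^ m (suc n) = nat-* m (m N.^ n) · cong (nat m *_) (nat-^ m n)

opaque
  unfolding int _+_ _*_ _<_ _≤_

  recip : ∀ {x} → 0# < x → ℚ
  recip {x} x>0 = (Q.1/ x) {{Q.pos⇒nonZero x {{Q.positive x>0}}}}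

  *-recip : ∀ {x} (x>0 : 0# < x) → x * recip x>0 ≡ 1#
  *-recip {x} x>0 = Q.*-inverseʳ x {{Q.pos⇒nonZero x {{Q.positive x>0}}}}

  0≤recip : ∀ {x} (x>0 : 0# < x) → 0# ≤ recip x>0
  0≤recip {x} x>0 = Q.<⇒≤ (Q.positive⁻¹ _ {{Q.1/pos⇒pos x {{Q.positive x>0}}}})

-- Finite sums over ranges and lists

sum : ℕ → (ℕ → ℚ) → ℚ
sum zero    f = 0#
sum (suc n) f = sum n f + f n

sum-cong : ∀ n {f g} → (∀ i → i N.< n → f i ≡ g i) → sum n f ≡ sum n g
sum-cong zero    h = refl
sum-cong (suc n) h = cong₂ _+_ (sum-cong n λ i i<n → h i (N.m<n⇒m<1+n i<n)) (h n N.≤-refl)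

sum-mono : ∀ n {f g} → (∀ i → i N.< n → f i ≤ g i) → sum n f ≤ sum n g
sum-mono zero    h = ≤-refl
sum-mono (suc n) h = +-mono-≤ (sum-mono n λ i i<n → h i (N.m<n⇒m<1+n i<n)) (h n N.≤-refl)

sum-zero : ∀ n {f} → (∀ i → i N.< n → f i ≡ 0#) → sum n f ≡ 0#
sum-zero zero    h = refl
sum-zero (suc n) h = cong₂ _+_ (sum-zero n λ i i<n → h i (N.m<n⇒m<1+n i<n)) (h n N.≤-refl) · +-identityʳ 0#

sum-nonneg : ∀ n {f} → (∀ i → i N.< n → 0# ≤ f i) → 0# ≤ sum n f
sum-nonneg zero    h = ≤-refl
sum-nonneg (suc n) h = +-nonneg (sum-nonneg n λ i i<n → h i (N.m<n⇒m<1+n i<n)) (h n N.≤-refl)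

sum-+ : ∀ n f g → sum n (λ i → f i + g i) ≡ sum n f + sum n g
sum-+ zero    f g = sym (+-identityʳ 0#)
sum-+ (suc n) f g = cong (_+ (f n + g n)) (sum-+ n f g) ·
  solve 4 (λ a b c d → a :+ b :+ (c :+ d) := a :+ c :+ (b :+ d)) refl (sum n f) (sum n g) (f n) (g n)

sum-*ˡ : ∀ n c f → sum n (λ i → c * f i) ≡ c * sum n f
sum-*ˡ zero    c f = sym (*-zeroʳ c)
sum-*ˡ (suc n) c f = cong (_+ c * f n) (sum-*ˡ n c f) · sym (*-distribˡ c (sum n f) (f n))

sum-*ʳ : ∀ n c f → sum n (λ i → f i * c) ≡ sum n f * c
sum-*ʳ n c f = (sum-cong n λ i _ → *-comm (f i) c) · sum-*ˡ n c f · *-comm c (sum n f)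

sum-const : ∀ n c → sum n (λ _ → c) ≡ nat n * c
sum-const zero    c = sym (*-zeroˡ c)
sum-const (suc n) c = cong (_+ c) (sum-const n c) · trans
  (solve 2 (λ n c → n :* c :+ c := (n :+ # 1) :* c) refl (nat n) c)
  (cong (_* c) (sym (nat-suc n)))

sum-append : ∀ m n f → sum (m N.+ n) f ≡ sum m f + sum n (λ i → f (m N.+ i))
sum-append m zero    f rewrite N.+-identityʳ m = sym (+-identityʳ _)
sum-append m (suc n) f rewrite N.+-suc m n =
  cong (_+ f (m N.+ n)) (sum-append m n f) · +-assoc (sum m f) _ _

sum-shift : ∀ n f → sum (suc n) f ≡ f 0 + sum n (f ∘ suc)
sum-shift n f = sum-append 1 n f · cong (_+ sum n (f ∘ suc)) (+-identityˡ (f 0))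

sum-mono-n : ∀ {m n} f → m N.≤ n → (∀ i → 0# ≤ f i) → sum m f ≤ sum n f
sum-mono-n {m} {n} f m≤n h = ≤-add (sum (n N.∸ m) (λ i → f (m N.+ i))) (sum-nonneg (n N.∸ m) λ i _ → h (m N.+ i))
  (sym (sum-append m (n N.∸ m) f) · cong (λ x → sum x f) (N.m+[n∸m]≡n m≤n))

sum-extend : ∀ {m n} f → m N.≤ n → (∀ i → m N.≤ i → f i ≡ 0#) → sum n f ≡ sum m f
sum-extend {m} {n} f m≤n h = begin
  sum n f ≡⟨ cong (λ x → sum x f) (sym (N.m+[n∸m]≡n m≤n)) ⟩
  sum (m N.+ (n N.∸ m)) f ≡⟨ sum-append m (n N.∸ m) f ⟩
  sum m f + sum (n N.∸ m) (λ i → f (m N.+ i)) ≡⟨ cong (sum m f +_) (sum-zero (n N.∸ m) λ i _ → h _ (N.m≤m+n m i)) ⟩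
  sum m f + 0# ≡⟨ +-identityʳ _ ⟩
  sum m f ∎
  where open ≡-Reasoning

sum-swap : ∀ m n (f : ℕ → ℕ → ℚ) → sum m (λ i → sum n (f i)) ≡ sum n (λ j → sum m (λ i → f i j))
sum-swap zero    n f = sym (sum-zero n λ _ _ → refl)
sum-swap (suc m) n f = cong (_+ sum n (f m)) (sum-swap m n f) · sym (sum-+ n _ (f m))

sum-∣-∣ : ∀ n f → ∣ sum n f ∣ ≤ sum n (λ i → ∣ f i ∣)
sum-∣-∣ zero    f = ≡⇒≤ (∣-∣-nonneg ≤-refl)
sum-∣-∣ (suc n) f = ∣-∣-triangle (sum n f) (f n) ◂ +-mono-≤ (sum-∣-∣ n f) ≤-refl

sum-single : ∀ n a (f : ℕ → ℚ) → a N.< n → sum n (λ i → ind (i N.≟ a) * f i) ≡ f a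
sum-single (suc n) a f a<1+n with a N.≟ n
... | yes refl = cong₂ _+_
        (sum-zero n λ i i<n → cong (_* f i) (ind-no (i N.≟ n) (N.<⇒≢ i<n)) · *-zeroˡ (f i))
        (cong (_* f n) (ind-yes (n N.≟ n) refl) · *-identityˡ (f n)) ·
        +-identityˡ (f n)
... | no a≢n = cong₂ _+_
        (sum-single n a f (N.≤∧≢⇒< (N.≤-pred a<1+n) a≢n))
        (cong (_* f n) (ind-no (n N.≟ a) (a≢n ∘ sym)) · *-zeroˡ (f n)) ·
        +-identityʳ (f a)

sumL : {A : Set} → List A → (A → ℚ) → ℚ
sumL []       f = 0#
sumL (x ∷ xs) f = f x + sumL xs f

module _ {A : Set} where

  sumL-cong : (xs : List A) {f g : A → ℚ} → (∀ x → x ∈ xs → f x ≡ g x) → sumL xs f ≡ sumL xs g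
  sumL-cong []       h = refl
  sumL-cong (x ∷ xs) h = cong₂ _+_ (h x (here refl)) (sumL-cong xs λ y p → h y (there p))

  sumL-mono : (xs : List A) {f g : A → ℚ} → (∀ x → x ∈ xs → f x ≤ g x) → sumL xs f ≤ sumL xs g
  sumL-mono []       h = ≤-refl
  sumL-mono (x ∷ xs) h = +-mono-≤ (h x (here refl)) (sumL-mono xs λ y p → h y (there p))

  sumL-*ˡ : (xs : List A) (c : ℚ) (f : A → ℚ) → sumL xs (λ x → c * f x) ≡ c * sumL xs f
  sumL-*ˡ []       c f = sym (*-zeroʳ c)
  sumL-*ˡ (x ∷ xs) c f = cong (c * f x +_) (sumL-*ˡ xs c f) · sym (*-distribˡ c (f x) (sumL xs f))

  sumL-*ʳ : (xs : List A) (c : ℚ) (f : A → ℚ) → sumL xs (λ x → f x * c) ≡ sumL xs f * c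
  sumL-*ʳ xs c f = (sumL-cong xs λ x _ → *-comm (f x) c) · sumL-*ˡ xs c f · *-comm c (sumL xs f)

  sumL-const : (xs : List A) (c : ℚ) → sumL xs (λ _ → c) ≡ nat (length xs) * c
  sumL-const []       c = sym (*-zeroˡ c)
  sumL-const (x ∷ xs) c = cong (c +_) (sumL-const xs c) · trans
    (solve 2 (λ n c → c :+ n :* c := (n :+ # 1) :* c) refl (nat (length xs)) c)
    (cong (_* c) (sym (nat-suc (length xs))))

  sumL-+ : (xs : List A) (f g : A → ℚ) → sumL xs (λ x → f x + g x) ≡ sumL xs f + sumL xs g
  sumL-+ []       f g = sym (+-identityʳ 0#)
  sumL-+ (x ∷ xs) f g = cong (f x + g x +_) (sumL-+ xs f g) ·
    solve 4 (λ a b c d → a :+ b :+ (c :+ d) := a :+ c :+ (b :+ d)) refl (f x) (g x) (sumL xs f) (sumL xs g)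

  sumL-∣-∣ : (xs : List A) (f : A → ℚ) → ∣ sumL xs f ∣ ≤ sumL xs (λ x → ∣ f x ∣)
  sumL-∣-∣ []       f = ≡⇒≤ (∣-∣-nonneg ≤-refl)
  sumL-∣-∣ (x ∷ xs) f = ∣-∣-triangle (f x) (sumL xs f) ◂ +-mono-≤ ≤-refl (sumL-∣-∣ xs f)

  sum-sumL : ∀ n (xs : List A) (f : ℕ → A → ℚ) →
    sum n (λ i → sumL xs (f i)) ≡ sumL xs (λ x → sum n (λ i → f i x))
  sum-sumL n []       f = sum-zero n λ _ _ → refl
  sum-sumL n (x ∷ xs) f = sum-+ n _ _ · cong (sum n (λ i → f i x) +_) (sum-sumL n xs f)

-- Sums over squarefree numbers by recursion on the primes

shift : (ℕ → ℚ) → ℕ → ℕ → ℚ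
shift ψ p r = ψ (p N.* r)

-- S P g ψ is the sum of ψ(r) ∏_{p ∣ r} g(p) over the squarefree products r of elements of P.
S : List ℕ → (ℕ → ℚ) → (ℕ → ℚ) → ℚ
S []      g ψ = ψ 1
S (p ∷ P) g ψ = S P g ψ + g p * S P g (shift ψ p)

Nonneg : {A : Set} → (A → ℚ) → Set
Nonneg f = ∀ x → 0# ≤ f x

Antitone : (ℕ → ℚ) → Set
Antitone ψ = ∀ p r → 1 N.≤ p → ψ (p N.* r) ≤ ψ r

Positive : List ℕ → Set
Positive = All (1 N.≤_)

shift-antitone : ∀ {ψ} p → Antitone ψ → Antitone (shift ψ p)
shift-antitone {ψ} p a q r 1≤q = subst (λ x → ψ x ≤ ψ (p N.* r)) (swap q p r) (a q (p N.* r) 1≤q)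
  where
  swap : ∀ q p r → q N.* (p N.* r) ≡ p N.* (q N.* r)
  swap q p r = sym (N.*-assoc q p r) · cong (N._* r) (N.*-comm q p) · N.*-assoc p q r

S-cong : ∀ P g {ψ ψ'} → (∀ r → ψ r ≡ ψ' r) → S P g ψ ≡ S P g ψ'
S-cong []      g h = h 1
S-cong (p ∷ P) g h = cong₂ _+_ (S-cong P g h) (cong (g p *_) (S-cong P g λ r → h (p N.* r)))

S-+ : ∀ P g ψ ψ' → S P g (λ r → ψ r + ψ' r) ≡ S P g ψ + S P g ψ'
S-+ []      g ψ ψ' = refl
S-+ (p ∷ P) g ψ ψ' rewrite S-+ P g ψ ψ' | S-+ P g (shift ψ p) (shift ψ' p) =
  solve 5 (λ a b c d g → a :+ b :+ g :* (c :+ d) := a :+ g :* c :+ (b :+ g :* d)) refl _ _ _ _ (g p)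

S-* : ∀ P g c ψ → S P g (λ r → c * ψ r) ≡ c * S P g ψ
S-* []      g c ψ = refl
S-* (p ∷ P) g c ψ rewrite S-* P g c ψ | S-* P g c (shift ψ p) =
  solve 4 (λ c a b g → c :* a :+ g :* (c :* b) := c :* (a :+ g :* b)) refl c _ _ (g p)

S-0 : ∀ P g ψ → (∀ r → ψ r ≡ 0#) → S P g ψ ≡ 0#
S-0 P g ψ h = (S-cong P g λ r → h r · sym (*-zeroˡ (ψ r))) · S-* P g 0# ψ · *-zeroˡ _

S-sum : ∀ P g n (f : ℕ → ℕ → ℚ) → S P g (λ r → sum n (λ i → f i r)) ≡ sum n (λ i → S P g (f i))
S-sum P g zero    f = S-0 P g _ (λ _ → refl)
S-sum P g (suc n) f = S-+ P g _ (f n) · cong (_+ S P g (f n)) (S-sum P g n f)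

S-mono : ∀ P {g ψ ψ'} → Nonneg g → (∀ r → ψ r ≤ ψ' r) → S P g ψ ≤ S P g ψ'
S-mono []      g≥0 h = h 1
S-mono (p ∷ P) g≥0 h = +-mono-≤ (S-mono P g≥0 h) (*-monoˡ-≤ (g≥0 p) (S-mono P g≥0 λ r → h (p N.* r)))

S-nonneg : ∀ P {g ψ} → Nonneg g → Nonneg ψ → 0# ≤ S P g ψ
S-nonneg []      g≥0 h = h 1
S-nonneg (p ∷ P) g≥0 h = +-nonneg (S-nonneg P g≥0 h) (*-nonneg (g≥0 p) (S-nonneg P g≥0 λ r → h (p N.* r)))

S-weight-mono : ∀ {P g g' ψ} → Nonneg g → All (λ p → g p ≤ g' p) P → Nonneg ψ → S P g ψ ≤ S P g' ψ
S-weight-mono {[]}    g≥0 []       h = ≤-refl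
S-weight-mono {p ∷ P} g≥0 (le ∷ l) h = +-mono-≤ (S-weight-mono g≥0 l h)
  (*-mono-≤ (g≥0 p) (S-nonneg P g≥0 λ r → h (p N.* r)) le (S-weight-mono g≥0 l λ r → h (p N.* r)))

∏[1+_] : (ℕ → ℚ) → List ℕ → ℚ
∏[1+ ε ] [] = 1#
∏[1+ ε ] (p ∷ P) = (1# + ε p) * ∏[1+ ε ] P

∏-nonneg : ∀ {ε} P → Nonneg ε → 0# ≤ ∏[1+ ε ] P
∏-nonneg []      h = 0≤1
∏-nonneg (p ∷ P) h = *-nonneg (+-nonneg 0≤1 (h p)) (∏-nonneg P h)

-- Changing the weight at p by `ε p` adds `ε p` times a sum over multiples of p, and an antitone ψ
-- bounds this sum by the full one. So each prime costs a factor 1 + `ε p`.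
S-perturb : ∀ {P g g' ε ψ} → Nonneg g → Nonneg g' → Nonneg ε → Nonneg ψ → Antitone ψ →
  Positive P → All (λ p → g p ≤ g' p + ε p) P → S P g ψ ≤ ∏[1+ ε ] P * S P g' ψ
S-perturb {[]} {ψ = ψ} _ _ _ _ _ _ _ = ≡⇒≤ (sym (*-identityˡ (ψ 1)))
S-perturb {p ∷ P} {g} {g'} {ε} {ψ} g≥0 g'≥0 ε≥0 ψ≥0 anti (1≤p ∷ pos) (le ∷ l) = begin
  S P g ψ + g p * S P g (shift ψ p) ≤⟨ +-mono-≤ (S-perturb g≥0 g'≥0 ε≥0 ψ≥0 anti pos l)
         (*-mono-≤ (g≥0 p) (S-nonneg P g≥0 (λ r → ψ≥0 (p N.* r))) le
           (S-perturb g≥0 g'≥0 ε≥0 (λ r → ψ≥0 (p N.* r)) (shift-antitone p anti) pos l)) ⟩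
  Π * A + (g' p + ε p) * (Π * A') ≤⟨ ≤-add (Π * (ε p * (A - A')) + Π * (ε p * (g' p * A')))
         (+-nonneg (*-nonneg Π≥0 (*-nonneg (ε≥0 p) (0≤y-x (S-mono P g'≥0 λ r → anti p r 1≤p))))
           (*-nonneg Π≥0 (*-nonneg (ε≥0 p) (*-nonneg (g'≥0 p) (S-nonneg P g'≥0 λ r → ψ≥0 (p N.* r))))))
         (solve 5 (λ Π A A' g ε → Π :* A :+ (g :+ ε) :* (Π :* A') :+ (Π :* (ε :* (A :- A')) :+ Π :* (ε :* (g :* A')))
                    := (# 1 :+ ε) :* Π :* (A :+ g :* A')) refl Π A A' (g' p) (ε p)) ⟩
  (1# + ε p) * Π * (A + g' p * A') ∎
  where
  open ≤-Reasoning
  Π = ∏[1+ ε ] P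
  Π≥0 = ∏-nonneg P ε≥0
  A = S P g' ψ
  A' = S P g' (shift ψ p)

S² : List ℕ → (α β ψ : ℕ → ℚ) → ℚ
S² P α β ψ = S P α (λ v → S P β (λ u → ψ (v N.* u)))

private
  rot : ∀ v p u → v N.* (p N.* u) ≡ p N.* (v N.* u)
  rot v p u = sym (N.*-assoc v p u) · cong (N._* u) (N.*-comm v p) · N.*-assoc p v u

-- The variables v and u may share primes: p divides exactly one of them, with total weight α + β,
-- or both, with weight α β and the argument p² v u.
S²-∷ : ∀ p P α β ψ → S² (p ∷ P) α β ψ ≡
  S² P α β ψ + (α p + β p) * S² P α β (shift ψ p) + α p * β p * S² P α β (shift (shift ψ p) p)
S²-∷ p P α β ψ = begin
  S P α (λ v → S P β (λ u → ψ (v N.* u)) + β p * S P β (λ u → ψ (v N.* (p N.* u))))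
    + α p * S P α (λ v → S P β (λ u → ψ (p N.* v N.* u)) + β p * S P β (λ u → ψ (p N.* v N.* (p N.* u)))) ≡⟨ cong₂ (λ x y → x + α p * y)
         (S-+ P α _ _ · cong (S² P α β ψ +_) (S-* P α (β p) _ ·
            cong (β p *_) (S-cong P α λ v → S-cong P β λ u → cong ψ (rot v p u))))
         (S-+ P α _ _ · cong₂ _+_ (S-cong P α λ v → S-cong P β λ u → cong ψ (N.*-assoc p v u))
            (S-* P α (β p) _ · cong (β p *_) (S-cong P α λ v → S-cong P β λ u → cong ψ (rot2 v u)))) ⟩
  S² P α β ψ + β p * S² P α β (shift ψ p) + α p * (S² P α β (shift ψ p) + β p * S² P α β (shift (shift ψ p) p)) ≡⟨ solve 5 (λ a b c α β → a :+ β :* b :+ α :* (b :+ β :* c) := a :+ (α :+ β) :* b :+ α :* β :* c) refl _ _ _ (α p) (β p) ⟩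
  S² P α β ψ + (α p + β p) * S² P α β (shift ψ p) + α p * β p * S² P α β (shift (shift ψ p) p) ∎
  where
  open ≡-Reasoning
  rot2 : ∀ v u → p N.* v N.* (p N.* u) ≡ p N.* (p N.* (v N.* u))
  rot2 v u = N.*-assoc p v (p N.* u) · cong (p N.*_) (rot v p u)

S²-nonneg : ∀ P {α β ψ} → Nonneg α → Nonneg β → Nonneg ψ → 0# ≤ S² P α β ψ
S²-nonneg P α≥0 β≥0 ψ≥0 = S-nonneg P α≥0 λ v → S-nonneg P β≥0 λ u → ψ≥0 (v N.* u)

-- The coprime pairs alone suffice: each prime of m = v u chooses one of the two variables, which
-- accounts for the weight α + β.
S≤S² : ∀ {P α β γ ψ} → Nonneg α → Nonneg β → Nonneg γ → Nonneg ψ →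
  All (λ p → γ p ≤ α p + β p) P → S P γ ψ ≤ S² P α β ψ
S≤S² {[]} _ _ _ _ _ = ≤-refl
S≤S² {p ∷ P} {α} {β} {γ} {ψ} α≥0 β≥0 γ≥0 ψ≥0 (le ∷ l) = begin
  S P γ ψ + γ p * S P γ (shift ψ p) ≤⟨ +-mono-≤ (S≤S² α≥0 β≥0 γ≥0 ψ≥0 l)
         (*-mono-≤ (γ≥0 p) (S-nonneg P γ≥0 λ r → ψ≥0 (p N.* r)) le (S≤S² α≥0 β≥0 γ≥0 (λ r → ψ≥0 (p N.* r)) l)) ⟩
  S² P α β ψ + (α p + β p) * S² P α β (shift ψ p) ≤⟨ ≤-add _ (*-nonneg (*-nonneg (α≥0 p) (β≥0 p)) (S²-nonneg P α≥0 β≥0 λ r → ψ≥0 (p N.* (p N.* r)))) refl ⟩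
  S² P α β ψ + (α p + β p) * S² P α β (shift ψ p) + α p * β p * S² P α β (shift (shift ψ p) p) ≡⟨ sym (S²-∷ p P α β ψ) ⟩
  S² (p ∷ P) α β ψ ∎
  where open ≤-Reasoning

-- A prime dividing both v and u produces the argument p² v u, where an antitone ψ is at most its
-- value at p v u. Hence it counts as a single p of weight α β.
S²≤S : ∀ {P α β γ ψ} → Nonneg α → Nonneg β → Nonneg ψ → Antitone ψ → Positive P →
  All (λ p → α p + β p + α p * β p ≤ γ p) P → S² P α β ψ ≤ S P γ ψ
S²≤S {[]} _ _ _ _ _ _ = ≤-refl
S²≤S {p ∷ P} {α} {β} {γ} {ψ} α≥0 β≥0 ψ≥0 anti (1≤p ∷ pos) (le ∷ l) = begin
  S² (p ∷ P) α β ψ ≡⟨ S²-∷ p P α β ψ ⟩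
  S² P α β ψ + (α p + β p) * S² P α β (shift ψ p) + α p * β p * S² P α β (shift (shift ψ p) p) ≤⟨ +-mono-≤ ≤-refl (*-monoˡ-≤ (*-nonneg (α≥0 p) (β≥0 p))
         (S-mono P α≥0 λ v → S-mono P β≥0 λ u → anti p (p N.* (v N.* u)) 1≤p)) ⟩
  S² P α β ψ + (α p + β p) * S² P α β (shift ψ p) + α p * β p * S² P α β (shift ψ p) ≡⟨ solve 4 (λ a b α β → a :+ (α :+ β) :* b :+ α :* β :* b := a :+ (α :+ β :+ α :* β) :* b) refl _ _ (α p) (β p) ⟩
  S² P α β ψ + (α p + β p + α p * β p) * S² P α β (shift ψ p) ≤⟨ +-mono-≤ (S²≤S α≥0 β≥0 ψ≥0 anti pos l)
         (*-mono-≤ (+-nonneg (+-nonneg (α≥0 p) (β≥0 p)) (*-nonneg (α≥0 p) (β≥0 p)))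
            (S²-nonneg P α≥0 β≥0 λ r → ψ≥0 (p N.* r)) le
            (S²≤S α≥0 β≥0 (λ r → ψ≥0 (p N.* r)) (shift-antitone p anti) pos l)) ⟩
  S P γ ψ + γ p * S P γ (shift ψ p) ∎
  where open ≤-Reasoning

-- Cutoffs and sums over sets of primes

χ : ℕ → ℕ → ℚ
χ x r = ind (r N.≤? x)

χ≥0 : ∀ x → Nonneg (χ x)
χ≥0 x r = 0≤ind (r N.≤? x)

χ-antitone : ∀ x → Antitone (χ x)
χ-antitone x p r 1≤p = ind-mono (p N.* r N.≤? x) (r N.≤? x)
  (λ le → subst (N._≤ p N.* r) (N.*-identityˡ r) (N.*-monoˡ-≤ r 1≤p) ◃ le)

χ-mono : ∀ {x y} → x N.≤ y → ∀ r → χ x r ≤ χ y r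
χ-mono {x} {y} x≤y r = ind-mono (r N.≤? x) (r N.≤? y) (λ le → le ◃ x≤y)

m*n≤o⇒n≤o/m : ∀ m n o .{{_ : NonZero m}} → m N.* n N.≤ o → n N.≤ o N./ m
m*n≤o⇒n≤o/m m n o le = subst (N._≤ o N./ m) (cong (N._/ m) (N.*-comm m n) · N.m*n/n≡m n m) (N./-monoˡ-≤ m le)

n≤o/m⇒m*n≤o : ∀ m n o .{{_ : NonZero m}} → n N.≤ o N./ m → m N.* n N.≤ o
n≤o/m⇒m*n≤o m n o le = N.*-monoʳ-≤ m le ◃
  subst (N._≤ o) (N.*-comm (o N./ m) m) (N.m/n*n≤m o m)

χ-shift : ∀ x p r .{{_ : NonZero p}} → χ x (p N.* r) ≡ χ (x N./ p) r
χ-shift x p r = ind-cong (p N.* r N.≤? x) (r N.≤? x N./ p) (m*n≤o⇒n≤o/m p r x) (n≤o/m⇒m*n≤o p r x)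

-- Z K P E is the sum of K^∣U∣ E(U) over the sublists U of P.
Z : ℚ → List ℕ → (List ℕ → ℚ) → ℚ
Z K []      E = E []
Z K (p ∷ P) E = Z K P E + K * Z K P (E ∘ (p ∷_))

Z-mono : ∀ {K} P {E E'} → 0# ≤ K → (∀ U → U ⊆ P → E U ≤ E' U) → Z K P E ≤ Z K P E'
Z-mono []      K≥0 h = h [] []
Z-mono (p ∷ P) K≥0 h = +-mono-≤ (Z-mono P K≥0 λ U s → h U (p ∷ʳ s))
  (*-monoˡ-≤ K≥0 (Z-mono P K≥0 λ U s → h (p ∷ U) (refl ∷ s)))

Z-nonneg : ∀ {K} P {E} → 0# ≤ K → Nonneg E → 0# ≤ Z K P E
Z-nonneg []      K≥0 h = h []
Z-nonneg (p ∷ P) K≥0 h = +-nonneg (Z-nonneg P K≥0 h) (*-nonneg K≥0 (Z-nonneg P K≥0 λ U → h (p ∷ U)))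

Z-+ : ∀ K P E E' → Z K P (λ U → E U + E' U) ≡ Z K P E + Z K P E'
Z-+ K []      E E' = refl
Z-+ K (p ∷ P) E E' rewrite Z-+ K P E E' | Z-+ K P (E ∘ (p ∷_)) (E' ∘ (p ∷_)) =
  solve 5 (λ a b c d g → a :+ b :+ g :* (c :+ d) := a :+ g :* c :+ (b :+ g :* d)) refl _ _ _ _ K

Z-* : ∀ K P c E → Z K P (λ U → c * E U) ≡ c * Z K P E
Z-* K []      c E = refl
Z-* K (p ∷ P) c E rewrite Z-* K P c E | Z-* K P c (E ∘ (p ∷_)) =
  solve 4 (λ c a b g → c :* a :+ g :* (c :* b) := c :* (a :+ g :* b)) refl c _ _ K

Z-power : ∀ K L P E → Z K P (λ U → L ^ length U * E U) ≡ Z (K * L) P E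
Z-power K L []      E = *-identityˡ (E [])
Z-power K L (p ∷ P) E = cong₂ _+_ (Z-power K L P E) (begin
  K * Z K P (λ U → L * L ^ length U * E (p ∷ U)) ≡⟨ cong (K *_) ((Z-cong P λ U → *-assoc L (L ^ length U) (E (p ∷ U))) · Z-* K P L _) ⟩
  K * (L * Z K P (λ U → L ^ length U * E (p ∷ U))) ≡⟨ sym (*-assoc K L _) ⟩
  K * L * Z K P (λ U → L ^ length U * E (p ∷ U)) ≡⟨ cong (K * L *_) (Z-power K L P (E ∘ (p ∷_))) ⟩
  K * L * Z (K * L) P (E ∘ (p ∷_)) ∎)
  where
  open ≡-Reasoning
  Z-cong : ∀ P {E E'} → (∀ U → E U ≡ E' U) → Z K P E ≡ Z K P E'
  Z-cong []      h = h []
  Z-cong (q ∷ P) h = cong₂ _+_ (Z-cong P h) (cong (K *_) (Z-cong P λ U → h (q ∷ U)))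

-- From K^ω ≤ b + K^{2ω}/b; the factor c makes the induction go through.
Z-split : ∀ {K} b b⁻¹ c P {E} → b * b⁻¹ ≡ 1# → 0# ≤ b → 0# ≤ b⁻¹ → Nonneg E →
  c * Z K P E ≤ b * Z 1# P E + b⁻¹ * (c * c * Z (K * K) P E)
Z-split b b⁻¹ c [] {E} eq b≥0 b⁻¹≥0 E≥0 = ≤-add (b⁻¹ * ((b * (b * E []) - b * (c * E [])) + c * c * E []) )
  (*-nonneg b⁻¹≥0 (subst (0# ≤_) (solve 3 (λ b c e → ((b :- c) :* (b :- c) :+ b :* c) :* e := b :* (b :* e) :- b :* (c :* e) :+ c :* c :* e) refl b c (E []))
     (*-nonneg sq≥0 (E≥0 []))))
  (solve 4 (λ b b⁻¹ c e → c :* e :+ b⁻¹ :* (b :* (b :* e) :- b :* (c :* e) :+ c :* c :* e)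
            := c :* e :+ (b :* b⁻¹) :* (b :* e) :- (b :* b⁻¹) :* (c :* e) :+ b⁻¹ :* (c :* c :* e)) refl b b⁻¹ c (E []) ·
   (cong (λ t → c * E [] + t * (b * E []) - t * (c * E []) + b⁻¹ * (c * c * E [])) eq ·
     solve 4 (λ b b⁻¹ c e → c :* e :+ # 1 :* (b :* e) :- # 1 :* (c :* e) :+ b⁻¹ :* (c :* c :* e)
            := b :* e :+ b⁻¹ :* (c :* c :* e)) refl b b⁻¹ c (E [])))
  where
  sq≥0 : 0# ≤ (b - c) * (b - c) + b * c
  sq≥0 = *-cancelˡ-≤ (<-suc 1) (≤-add ((b - c) * (b - c) + (b * b + c * c))
    (+-nonneg (sq-nonneg (b - c)) (+-nonneg (sq-nonneg b) (sq-nonneg c)))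
    (solve 2 (λ b c → # 2 :* # 0 :+ ((b :- c) :* (b :- c) :+ (b :* b :+ c :* c)) := # 2 :* ((b :- c) :* (b :- c) :+ b :* c)) refl b c))
Z-split {K} b b⁻¹ c (p ∷ P) {E} eq b≥0 b⁻¹≥0 E≥0 = begin
  c * (Z K P E + K * Z K P E') ≡⟨ solve 4 (λ c k x y → c :* (x :+ k :* y) := c :* x :+ (c :* k) :* y) refl c K _ _ ⟩
  c * Z K P E + c * K * Z K P E' ≤⟨ +-mono-≤ (Z-split b b⁻¹ c P eq b≥0 b⁻¹≥0 E≥0) (Z-split b b⁻¹ (c * K) P eq b≥0 b⁻¹≥0 λ U → E≥0 (p ∷ U)) ⟩
  b * Z 1# P E + b⁻¹ * (c * c * Z (K * K) P E) + (b * Z 1# P E' + b⁻¹ * (c * K * (c * K) * Z (K * K) P E')) ≡⟨ solve 8 (λ b b⁻¹ c k x y u v → b :* x :+ b⁻¹ :* (c :* c :* u) :+ (b :* y :+ b⁻¹ :* (c :* k :* (c :* k) :* v))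
           := b :* (x :+ # 1 :* y) :+ b⁻¹ :* (c :* c :* (u :+ k :* k :* v))) refl b b⁻¹ c K _ _ _ _ ⟩
  b * (Z 1# P E + 1# * Z 1# P E') + b⁻¹ * (c * c * (Z (K * K) P E + K * K * Z (K * K) P E')) ∎
  where
  open ≤-Reasoning
  E' = E ∘ (p ∷_)

Z≡S : ∀ P {K} ψ → Z K P (ψ ∘ product) ≡ S P (λ _ → K) ψ
Z≡S []      ψ = refl
Z≡S (p ∷ P) {K} ψ = cong₂ (λ x y → x + K * y) (Z≡S P ψ) (Z≡S P (shift ψ p))

-- The sieve weight and its quadratic form

-- The function n ↦ Λ of the sieve, where ι is the indicator of the primes dividing ∏(n + hᵢ):
-- the sum over squarefree r of y(r) ∏_{p ∣ r} (g(p) − (1 + g(p)) ι(p)).  When ι has mean g/(1 + g),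
-- the factors have mean zero and second moment g, so distinct r are orthogonal.
Λ : List ℕ → (g ι y : ℕ → ℚ) → ℚ
Λ []      g ι y = y 1
Λ (p ∷ P) g ι y = Λ P g ι y + (g p - (1# + g p) * ι p) * Λ P g ι (shift y p)

∏ : (ℕ → ℚ) → List ℕ → ℚ
∏ ι [] = 1#
∏ ι (p ∷ U) = ι p * ∏ ι U

-- The expectation of Λ(y) Λ(z) if Ψ(U) is the expectation of ∏_{p ∈ U} ι(p).
B : List ℕ → (g : ℕ → ℚ) → (List ℕ → ℚ) → (y z : ℕ → ℚ) → ℚ
B []      g Ψ y z = y 1 * z 1 * Ψ []
B (p ∷ P) g Ψ y z =
  B P g Ψ y z + g p * (B P g Ψ yₚ z + B P g Ψ y zₚ) + g p * g p * B P g Ψ yₚ zₚ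
    - (1# + g p) * (B P g Ψₚ yₚ z + B P g Ψₚ y zₚ) + (1# - g p * g p) * B P g Ψₚ yₚ zₚ
  where
  yₚ = shift y p
  zₚ = shift z p
  Ψₚ = Ψ ∘ (p ∷_)

private
  combine : ∀ a₁ a₂ a₃ a₄ a₅ a₆ a₇ b₁ b₂ b₃ b₄ b₅ b₆ b₇ c g →
    a₁ + c * b₁ + g * (a₂ + c * b₂ + (a₃ + c * b₃)) + g * g * (a₄ + c * b₄)
      - (1# + g) * (a₅ + c * b₅ + (a₆ + c * b₆)) + (1# - g * g) * (a₇ + c * b₇)
    ≡ a₁ + g * (a₂ + a₃) + g * g * a₄ - (1# + g) * (a₅ + a₆) + (1# - g * g) * a₇
      + c * (b₁ + g * (b₂ + b₃) + g * g * b₄ - (1# + g) * (b₅ + b₆) + (1# - g * g) * b₇)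
  combine = solve 16 (λ a₁ a₂ a₃ a₄ a₅ a₆ a₇ b₁ b₂ b₃ b₄ b₅ b₆ b₇ c g →
    a₁ :+ c :* b₁ :+ g :* (a₂ :+ c :* b₂ :+ (a₃ :+ c :* b₃)) :+ g :* g :* (a₄ :+ c :* b₄)
      :- (# 1 :+ g) :* (a₅ :+ c :* b₅ :+ (a₆ :+ c :* b₆)) :+ (# 1 :- g :* g) :* (a₇ :+ c :* b₇)
    := a₁ :+ g :* (a₂ :+ a₃) :+ g :* g :* a₄ :- (# 1 :+ g) :* (a₅ :+ a₆) :+ (# 1 :- g :* g) :* a₇
      :+ c :* (b₁ :+ g :* (b₂ :+ b₃) :+ g :* g :* b₄ :- (# 1 :+ g) :* (b₅ :+ b₆) :+ (# 1 :- g :* g) :* b₇)) refl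


module _ {g : ℕ → ℚ} where

  B-cong : ∀ P {Ψ Ψ' y y' z z'} → (∀ U → Ψ U ≡ Ψ' U) → (∀ r → y r ≡ y' r) → (∀ r → z r ≡ z' r) →
    B P g Ψ y z ≡ B P g Ψ' y' z'
  B-cong [] h u v = cong₂ _*_ (cong₂ _*_ (u 1) (v 1)) (h [])
  B-cong (p ∷ P) h u v
    rewrite B-cong P h u v | B-cong P h (λ r → u (p N.* r)) v | B-cong P h u (λ r → v (p N.* r))
          | B-cong P h (λ r → u (p N.* r)) (λ r → v (p N.* r))
          | B-cong P (λ U → h (p ∷ U)) (λ r → u (p N.* r)) v | B-cong P (λ U → h (p ∷ U)) u (λ r → v (p N.* r))
          | B-cong P (λ U → h (p ∷ U)) (λ r → u (p N.* r)) (λ r → v (p N.* r)) = refl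

  -- Linearity in Ψ lets the form at a single n be averaged over n, and lets the error be split off
  -- from the model.
  B-linear : ∀ P c Ψ Ψ' y z → B P g (λ U → Ψ U + c * Ψ' U) y z ≡ B P g Ψ y z + c * B P g Ψ' y z
  B-linear [] c Ψ Ψ' y z = solve 5 (λ y z a b c → y :* z :* (a :+ c :* b) := y :* z :* a :+ c :* (y :* z :* b))
    refl (y 1) (z 1) (Ψ []) (Ψ' []) c
  B-linear (p ∷ P) c Ψ Ψ' y z
    rewrite B-linear P c Ψ Ψ' y z | B-linear P c Ψ Ψ' (shift y p) z | B-linear P c Ψ Ψ' y (shift z p)
          | B-linear P c Ψ Ψ' (shift y p) (shift z p)
          | B-linear P c (Ψ ∘ (p ∷_)) (Ψ' ∘ (p ∷_)) (shift y p) z | B-linear P c (Ψ ∘ (p ∷_)) (Ψ' ∘ (p ∷_)) y (shift z p)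
          | B-linear P c (Ψ ∘ (p ∷_)) (Ψ' ∘ (p ∷_)) (shift y p) (shift z p) =
    combine _ _ _ _ _ _ _ _ _ _ _ _ _ _ c (g p)

  B-scale : ∀ P c Ψ y z → B P g (λ U → c * Ψ U) y z ≡ c * B P g Ψ y z
  B-scale P c Ψ y z = begin
    B P g (λ U → c * Ψ U) y z ≡⟨ B-cong P (λ U → solve 2 (λ c x → c :* x := x :+ (c :- # 1) :* x) refl c (Ψ U)) (λ _ → refl) (λ _ → refl) ⟩
    B P g (λ U → Ψ U + (c - 1#) * Ψ U) y z ≡⟨ B-linear P (c - 1#) Ψ Ψ y z ⟩
    B P g Ψ y z + (c - 1#) * B P g Ψ y z ≡⟨ solve 2 (λ c x → x :+ (c :- # 1) :* x := c :* x) refl c _ ⟩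
    c * B P g Ψ y z ∎
    where open ≡-Reasoning

  B-sum : ∀ P n (f : ℕ → List ℕ → ℚ) y z → B P g (λ U → sum n (λ i → f i U)) y z ≡ sum n (λ i → B P g (f i) y z)
  B-sum P zero f y z = B-cong P (λ U → sym (*-zeroˡ 0#)) (λ _ → refl) (λ _ → refl) ·
    B-scale P 0# (λ _ → 0#) y z · *-zeroˡ _
  B-sum P (suc n) f y z = begin
    B P g (λ U → sum n (λ i → f i U) + f n U) y z ≡⟨ B-cong P (λ U → cong (sum n (λ i → f i U) +_) (sym (*-identityˡ (f n U)))) (λ _ → refl) (λ _ → refl) ⟩
    B P g (λ U → sum n (λ i → f i U) + 1# * f n U) y z ≡⟨ B-linear P 1# _ (f n) y z ⟩
    B P g (λ U → sum n (λ i → f i U)) y z + 1# * B P g (f n) y z ≡⟨ cong₂ _+_ (B-sum P n f y z) (*-identityˡ _) ⟩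
    sum n (λ i → B P g (f i) y z) + B P g (f n) y z ∎
    where open ≡-Reasoning

  private
    pull : ∀ P c π y z p → B P g (λ U → c * (π p * ∏ π U)) y z ≡ π p * B P g (λ U → c * ∏ π U) y z
    pull P c π y z p = trans
      (B-cong P (λ U → solve 3 (λ a b c → a :* (b :* c) := b :* (a :* c)) refl c (π p) (∏ π U)) (λ _ → refl) (λ _ → refl))
      (B-scale P (π p) _ y z)

  -- For product densities the coefficients collapse to the mean g - (1 + g) π and the second moment
  -- g² + (1 - g²) π of the local factor g - (1 + g) ι.
  B-∏-∷ : ∀ p P c π y z → B (p ∷ P) g (λ U → c * ∏ π U) y z ≡
    B P g (λ U → c * ∏ π U) y z
      + (g p - (1# + g p) * π p) * (B P g (λ U → c * ∏ π U) (shift y p) z + B P g (λ U → c * ∏ π U) y (shift z p))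
      + (g p * g p + (1# - g p * g p) * π p) * B P g (λ U → c * ∏ π U) (shift y p) (shift z p)
  B-∏-∷ p P c π y z rewrite pull P c π (shift y p) z p | pull P c π y (shift z p) p | pull P c π (shift y p) (shift z p) p =
    solve 6 (λ a b₁ b₂ d g π → a :+ g :* (b₁ :+ b₂) :+ g :* g :* d :- (# 1 :+ g) :* (π :* b₁ :+ π :* b₂) :+ (# 1 :- g :* g) :* (π :* d)
       := a :+ (g :- (# 1 :+ g) :* π) :* (b₁ :+ b₂) :+ (g :* g :+ (# 1 :- g :* g) :* π) :* d) refl _ _ _ _ (g p) (π p)

  -- For an actual indicator, ι² = ι turns the second moment g² + (1 - g²) ι into the square of g -
  -- (1 + g) ι, so that the form factors.
  B-Λ : ∀ {P} c ι y z → All (λ p → ι p * ι p ≡ ι p) P → B P g (λ U → c * ∏ ι U) y z ≡ c * (Λ P g ι y * Λ P g ι z)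
  B-Λ {[]} c ι y z _ = solve 3 (λ c y z → y :* z :* (c :* # 1) := c :* (y :* z)) refl c (y 1) (z 1)
  B-Λ {p ∷ P} c ι y z (idem ∷ l)
    rewrite B-∏-∷ p P c ι y z | B-Λ c ι y z l | B-Λ c ι (shift y p) z l | B-Λ c ι y (shift z p) l | B-Λ c ι (shift y p) (shift z p) l =
    cong (λ t → c * (Y * Z') + (G - (1# + G) * I) * (c * (Yp * Z') + c * (Y * Zp)) + t * (c * (Yp * Zp))) sq ·
      solve 7 (λ c y y' z z' g i → c :* (y :* z) :+ (g :- (# 1 :+ g) :* i) :* (c :* (y' :* z) :+ c :* (y :* z'))
            :+ (g :- (# 1 :+ g) :* i) :* (g :- (# 1 :+ g) :* i) :* (c :* (y' :* z'))
          := c :* ((y :+ (g :- (# 1 :+ g) :* i) :* y') :* (z :+ (g :- (# 1 :+ g) :* i) :* z'))) refl c Y Yp Z' Zp G I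
    where
    Y = Λ P g ι y
    Yp = Λ P g ι (shift y p)
    Z' = Λ P g ι z
    Zp = Λ P g ι (shift z p)
    G = g p
    I = ι p
    sq : G * G + (1# - G * G) * I ≡ (G - (1# + G) * I) * (G - (1# + G) * I)
    sq = solve 2 (λ g i → g :* g :+ (# 1 :- g :* g) :* i := g :* g :- # 2 :* (g :* (# 1 :+ g)) :* i
                  :+ (# 1 :+ g) :* (# 1 :+ g) :* i) refl G I ·
         (cong (λ t → G * G - nat 2 * (G * (1# + G)) * I + (1# + G) * (1# + G) * t) (sym idem) ·
           solve 2 (λ g i → g :* g :- # 2 :* (g :* (# 1 :+ g)) :* i :+ (# 1 :+ g) :* (# 1 :+ g) :* (i :* i)
               := (g :- (# 1 :+ g) :* i) :* (g :- (# 1 :+ g) :* i)) refl G I)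

  -- The condition (1 + g) π = g says that the local factor has mean 0, which removes the cross
  -- terms. Its second moment is then g² + (1 - g) g = g.
  B-orthogonal : ∀ {P} c π y z → All (λ p → (1# + g p) * π p ≡ g p) P →
    B P g (λ U → c * ∏ π U) y z ≡ c * S P g (λ r → y r * z r)
  B-orthogonal {[]} c π y z _ = solve 3 (λ c y z → y :* z :* (c :* # 1) := c :* (y :* z)) refl c (y 1) (z 1)
  B-orthogonal {p ∷ P} c π y z (eq ∷ l)
    rewrite B-∏-∷ p P c π y z | B-orthogonal c π y z l | B-orthogonal c π (shift y p) (shift z p) l = begin
      c * s₀ + (G - (1# + G) * π p) * X + (G * G + (1# - G * G) * π p) * (c * s₁) ≡⟨ solve 6 (λ c s₀ s₁ x g π → c :* s₀ :+ (g :- (# 1 :+ g) :* π) :* x :+ (g :* g :+ (# 1 :- g :* g) :* π) :* (c :* s₁)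
              := c :* s₀ :+ (g :- (# 1 :+ g) :* π) :* x :+ (g :* g :+ (# 1 :- g) :* ((# 1 :+ g) :* π)) :* (c :* s₁)) refl c s₀ s₁ X G (π p) ⟩
      c * s₀ + (G - (1# + G) * π p) * X + (G * G + (1# - G) * ((1# + G) * π p)) * (c * s₁) ≡⟨ cong (λ t → c * s₀ + (G - t) * X + (G * G + (1# - G) * t) * (c * s₁)) eq ⟩
      c * s₀ + (G - G) * X + (G * G + (1# - G) * G) * (c * s₁) ≡⟨ solve 5 (λ c s₀ s₁ x g → c :* s₀ :+ (g :- g) :* x :+ (g :* g :+ (# 1 :- g) :* g) :* (c :* s₁) := c :* (s₀ :+ g :* s₁)) refl c s₀ s₁ X G ⟩
      c * (s₀ + G * s₁) ∎
    where
    open ≡-Reasoning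
    G = g p
    X = B P g (λ U → c * ∏ π U) (shift y p) z + B P g (λ U → c * ∏ π U) y (shift z p)
    s₀ = S P g (λ r → y r * z r)
    s₁ = S P g (shift (λ r → y r * z r) p)

  B-linearˡ : ∀ P c Ψ y y' z → B P g Ψ (λ r → y r + c * y' r) z ≡ B P g Ψ y z + c * B P g Ψ y' z
  B-linearˡ [] c Ψ y y' z = solve 5 (λ y y' z w c → (y :+ c :* y') :* z :* w := y :* z :* w :+ c :* (y' :* z :* w)) refl (y 1) (y' 1) (z 1) (Ψ []) c
  B-linearˡ (p ∷ P) c Ψ y y' z
    rewrite B-linearˡ P c Ψ y y' z | B-linearˡ P c Ψ (shift y p) (shift y' p) z | B-linearˡ P c Ψ y y' (shift z p)
          | B-linearˡ P c Ψ (shift y p) (shift y' p) (shift z p)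
          | B-linearˡ P c (Ψ ∘ (p ∷_)) (shift y p) (shift y' p) z | B-linearˡ P c (Ψ ∘ (p ∷_)) y y' (shift z p)
          | B-linearˡ P c (Ψ ∘ (p ∷_)) (shift y p) (shift y' p) (shift z p) = combine _ _ _ _ _ _ _ _ _ _ _ _ _ _ c (g p)

  B-sym : ∀ P Ψ y z → B P g Ψ y z ≡ B P g Ψ z y
  B-sym [] Ψ y z = cong (_* Ψ []) (*-comm (y 1) (z 1))
  B-sym (p ∷ P) Ψ y z
    rewrite B-sym P Ψ y z | B-sym P Ψ (shift y p) z | B-sym P Ψ y (shift z p) | B-sym P Ψ (shift y p) (shift z p)
          | B-sym P (Ψ ∘ (p ∷_)) (shift y p) z | B-sym P (Ψ ∘ (p ∷_)) y (shift z p)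
          | B-sym P (Ψ ∘ (p ∷_)) (shift y p) (shift z p) =
    cong₂ (λ s t → B P g Ψ z y + g p * s + g p * g p * B P g Ψ (shift z p) (shift y p) - (1# + g p) * t + (1# - g p * g p) * B P g (Ψ ∘ (p ∷_)) (shift z p) (shift y p))
      (+-comm _ _) (+-comm _ _)

  B-square : ∀ P Ψ y y' c → B P g Ψ (λ r → y r + c * y' r) (λ r → y r + c * y' r) ≡
    B P g Ψ y y + c * (B P g Ψ y' y + B P g Ψ y y') + c * c * B P g Ψ y' y'
  B-square P Ψ y y' c = begin
    B P g Ψ w w ≡⟨ B-linearˡ P c Ψ y y' w ⟩
    B P g Ψ y w + c * B P g Ψ y' w ≡⟨ cong₂ (λ s t → s + c * t) (right y) (right y') ⟩
    B P g Ψ y y + c * B P g Ψ y y' + c * (B P g Ψ y' y + c * B P g Ψ y' y') ≡⟨ solve 5 (λ a b d e c → a :+ c :* b :+ c :* (d :+ c :* e) := a :+ c :* (d :+ b) :+ c :* c :* e) refl _ _ _ _ c ⟩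
    B P g Ψ y y + c * (B P g Ψ y' y + B P g Ψ y y') + c * c * B P g Ψ y' y' ∎
    where
    open ≡-Reasoning
    w : ℕ → ℚ
    w r = y r + c * y' r
    right : ∀ u → B P g Ψ u w ≡ B P g Ψ u y + c * B P g Ψ u y'
    right u = B-sym P Ψ u w · (B-linearˡ P c Ψ y y' u ·
      cong₂ (λ s t → s + c * t) (B-sym P Ψ y u) (B-sym P Ψ y' u))

  -- If ι has mean π, then g − (1 + g) ι has mean e and variance γ (1 + e)².
  B-lower : ∀ {P} c π {e γ : ℕ → ℚ} y → 0# ≤ c → Nonneg e → Nonneg γ → Nonneg y → Antitone y → Positive P →
    All (λ p → g p - (1# + g p) * π p ≡ e p) P →
    All (λ p → g p * g p + (1# - g p * g p) * π p ≡ e p * e p + γ p * ((1# + e p) * (1# + e p))) P →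
    c * S P γ (λ r → S P e (shift y r) * S P e (shift y r)) ≤ B P g (λ U → c * ∏ π U) y y
  B-lower {[]} c π y _ _ _ _ _ _ _ _ = ≡⇒≤
    (solve 2 (λ c y → c :* (y :* y) := y :* y :* (c :* # 1)) refl c (y 1))
  B-lower {p ∷ P} c π {e} {γ} y c≥0 e≥0 γ≥0 y≥0 anti (1≤p ∷ pos) (mean ∷ ms) (var ∷ vs) = begin
    c * (S P γ (λ r → S (p ∷ P) e (shift y r) * S (p ∷ P) e (shift y r))
      + γ p * S P γ (λ r → S (p ∷ P) e (shift y (p N.* r)) * S (p ∷ P) e (shift y (p N.* r)))) ≤⟨ *-monoˡ-≤ c≥0 (+-mono-≤ (≡⇒≤ (S-cong P γ λ r → cong (λ t → t * t) (inner r)))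
           (*-monoˡ-≤ (γ≥0 p) ((S-mono P γ≥0 λ r → *-mono-≤ (inner≥0 r) (inner≥0 r) (bound r) (bound r)) ◂
              ≡⇒≤ ((S-cong P γ λ r → solve 2 (λ a b → (a :* b) :* (a :* b) := (a :* a) :* (b :* b)) refl (1# + e p) _) · S-* P γ _ _)))) ⟩
    c * (S P γ (λ r → S P e (shift w r) * S P e (shift w r))
      + γ p * ((1# + e p) * (1# + e p) * S P γ (λ r → S P e (shift yₚ r) * S P e (shift yₚ r)))) ≡⟨ solve 5 (λ c a g f b → c :* (a :+ g :* (f :* b)) := c :* a :+ g :* f :* (c :* b)) refl c _ (γ p) ((1# + e p) * (1# + e p)) _ ⟩
    c * S P γ (λ r → S P e (shift w r) * S P e (shift w r))
      + γ p * ((1# + e p) * (1# + e p)) * (c * S P γ (λ r → S P e (shift yₚ r) * S P e (shift yₚ r))) ≤⟨ +-mono-≤ (B-lower c π w c≥0 e≥0 γ≥0 w≥0 w-anti pos ms vs)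
           (*-monoˡ-≤ (*-nonneg (γ≥0 p) (*-nonneg (+-nonneg 0≤1 (e≥0 p)) (+-nonneg 0≤1 (e≥0 p))))
             (B-lower c π yₚ c≥0 e≥0 γ≥0 (λ r → y≥0 (p N.* r)) (shift-antitone p anti) pos ms vs)) ⟩
    B P g Ψ w w + γ p * ((1# + e p) * (1# + e p)) * B P g Ψ yₚ yₚ ≡⟨ cong (_+ γ p * ((1# + e p) * (1# + e p)) * B P g Ψ yₚ yₚ) (B-square P Ψ y yₚ (e p)) ⟩
    B P g Ψ y y + e p * (B P g Ψ yₚ y + B P g Ψ y yₚ) + e p * e p * B P g Ψ yₚ yₚ
      + γ p * ((1# + e p) * (1# + e p)) * B P g Ψ yₚ yₚ ≡⟨ solve 5 (λ a b e d f → a :+ e :* b :+ e :* e :* d :+ f :* d := a :+ e :* b :+ (e :* e :+ f) :* d) refl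
           (B P g Ψ y y) (B P g Ψ yₚ y + B P g Ψ y yₚ) (e p) (B P g Ψ yₚ yₚ) (γ p * ((1# + e p) * (1# + e p))) ⟩
    B P g Ψ y y + e p * (B P g Ψ yₚ y + B P g Ψ y yₚ) + (e p * e p + γ p * ((1# + e p) * (1# + e p))) * B P g Ψ yₚ yₚ ≡⟨ cong₂ (λ s t → B P g Ψ y y + s * (B P g Ψ yₚ y + B P g Ψ y yₚ) + t * B P g Ψ yₚ yₚ) (sym mean) (sym var) ⟩
    B P g Ψ y y + (g p - (1# + g p) * π p) * (B P g Ψ yₚ y + B P g Ψ y yₚ) + (g p * g p + (1# - g p * g p) * π p) * B P g Ψ yₚ yₚ ≡⟨ sym (B-∏-∷ p P c π y y) ⟩
    B (p ∷ P) g Ψ y y ∎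
    where
    open ≤-Reasoning
    Ψ : List ℕ → ℚ
    Ψ U = c * ∏ π U
    yₚ w : ℕ → ℚ
    yₚ = shift y p
    -- Completing the square: the mean e of the local factor at p pairs y with `yₚ`, and what is
    -- left is the variance times the form at `yₚ`.
    w r = y r + e p * yₚ r
    w≥0 : Nonneg w
    w≥0 r = +-nonneg (y≥0 r) (*-nonneg (e≥0 p) (y≥0 (p N.* r)))
    w-anti : Antitone w
    w-anti q r 1≤q = +-mono-≤ (anti q r 1≤q) (*-monoˡ-≤ (e≥0 p) (shift-antitone p anti q r 1≤q))
    rotate : ∀ v u → v N.* (p N.* u) ≡ p N.* (v N.* u)
    rotate v u = sym (N.*-assoc v p u) · cong (N._* u) (N.*-comm v p) · N.*-assoc p v u
    inner : ∀ r → S (p ∷ P) e (shift y r) ≡ S P e (shift w r)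
    inner r = sym (S-+ P e _ _ · cong (S P e (shift y r) +_)
      (S-* P e (e p) _ · cong (e p *_) (S-cong P e λ m → cong y (sym (rotate r m)))))
    inner≥0 : ∀ r → 0# ≤ S (p ∷ P) e (shift y (p N.* r))
    inner≥0 r = S-nonneg (p ∷ P) e≥0 λ m → y≥0 (p N.* r N.* m)
    -- In the exact diagonal form m is coprime to r, with a factor 1 + e for each prime of r.
    -- Letting m share primes with r instead gives less, since y(p r p m) ≤ y(p r m).
    bound : ∀ r → S (p ∷ P) e (shift y (p N.* r)) ≤ (1# + e p) * S P e (shift yₚ r)
    bound r = begin
      S P e (shift y (p N.* r)) + e p * S P e (λ m → y (p N.* r N.* (p N.* m))) ≤⟨ +-mono-≤ ≤-refl (*-monoˡ-≤ (e≥0 p) (S-mono P e≥0 λ m → ≡⇒≤ (cong y (rotate (p N.* r) m)) ◂ anti p _ 1≤p)) ⟩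
      S P e (shift y (p N.* r)) + e p * S P e (shift y (p N.* r)) ≡⟨ solve 2 (λ a e → a :+ e :* a := (# 1 :+ e) :* a) refl _ (e p) ⟩
      (1# + e p) * S P e (shift y (p N.* r)) ≡⟨ cong ((1# + e p) *_) (S-cong P e λ m → cong y (N.*-assoc p r m)) ⟩
      (1# + e p) * S P e (shift yₚ r) ∎

  -- The terms without ι(p) reproduce the product of the two sums `S`. Those with ι(p) have
  -- coefficients 1 + g, 1 + g and 1 - g², at most 5 in total, hence a factor 5 for each prime of U.
  -- In the latter y or z is shifted by p, so one cutoff is divided by p and only products up to x
  -- x' are asked for.
  B-bound : ∀ {P} x x' {c c' Ψ} {E : List ℕ → ℚ} {y z} → 0# ≤ c → 0# ≤ c' →
    (∀ r → ∣ y r ∣ ≤ c * χ x r) → (∀ r → ∣ z r ∣ ≤ c' * χ x' r) → Nonneg E →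
    (∀ U → U ⊆ P → χ (x N.* x') (product U) * ∣ Ψ U ∣ ≤ E U) →
    Nonneg g → All (λ p → g p ≤ 1#) P → Positive P →
    ∣ B P g Ψ y z ∣ ≤ c * c' * (S P g (χ x) * S P g (χ x') * Z (nat 5) P E)
  B-bound {[]} x x' {c} {c'} {Ψ} {E} {y} {z} c≥0 c'≥0 hy hz E≥0 hΨ _ _ _ = begin
    ∣ y 1 * z 1 * Ψ [] ∣ ≡⟨ (∣-∣-* _ _) · cong (_* ∣ Ψ [] ∣) (∣-∣-* _ _) ⟩
    ∣ y 1 ∣ * ∣ z 1 ∣ * ∣ Ψ [] ∣ ≤⟨ *-monoʳ-≤ (0≤∣-∣ _) (*-mono-≤ (0≤∣-∣ _) (0≤∣-∣ _) (hy 1) (hz 1)) ⟩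
    c * χ x 1 * (c' * χ x' 1) * ∣ Ψ [] ∣ ≡⟨ solve 5 (λ a b c d e → a :* b :* (c :* d) :* e := a :* c :* (b :* d :* e)) refl c (χ x 1) c' (χ x' 1) ∣ Ψ [] ∣ ⟩
    c * c' * (χ x 1 * χ x' 1 * ∣ Ψ [] ∣) ≤⟨ *-monoˡ-≤ (*-nonneg c≥0 c'≥0) base ⟩
    c * c' * (χ x 1 * χ x' 1 * E []) ∎
    where
    open ≤-Reasoning
    base : χ x 1 * χ x' 1 * ∣ Ψ [] ∣ ≤ χ x 1 * χ x' 1 * E []
    base with 1 N.≤? x | 1 N.≤? x'
    ... | no _  | _ = ≡⇒≤ (solve 3 (λ a b c → # 0 :* a :* b := # 0 :* a :* c) refl _ _ _)
    ... | yes _ | no _ = ≡⇒≤ (solve 2 (λ b c → # 1 :* # 0 :* b := # 1 :* # 0 :* c) refl _ _)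
    ... | yes p | yes q = *-monoˡ-≤ (*-nonneg 0≤1 0≤1) (≤-trans
      (≡⇒≤ (sym (cong (_* ∣ Ψ [] ∣) (ind-yes (1 N.≤? x N.* x') (N.*-mono-≤ p q)) · *-identityˡ _))) (hΨ [] []))
  B-bound {p ∷ P} x x' {c} {c'} {Ψ} {E} {y} {z} c≥0 c'≥0 hy hz E≥0 hΨ g≥0 (g≤1 ∷ gs) (1≤p ∷ pos) = begin
    ∣ b₁ + G * (b₂ + b₃) + G * G * b₄ - (1# + G) * (b₅ + b₆) + (1# - G * G) * b₇ ∣ ≤⟨ tri b₁ b₂ b₃ b₄ b₅ b₆ b₇ ⟩
    ∣ b₁ ∣ + G * (∣ b₂ ∣ + ∣ b₃ ∣) + G * G * ∣ b₄ ∣ + ((1# + G) * (∣ b₅ ∣ + ∣ b₆ ∣) + (1# - G * G) * ∣ b₇ ∣) ≤⟨ +-mono-≤ (+-mono-≤ (+-mono-≤ (rec hy hz (≤χ N.≤-refl) hE)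
             (*-monoˡ-≤ (g≥0 p) (+-mono-≤ (rec hyₚ hz (≤χ (N.*-monoˡ-≤ x' x/p≤x)) hE) (rec hy hzₚ (≤χ (N.*-monoʳ-≤ x x'/p≤x')) hE))))
             (*-monoˡ-≤ (*-nonneg (g≥0 p) (g≥0 p)) (rec hyₚ hzₚ (≤χ (N.*-mono-≤ x/p≤x x'/p≤x')) hE)))
           (+-mono-≤ (*-monoˡ-≤ (+-nonneg 0≤1 (g≥0 p)) (+-mono-≤
               (rec hyₚ hz (≤χ N.≤-refl) hEₚ)
               (rec hy hzₚ (≤χ (N.≤-reflexive refl)) hEₚ')))
             (*-monoˡ-≤ 1-G²≥0 (rec hyₚ hzₚ (≤χ (N.*-monoʳ-≤ (x N./ p) x'/p≤x')) hEₚ))) ⟩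
    C * (X * X' * ζ) + G * (C * (Xₚ * X' * ζ) + C * (X * X'ₚ * ζ)) + G * G * (C * (Xₚ * X'ₚ * ζ))
      + ((1# + G) * (C * (Xₚ * X' * ζₚ) + C * (X * X'ₚ * ζₚ)) + (1# - G * G) * (C * (Xₚ * X'ₚ * ζₚ))) ≤⟨ +-mono-≤ ≤-refl (+-mono-≤
           (*-mono-≤ (+-nonneg 0≤1 (g≥0 p)) (+-nonneg (*-nonneg C≥0 (t≥0 Xₚ≥0 X'≥0)) (*-nonneg C≥0 (t≥0 X≥0 X'ₚ≥0)))
              (+-mono-≤ (≤-refl {1#}) g≤1) (+-mono-≤ (*-monoˡ-≤ C≥0 (t≤ Xₚ≥0 X'≥0 Xₚ≤ X'≤)) (*-monoˡ-≤ C≥0 (t≤ X≥0 X'ₚ≥0 X≤ X'ₚ≤))))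
           (*-mono-≤ 1-G²≥0 (*-nonneg C≥0 (t≥0 Xₚ≥0 X'ₚ≥0)) (≤-add (G * G) (*-nonneg (g≥0 p) (g≥0 p)) (solve 1 (λ g → # 1 :- g :* g :+ g :* g := # 1) refl G))
              (*-monoˡ-≤ C≥0 (t≤ Xₚ≥0 X'ₚ≥0 Xₚ≤ X'ₚ≤)))) ⟩
    C * (X * X' * ζ) + G * (C * (Xₚ * X' * ζ) + C * (X * X'ₚ * ζ)) + G * G * (C * (Xₚ * X'ₚ * ζ))
      + ((1# + 1#) * (C * (T * ζₚ) + C * (T * ζₚ)) + 1# * (C * (T * ζₚ))) ≡⟨ solve 8 (λ C X X' Xₚ X'ₚ G ζ ζₚ →
           C :* (X :* X' :* ζ) :+ G :* (C :* (Xₚ :* X' :* ζ) :+ C :* (X :* X'ₚ :* ζ)) :+ G :* G :* (C :* (Xₚ :* X'ₚ :* ζ))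
           :+ ((# 1 :+ # 1) :* (C :* ((X :+ G :* Xₚ) :* (X' :+ G :* X'ₚ) :* ζₚ) :+ C :* ((X :+ G :* Xₚ) :* (X' :+ G :* X'ₚ) :* ζₚ))
                :+ # 1 :* (C :* ((X :+ G :* Xₚ) :* (X' :+ G :* X'ₚ) :* ζₚ)))
           := C :* ((X :+ G :* Xₚ) :* (X' :+ G :* X'ₚ) :* (ζ :+ # 5 :* ζₚ))) refl C X X' Xₚ X'ₚ G ζ ζₚ ⟩
    C * (T * (ζ + nat 5 * ζₚ)) ≡⟨ cong₂ (λ u v → C * ((X + G * u) * (X' + G * v) * (ζ + nat 5 * ζₚ))) (S-cong P g λ r → sym (χ-shift x p r)) (S-cong P g λ r → sym (χ-shift x' p r)) ⟩
    C * (S (p ∷ P) g (χ x) * S (p ∷ P) g (χ x') * Z (nat 5) (p ∷ P) E) ∎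
    where
    open ≤-Reasoning
    instance
      _ : NonZero p
      _ = N.>-nonZero 1≤p
    Eₚ Ψₚ : List ℕ → ℚ
    Eₚ = E ∘ (p ∷_)
    Ψₚ = Ψ ∘ (p ∷_)
    C = c * c'
    G = g p
    X = S P g (χ x)
    X' = S P g (χ x')
    Xₚ = S P g (χ (x N./ p))
    X'ₚ = S P g (χ (x' N./ p))
    T = (X + G * Xₚ) * (X' + G * X'ₚ)
    ζ = Z (nat 5) P E
    ζₚ = Z (nat 5) P Eₚ
    b₁ = B P g Ψ y z
    b₂ = B P g Ψ (shift y p) z
    b₃ = B P g Ψ y (shift z p)
    b₄ = B P g Ψ (shift y p) (shift z p)
    b₅ = B P g Ψₚ (shift y p) z
    b₆ = B P g Ψₚ y (shift z p)
    b₇ = B P g Ψₚ (shift y p) (shift z p)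
    C≥0 = *-nonneg c≥0 c'≥0
    X≥0 = S-nonneg P g≥0 (χ≥0 x)
    X'≥0 = S-nonneg P g≥0 (χ≥0 x')
    Xₚ≥0 = S-nonneg P g≥0 (χ≥0 (x N./ p))
    X'ₚ≥0 = S-nonneg P g≥0 (χ≥0 (x' N./ p))
    ζₚ≥0 = Z-nonneg P (0≤nat 5) (λ U → E≥0 (p ∷ U))
    x/p≤x = N.m/n≤m x p
    x'/p≤x' = N.m/n≤m x' p
    1-G²≥0 : 0# ≤ 1# - G * G
    1-G²≥0 = 0≤y-x (*-mono-≤ (g≥0 p) (g≥0 p) g≤1 g≤1 ◂ ≡⇒≤ (*-identityˡ 1#))
    X≤ : X ≤ X + G * Xₚ
    X≤ = ≤-add (G * Xₚ) (*-nonneg (g≥0 p) Xₚ≥0) refl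
    X'≤ : X' ≤ X' + G * X'ₚ
    X'≤ = ≤-add (G * X'ₚ) (*-nonneg (g≥0 p) X'ₚ≥0) refl
    Xₚ≤ : Xₚ ≤ X + G * Xₚ
    Xₚ≤ = S-mono P g≥0 (χ-mono x/p≤x) ◂ X≤
    X'ₚ≤ : X'ₚ ≤ X' + G * X'ₚ
    X'ₚ≤ = S-mono P g≥0 (χ-mono x'/p≤x') ◂ X'≤
    t≥0 : ∀ {u v} → 0# ≤ u → 0# ≤ v → 0# ≤ u * v * ζₚ
    t≥0 u v = *-nonneg (*-nonneg u v) ζₚ≥0
    t≤ : ∀ {u v} → 0# ≤ u → 0# ≤ v → u ≤ X + G * Xₚ → v ≤ X' + G * X'ₚ → u * v * ζₚ ≤ T * ζₚ
    t≤ u≥0 v≥0 u≤ v≤ = *-monoʳ-≤ ζₚ≥0 (*-mono-≤ u≥0 v≥0 u≤ v≤)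
    hyₚ : ∀ r → ∣ shift y p r ∣ ≤ c * χ (x N./ p) r
    hyₚ r = hy (p N.* r) ◂ ≡⇒≤ (cong (c *_) (χ-shift x p r))
    hzₚ : ∀ r → ∣ shift z p r ∣ ≤ c' * χ (x' N./ p) r
    hzₚ r = hz (p N.* r) ◂ ≡⇒≤ (cong (c' *_) (χ-shift x' p r))
    hE : Nonneg E × (∀ U → U ⊆ P → χ (x N.* x') (product U) * ∣ Ψ U ∣ ≤ E U)
    hE = E≥0 , λ U s → hΨ U (p ∷ʳ s)
    ≤χ : ∀ {u v} → u N.≤ v → ∀ r → χ u r ≤ χ v r
    ≤χ = χ-mono
    hEₚ : Nonneg Eₚ × (∀ U → U ⊆ P → χ (x N./ p N.* x') (product U) * ∣ Ψₚ U ∣ ≤ Eₚ U)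
    hEₚ = (λ U → E≥0 (p ∷ U)) , λ U s → *-monoʳ-≤ (0≤∣-∣ _) (ind-mono (product U N.≤? _) (p N.* product U N.≤? _)
      (λ le → N.*-monoʳ-≤ p le ◃ subst (N._≤ x N.* x') (N.*-assoc p (x N./ p) x')
         (N.*-monoˡ-≤ x' (n≤o/m⇒m*n≤o p (x N./ p) x N.≤-refl)))) ◂ hΨ (p ∷ U) (refl ∷ s)
    hEₚ' : Nonneg Eₚ × (∀ U → U ⊆ P → χ (x N.* (x' N./ p)) (product U) * ∣ Ψₚ U ∣ ≤ Eₚ U)
    hEₚ' = (λ U → E≥0 (p ∷ U)) , λ U s → *-monoʳ-≤ (0≤∣-∣ _) (ind-mono (product U N.≤? _) (p N.* product U N.≤? _)
      (λ le → N.*-monoʳ-≤ p le ◃ subst (N._≤ x N.* x') (sym (N.*-assoc x p (x' N./ p)) · cong (N._* (x' N./ p)) (N.*-comm x p) · N.*-assoc p x (x' N./ p))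
         (N.*-monoʳ-≤ x (n≤o/m⇒m*n≤o p (x' N./ p) x' N.≤-refl)))) ◂ hΨ (p ∷ U) (refl ∷ s)
    rec : ∀ {u v t Ψ E y z} → (∀ r → ∣ y r ∣ ≤ c * χ u r) → (∀ r → ∣ z r ∣ ≤ c' * χ v r) →
      (∀ r → χ (u N.* v) r ≤ χ t r) → (Nonneg E × (∀ U → U ⊆ P → χ t (product U) * ∣ Ψ U ∣ ≤ E U)) →
      ∣ B P g Ψ y z ∣ ≤ C * (S P g (χ u) * S P g (χ v) * Z (nat 5) P E)
    rec hy hz le (E≥0 , h) = B-bound _ _ c≥0 c'≥0 hy hz E≥0
      (λ U s → *-monoʳ-≤ (0≤∣-∣ _) (le (product U)) ◂ h U s) g≥0 gs pos
    tri : ∀ a₁ a₂ a₃ a₄ a₅ a₆ a₇ →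
      ∣ a₁ + G * (a₂ + a₃) + G * G * a₄ - (1# + G) * (a₅ + a₆) + (1# - G * G) * a₇ ∣
      ≤ ∣ a₁ ∣ + G * (∣ a₂ ∣ + ∣ a₃ ∣) + G * G * ∣ a₄ ∣ + ((1# + G) * (∣ a₅ ∣ + ∣ a₆ ∣) + (1# - G * G) * ∣ a₇ ∣)
    tri a₁ a₂ a₃ a₄ a₅ a₆ a₇ = begin
      ∣ a₁ + G * (a₂ + a₃) + G * G * a₄ - (1# + G) * (a₅ + a₆) + (1# - G * G) * a₇ ∣ ≤⟨ ∣-∣-triangle _ _ ◂ +-mono-≤ (∣-∣-triangle _ _ ◂ +-mono-≤ (∣-∣-triangle _ _ ◂
             +-mono-≤ (∣-∣-triangle _ _ ◂ +-mono-≤ ≤-refl (mul (g≥0 p) (∣-∣-triangle a₂ a₃))) (mul (*-nonneg (g≥0 p) (g≥0 p)) ≤-refl))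
             (≡⇒≤ (∣-∣-neg _) ◂ mul (+-nonneg 0≤1 (g≥0 p)) (∣-∣-triangle a₅ a₆))) (mul 1-G²≥0 ≤-refl) ⟩
      ∣ a₁ ∣ + G * (∣ a₂ ∣ + ∣ a₃ ∣) + G * G * ∣ a₄ ∣ + (1# + G) * (∣ a₅ ∣ + ∣ a₆ ∣) + (1# - G * G) * ∣ a₇ ∣ ≡⟨ +-assoc _ _ _ ⟩
      ∣ a₁ ∣ + G * (∣ a₂ ∣ + ∣ a₃ ∣) + G * G * ∣ a₄ ∣ + ((1# + G) * (∣ a₅ ∣ + ∣ a₆ ∣) + (1# - G * G) * ∣ a₇ ∣) ∎
      where
      mul : ∀ {k a b} → 0# ≤ k → ∣ a ∣ ≤ b → ∣ k * a ∣ ≤ k * b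
      mul {k} {a} k≥0 le = ≡⇒≤ ((∣-∣-* k a) · cong (_* ∣ a ∣) (∣-∣-nonneg k≥0)) ◂ *-monoˡ-≤ k≥0 le

-- Coprimality

cop-*ʳ : ∀ {m a b} → Coprime m a → Coprime m b → Coprime m (a N.* b)
cop-*ʳ c d {e} (e∣m , e∣ab) = d (e∣m , coprime-divisor (λ { (x , y) → c (∣-trans x e∣m , y) }) e∣ab)

cop-∣ʳ : ∀ {m n d} → d ∣ n → Coprime m n → Coprime m d
cop-∣ʳ d∣n c (x , y) = c (x , ∣-trans y d∣n)

cop-∣ˡ : ∀ {m n d} → d ∣ m → Coprime m n → Coprime d n
cop-∣ˡ d∣m c (x , y) = c (∣-trans x d∣m , y)

cop-*ˡ : ∀ {m n a} → Coprime m a → Coprime n a → Coprime (m N.* n) a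
cop-*ˡ c d = Coprime.sym (cop-*ʳ (Coprime.sym c) (Coprime.sym d))

prime-∤⇒cop : ∀ {p m} → Prime p → ¬ p ∣ m → Coprime m p
prime-∤⇒cop pp p∤m {d} (d∣m , d∣p) with prime⇒irreducible pp d∣p
... | inj₁ d≡1 = d≡1
... | inj₂ refl = ⊥-elim (p∤m d∣m)

1<prime : ∀ {p} → Prime p → 1 N.< p
1<prime pp = N.nonTrivial⇒n>1 _ {{prime⇒nonTrivial pp}}

1≤prime : ∀ {p} → Prime p → 1 N.≤ p
1≤prime pp = N.<⇒≤ (1<prime pp)

cop⇒∤ : ∀ {p m} → Prime p → Coprime m p → ¬ p ∣ m
cop⇒∤ pp c p∣m = N.<⇒≢ (1<prime pp) (sym (c (p∣m , ∣-refl)))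

m∣n! : ∀ {m n} → 1 N.≤ m → m N.≤ n → m ∣ n !
m∣n! {suc m} {n} _ m≤n = ∣-trans (m∣m*n (m !)) (m≤n⇒m!∣n! m≤n)

prime-cop-! : ∀ {p} D → Prime p → D N.< p → Coprime p (D !)
prime-cop-! zero    pp D<p (_ , y) = ∣1⇒≡1 y
prime-cop-! (suc D) pp D<p = cop-*ʳ (Coprime.sym (prime-∤⇒cop pp λ p∣ → N.<⇒≱ D<p (∣⇒≤ p∣)))
  (prime-cop-! D pp (N.<-trans N.≤-refl D<p))

-- A composite D + 1 is a product of two factors up to D, and both divide D !. So only primes
-- tighten the condition of being coprime to D !.
cop-composite : ∀ D {m} → 1 N.≤ D → ¬ Prime (suc D) → Coprime m (D !) → Coprime m (suc D !)
cop-composite (suc D) {m} _ ¬p c = cop-*ʳ c' c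
  where
  c' : Coprime m (suc (suc D))
  c' with composite? (suc (suc D))
  ... | no ¬comp = ⊥-elim (¬p (prime ¬comp))
  ... | yes (composite {d} d<n (divides q n≡q*d)) = subst (Coprime m) (sym n≡q*d)
    (cop-*ʳ (cop-∣ʳ (m∣n! q≥1 q≤D) c) (cop-∣ʳ (m∣n! (N.<⇒≤ (N.nonTrivial⇒n>1 d)) (N.≤-pred d<n)) c))
    where
    q≥1 : 1 N.≤ q
    q≥1 = N.n≢0⇒n>0 λ { refl → case-0 n≡q*d }
      where
      case-0 : ∀ {n} → suc n ≡ 0 → ⊥
      case-0 ()
    q≤D : q N.≤ suc D
    q≤D = N.≤-pred (subst (q N.<_) (sym n≡q*d) (N.m<m*n q d {{N.>-nonZero q≥1}} (N.nonTrivial⇒n>1 d)))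

-- Congruences

∣-∣-shift : ∀ m n c → N.∣ m N.+ c - n N.+ c ∣ ≡ N.∣ m - n ∣
∣-∣-shift m n c = cong₂ N.∣_-_∣ (N.+-comm m c) (N.+-comm n c) · N.∣m+n-m+o∣≡∣n-o∣ c m n

≡mod-shift : ∀ {m n q} c → m ≡ n [mod q ] → (m N.+ c) ≡ (n N.+ c) [mod q ]
≡mod-shift {m} {n} c h = subst (_ ∣_) (sym (∣-∣-shift m n c)) h

≡mod-unshift : ∀ {m n q} c → (m N.+ c) ≡ (n N.+ c) [mod q ] → m ≡ n [mod q ]
≡mod-unshift {m} {n} c h = subst (_ ∣_) (∣-∣-shift m n c) h

≡mod-sym : ∀ {m n q} → m ≡ n [mod q ] → n ≡ m [mod q ]
≡mod-sym {m} {n} h = subst (_ ∣_) (N.∣-∣-comm m n) h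

≡mod-+ : ∀ m d {q} → q ∣ d → (m N.+ d) ≡ m [mod q ]
≡mod-+ m d {q} h = subst (q ∣_) (sym (N.∣-∣-comm (m N.+ d) m · N.∣m-m+n∣≡n m d)) h

≡mod⇒+ : ∀ {m n q} → m ≡ n [mod q ] → ∃[ d ] q ∣ d × (m ≡ n N.+ d ⊎ n ≡ m N.+ d)
≡mod⇒+ {m} {n} h with N.≤-total m n
... | inj₁ m≤n = N.∣ m - n ∣ , h , inj₂ (sym (cong (m N.+_) (N.m≤n⇒∣m-n∣≡n∸m m≤n) · (N.m+[n∸m]≡n m≤n)))
... | inj₂ n≤m = N.∣ m - n ∣ , h , inj₁ (sym (cong (n N.+_) (N.m≤n⇒∣n-m∣≡n∸m n≤m) · (N.m+[n∸m]≡n n≤m)))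

≡mod-∣ : ∀ {m n q} → m ≡ n [mod q ] → q ∣ m → q ∣ n
≡mod-∣ {m} {n} {q} h q∣m with ≡mod⇒+ {m} {n} h
... | d , q∣d , inj₁ refl = ∣m+n∣m⇒∣n (subst (q ∣_) (N.+-comm n d) q∣m) q∣d
... | d , q∣d , inj₂ refl = ∣m∣n⇒∣m+n q∣m q∣d

≡mod-trans : ∀ {m n o q} → m ≡ n [mod q ] → n ≡ o [mod q ] → m ≡ o [mod q ]
≡mod-trans {m} {n} {o} {q} h k with ≡mod⇒+ {m} {n} h
... | d , q∣d , inj₁ refl = aux k
  where
  aux : n ≡ o [mod q ] → (n N.+ d) ≡ o [mod q ]
  aux k with ≡mod⇒+ {n} {o} k
  ... | e , q∣e , inj₁ refl = subst (_≡ o [mod q ]) (sym (N.+-assoc o e d)) (≡mod-+ o (e N.+ d) (∣m∣n⇒∣m+n q∣e q∣d))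
  ... | e , q∣e , inj₂ refl = subst₂ (_≡_[mod q ]) (N.+-comm d n) (N.+-comm e n) (≡mod-shift {d} {e} n (diff q∣d q∣e))
    where
    diff : ∀ {d e} → q ∣ d → q ∣ e → q ∣ N.∣ d - e ∣
    diff {d} {e} (divides x refl) (divides y refl) = divides N.∣ x - y ∣ (sym (N.*-distribʳ-∣-∣ q x y))
... | d , q∣d , inj₂ refl with ≡mod⇒+ {m N.+ d} {o} k
...   | e , q∣e , inj₂ refl = ≡mod-sym {m N.+ d N.+ e} {m} (subst (_≡ m [mod q ]) (sym (N.+-assoc m d e)) (≡mod-+ m (d N.+ e) (∣m∣n⇒∣m+n q∣d q∣e)))
...   | e , q∣e , inj₁ eq = ≡mod-unshift {m} {o} d (subst (_≡ (o N.+ d) [mod q ]) (sym eq)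
          (subst₂ (_≡_[mod q ]) (N.+-comm e o) (N.+-comm d o) (≡mod-shift {e} {d} o (diff q∣e q∣d))))
    where
    diff : ∀ {d e} → q ∣ d → q ∣ e → q ∣ N.∣ d - e ∣
    diff {d} {e} (divides x refl) (divides y refl) = divides N.∣ x - y ∣ (sym (N.*-distribʳ-∣-∣ q x y))

≡mod-∣mod : ∀ {m n q d} → d ∣ q → m ≡ n [mod q ] → m ≡ n [mod d ]
≡mod-∣mod = ∣-trans

%-≡mod : ∀ m q .{{_ : NonZero q}} → m ≡ (m N.% q) [mod q ]
%-≡mod m q = subst (_≡ (m N.% q) [mod q ]) (sym (N.m≡m%n+[m/n]*n m q)) (≡mod-+ (m N.% q) _ (n∣m*n (m N./ q)))

≡mod-< : ∀ {m n q} → m N.< q → n N.< q → m ≡ n [mod q ] → m ≡ n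
≡mod-< {m} {n} {q} m<q n<q h with ≡mod⇒+ {m} {n} h
... | d , q∣d , eq with d N.≟ 0
≡mod-< {m} {n} m<q n<q h | d , q∣d , inj₁ eq | yes refl = eq · N.+-identityʳ n
≡mod-< {m} {n} m<q n<q h | d , q∣d , inj₂ eq | yes refl = sym (eq · N.+-identityʳ m)
≡mod-< {m} {n} m<q n<q h | d , q∣d , inj₁ eq | no d≢0 = ⊥-elim (N.<⇒≱ m<q ((∣⇒≤ {{N.≢-nonZero d≢0}} q∣d) ◃ subst (d N.≤_) (sym eq) (N.m≤n+m d n)))
≡mod-< {m} {n} m<q n<q h | d , q∣d , inj₂ eq | no d≢0 = ⊥-elim (N.<⇒≱ n<q ((∣⇒≤ {{N.≢-nonZero d≢0}} q∣d) ◃ subst (d N.≤_) (sym eq) (N.m≤n+m d m)))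

cop-≡mod : ∀ {m n q} → m ≡ n [mod q ] → Coprime m q → Coprime n q
cop-≡mod {m} {n} h c {d} (d∣n , d∣q) = c (≡mod-∣ {n} {m} (≡mod-sym {m} {n} (≡mod-∣mod {m} {n} d∣q h)) d∣n , d∣q)

-- Each of the two congruences is solved by a multiple of the other modulus.
crt : ∀ {p q} a b → Coprime p q → 1 N.≤ p → 1 N.≤ q → ∃[ c ] c ≡ a [mod p ] × c ≡ b [mod q ]
crt {p} {q} a b cop 1≤p 1≤q with unit cop 1≤q | unit (Coprime.sym cop) 1≤p
  where
  unit : ∀ {p q} → Coprime p q → 1 N.≤ q → ∃[ u ] p ∣ u × u ≡ 1 [mod q ]
  unit {p} {q} cop 1≤q with coprime-Bézout cop
  ... | Bézout.+- x y eq = x N.* p , n∣m*n x , subst (_≡ 1 [mod q ]) eq (≡mod-+ 1 (y N.* q) (n∣m*n y))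
  ... | Bézout.-+ x y eq = x N.* p N.* (q N.∸ 1) , ∣m⇒∣m*n (q N.∸ 1) (n∣m*n x) ,
    ≡mod-unshift {x N.* p N.* (q N.∸ 1)} {1} (x N.* p) (subst₂ (_≡_[mod q ])
      (cong (x N.* p N.*_) (sym (N.m∸n+n≡m 1≤q)) · N.*-distribˡ-+ (x N.* p) (q N.∸ 1) 1 · cong (x N.* p N.* (q N.∸ 1) N.+_) (N.*-identityʳ _))
      (sym eq) (∣-trans (diff (x N.* p) y) ∣-refl))
    where
    diff : ∀ u v → q ∣ N.∣ u N.* q - v N.* q ∣
    diff u v = divides N.∣ u - v ∣ (sym (N.*-distribʳ-∣-∣ q u v))
... | u , p∣u , u≡1 | v , q∣v , v≡1 = a N.* v N.+ b N.* u ,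
  ≡mod-trans {a N.* v N.+ b N.* u} {a N.* v} (≡mod-+ (a N.* v) (b N.* u) (∣n⇒∣m*n b p∣u)) (scale a v v≡1) ,
  subst (_≡ b [mod q ]) (N.+-comm (b N.* u) (a N.* v))
    (≡mod-trans {b N.* u N.+ a N.* v} {b N.* u} (≡mod-+ (b N.* u) (a N.* v) (∣n⇒∣m*n a q∣v)) (scale b u u≡1))
  where
  scale : ∀ {q} a v → v ≡ 1 [mod q ] → (a N.* v) ≡ a [mod q ]
  scale {q} a v h = subst (λ t → (a N.* v) ≡ t [mod q ]) (N.*-identityʳ a)
    (subst (q ∣_) (N.*-distribˡ-∣-∣ a v 1) (∣n⇒∣m*n a h))

crt-unique : ∀ {p q m n} → Coprime p q → m ≡ n [mod p ] → m ≡ n [mod q ] → m ≡ n [mod p N.* q ]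
crt-unique {p} {q} {m} {n} cop h (divides k eq) with coprime-divisor cop (subst (p ∣_) (eq · N.*-comm k q) h)
... | divides j refl = divides j (eq · N.*-assoc j p q)

-- Sums of periodic functions

Periodic : ℕ → (ℕ → ℚ) → Set
Periodic W f = ∀ m → f (m N.+ W) ≡ f m

sum-period : ∀ W f → Periodic W f → ∀ x → sum W (λ i → f (x N.+ i)) ≡ sum W f
sum-period W f per zero = refl
sum-period W f per (suc x) = trans (step x) (sum-period W f per x)
  where
  step : ∀ x → sum W (λ i → f (suc x N.+ i)) ≡ sum W (λ i → f (x N.+ i))
  step x = begin
    sum W (λ i → f (suc x N.+ i)) ≡⟨ sum-cong W (λ i _ → cong f (sym (N.+-suc x i))) ⟩
    sum W ((λ i → f (x N.+ i)) ∘ suc) ≡⟨ solve 3 (λ a b c → b := (a :+ b) :- a) refl (f (x N.+ 0)) _ 0# ⟩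
    f (x N.+ 0) + sum W ((λ i → f (x N.+ i)) ∘ suc) - f (x N.+ 0) ≡⟨ cong (_- f (x N.+ 0)) (sym (sum-shift W (λ i → f (x N.+ i)))) ⟩
    sum W (λ i → f (x N.+ i)) + f (x N.+ W) - f (x N.+ 0) ≡⟨ cong₂ (λ u v → sum W (λ i → f (x N.+ i)) + u - v) (per x) (cong f (N.+-identityʳ x)) ⟩
    sum W (λ i → f (x N.+ i)) + f x - f x ≡⟨ solve 2 (λ a b → a :+ b :- b := a) refl _ (f x) ⟩
    sum W (λ i → f (x N.+ i)) ∎
    where open ≡-Reasoning

sum-periods : ∀ W f → Periodic W f → ∀ y x → sum (y N.* W) (λ i → f (x N.+ i)) ≡ nat y * sum W f
sum-periods W f per zero    x = sym (*-zeroˡ _)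
sum-periods W f per (suc y) x = begin
  sum (W N.+ y N.* W) (λ i → f (x N.+ i)) ≡⟨ sum-append W (y N.* W) _ ⟩
  sum W (λ i → f (x N.+ i)) + sum (y N.* W) (λ i → f (x N.+ (W N.+ i))) ≡⟨ cong₂ _+_ (sum-period W f per x) ((sum-cong (y N.* W) λ i _ → cong f (sym (N.+-assoc x W i))) · sum-periods W f per y (x N.+ W)) ⟩
  sum W f + nat y * sum W f ≡⟨ solve 2 (λ y s → s :+ y :* s := (y :+ # 1) :* s) refl (nat y) _ ⟩
  (nat y + 1#) * sum W f ≡⟨ cong (_* sum W f) (sym (nat-suc y)) ⟩
  nat (suc y) * sum W f ∎
  where open ≡-Reasoning

sum-multiples : ∀ D y (f : ℕ → ℚ) .{{_ : NonZero D}} → sum (y N.* D) (λ a → ind (D ∣? a) * f a) ≡ sum y (λ j → f (D N.* j))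
sum-multiples D zero    f = refl
sum-multiples D@(suc D') (suc y) f = begin
  sum (D N.+ y N.* D) g ≡⟨ cong (λ t → sum t g) (N.+-comm D (y N.* D)) ⟩
  sum (y N.* D N.+ D) g ≡⟨ sum-append (y N.* D) D g ⟩
  sum (y N.* D) g + sum D (λ i → g (y N.* D N.+ i)) ≡⟨ cong₂ _+_ (sum-multiples D y f) block ⟩
  sum y (λ j → f (D N.* j)) + f (D N.* y) ∎
  where
  open ≡-Reasoning
  g : ℕ → ℚ
  g a = ind (D ∣? a) * f a
  block : sum D (λ i → g (y N.* D N.+ i)) ≡ f (D N.* y)
  block = begin
    sum D (λ i → g (y N.* D N.+ i)) ≡⟨ sum-shift D' _ ⟩
    g (y N.* D N.+ 0) + sum D' (λ i → g (y N.* D N.+ suc i)) ≡⟨ cong₂ _+_ (cong g (N.+-identityʳ _ · N.*-comm y D) ·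
            cong (_* f (D N.* y)) (ind-yes (D ∣? D N.* y) (m∣m*n y)) · *-identityˡ _)
           (sum-zero D' λ i i<D' → cong (_* f (y N.* D N.+ suc i)) (ind-no (D ∣? _)
              (λ D∣ → N.<⇒≱ (s≤s i<D') (∣⇒≤ (∣m+n∣m⇒∣n D∣ (n∣m*n y))))) · *-zeroˡ _) ⟩
    f (D N.* y) + 0# ≡⟨ +-identityʳ _ ⟩
    f (D N.* y) ∎

-- Euler's function and arithmetic progressions

length-filter-ind : {A : Set} {P : Pred A _} (P? : Decidable P) (xs : List A) →
  nat (length (filter P? xs)) ≡ sumL xs (λ x → ind (P? x))
length-filter-ind P? [] = refl
length-filter-ind P? (x ∷ xs) with P? x
... | yes _ = nat-+ 1 _ · cong (1# +_) (length-filter-ind P? xs)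
... | no  _ = length-filter-ind P? xs · sym (+-identityˡ _)

sumL-applyUpTo : {A : Set} (f : ℕ → A) (g : A → ℚ) → ∀ n → sumL (applyUpTo f n) g ≡ sum n (g ∘ f)
sumL-applyUpTo f g zero = refl
sumL-applyUpTo f g (suc n) = cong (g (f 0) +_) (sumL-applyUpTo (f ∘ suc) g n) · sym (sum-shift n (g ∘ f))

φ-sum : ∀ q → nat (φ q) ≡ sum q (λ a → ind (coprime? a q))
φ-sum q = length-filter-ind (λ a → coprime? a q) (upTo q) · sumL-applyUpTo id _ q

cop-periodic : ∀ q → Periodic q (λ a → ind (coprime? a q))
cop-periodic q m = ind-cong (coprime? (m N.+ q) q) (coprime? m q)
  (cop-≡mod {m N.+ q} {m} (≡mod-+ m q ∣-refl)) (cop-≡mod {m} {m N.+ q} (≡mod-sym {m N.+ q} {m} (≡mod-+ m q ∣-refl)))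

-- Of the a < p q coprime to q, those divisible by p are the p j with j < q coprime to q.
φ-prime-* : ∀ {p} q → Prime p → Coprime p q → nat (φ (p N.* q)) ≡ (nat p - 1#) * nat (φ q)
φ-prime-* {p} q pp cop = begin
  nat (φ (p N.* q)) ≡⟨ φ-sum (p N.* q) ⟩
  sum (p N.* q) (λ a → ind (coprime? a (p N.* q))) ≡⟨ sum-cong (p N.* q) (λ a _ → split a) ⟩
  sum (p N.* q) (λ a → f a + - 1# * (ind (p ∣? a) * f a)) ≡⟨ sum-+ (p N.* q) f _ · cong (sum (p N.* q) f +_) (sum-*ˡ (p N.* q) (- 1#) _) ⟩
  sum (p N.* q) f + - 1# * sum (p N.* q) (λ a → ind (p ∣? a) * f a) ≡⟨ cong₂ (λ u v → u + - 1# * v) (sum-periods q f (cop-periodic q) p 0)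
         (cong (λ t → sum t (λ a → ind (p ∣? a) * f a)) (N.*-comm p q) · (sum-multiples p q f ·
            (sum-cong q λ j _ → ind-cong (coprime? (p N.* j) q) (coprime? j q) (cop-∣ˡ (n∣m*n p)) (cop-*ˡ cop)))) ⟩
  nat p * sum q f + - 1# * sum q f ≡⟨ solve 2 (λ p s → p :* s :+ :- # 1 :* s := (p :- # 1) :* s) refl (nat p) (sum q f) ⟩
  (nat p - 1#) * sum q f ≡⟨ cong ((nat p - 1#) *_) (sym (φ-sum q)) ⟩
  (nat p - 1#) * nat (φ q) ∎
  where
  open ≡-Reasoning
  instance
    _ : NonZero p
    _ = prime⇒nonZero pp
  f : ℕ → ℚ
  f a = ind (coprime? a q)
  split : ∀ a → ind (coprime? a (p N.* q)) ≡ f a + - 1# * (ind (p ∣? a) * f a)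
  split a with p ∣? a
  ... | yes p∣a = ind-no (coprime? a (p N.* q)) (λ c → cop⇒∤ pp (cop-∣ʳ (m∣m*n q) c) p∣a) ·
    solve 1 (λ x → # 0 := x :+ :- # 1 :* (# 1 :* x)) refl (f a)
  ... | no p∤a = ind-cong (coprime? a (p N.* q)) (coprime? a q) (cop-∣ʳ (n∣m*n p)) (cop-*ʳ (prime-∤⇒cop pp p∤a)) ·
    solve 1 (λ x → x := x :+ :- # 1 :* (# 0 :* x)) refl (f a)

φ>0 : ∀ q → 1 N.≤ q → 1 N.≤ φ q
-- The residue 1 mod q instead of 1 also covers q = 1, where the residue counted is 0.
φ>0 q 1≤q = nat-cancel (subst (1# ≤_) (sym (φ-sum q)) (≡⇒≤ (sym (ind-yes (coprime? (1 N.% q) q) c)) ◂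
  (≡⇒≤ (sym (sum-single q (1 N.% q) f (N.m%n<n 1 q))) ◂
    (sum-mono q λ i _ → *-monoʳ-≤ (0≤ind (coprime? i q)) (ind≤1 (i N.≟ 1 N.% q)) ◂ ≡⇒≤ (*-identityˡ _)))))
  where
  instance
    _ : NonZero q
    _ = N.>-nonZero 1≤q
  f : ℕ → ℚ
  f i = ind (coprime? i q)
  c : Coprime (1 N.% q) q
  c = cop-≡mod {1} {1 N.% q} (%-≡mod 1 q) (Coprime.1-coprimeTo q)

class-periodic : ∀ a q → Periodic q (λ n → ind (n ≡? a [mod q ]))
class-periodic a q m = ind-cong ((m N.+ q) ≡? a [mod q ]) (m ≡? a [mod q ])
  (≡mod-trans {m} {m N.+ q} {a} (≡mod-sym {m N.+ q} {m} (≡mod-+ m q ∣-refl)))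
  (≡mod-trans {m N.+ q} {m} {a} (≡mod-+ m q ∣-refl))

class-sum : ∀ a q → 1 N.≤ q → sum q (λ n → ind (n ≡? a [mod q ])) ≡ 1#
class-sum a q 1≤q = trans (sum-cong q λ i i<q → ind-cong (i ≡? a [mod q ]) (i N.≟ a N.% q)
    (λ h → ≡mod-< i<q (N.m%n<n a q) (≡mod-trans {i} {a} h (%-≡mod a q)))
    (λ eq → subst (_≡ a [mod q ]) (sym eq) (≡mod-sym {a} {a N.% q} (%-≡mod a q))) · sym (*-identityʳ _))
  (sum-single q (a N.% q) (λ _ → 1#) (N.m%n<n a q))
  where
  instance
    _ : NonZero q
    _ = N.>-nonZero 1≤q

-- Both sides lie between ⌊L/q⌋ and ⌊L/q⌋ + 1.
class-count : ∀ a q x L → 1 N.≤ q →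
  ∣ sum L (λ i → ind ((x N.+ i) ≡? a [mod q ])) - nat L * inv q ∣ ≤ 1#
class-count a q x L 1≤q = ∣-∣≤
  (≤-add (1# - C + (nat L * inv q - nat y)) (+-nonneg (0≤y-x C≤1) (0≤y-x lo))
    (cong (λ t → t - nat L * inv q + (1# - C + (nat L * inv q - nat y))) total ·
      (solve 3 (λ c l y → y :+ c :- l :+ (# 1 :- c :+ (l :- y)) := # 1) refl C (nat L * inv q) (nat y))))
  (≤-add (C + (nat y + 1# - nat L * inv q)) (+-nonneg C≥0 (0≤y-x hi))
    (cong (λ t → - (t - nat L * inv q) + (C + (nat y + 1# - nat L * inv q))) total ·
      (solve 3 (λ c l y → :- (y :+ c :- l) :+ (c :+ (y :+ # 1 :- l)) := # 1) refl C (nat L * inv q) (nat y))))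
  where
  instance
    _ : NonZero q
    _ = N.>-nonZero 1≤q
  y z : ℕ
  y = L N./ q
  z = L N.% q
  f : ℕ → ℚ
  f n = ind (n ≡? a [mod q ])
  f≥0 : ∀ n → 0# ≤ f n
  f≥0 n = 0≤ind (n ≡? a [mod q ])
  C = sum z (λ i → f (x N.+ (y N.* q N.+ i)))
  C≥0 : 0# ≤ C
  C≥0 = sum-nonneg z λ i _ → f≥0 (x N.+ (y N.* q N.+ i))
  L≡ : L ≡ y N.* q N.+ z
  L≡ = (N.m≡m%n+[m/n]*n L q) · N.+-comm z (y N.* q)
  total : sum L (λ i → f (x N.+ i)) ≡ nat y + C
  total = cong (λ t → sum t (λ i → f (x N.+ i))) L≡ · (sum-append (y N.* q) z _ ·
    cong (_+ C) (sum-periods q f (class-periodic a q) y x · cong (nat y *_) (class-sum a q 1≤q) · *-identityʳ _))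
  C≤1 : C ≤ 1#
  C≤1 = sum-mono-n (λ i → f (x N.+ (y N.* q N.+ i))) (N.<⇒≤ (N.m%n<n L q)) (λ i → f≥0 (x N.+ (y N.* q N.+ i))) ◂
    ≡⇒≤ ((sum-cong q λ i _ → cong f (sym (N.+-assoc x (y N.* q) i))) ·
      sum-period q f (class-periodic a q) (x N.+ y N.* q) · class-sum a q 1≤q)
  cancel : ∀ n → nat (n N.* q) * inv q ≡ nat n
  cancel n = cong (_* inv q) (nat-* n q) · *-assoc _ _ _ · cong (nat n *_) (natinv q) · *-identityʳ _
  lo : nat y ≤ nat L * inv q
  lo = subst (_≤ nat L * inv q) (cancel y) (*-monoʳ-≤ (0≤inv q) (nat-mono (N.m/n*n≤m L q)))
  hi : nat L * inv q ≤ nat y + 1#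
  hi = subst (nat L * inv q ≤_) (cancel (suc y) · nat-suc y) (*-monoʳ-≤ (0≤inv q) (nat-mono
    (subst₂ N._≤_ (sym L≡) (N.+-comm (y N.* q) q) (N.+-monoʳ-≤ (y N.* q) (N.<⇒≤ (N.m%n<n L q))))))

-- Primes and rough numbers

primesFrom : ℕ → ℕ → List ℕ
primesFrom D zero = []
primesFrom D (suc n) with prime? (suc D)
... | yes _ = suc D ∷ primesFrom (suc D) n
... | no  _ = primesFrom (suc D) n

primesFrom-All : ∀ D n → All (λ p → Prime p × D N.< p) (primesFrom D n)
primesFrom-All D zero = []
primesFrom-All D (suc n) with prime? (suc D)
... | yes pp = (pp , N.≤-refl) ∷ All.map (λ { (a , b) → a , N.<-trans N.≤-refl b }) (primesFrom-All (suc D) n)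
... | no  _ = All.map (λ { (a , b) → a , N.<-trans N.≤-refl b }) (primesFrom-All (suc D) n)

primesFrom-positive : ∀ D n → Positive (primesFrom D n)
primesFrom-positive D n = All.map (λ { (a , b) → 1≤prime a }) (primesFrom-All D n)

S-mono⁺ : ∀ {P g ψ ψ'} → Positive P → Nonneg g → (∀ r → 1 N.≤ r → ψ r ≤ ψ' r) → S P g ψ ≤ S P g ψ'
S-mono⁺ {[]}    _           g≥0 h = h 1 N.≤-refl
S-mono⁺ {p ∷ P} (1≤p ∷ pos) g≥0 h = +-mono-≤ (S-mono⁺ pos g≥0 h)
  (*-monoˡ-≤ (g≥0 p) (S-mono⁺ pos g≥0 λ r 1≤r → h (p N.* r) (N.*-mono-≤ 1≤p 1≤r)))

S-zero⁺ : ∀ {P g ψ} → Positive P → Nonneg g → (∀ r → 1 N.≤ r → ψ r ≡ 0#) → S P g ψ ≡ 0#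
S-zero⁺ {P} {g} {ψ} pos g≥0 h = trans
  (≤-antisym (S-mono⁺ pos g≥0 λ r 1≤r → ≡⇒≤ (h r 1≤r)) (S-mono⁺ {ψ = λ _ → 0#} pos g≥0 λ r 1≤r → ≡⇒≤ (sym (h r 1≤r))))
  (S-0 P g (λ _ → 0#) (λ _ → refl))

-- The sum of ψ over the integers up to X without prime factors up to D.
F : ℕ → ℕ → (ℕ → ℚ) → ℚ
F D X ψ = sum X (λ i → ind (coprime? (suc i) (D !)) * ψ (suc i))

VanishesBeyond : ℕ → (ℕ → ℚ) → Set
VanishesBeyond X ψ = ∀ m → X N.< m → ψ m ≡ 0#

F-mono : ∀ D X {ψ ψ'} → (∀ m → ψ m ≤ ψ' m) → F D X ψ ≤ F D X ψ'
F-mono D X h = sum-mono X λ i _ → *-monoˡ-≤ (0≤ind (coprime? (suc i) (D !))) (h (suc i))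

shift-vanishes : ∀ {X ψ} p → 1 N.≤ p → VanishesBeyond X ψ → VanishesBeyond X (shift ψ p)
shift-vanishes {X} p 1≤p v m X<m = v (p N.* m) (N.<-≤-trans X<m (subst (N._≤ p N.* m) (N.*-identityˡ m) (N.*-monoˡ-≤ m 1≤p)))

private
  0-notcop : ∀ D → 2 N.≤ D → ¬ Coprime 0 (D !)
  0-notcop D 2≤D c = N.<⇒≢ (2≤D ◃ (∣⇒≤ {{N._!≢0 D}} (m∣n! (s≤s z≤n ◃ 2≤D) N.≤-refl)) ◃ N.≤-refl)
    (sym (c (_ ∣0 , ∣-refl)))

  F-from0 : ∀ D X ψ → 2 N.≤ D → sum (suc X) (λ m → ind (coprime? m (D !)) * ψ m) ≡ F D X ψ
  F-from0 D X ψ 2≤D = sum-shift X _ · cong (_+ F D X ψ)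
    (cong (_* ψ 0) (ind-no (coprime? 0 (D !)) (0-notcop D 2≤D)) · *-zeroˡ (ψ 0)) · +-identityˡ _

F-composite : ∀ D X ψ → 1 N.≤ D → ¬ Prime (suc D) → F D X ψ ≡ F (suc D) X ψ
F-composite D X ψ 1≤D ¬p = sum-cong X λ i _ → cong (_* ψ (suc i))
  (ind-cong (coprime? (suc i) (D !)) (coprime? (suc i) (suc D !)) (cop-composite D 1≤D ¬p) (cop-∣ʳ (n∣m*n (suc D))))

-- A Buchstab step for p = D + 1. The rough multiples of p are the p j where j may contain p again,
-- so the second sum keeps D; since ψ vanishes beyond X, it can keep the range X as well.
F-prime : ∀ D X ψ → 2 N.≤ D → Prime (suc D) → VanishesBeyond X ψ →
  F D X ψ ≡ F (suc D) X ψ + F D X (shift ψ (suc D))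
F-prime D X ψ 2≤D pp van = begin
  F D X ψ ≡⟨ sym (F-from0 D X ψ 2≤D) ⟩
  sum (suc X) (λ m → c m * ψ m) ≡⟨ sum-cong (suc X) (λ m _ → split m) ⟩
  sum (suc X) (λ m → c' m * ψ m + ind (p ∣? m) * (c m * ψ m)) ≡⟨ sum-+ (suc X) _ _ ⟩
  sum (suc X) (λ m → c' m * ψ m) + sum (suc X) (λ m → ind (p ∣? m) * (c m * ψ m)) ≡⟨ cong₂ _+_ (F-from0 (suc D) X ψ (N.m≤n⇒m≤1+n 2≤D)) multiples ⟩
  F (suc D) X ψ + F D X (shift ψ p) ∎
  where
  open ≡-Reasoning
  p : ℕ
  p = suc D
  c c' : ℕ → ℚ
  c  m = ind (coprime? m (D !))
  c' m = ind (coprime? m (p !))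
  split : ∀ m → c m * ψ m ≡ c' m * ψ m + ind (p ∣? m) * (c m * ψ m)
  split m with p ∣? m
  ... | yes p∣m = solve 2 (λ c x → c :* x := # 0 :* x :+ # 1 :* (c :* x)) refl (c m) (ψ m) ·
    cong (λ t → t * ψ m + 1# * (c m * ψ m)) (sym (ind-no (coprime? m (p !)) λ cop → cop⇒∤ pp (cop-∣ʳ (m∣m*n (D !)) cop) p∣m))
  ... | no p∤m = cong (_* ψ m) (ind-cong (coprime? m (D !)) (coprime? m (p !))
      (λ cop → cop-*ʳ (prime-∤⇒cop pp p∤m) cop) (cop-∣ʳ (n∣m*n p))) ·
    solve 2 (λ x y → x := x :+ # 0 :* y) refl (c' m * ψ m) (c m * ψ m)
  multiples : sum (suc X) (λ m → ind (p ∣? m) * (c m * ψ m)) ≡ F D X (shift ψ p)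
  multiples = begin
    sum (suc X) (λ m → ind (p ∣? m) * (c m * ψ m)) ≡⟨ sym (sum-extend _ (N.m≤m*n (suc X) p) λ m X<m → cong (λ t → ind (p ∣? m) * (c m * t)) (van m X<m) ·
           solve 2 (λ a b → a :* (b :* # 0) := # 0) refl (ind (p ∣? m)) (c m)) ⟩
    sum (suc X N.* p) (λ m → ind (p ∣? m) * (c m * ψ m)) ≡⟨ sum-multiples p (suc X) (λ m → c m * ψ m) ⟩
    sum (suc X) (λ j → c (p N.* j) * ψ (p N.* j)) ≡⟨ sum-cong (suc X) (λ j _ → cong (_* ψ (p N.* j)) (ind-cong (coprime? (p N.* j) (D !)) (coprime? j (D !))
           (cop-∣ˡ (n∣m*n p)) (cop-*ˡ (prime-cop-! D pp N.≤-refl)))) ⟩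
    sum (suc X) (λ j → c j * ψ (p N.* j)) ≡⟨ F-from0 D X (shift ψ p) 2≤D ⟩
    F D X (shift ψ p) ∎

F-anti : ∀ D X {ψ} → Nonneg ψ → F (suc D) X ψ ≤ F D X ψ
F-anti D X {ψ} ψ≥0 = sum-mono X λ i _ → *-monoʳ-≤ (ψ≥0 (suc i))
  (ind-mono (coprime? (suc i) (suc D !)) (coprime? (suc i) (D !)) (cop-∣ʳ (n∣m*n (suc D))))

-- Squarefree products of primes beyond D are distinct D-rough integers.
S≤F : ∀ D n X ψ → 2 N.≤ D → Nonneg ψ → VanishesBeyond X ψ → S (primesFrom D n) (λ _ → 1#) ψ ≤ F D X ψ
S≤F D zero zero ψ 2≤D ψ≥0 van = ≡⇒≤ (van 1 (s≤s z≤n))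
S≤F D zero (suc X) ψ 2≤D ψ≥0 van = ≤-trans
  (≡⇒≤ (sym (+-identityˡ _ · cong (_* ψ 1) (ind-yes (coprime? 1 (D !)) (Coprime.1-coprimeTo _)) · *-identityˡ (ψ 1))))
  (sum-mono-n {1} {suc X} (λ i → ind (coprime? (suc i) (D !)) * ψ (suc i)) (s≤s z≤n) λ i → *-nonneg (0≤ind (coprime? (suc i) (D !))) (ψ≥0 (suc i)))
S≤F D (suc n) X ψ 2≤D ψ≥0 van with prime? (suc D)
... | no ¬p = S≤F (suc D) n X ψ (N.m≤n⇒m≤1+n 2≤D) ψ≥0 van ◂ ≡⇒≤ (sym (F-composite D X ψ (s≤s z≤n ◃ 2≤D) ¬p))
... | yes pp = ≤-trans (+-mono-≤ (S≤F (suc D) n X ψ (N.m≤n⇒m≤1+n 2≤D) ψ≥0 van)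
    (≡⇒≤ (*-identityˡ _) ◂ ≤-trans
      (S≤F (suc D) n X (shift ψ (suc D)) (N.m≤n⇒m≤1+n 2≤D) ψp≥0 (shift-vanishes (suc D) (s≤s z≤n) van)) (F-anti D X ψp≥0)))
  (≡⇒≤ (sym (F-prime D X ψ 2≤D pp van)))
  where
  ψp≥0 : Nonneg (shift ψ (suc D))
  ψp≥0 r = ψ≥0 (suc D N.* r)

S-inv : ∀ P ψ → S P inv ψ ≡ S P (λ _ → 1#) (λ r → inv r * ψ r)
S-inv [] ψ = sym (*-identityˡ (ψ 1)) · cong (_* ψ 1) (sym inv-1)
S-inv (p ∷ P) ψ = cong₂ _+_ (S-inv P ψ) (begin
  inv p * S P inv (shift ψ p) ≡⟨ cong (inv p *_) (S-inv P (shift ψ p)) ⟩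
  inv p * S P (λ _ → 1#) (λ r → inv r * ψ (p N.* r)) ≡⟨ sym (S-* P _ (inv p) _) ⟩
  S P (λ _ → 1#) (λ r → inv p * (inv r * ψ (p N.* r))) ≡⟨ S-cong P _ (λ r → sym (*-assoc _ _ _) · cong (_* ψ (p N.* r)) (sym (inv-* p r))) ⟩
  S P (λ _ → 1#) (λ r → inv (p N.* r) * ψ (p N.* r)) ≡⟨ sym (*-identityˡ _) ⟩
  1# * S P (λ _ → 1#) (λ r → inv (p N.* r) * ψ (p N.* r)) ∎)
  where open ≡-Reasoning

-- An antitone ψ allows a rough m to be replaced by its radical, and the powers of p then sum to 1 /
-- p + 1 / p² + ... = 1 / (p - 1). By X ≤ D + n the list contains every prime that occurs.
F≤S : ∀ D n X ψ → 2 N.≤ D → X N.≤ D N.+ n → Nonneg ψ → Antitone ψ → VanishesBeyond X ψ →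
  F D X (λ m → inv m * ψ m) ≤ S (primesFrom D n) (λ p → inv (p N.∸ 1)) ψ
F≤S D zero X ψ 2≤D X≤ ψ≥0 anti van = ≤-trans (sum-mono X λ i i<X → only1 i i<X) (single X)
  where
  f : ℕ → ℚ
  f i = ψ (suc i)
  -- No primes are left and X ≤ D, so 1 is the only rough number up to X.
  only1 : ∀ i → i N.< X → ind (coprime? (suc i) (D !)) * (inv (suc i) * ψ (suc i)) ≤ ind (i N.≟ 0) * f i
  only1 zero i<X = *-monoʳ-≤ (*-nonneg (0≤inv 1) (ψ≥0 1)) (ind≤1 (coprime? 1 (D !))) ◂
    *-monoˡ-≤ 0≤1 (*-monoʳ-≤ (ψ≥0 1) (inv≤1 1) ◂ ≡⇒≤ (*-identityˡ _))
  only1 (suc i) i<X = ≡⇒≤ (cong (_* _) (ind-no (coprime? (suc (suc i)) (D !)) λ c → N.1+n≢0 (N.suc-injective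
      (c (∣-refl , m∣n! (s≤s z≤n) (i<X ◃ subst (X N.≤_) (N.+-identityʳ D) X≤))))) · *-zeroˡ _ · sym (*-zeroˡ _))
  single : ∀ X → sum X (λ i → ind (i N.≟ 0) * f i) ≤ ψ 1
  single zero = ψ≥0 1
  single (suc X) = ≡⇒≤ (sum-single (suc X) 0 f (s≤s z≤n))
F≤S D (suc n) X ψ 2≤D X≤ ψ≥0 anti van with prime? (suc D)
... | no ¬p = ≡⇒≤ (F-composite D X (λ m → inv m * ψ m) (s≤s z≤n ◃ 2≤D) ¬p) ◂
      F≤S (suc D) n X ψ (N.m≤n⇒m≤1+n 2≤D) (subst (X N.≤_) (N.+-suc D n) X≤) ψ≥0 anti van
... | yes pp = begin
    F D X ψ̃ ≡⟨ F-prime D X ψ̃ 2≤D pp vañ ⟩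
    F (suc D) X ψ̃ + F D X (shift ψ̃ p) ≡⟨ cong (F (suc D) X ψ̃ +_) (pull D ψ) ⟩
    F (suc D) X ψ̃ + inv p * A ≤⟨ +-mono-≤ IH₀ A≤ ⟩
    S P e ψ + e p * S P e (shift ψ p) ∎
  where
  open ≤-Reasoning
  p : ℕ
  p = suc D
  P : List ℕ
  P = primesFrom p n
  e ψ̃ ψ̃p : ℕ → ℚ
  e q = inv (q N.∸ 1)
  ψ̃ m = inv m * ψ m
  ψ̃p m = inv m * shift ψ p m
  vañ : VanishesBeyond X ψ̃
  vañ m X<m = cong (inv m *_) (van m X<m) · *-zeroʳ _
  IH₀ = F≤S p n X ψ (N.m≤n⇒m≤1+n 2≤D) (subst (X N.≤_) (N.+-suc D n) X≤) ψ≥0 anti van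
  IH₁ = F≤S p n X (shift ψ p) (N.m≤n⇒m≤1+n 2≤D) (subst (X N.≤_) (N.+-suc D n) X≤) (λ r → ψ≥0 (p N.* r))
          (shift-antitone p anti) (shift-vanishes p (s≤s z≤n) van)
  pull : ∀ D ψ → F D X (shift (λ m → inv m * ψ m) p) ≡ inv p * F D X (λ m → inv m * shift ψ p m)
  pull D ψ = (sum-cong X λ i _ → cong (λ t → ind (coprime? (suc i) (D !)) * (t * ψ (p N.* suc i))) (inv-* p (suc i)) ·
      solve 4 (λ a b c d → a :* (b :* c :* d) := b :* (a :* (c :* d))) refl (ind (coprime? (suc i) (D !))) (inv p) (inv (suc i)) (ψ (p N.* suc i))) ·
    sum-*ˡ X (inv p) _
  A = F D X ψ̃p
  -- A ≤ IH₁ + A / p, and p / (p − 1) = 1 / (1 − 1/p).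
  self : A ≤ S P e (shift ψ p) + inv p * A
  self = begin
    A ≡⟨ F-prime D X ψ̃p 2≤D pp (λ m X<m → cong (inv m *_) (shift-vanishes p (s≤s z≤n) van m X<m) · *-zeroʳ _) ⟩
    F p X ψ̃p + F D X (shift ψ̃p p) ≡⟨ cong (F p X ψ̃p +_) (pull D (shift ψ p)) ⟩
    F p X ψ̃p + inv p * F D X (λ m → inv m * shift (shift ψ p) p m) ≤⟨ +-mono-≤ IH₁ (*-monoˡ-≤ (0≤inv p) (F-mono D X λ m → *-monoˡ-≤ (0≤inv m) (shift-antitone p anti p m (s≤s z≤n)))) ⟩
    S P e (shift ψ p) + inv p * A ∎
  A≤ : inv p * A ≤ e p * S P e (shift ψ p)
  A≤ = *-cancelˡ-≤ {nat D} (0<nat D {{N.>-nonZero (s≤s z≤n ◃ 2≤D)}}) (begin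
    nat D * (inv p * A) ≡⟨ solve 4 (λ d i a s → d :* (i :* a) := (d :+ # 1) :* i :* a :- i :* a) refl (nat D) (inv p) A 0# ⟩
    (nat D + 1#) * inv p * A - inv p * A ≡⟨ cong (λ t → t * inv p * A - inv p * A) (sym (nat-suc D)) ⟩
    nat p * inv p * A - inv p * A ≡⟨ cong (λ t → t * A - inv p * A) (natinv p) ⟩
    1# * A - inv p * A ≤⟨ ≤-add _ (0≤y-x self) (solve 3 (λ a i s → # 1 :* a :- i :* a :+ (s :+ i :* a :- a) := s) refl A (inv p) (S P e (shift ψ p))) ⟩
    S P e (shift ψ p) ≡⟨ sym (*-identityˡ _) ⟩
    1# * S P e (shift ψ p) ≡⟨ cong (_* S P e (shift ψ p)) (sym (natinv D {{N.>-nonZero (s≤s z≤n ◃ 2≤D)}})) ⟩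
    nat D * inv D * S P e (shift ψ p) ≡⟨ *-assoc _ _ _ ⟩
    nat D * (e p * S P e (shift ψ p)) ∎)

-- Harmonic sums over the integers coprime to W

H : ℕ → ℚ
H n = sum n (λ i → inv (suc i))

H-mono : ∀ {m n} → m N.≤ n → H m ≤ H n
H-mono le = sum-mono-n (λ i → inv (suc i)) le (λ i → 0≤inv (suc i))

0≤H : ∀ n → 0# ≤ H n
0≤H n = sum-nonneg n λ i _ → 0≤inv (suc i)

1≤H : ∀ n → 1 N.≤ n → 1# ≤ H n
1≤H n 1≤n = subst (_≤ H n) (+-identityˡ _ · inv-1) (H-mono {1} 1≤n)

coprimeSum : ℕ → ℕ → ℚ
coprimeSum W n = sum n (λ i → ind (coprime? (suc i) W) * inv (suc i))

-- The interval (cx, (c+1)x] contains y φ(W) integers coprime to W, where x = y W.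
module _ (W y : ℕ) (1≤W : 1 N.≤ W) (1≤y : 1 N.≤ y) where
  private
    x = y N.* W
    β = nat (φ W) * inv W
    c : ℕ → ℚ
    c m = ind (coprime? m W)
    instance
      _ : NonZero y
      _ = N.>-nonZero 1≤y
      _ : NonZero W
      _ = N.>-nonZero 1≤W
      x≢0 : NonZero x
      x≢0 = N.m*n≢0 y W
    term : ℕ → ℚ
    term i = c (suc i) * inv (suc i)
    block : ℕ → ℚ
    block b = sum x (λ i → term (b N.* x N.+ i))
    count : ∀ b → sum x (λ i → c (suc (b N.* x N.+ i))) ≡ nat y * nat (φ W)
    count b = sum-periods W c (cop-periodic W) y (suc (b N.* x)) · cong (nat y *_) (sym (φ-sum W))
    scale : ∀ b → nat y * nat (φ W) * inv (b N.* x) ≡ β * inv b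
    scale b = begin
      nat y * nat (φ W) * inv (b N.* x) ≡⟨ cong (nat y * nat (φ W) *_) (inv-* b x · cong (inv b *_) (inv-* y W)) ⟩
      nat y * nat (φ W) * (inv b * (inv y * inv W)) ≡⟨ solve 5 (λ y f b iy iw → y :* f :* (b :* (iy :* iw)) := (y :* iy) :* (f :* iw :* b)) refl (nat y) (nat (φ W)) (inv b) (inv y) (inv W) ⟩
      nat y * inv y * (β * inv b) ≡⟨ cong (_* (β * inv b)) (natinv y) · *-identityˡ _ ⟩
      β * inv b ∎
      where open ≡-Reasoning
    block-≤ : ∀ b → 1 N.≤ b → block b ≤ β * inv b
    block-≤ b 1≤b = begin
      block b ≤⟨ sum-mono x (λ i _ → *-monoˡ-≤ (0≤ind (coprime? (suc (b N.* x N.+ i)) W))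
             (inv-anti {{N.m*n≢0 b x {{N.>-nonZero 1≤b}}}} (N.m≤n⇒m≤1+n (N.m≤m+n (b N.* x) i)))) ⟩
      sum x (λ i → c (suc (b N.* x N.+ i)) * inv (b N.* x)) ≡⟨ sum-*ʳ x _ _ · cong (_* inv (b N.* x)) (count b) ⟩
      nat y * nat (φ W) * inv (b N.* x) ≡⟨ scale b ⟩
      β * inv b ∎
      where open ≤-Reasoning
    block-≥ : ∀ b → β * inv (suc b) ≤ block b
    block-≥ b = begin
      β * inv (suc b) ≡⟨ sym (scale (suc b)) ⟩
      nat y * nat (φ W) * inv (suc b N.* x) ≡⟨ sym (sum-*ʳ x _ _ · cong (_* inv (suc b N.* x)) (count b)) ⟩
      sum x (λ i → c (suc (b N.* x N.+ i)) * inv (suc b N.* x)) ≤⟨ sum-mono x (λ i i<x → *-monoˡ-≤ (0≤ind (coprime? (suc (b N.* x N.+ i)) W))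
             (inv-anti (subst (suc (b N.* x N.+ i) N.≤_) (N.+-comm (b N.* x) x) (N.+-monoʳ-< (b N.* x) i<x)))) ⟩
      block b ∎
      where open ≤-Reasoning
    step : ∀ s → coprimeSum W (suc s N.* x) ≡ coprimeSum W (s N.* x) + block s
    step s = cong (λ t → sum t term) (N.+-comm x (s N.* x)) · sum-append (s N.* x) x term

  coprimeSum-≤ : ∀ s → coprimeSum W (suc s N.* x) ≤ coprimeSum W x + β * H s
  coprimeSum-≤ zero = ≡⇒≤ (cong (coprimeSum W) (N.*-identityˡ x) · sym (cong (coprimeSum W x +_) (*-zeroʳ β) · +-identityʳ _))
  coprimeSum-≤ (suc s) = begin
    coprimeSum W (suc (suc s) N.* x) ≡⟨ step (suc s) ⟩
    coprimeSum W (suc s N.* x) + block (suc s) ≤⟨ +-mono-≤ (coprimeSum-≤ s) (block-≤ (suc s) (s≤s z≤n)) ⟩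
    coprimeSum W x + β * H s + β * inv (suc s) ≡⟨ solve 4 (λ a b h i → a :+ b :* h :+ b :* i := a :+ b :* (h :+ i)) refl _ β (H s) (inv (suc s)) ⟩
    coprimeSum W x + β * H (suc s) ∎
    where open ≤-Reasoning

  coprimeSum-≥ : ∀ s → coprimeSum W x + β * (H (suc s) - 1#) ≤ coprimeSum W (suc s N.* x)
  coprimeSum-≥ zero = ≡⇒≤ (cong (λ t → coprimeSum W x + β * (t - 1#)) (+-identityˡ _ · inv-1) ·
    solve 2 (λ a b → a :+ b :* (# 1 :- # 1) := a) refl _ β · cong (coprimeSum W) (sym (N.*-identityˡ x)))
  coprimeSum-≥ (suc s) = begin
    coprimeSum W x + β * (H (suc s) + inv (suc (suc s)) - 1#) ≡⟨ solve 4 (λ a b h i → a :+ b :* (h :+ i :- # 1) := a :+ b :* (h :- # 1) :+ b :* i) refl _ β (H (suc s)) (inv (suc (suc s))) ⟩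
    coprimeSum W x + β * (H (suc s) - 1#) + β * inv (suc (suc s)) ≤⟨ +-mono-≤ (coprimeSum-≥ s) (block-≥ (suc s)) ⟩
    coprimeSum W (suc s N.* x) + block (suc s) ≡⟨ sym (step (suc s)) ⟩
    coprimeSum W (suc (suc s) N.* x) ∎
    where open ≤-Reasoning

private
  H-coprime : ∀ n → coprimeSum 1 n ≡ H n
  H-coprime n = sum-cong n λ i _ → cong (_* inv (suc i)) (ind-yes (coprime? (suc i) 1) (Coprime.sym (Coprime.1-coprimeTo _))) · *-identityˡ _

  φ1 : nat (φ 1) * inv 1 ≡ 1#
  φ1 = cong₂ _*_ (refl {x = nat (φ 1)}) inv-1 · *-identityˡ 1#

-- The case W = 1 of the block comparison. Together with `H-*-≥` it makes H additive up to an error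
-- of 1, so that H can stand for the logarithm in the sieve.
H-* : ∀ s y → 1 N.≤ y → H (suc s N.* y) ≤ H y + H (suc s)
H-* s y 1≤y = subst₂ _≤_ (H-coprime (suc s N.* (y N.* 1)) · cong (λ t → H (suc s N.* t)) (N.*-identityʳ y))
    (cong₂ _+_ (H-coprime (y N.* 1) · cong H (N.*-identityʳ y)) (cong (_* H s) φ1 · *-identityˡ (H s)))
    (coprimeSum-≤ 1 y N.≤-refl 1≤y s) ◂
  +-mono-≤ ≤-refl (H-mono (N.n≤1+n s))

H-*-≥ : ∀ s y → 1 N.≤ y → H y + (H (suc s) - 1#) ≤ H (suc s N.* y)
H-*-≥ s y 1≤y = subst₂ _≤_
    (cong₂ _+_ (H-coprime (y N.* 1) · cong H (N.*-identityʳ y)) (cong (_* (H (suc s) - 1#)) φ1 · *-identityˡ _))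
    (H-coprime (suc s N.* (y N.* 1)) · cong (λ t → H (suc s N.* t)) (N.*-identityʳ y))
    (coprimeSum-≥ 1 y N.≤-refl 1≤y s)

H-^ : ∀ T j → 1 N.≤ T → H (T N.^ suc j) ≤ nat (suc j) * H T
H-^ T zero 1≤T = ≡⇒≤ (cong H (N.*-identityʳ T) · sym (*-identityˡ _))
H-^ (suc s) (suc j) 1≤T = ≤-trans (H-* s (T N.^ suc j) (N.m^n>0 T (suc j))) (+-mono-≤ (H-^ T j 1≤T) ≤-refl ◂
  ≡⇒≤ (solve 2 (λ n h → n :* h :+ h := (n :+ # 1) :* h) refl (nat (suc j)) (H T) · cong (_* H T) (sym (nat-suc (suc j)))))
  where T = suc s

-- Doubling the range adds at least 1/2.
H-2^ : ∀ n → inv 2 * nat n + 1# ≤ H (2 N.^ n)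
H-2^ zero = ≡⇒≤ (solve 1 (λ a → a :* # 0 :+ # 1 := # 1) refl (inv 2) · sym (+-identityˡ _ · inv-1))
H-2^ (suc n) = begin
  inv 2 * nat (suc n) + 1# ≡⟨ cong (λ t → inv 2 * t + 1#) (nat-suc n) · solve 2 (λ a n → a :* (n :+ # 1) :+ # 1 := a :* n :+ # 1 :+ a) refl (inv 2) (nat n) ⟩
  inv 2 * nat n + 1# + inv 2 ≤⟨ +-mono-≤ (H-2^ n) (≡⇒≤ (solve 1 (λ a → a := # 0 :+ # 1 :+ a :- # 1) refl (inv 2) · cong (λ t → 0# + t + inv 2 - 1#) (sym inv-1))) ⟩
  H (2 N.^ n) + (H 2 - 1#) ≤⟨ H-*-≥ 1 (2 N.^ n) (N.m^n>0 2 n) ⟩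
  H (2 N.^ suc n) ∎
  where open ≤-Reasoning

H≤n : ∀ n → H n ≤ nat n
H≤n n = (sum-mono n λ i _ → inv≤1 (suc i)) ◂ ≡⇒≤ (sum-const n 1# · *-identityʳ _)

H-unbounded : ∀ x → ∃[ n ] 1 N.≤ n × x ≤ H n
H-unbounded x = 2 N.^ (2 N.* c) , N.m^n>0 2 (2 N.* c) , ≤-trans (≤-ceiling x) (≤-trans
  (≤-add 1# 0≤1 (cong (_+ 1#) (sym (cong (inv 2 *_) (nat-* 2 c) · sym (*-assoc _ _ _) · cong (_* nat c) (invnat 2) · *-identityˡ _)) · refl))
  (H-2^ (2 N.* c)))
  where c = ceiling x

coprimeSum-≤n : ∀ W n → coprimeSum W n ≤ nat n
coprimeSum-≤n W n = (sum-mono n λ i _ → *-mono-≤ (0≤ind (coprime? (suc i) W)) (0≤inv (suc i)) (ind≤1 (coprime? (suc i) W)) (inv≤1 (suc i))) ◂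
  ≡⇒≤ (sum-const n _ · cong (nat n *_) (*-identityˡ 1#) · *-identityʳ _)

-- Chains of cells and a geometric mesh

-- U κ j = C(j+κ−1, κ) and L κ j = C(j, κ) for κ ≥ 1: the numbers of weakly and strictly increasing chains of cells.
U L : ℕ → ℕ → ℕ
U zero    j = 1
U (suc κ) zero = 0
U (suc κ) (suc j) = U (suc κ) j N.+ U κ (suc j)

L zero    j = 1
L (suc κ) zero = 0
L (suc κ) (suc j) = L (suc κ) j N.+ L κ j

sum-U : ∀ κ j → sum j (λ a → nat (U κ (j N.∸ a))) ≡ nat (U (suc κ) j)
sum-U κ zero = refl
sum-U κ (suc j) = sum-shift j _ · cong (nat (U κ (suc j)) +_) (sum-U κ j) ·
  +-comm _ _ · sym (nat-+ (U (suc κ) j) (U κ (suc j)))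

sum-L : ∀ κ j → sum j (λ a → nat (L κ (j N.∸ suc a))) ≡ nat (L (suc κ) j)
sum-L κ zero = refl
sum-L κ (suc j) = sum-shift j _ · cong (nat (L κ j) +_) (sum-L κ j) ·
  +-comm _ _ · sym (nat-+ (L (suc κ) j) (L κ j))

-- The endpoints of the cells (0, T], (T, T²], (T², T³], …
edge : ℕ → ℕ → ℕ
edge T zero = 0
edge T (suc a) = T N.^ suc a

module Mesh (D t' : ℕ) (2≤D : 2 N.≤ D) where

  -- T is a multiple of W, so that the cells consist of complete periods modulo W.
  W t T : ℕ
  W = D !
  t = suc t'
  T = t N.* W

  1≤W : 1 N.≤ W
  1≤W = N.n≢0⇒n>0 (N.≢-nonZero⁻¹ W {{N._!≢0 D}})

  1≤T : 1 N.≤ T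
  1≤T = N.*-mono-≤ {1} {t} (s≤s z≤n) 1≤W

  private instance
    _ : NonZero T
    _ = N.>-nonZero 1≤T

  -- Bounds for the sum of 1 / m over the m coprime to W in a cell, the same for all cells; β is the
  -- density of these m. The summand W of h⁺ is a trivial bound for the block (0, W] in the first
  -- cell. For fixed D the difference h⁺ - h⁻ stays bounded while both grow with t.
  β h⁺ h⁻ : ℚ
  β = nat (φ W) * inv W
  h⁺ = β * H T + nat W
  h⁻ = β * (H t - 1#)

  0≤β : 0# ≤ β
  0≤β = *-nonneg (0≤nat (φ W)) (0≤inv W)

  0≤h⁺ : 0# ≤ h⁺
  0≤h⁺ = +-nonneg (*-nonneg 0≤β (0≤H T)) (0≤nat W)

  0≤h⁻ : 0# ≤ h⁻
  0≤h⁻ = *-nonneg 0≤β (0≤y-x (1≤H t (s≤s z≤n)))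

  private
    pred-form : ∀ {n} → 1 N.≤ n → ∃[ m ] n ≡ suc m
    pred-form {suc m} _ = m , refl
    T' : ℕ
    T' = proj₁ (pred-form 1≤T)
    T≡ : T ≡ suc T'
    T≡ = proj₂ (pred-form 1≤T)
    y : ℕ → ℕ
    y a = t N.* T N.^ a
    power : ∀ a → y a N.* W ≡ T N.^ suc a
    power a = N.*-assoc t (T N.^ a) W · cong (t N.*_) (N.*-comm (T N.^ a) W) · sym (N.*-assoc t W (T N.^ a))
    1≤y : ∀ a → 1 N.≤ y a
    1≤y a = N.*-mono-≤ {1} {t} (s≤s z≤n) (N.m^n>0 T a)

  cell-≤ : ∀ a → coprimeSum W (edge T (suc a)) ≤ coprimeSum W (edge T a) + h⁺
  cell-≤ zero = begin
    coprimeSum W (T N.* 1) ≡⟨ cong (coprimeSum W) (N.*-identityʳ T · cong (t N.*_) (sym (N.*-identityˡ W))) ⟩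
    coprimeSum W (t N.* (1 N.* W)) ≤⟨ coprimeSum-≤ W 1 1≤W N.≤-refl t' ⟩
    coprimeSum W (1 N.* W) + β * H t' ≤⟨ +-mono-≤ (coprimeSum-≤n W (1 N.* W) ◂ ≡⇒≤ (cong nat (N.*-identityˡ W)))
           (*-monoˡ-≤ 0≤β (H-mono (N.n≤1+n t' ◃ N.m≤m*n t W {{N.>-nonZero 1≤W}}))) ⟩
    nat W + β * H T ≡⟨ +-comm _ _ · sym (+-identityˡ _) ⟩
    0# + h⁺ ∎
    where open ≤-Reasoning
  cell-≤ (suc a) = begin
    coprimeSum W (T N.* T N.^ suc a) ≡⟨ cong (coprimeSum W) (cong₂ N._*_ T≡ (sym (power a))) ⟩
    coprimeSum W (suc T' N.* (y a N.* W)) ≤⟨ coprimeSum-≤ W (y a) 1≤W (1≤y a) T' ⟩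
    coprimeSum W (y a N.* W) + β * H T' ≤⟨ +-mono-≤ (≡⇒≤ (cong (coprimeSum W) (power a)))
           (≤-add (β * (H T - H T') + nat W) (+-nonneg (*-nonneg 0≤β (0≤y-x (H-mono (subst (T' N.≤_) (sym T≡) (N.n≤1+n T'))))) (0≤nat W))
             (solve 4 (λ b u v w → b :* u :+ (b :* (v :- u) :+ w) := b :* v :+ w) refl β (H T') (H T) (nat W))) ⟩
    coprimeSum W (T N.^ suc a) + h⁺ ∎
    where open ≤-Reasoning

  cell-≥ : ∀ a → coprimeSum W (edge T a) + h⁻ ≤ coprimeSum W (edge T (suc a))
  cell-≥ zero = begin
    0# + h⁻ ≤⟨ +-mono-≤ (sum-nonneg (1 N.* W) λ i _ → *-nonneg (0≤ind (coprime? (suc i) W)) (0≤inv (suc i))) ≤-refl ⟩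
    coprimeSum W (1 N.* W) + h⁻ ≤⟨ coprimeSum-≥ W 1 1≤W N.≤-refl t' ⟩
    coprimeSum W (t N.* (1 N.* W)) ≡⟨ cong (coprimeSum W) (sym (N.*-identityʳ T · cong (t N.*_) (sym (N.*-identityˡ W)))) ⟩
    coprimeSum W (T N.* 1) ∎
    where open ≤-Reasoning
  cell-≥ (suc a) = begin
    coprimeSum W (T N.^ suc a) + h⁻ ≤⟨ +-mono-≤ (≡⇒≤ (cong (coprimeSum W) (sym (power a)))) (*-monoˡ-≤ 0≤β
           (+-mono-≤ (H-mono (N.m≤m*n t W {{N.>-nonZero 1≤W}}) ◂ ≡⇒≤ (cong H T≡)) ≤-refl)) ⟩
    coprimeSum W (y a N.* W) + β * (H (suc T') - 1#) ≤⟨ coprimeSum-≥ W (y a) 1≤W (1≤y a) T' ⟩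
    coprimeSum W (suc T' N.* (y a N.* W)) ≡⟨ cong (coprimeSum W) (sym (cong₂ N._*_ T≡ (sym (power a)))) ⟩
    coprimeSum W (T N.* T N.^ suc a) ∎
    where open ≤-Reasoning

  edge-mono : ∀ a → edge T a N.≤ edge T (suc a)
  edge-mono zero = z≤n
  edge-mono (suc a) = N.m≤n*m (T N.^ suc a) T

  private
    interval : ∀ a (g : ℕ → ℚ) → sum (edge T (suc a)) g ≡
      sum (edge T a) g + sum (edge T (suc a) N.∸ edge T a) (λ i → g (edge T a N.+ i))
    interval a g = cong (λ s → sum s g) (sym (N.m+[n∸m]≡n (edge-mono a))) · sum-append (edge T a) _ g
    w : ℕ → ℚ
    w i = ind (coprime? (suc i) W) * inv (suc i)
    0≤w : ∀ i → 0# ≤ w i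
    0≤w i = *-nonneg (0≤ind (coprime? (suc i) W)) (0≤inv (suc i))
    cellSum : ℕ → ℚ
    cellSum a = sum (edge T (suc a) N.∸ edge T a) (λ i → w (edge T a N.+ i))
    cellSum-≤ : ∀ a → cellSum a ≤ h⁺
    cellSum-≤ a = ≤-add (h⁺ - cellSum a) (0≤y-x (0≤y-x⇒x≤y (subst (0# ≤_)
        (cong (λ s → coprimeSum W (edge T a) + h⁺ - s) (interval a w) ·
          solve 3 (λ a h c → a :+ h :- (a :+ c) := h :- c) refl (coprimeSum W (edge T a)) h⁺ (cellSum a))
        (0≤y-x (cell-≤ a))))) (solve 2 (λ a b → a :+ (b :- a) := b) refl (cellSum a) h⁺)
    cellSum-≥ : ∀ a → h⁻ ≤ cellSum a
    cellSum-≥ a = 0≤y-x⇒x≤y (subst (0# ≤_)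
        (cong (_- (coprimeSum W (edge T a) + h⁻)) (interval a w) ·
          solve 3 (λ a h c → a :+ c :- (a :+ h) := c :- h) refl (coprimeSum W (edge T a)) h⁻ (cellSum a))
        (0≤y-x (cell-≥ a)))

  InCell : ℕ → ℕ → Set
  InCell a m = edge T a N.< m × m N.≤ edge T (suc a)

  private
    in-cell : ∀ a i → i N.< edge T (suc a) N.∸ edge T a → InCell a (suc (edge T a N.+ i))
    in-cell a i i< = s≤s (N.m≤m+n (edge T a) i) ,
      subst (suc (edge T a N.+ i) N.≤_) (N.m+[n∸m]≡n (edge-mono a)) (N.+-monoʳ-< (edge T a) i<)

  F-cells-≤ : ∀ j {ψ c : ℕ → ℚ} → Nonneg c → (∀ a m → a N.< j → InCell a m → ψ m ≤ c a) →
    F D (edge T j) (λ m → inv m * ψ m) ≤ h⁺ * sum j c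
  F-cells-≤ zero    c≥0 h = ≡⇒≤ (sym (*-zeroʳ h⁺))
  F-cells-≤ (suc j) {ψ} {c} c≥0 h = begin
    sum (edge T (suc j)) g ≡⟨ interval j g ⟩
    F D (edge T j) (λ m → inv m * ψ m) + sum (edge T (suc j) N.∸ edge T j) (λ i → g (edge T j N.+ i)) ≤⟨ +-mono-≤ (F-cells-≤ j c≥0 λ a m a<j → h a m (N.m<n⇒m<1+n a<j))
           (sum-mono (edge T (suc j) N.∸ edge T j) λ i i< → ≡⇒≤ (sym (*-assoc _ _ _)) ◂ *-monoˡ-≤ (0≤w (edge T j N.+ i)) (h j _ N.≤-refl (in-cell j i i<))) ⟩
    h⁺ * sum j c + sum (edge T (suc j) N.∸ edge T j) (λ i → w (edge T j N.+ i) * c j) ≡⟨ cong (h⁺ * sum j c +_) (sum-*ʳ (edge T (suc j) N.∸ edge T j) (c j) (λ i → w (edge T j N.+ i))) ⟩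
    h⁺ * sum j c + cellSum j * c j ≤⟨ +-mono-≤ ≤-refl (*-monoʳ-≤ (c≥0 j) (cellSum-≤ j)) ⟩
    h⁺ * sum j c + h⁺ * c j ≡⟨ sym (*-distribˡ _ _ _) ⟩
    h⁺ * sum (suc j) c ∎
    where
    open ≤-Reasoning
    g : ℕ → ℚ
    g i = ind (coprime? (suc i) W) * (inv (suc i) * ψ (suc i))

  F-cells-≥ : ∀ j {ψ c : ℕ → ℚ} → Nonneg c → (∀ a m → a N.< j → InCell a m → c a ≤ ψ m) →
    h⁻ * sum j c ≤ F D (edge T j) (λ m → inv m * ψ m)
  F-cells-≥ zero    c≥0 h = ≡⇒≤ (*-zeroʳ h⁻)
  F-cells-≥ (suc j) {ψ} {c} c≥0 h = begin
    h⁻ * sum (suc j) c ≡⟨ *-distribˡ _ _ _ ⟩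
    h⁻ * sum j c + h⁻ * c j ≤⟨ +-mono-≤ ≤-refl (*-monoʳ-≤ (c≥0 j) (cellSum-≥ j)) ⟩
    h⁻ * sum j c + cellSum j * c j ≡⟨ cong (h⁻ * sum j c +_) (sym (sum-*ʳ (edge T (suc j) N.∸ edge T j) (c j) (λ i → w (edge T j N.+ i)))) ⟩
    h⁻ * sum j c + sum (edge T (suc j) N.∸ edge T j) (λ i → w (edge T j N.+ i) * c j) ≤⟨ +-mono-≤ (F-cells-≥ j c≥0 λ a m a<j → h a m (N.m<n⇒m<1+n a<j))
           (sum-mono (edge T (suc j) N.∸ edge T j) λ i i< → *-monoˡ-≤ (0≤w (edge T j N.+ i)) (h j _ N.≤-refl (in-cell j i i<)) ◂ ≡⇒≤ (*-assoc _ _ _)) ⟩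
    F D (edge T j) (λ m → inv m * ψ m) + sum (edge T (suc j) N.∸ edge T j) (λ i → g (edge T j N.+ i)) ≡⟨ sym (interval j g) ⟩
    sum (edge T (suc j)) g ∎
    where
    open ≤-Reasoning
    g : ℕ → ℚ
    g i = ind (coprime? (suc i) W) * (inv (suc i) * ψ (suc i))

-- Masses of squarefree sums in terms of cells

over : ℕ → ℕ → ℚ
over κ p = nat κ * inv p

-- Upper bounds use the weights κ / p. Lower bounds use the larger κ / (p - k), which leave room for
-- a prime that divides two variables at once.
overShifted : ℕ → ℕ → ℕ → ℚ
overShifted k κ p = nat κ * inv (p N.∸ k)

over≥0 : ∀ κ → Nonneg (over κ)
over≥0 κ p = *-nonneg (0≤nat κ) (0≤inv p)

overShifted≥0 : ∀ k κ → Nonneg (overShifted k κ)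
overShifted≥0 k κ p = *-nonneg (0≤nat κ) (0≤inv (p N.∸ k))

S-weight0 : ∀ P (f : ℕ → ℚ) ψ → S P (λ p → nat 0 * f p) ψ ≡ ψ 1
S-weight0 []      f ψ = refl
S-weight0 (p ∷ P) f ψ = cong₂ (λ a b → a + b * S P (λ p → nat 0 * f p) (shift ψ p)) (S-weight0 P f ψ) (*-zeroˡ (f p)) ·
  cong (ψ 1 +_) (*-zeroˡ _) · +-identityʳ _

over-suc : ∀ κ p → over (suc κ) p ≤ inv p + over κ p
over-suc κ p = ≡⇒≤ (cong (_* inv p) (nat-suc κ) · solve 2 (λ n i → (n :+ # 1) :* i := i :+ n :* i) refl (nat κ) (inv p))

χ-out : ∀ {x v} u → x N.< v → 1 N.≤ u → χ x (v N.* u) ≡ 0#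
χ-out {x} {v} u x<v 1≤u = ind-no (v N.* u N.≤? x) λ le → N.<⇒≱ x<v (subst (N._≤ v N.* u) (N.*-identityʳ v) (N.*-monoʳ-≤ v 1≤u) ◃ le)

module _ (D n : ℕ) (2≤D : 2 N.≤ D) where
  private
    P = primesFrom D n
    pos = primesFrom-positive D n

  -- One of the κ + 1 units of weight at each prime is collected in a separate variable v, and v is
  -- then allowed to be any rough integer.
  S-over-F : ∀ κ x → S P (over (suc κ)) (χ x) ≤ F D x (λ v → inv v * S P (over κ) (λ u → χ x (v N.* u)))
  S-over-F κ x = begin
    S P (over (suc κ)) (χ x) ≤⟨ S≤S² 0≤inv (over≥0 κ) (over≥0 (suc κ)) (χ≥0 x) (All.tabulate {xs = P} λ {p} _ → over-suc κ p) ⟩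
    S P inv ψ ≡⟨ S-inv P ψ ⟩
    S P (λ _ → 1#) (λ v → inv v * ψ v) ≤⟨ S≤F D n x _ 2≤D (λ v → *-nonneg (0≤inv v) (S-nonneg P (over≥0 κ) λ u → χ≥0 x (v N.* u)))
           (λ v x<v → cong (inv v *_) (S-zero⁺ pos (over≥0 κ) λ u 1≤u → χ-out u x<v 1≤u) · *-zeroʳ _) ⟩
    F D x (λ v → inv v * ψ v) ∎
    where
    open ≤-Reasoning
    ψ : ℕ → ℚ
    ψ v = S P (over κ) (λ u → χ x (v N.* u))

  -- The crude form of the bound, without cells, for the error terms.
  S-over-H : ∀ κ x → S P (over κ) (χ x) ≤ H x ^ κ
  S-over-H zero    x = ≡⇒≤ (S-weight0 P inv (χ x)) ◂ ind≤1 (1 N.≤? x)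
  S-over-H (suc κ) x = begin
    S P (over (suc κ)) (χ x) ≤⟨ S-over-F κ x ⟩
    F D x (λ v → inv v * S P (over κ) (λ u → χ x (v N.* u))) ≤⟨ sum-mono x (λ i _ → *-monoʳ-≤ (*-nonneg (0≤inv (suc i)) (S-nonneg P (over≥0 κ) λ u → χ≥0 x (suc i N.* u))) (ind≤1 (coprime? (suc i) (D !))) ◂
           ≡⇒≤ (*-identityˡ _) ◂ *-monoˡ-≤ (0≤inv (suc i))
             ((S-mono P (over≥0 κ) λ u → χ-antitone x (suc i) u (s≤s z≤n)) ◂ S-over-H κ x)) ⟩
    sum x (λ i → inv (suc i) * H x ^ κ) ≡⟨ sum-*ʳ x (H x ^ κ) _ ⟩
    H x * H x ^ κ ∎
    where open ≤-Reasoning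

module Masses (D t' n : ℕ) (2≤D : 2 N.≤ D) where
  open Mesh D t' 2≤D
  P : List ℕ
  P = primesFrom D n
  pos : Positive P
  pos = primesFrom-positive D n

  private
    T^ : ℕ → ℕ
    T^ j = T N.^ j
    instance
      _ : NonZero T
      _ = N.>-nonZero 1≤T

  -- A variable v in (T^a, T^(a + 1)] leaves at most T^(j + 1 - a) for the others, so that summation
  -- over a is the recursion of `U`.
  S-over-≤ : ∀ κ j → S P (over κ) (χ (T^ (suc j))) ≤ h⁺ ^ κ * nat (U κ (suc j))
  S-over-≤ zero    j = ≡⇒≤ (S-weight0 P inv _) ◂ ind≤1 (1 N.≤? T^ (suc j)) ◂ ≡⇒≤ (sym (*-identityˡ _))
  S-over-≤ (suc κ) j = begin
    S P (over (suc κ)) (χ x) ≤⟨ S-over-F D n 2≤D κ x ⟩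
    F D x (λ v → inv v * S P (over κ) (λ u → χ x (v N.* u))) ≤⟨ F-cells-≤ (suc j) c≥0 bound ⟩
    h⁺ * sum (suc j) (λ a → h⁺ ^ κ * nat (U κ (suc j N.∸ a))) ≡⟨ cong (h⁺ *_) (sum-*ˡ (suc j) (h⁺ ^ κ) _ · cong (h⁺ ^ κ *_) (sum-U κ (suc j))) ⟩
    h⁺ * (h⁺ ^ κ * nat (U (suc κ) (suc j))) ≡⟨ sym (*-assoc _ _ _) ⟩
    h⁺ ^ suc κ * nat (U (suc κ) (suc j)) ∎
    where
    open ≤-Reasoning
    x : ℕ
    x = T^ (suc j)
    c≥0 : Nonneg (λ a → h⁺ ^ κ * nat (U κ (suc j N.∸ a)))
    c≥0 a = *-nonneg (^-nonneg κ 0≤h⁺) (0≤nat (U κ (suc j N.∸ a)))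
    bound : ∀ a m → a N.< suc j → InCell a m → S P (over κ) (λ u → χ x (m N.* u)) ≤ h⁺ ^ κ * nat (U κ (suc j N.∸ a))
    bound zero m a<j (0<m , _) = (S-mono P (over≥0 κ) λ u → χ-antitone x m u 0<m) ◂ S-over-≤ κ j
    bound (suc a) m (s≤s a<j) (lt , _) = ≤-trans
      (S-mono P (over≥0 κ) λ u → ind-mono (m N.* u N.≤? x) (u N.≤? T^ (j N.∸ a)) λ le →
         N.*-cancelˡ-≤ (T^ (suc a)) {{N.m^n≢0 T (suc a)}} (N.*-monoˡ-≤ u (N.<⇒≤ lt) ◃ le ◃ N.≤-reflexive
           (cong T^ (sym (cong suc (N.m+[n∸m]≡n (N.<⇒≤ a<j)))) · N.^-distribˡ-+-* T (suc a) (j N.∸ a))))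
      (≡⇒≤ (cong (λ s → S P (over κ) (χ (T^ s))) j∸a≡) ◂ S-over-≤ κ (j N.∸ suc a) ◂ ≡⇒≤ (cong (λ s → h⁺ ^ κ * nat (U κ s)) (sym j∸a≡)))
      where
      j∸a≡ : j N.∸ a ≡ suc (j N.∸ suc a)
      j∸a≡ = N.+-∸-assoc 1 a<j

  module _ (k : ℕ) (k≤D : k N.≤ D) where

    private
      weights : ∀ κ → suc κ N.≤ k → ∀ {p} → D N.< p →
        inv (p N.∸ 1) + overShifted k κ p + inv (p N.∸ 1) * overShifted k κ p ≤ overShifted k (suc κ) p
      weights κ κ<k {p} D<p = ≤-add (a * b * (nat k - nat (suc κ))) (*-nonneg (*-nonneg (0≤inv (p N.∸ k)) (0≤inv (p N.∸ 1))) (0≤y-x (nat-mono κ<k)))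
        (begin
          b + nat κ * a + b * (nat κ * a) + a * b * (nat k - nat (suc κ)) ≡⟨ cong₂ (λ s t → s + nat κ * t + b * (nat κ * a) + a * b * (nat k - nat (suc κ))) b≡ a≡ ⟩
          b * ((nat p - nat k) * a) + nat κ * (a * ((nat p - 1#) * b)) + b * (nat κ * a) + a * b * (nat k - nat (suc κ)) ≡⟨ cong (λ s → b * ((nat p - nat k) * a) + nat κ * (a * ((nat p - 1#) * b)) + b * (nat κ * a) + a * b * (nat k - s)) (nat-suc κ) ⟩
          b * ((nat p - nat k) * a) + nat κ * (a * ((nat p - 1#) * b)) + b * (nat κ * a) + a * b * (nat k - (nat κ + 1#)) ≡⟨ solve 5 (λ a b p k κ → b :* ((p :- k) :* a) :+ κ :* (a :* ((p :- # 1) :* b)) :+ b :* (κ :* a) :+ a :* b :* (k :- (κ :+ # 1))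
                  := (κ :+ # 1) :* (a :* ((p :- # 1) :* b))) refl a b (nat p) (nat k) (nat κ) ⟩
          (nat κ + 1#) * (a * ((nat p - 1#) * b)) ≡⟨ cong₂ _*_ (sym (nat-suc κ)) (sym a≡) ⟩
          nat (suc κ) * a ∎)
        where
        open ≡-Reasoning
        a b : ℚ
        a = inv (p N.∸ k)
        b = inv (p N.∸ 1)
        k<p = N.≤-<-trans k≤D D<p
        1<p = N.≤-<-trans (s≤s z≤n ◃ 2≤D) D<p
        b≡ : b ≡ b * ((nat p - nat k) * a)
        b≡ = sym (cong (λ s → b * (s * a)) (sym (nat-∸ (N.<⇒≤ k<p))) · cong (b *_) (natinv (p N.∸ k) {{N.>-nonZero (N.m<n⇒0<n∸m k<p)}}) · *-identityʳ b)
        a≡ : a ≡ a * ((nat p - 1#) * b)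
        a≡ = sym (cong (λ s → a * (s * b)) (sym (nat-∸ (N.<⇒≤ 1<p))) · cong (a *_) (natinv (p N.∸ 1) {{N.>-nonZero (N.m<n⇒0<n∸m 1<p)}}) · *-identityʳ a)

    -- Here v ≤ T^(a + 1) leaves at least T^(j - a) of T^(j + 1) for the others, which is one cell
    -- less and leads to `L`. The condition T^j ≤ D + n puts every prime beyond D and below the
    -- cutoff into the list.
    S-overShifted-≥ : ∀ κ j → κ N.≤ k → T^ j N.≤ D N.+ n → h⁻ ^ κ * nat (L κ j) ≤ S P (overShifted k κ) (χ (T^ j))
    S-overShifted-≥ zero j _ _ = ≡⇒≤ (*-identityˡ _ · sym (S-weight0 P (λ p → inv (p N.∸ k)) _ · ind-yes (1 N.≤? T^ j) (N.m^n>0 T j)))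
    S-overShifted-≥ (suc κ) zero _ _ = ≡⇒≤ (*-zeroʳ _) ◂ S-nonneg P (overShifted≥0 k (suc κ)) (χ≥0 (T^ 0))
    S-overShifted-≥ (suc κ) (suc j) κ<k le = begin
      h⁻ ^ suc κ * nat (L (suc κ) (suc j)) ≡⟨ *-assoc _ _ _ ⟩
      h⁻ * (h⁻ ^ κ * nat (L (suc κ) (suc j))) ≡⟨ cong (h⁻ *_) (sym (sum-*ˡ (suc j) (h⁻ ^ κ) _ · cong (h⁻ ^ κ *_) (sum-L κ (suc j)))) ⟩
      h⁻ * sum (suc j) (λ a → h⁻ ^ κ * nat (L κ (suc j N.∸ suc a))) ≤⟨ F-cells-≥ (suc j) (λ a → *-nonneg (^-nonneg κ 0≤h⁻) (0≤nat (L κ (j N.∸ a)))) bound ⟩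
      F D x (λ v → inv v * ψ v) ≤⟨ F≤S D n x ψ 2≤D le (λ v → S-nonneg P (overShifted≥0 k κ) λ u → χ≥0 x (v N.* u))
             (λ p v 1≤p → S-mono P (overShifted≥0 k κ) λ u → ≡⇒≤ (cong (χ x) (N.*-assoc p v u)) ◂ χ-antitone x p (v N.* u) 1≤p)
             (λ v x<v → S-zero⁺ pos (overShifted≥0 k κ) λ u 1≤u → χ-out u x<v 1≤u) ⟩
      S² P (λ p → inv (p N.∸ 1)) (overShifted k κ) (χ x) ≤⟨ S²≤S (λ p → 0≤inv (p N.∸ 1)) (overShifted≥0 k κ) (χ≥0 x) (χ-antitone x) pos (All.map (λ { (_ , D<p) → weights κ κ<k D<p }) (primesFrom-All D n)) ⟩
      S P (overShifted k (suc κ)) (χ x) ∎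
      where
      open ≤-Reasoning
      x : ℕ
      x = T^ (suc j)
      ψ : ℕ → ℚ
      ψ v = S P (overShifted k κ) (λ u → χ x (v N.* u))
      bound : ∀ a m → a N.< suc j → InCell a m → h⁻ ^ κ * nat (L κ (j N.∸ a)) ≤ ψ m
      bound a m (s≤s a≤j) (_ , m≤) = S-overShifted-≥ κ (j N.∸ a) (N.n≤1+n κ ◃ κ<k)
          (N.^-monoʳ-≤ T (N.m∸n≤m j a ◃ N.n≤1+n j) ◃ le) ◂
        (S-mono P (overShifted≥0 k κ) λ u → ind-mono (u N.≤? T^ (j N.∸ a)) (m N.* u N.≤? x) λ u≤ →
          N.*-mono-≤ m≤ u≤ ◃ N.≤-reflexive (sym (N.^-distribˡ-+-* T (suc a) (j N.∸ a)) · cong (λ s → T^ (suc s)) (N.m+[n∸m]≡n a≤j)))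

-- Euler products and local densities

-- The Euler product is bounded by telescoping: (1 − u)(1 + u − v) ≤ 1 − v.
∏-telescope : ∀ {ε} C D n → Nonneg ε → 1 N.≤ D → 0# ≤ 1# - C * inv D → 0# ≤ C →
  (∀ p → Prime p → D N.< p → ε p ≤ C * (inv (p N.∸ 1) - inv p)) →
  (1# - C * inv D) * ∏[1+ ε ] (primesFrom D n) ≤ 1#
∏-telescope C D zero ε≥0 1≤D small C≥0 h = ≤-add (C * inv D) (*-nonneg C≥0 (0≤inv D)) (solve 2 (λ c i → (# 1 :- c :* i) :* # 1 :+ c :* i := # 1) refl C (inv D))
∏-telescope {ε} C D (suc n) ε≥0 1≤D small C≥0 h with prime? (suc D)
... | no _ = *-monoʳ-≤ (∏-nonneg (primesFrom (suc D) n) ε≥0) (0≤y-x⇒x≤y (subst (0# ≤_)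
        (solve 3 (λ c i j → c :* (i :- j) := # 1 :- c :* j :- (# 1 :- c :* i)) refl C (inv D) (inv (suc D)))
        (*-nonneg C≥0 (0≤y-x (inv-anti {{N.>-nonZero 1≤D}} (N.n≤1+n D)))))) ◂
    (∏-telescope C (suc D) n ε≥0 (s≤s z≤n) (small ◂ ≤-add (C * (inv D - inv (suc D))) (*-nonneg C≥0 (0≤y-x (inv-anti {{N.>-nonZero 1≤D}} (N.n≤1+n D))))
        (solve 3 (λ c i j → # 1 :- c :* i :+ c :* (i :- j) := # 1 :- c :* j) refl C (inv D) (inv (suc D)))) C≥0 (λ p pp lt → h p pp (N.<-trans N.≤-refl lt)))
... | yes pp = begin
    (1# - C * inv D) * ((1# + ε (suc D)) * Π) ≤⟨ *-monoˡ-≤ small (*-monoʳ-≤ Π≥0 (+-mono-≤ (≤-refl {1#}) (h (suc D) pp N.≤-refl))) ⟩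
    (1# - C * inv D) * ((1# + C * (inv D - inv (suc D))) * Π) ≤⟨ ≤-add (C * inv D * (C * (inv D - inv (suc D))) * Π) (*-nonneg (*-nonneg (*-nonneg C≥0 (0≤inv D)) (*-nonneg C≥0 d≥0)) Π≥0)
           (solve 4 (λ c i j π → (# 1 :- c :* i) :* ((# 1 :+ c :* (i :- j)) :* π) :+ c :* i :* (c :* (i :- j)) :* π
              := (# 1 :- c :* j) :* π) refl C (inv D) (inv (suc D)) Π) ⟩
    (1# - C * inv (suc D)) * Π ≤⟨ ∏-telescope C (suc D) n ε≥0 (s≤s z≤n) (small ◂ ≤-add (C * (inv D - inv (suc D))) (*-nonneg C≥0 d≥0)
        (solve 3 (λ c i j → # 1 :- c :* i :+ c :* (i :- j) := # 1 :- c :* j) refl C (inv D) (inv (suc D)))) C≥0 (λ p pp lt → h p pp (N.<-trans N.≤-refl lt)) ⟩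
    1# ∎
    where
    open ≤-Reasoning
    Π = ∏[1+ ε ] (primesFrom (suc D) n)
    Π≥0 = ∏-nonneg (primesFrom (suc D) n) ε≥0
    d≥0 : 0# ≤ inv D - inv (suc D)
    d≥0 = 0≤y-x (inv-anti {{N.>-nonZero 1≤D}} (N.n≤1+n D))

module Densities (k' : ℕ) where

  k : ℕ
  k = suc k'

  -- With p large prime: g = k/(p−k), and π = k/p and π* = (k−1)/(p−1) are the densities of the
  -- residues n mod p with p ∣ ∏(n + hᵢ), among all n and among those with n + hₘ invertible.
  g γ e π π* ε : ℕ → ℚ
  g = overShifted k k
  γ = overShifted k k'
  e  p = inv (p N.∸ 1)
  π = over k
  π* p = nat k' * inv (p N.∸ 1)
  ε  p = nat k * inv p * (nat k * inv (p N.∸ k))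

  module _ {p : ℕ} (2k<p : 2 N.* k N.< p) where
    private
      k<p : k N.< p
      k<p = N.≤-<-trans (N.m≤n*m k 2) 2k<p
      1<p : 1 N.< p
      1<p = N.≤-<-trans (s≤s z≤n) k<p
      instance
        _ : NonZero p
        _ = N.>-nonZero (N.<-trans (s≤s z≤n) 1<p)
      Kₙ K' Pₙ a b q : ℚ
      Kₙ = nat k
      K' = nat k'
      Pₙ = nat p
      a = inv (p N.∸ k)
      b = inv (p N.∸ 1)
      q = inv p
      v≡1 : (Pₙ - Kₙ) * a ≡ 1#
      v≡1 = cong (_* a) (sym (nat-∸ (N.<⇒≤ k<p))) · natinv (p N.∸ k) {{N.>-nonZero (N.m<n⇒0<n∸m k<p)}}
      u≡1 : (Pₙ - 1#) * b ≡ 1#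
      u≡1 = cong (_* b) (sym (nat-∸ (N.<⇒≤ 1<p))) · natinv (p N.∸ 1) {{N.>-nonZero (N.m<n⇒0<n∸m 1<p)}}
      K≡ : Kₙ ≡ K' + 1#
      K≡ = nat-suc k'
      Pa≡ : 1# + Kₙ * a ≡ Pₙ * a
      Pa≡ = cong (_+ Kₙ * a) (sym v≡1) · solve 3 (λ p k a → (p :- k) :* a :+ k :* a := p :* a) refl Pₙ Kₙ a

    [1+g]π≡g : (1# + g p) * π p ≡ g p
    [1+g]π≡g = cong (_* π p) Pa≡ · solve 4 (λ p a k q → p :* a :* (k :* q) := (p :* q) :* (k :* a)) refl Pₙ a Kₙ q ·
      cong (_* (Kₙ * a)) (natinv p) · *-identityˡ _

    -- Among the n with n + hₘ invertible modulo p, the local factor no longer has mean 0 but 1 / (p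
    -- - 1). Orthogonality is lost for the prime sums, and `B-lower` takes its place.
    mean : g p - (1# + g p) * π* p ≡ e p
    mean = begin
      Kₙ * a - (1# + Kₙ * a) * (K' * b) ≡⟨ cong (λ s → Kₙ * a - s * (K' * b)) Pa≡ ⟩
      Kₙ * a - Pₙ * a * (K' * b) ≡⟨ cong (_- Pₙ * a * (K' * b)) (sym (cong (Kₙ * a *_) u≡1 · *-identityʳ _)) ⟩
      Kₙ * a * ((Pₙ - 1#) * b) - Pₙ * a * (K' * b) ≡⟨ cong (λ s → s * a * ((Pₙ - 1#) * b) - Pₙ * a * (K' * b)) K≡ ⟩
      (K' + 1#) * a * ((Pₙ - 1#) * b) - Pₙ * a * (K' * b) ≡⟨ solve 4 (λ k p a b → (k :+ # 1) :* a :* ((p :- # 1) :* b) :- p :* a :* (k :* b) := b :* ((p :- (k :+ # 1)) :* a)) refl K' Pₙ a b ⟩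
      b * ((Pₙ - (K' + 1#)) * a) ≡⟨ cong (λ s → b * ((Pₙ - s) * a)) (sym K≡) ⟩
      b * ((Pₙ - Kₙ) * a) ≡⟨ cong (b *_) v≡1 · *-identityʳ b ⟩
      b ∎
      where open ≡-Reasoning

    -- Both sides are homogenised with the factors u = (p − 1) b = 1 and v = (p − k) a = 1.
    second-moment : g p * g p + (1# - g p * g p) * π* p ≡ e p * e p + γ p * ((1# + e p) * (1# + e p))
    second-moment = begin
      Kₙ * a * (Kₙ * a) + (1# - Kₙ * a * (Kₙ * a)) * (K' * b) ≡⟨ cong (λ s → s * a * (s * a) + (1# - s * a * (s * a)) * (K' * b)) K≡ ⟩
      (K' + 1#) * a * ((K' + 1#) * a) + (1# - (K' + 1#) * a * ((K' + 1#) * a)) * (K' * b) ≡⟨ solve 3 (λ k a b → (k :+ # 1) :* a :* ((k :+ # 1) :* a) :+ (# 1 :- (k :+ # 1) :* a :* ((k :+ # 1) :* a)) :* (k :* b)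
             := (k :+ # 1) :* a :* ((k :+ # 1) :* a) :* (# 1 :* # 1) :+ (# 1 :* # 1 :- (k :+ # 1) :* a :* ((k :+ # 1) :* a)) :* (k :* b :* # 1)) refl K' a b ⟩
      lhs 1# 1# ≡⟨ cong₂ lhs (sym u≡1) (sym v'≡1) ⟩
      lhs ((Pₙ - 1#) * b) ((Pₙ - (K' + 1#)) * a) ≡⟨ solve 4 (λ k a b p →
             (k :+ # 1) :* a :* ((k :+ # 1) :* a) :* (((p :- # 1) :* b) :* ((p :- # 1) :* b))
               :+ (((p :- (k :+ # 1)) :* a) :* ((p :- (k :+ # 1)) :* a) :- (k :+ # 1) :* a :* ((k :+ # 1) :* a)) :* (k :* b :* ((p :- # 1) :* b))
             := b :* b :* (((p :- (k :+ # 1)) :* a) :* ((p :- (k :+ # 1)) :* a))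
               :+ k :* a :* (((p :- # 1) :* b :+ b) :* ((p :- # 1) :* b :+ b)) :* ((p :- (k :+ # 1)) :* a)) refl K' a b Pₙ ⟩
      rhs ((Pₙ - 1#) * b) ((Pₙ - (K' + 1#)) * a) ≡⟨ cong₂ rhs u≡1 v'≡1 ⟩
      rhs 1# 1# ≡⟨ solve 3 (λ k a b → b :* b :* (# 1 :* # 1) :+ k :* a :* ((# 1 :+ b) :* (# 1 :+ b)) :* # 1
              := b :* b :+ k :* a :* ((# 1 :+ b) :* (# 1 :+ b))) refl K' a b ⟩
      b * b + K' * a * ((1# + b) * (1# + b)) ∎
      where
      open ≡-Reasoning
      v'≡1 : (Pₙ - (K' + 1#)) * a ≡ 1#
      v'≡1 = cong (λ s → (Pₙ - s) * a) (sym K≡) · v≡1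
      lhs rhs : ℚ → ℚ → ℚ
      lhs u v = (K' + 1#) * a * ((K' + 1#) * a) * (u * u) + (v * v - (K' + 1#) * a * ((K' + 1#) * a)) * (K' * b * u)
      rhs u v = b * b * (v * v) + K' * a * ((u + b) * (u + b)) * v

    g≤1 : g p ≤ 1#
    g≤1 = ≤-trans (*-monoʳ-≤ (0≤inv (p N.∸ k)) (nat-mono k≤p∸k)) (≡⇒≤ (natinv (p N.∸ k) {{N.>-nonZero (N.m<n⇒0<n∸m k<p)}}))
      where
      k≤p∸k : k N.≤ p N.∸ k
      k≤p∸k = subst (N._≤ p N.∸ k) (cong (N._∸ k) (cong (k N.+_) (N.+-identityʳ k)) · N.m+n∸n≡m k k) (N.∸-monoˡ-≤ k (N.<⇒≤ 2k<p))

    g≤2k/p : g p ≤ over (2 N.* k) p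
    g≤2k/p = *-cancelˡ-≤ {Pₙ} (0<nat p) (subst₂ _≤_ (sym lhs) (sym rhs) (+-mono-≤ (*-monoʳ-≤ (0≤nat k) g≤1) ≤-refl))
      where
      lhs : Pₙ * (Kₙ * a) ≡ g p * Kₙ + Kₙ
      lhs = (solve 3 (λ p k a → p :* (k :* a) := k :* (p :* a)) refl Pₙ Kₙ a · cong (Kₙ *_) (sym Pa≡)) ·
        solve 2 (λ k a → k :* (# 1 :+ k :* a) := k :* a :* k :+ k) refl Kₙ a
      rhs : Pₙ * (nat (2 N.* k) * q) ≡ 1# * Kₙ + Kₙ
      rhs = solve 3 (λ p k q → p :* (k :* q) := p :* q :* k) refl Pₙ (nat (2 N.* k)) q ·
        cong₂ _*_ (natinv p) (nat-* 2 k) · solve 1 (λ k → # 1 :* (# 2 :* k) := # 1 :* k :+ k) refl Kₙ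

    g≤π+ε : g p ≤ π p + ε p
    g≤π+ε = ≡⇒≤ (sym (begin
      Kₙ * q + Kₙ * q * (Kₙ * a) ≡⟨ solve 3 (λ k q a → k :* q :+ k :* q :* (k :* a) := k :* q :* (# 1 :+ k :* a)) refl Kₙ q a ⟩
      Kₙ * q * (1# + Kₙ * a) ≡⟨ *-comm _ _ ⟩
      (1# + g p) * π p ≡⟨ [1+g]π≡g ⟩
      Kₙ * a ∎))
      where open ≡-Reasoning

    -- From p > 2 k follows 1 / (p (p - k)) ≤ 2 / (p (p - 1)), and 1 / (p (p - 1)) is a difference
    -- of consecutive reciprocals, as `∏-telescope` asks.
    ε-telescopes : ε p ≤ nat (2 N.* k N.* k) * (inv (p N.∸ 1) - inv p)
    ε-telescopes = begin
      Kₙ * q * (Kₙ * a) ≤⟨ *-monoˡ-≤ (*-nonneg (0≤nat k) (0≤inv p)) (*-monoˡ-≤ (0≤nat k) a≤2b) ⟩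
      Kₙ * q * (Kₙ * (nat 2 * b)) ≡⟨ solve 3 (λ k q b → k :* q :* (k :* (# 2 :* b)) := # 2 :* k :* k :* (b :* q)) refl Kₙ q b ⟩
      nat 2 * Kₙ * Kₙ * (b * q) ≡⟨ cong₂ _*_ (sym (nat-* (2 N.* k) k · cong (_* Kₙ) (nat-* 2 k))) bq ⟩
      nat (2 N.* k N.* k) * (b - q) ∎
      where
      open ≤-Reasoning
      bq : b * q ≡ b - q
      bq = solve 3 (λ p b q → b :* q := b :* (p :* q) :- q :* ((p :- # 1) :* b)) refl Pₙ b q ·
        cong₂ (λ s t → b * s - q * t) (natinv p) u≡1 · cong₂ _-_ (*-identityʳ b) (*-identityʳ q)
      a≤2b : a ≤ nat 2 * b
      a≤2b = ≤-add (a * b * (Pₙ - nat 2 * Kₙ + 1#)) (*-nonneg (*-nonneg (0≤inv (p N.∸ k)) (0≤inv (p N.∸ 1)))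
          (+-nonneg (0≤y-x (subst (_≤ Pₙ) (nat-* 2 k) (nat-mono (N.<⇒≤ 2k<p)))) 0≤1))
        (begin-equality
          a + a * b * (Pₙ - nat 2 * Kₙ + 1#) ≡⟨ cong (_+ a * b * (Pₙ - nat 2 * Kₙ + 1#)) (sym (cong (a *_) u≡1 · *-identityʳ a)) ⟩
          a * ((Pₙ - 1#) * b) + a * b * (Pₙ - nat 2 * Kₙ + 1#) ≡⟨ solve 4 (λ a b p k → a :* ((p :- # 1) :* b) :+ a :* b :* (p :- # 2 :* k :+ # 1) := # 2 :* b :* ((p :- k) :* a)) refl a b Pₙ Kₙ ⟩
          nat 2 * b * ((Pₙ - Kₙ) * a) ≡⟨ cong (nat 2 * b *_) v≡1 · *-identityʳ _ ⟩
          nat 2 * b ∎)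

-- Step functions as sieve coefficients

telescope : ∀ n c (f : ℕ → ℚ) → c N.≤ n → sum n (λ j → (f j - f (suc j)) * ind (c N.≤? j)) ≡ f c - f n
telescope zero zero f _ = sym (+-inverseʳ (f 0))
telescope (suc n) c f c≤1+n with c N.≤? n
... | yes c≤n = cong (_+ (f n - f (suc n)) * 1#) (telescope n c f c≤n) ·
  solve 3 (λ a b c → a :- b :+ (b :- c) :* # 1 := a :- c) refl (f c) (f n) (f (suc n))
... | no c≰n with refl ← N.≤-antisym c≤1+n (N.≰⇒> c≰n) = trans
  (cong₂ _+_ (sum-zero n λ j j<n → cong ((f j - f (suc j)) *_) (ind-no (suc n N.≤? j) (λ le → N.<⇒≱ j<n (N.n≤1+n n ◃ le))) · *-zeroʳ _) (*-zeroʳ _))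
  (+-identityʳ 0# · sym (+-inverseʳ (f (suc n))))

module StepFunction (M : ℕ) (b : ℕ → ℕ) where

  -- `Y i` is the value of the step function `y` at r if i is the least exponent with r ≤ T^i. `V i`
  -- adds up the values Y (i + 1), Y (i + 2), ...: it is the size of the sum of y(r m) over m in
  -- units of h.
  Y V : ℕ → ℚ
  Y i = sum (suc M) (λ j → nat (b j) * ind (i N.≤? j))
  V i = sum (suc M) (λ j → nat (b j) * nat (j N.∸ i))

  -- The sum of f² against the increments of N, after summation by parts. For decreasing f this
  -- writes f² as a combination of cutoffs with nonnegative coefficients, and N j stands for the
  -- mass up to T^j.
  layers : (ℕ → ℚ) → (ℕ → ℕ) → ℚ
  layers f N = sum (suc M) (λ j → (f j * f j - f (suc j) * f (suc j)) * nat (N j))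

  Y≥0 : Nonneg Y
  Y≥0 i = sum-nonneg (suc M) λ j _ → *-nonneg (0≤nat (b j)) (0≤ind (i N.≤? j))

  V≥0 : Nonneg V
  V≥0 i = sum-nonneg (suc M) λ j _ → *-nonneg (0≤nat (b j)) (0≤nat (j N.∸ i))

  Y-decreasing : ∀ i → Y (suc i) ≤ Y i
  Y-decreasing i = sum-mono (suc M) λ j _ → *-monoˡ-≤ (0≤nat (b j)) (ind-mono (suc i N.≤? j) (i N.≤? j) (N.≤-trans (N.n≤1+n i)))

  V-decreasing : ∀ i → V (suc i) ≤ V i
  V-decreasing i = sum-mono (suc M) λ j _ → *-monoˡ-≤ (0≤nat (b j)) (nat-mono (N.∸-monoʳ-≤ j (N.n≤1+n i)))

  Y-end : Y (suc M) ≡ 0#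
  Y-end = sum-zero (suc M) λ j j≤M → cong (nat (b j) *_) (ind-no (suc M N.≤? j) (N.<⇒≱ j≤M)) · *-zeroʳ _

  V-end : V (suc M) ≡ 0#
  V-end = sum-zero (suc M) λ j j≤M → cong (λ s → nat (b j) * nat s) (N.m≤n⇒m∸n≡0 (N.<⇒≤ j≤M)) · *-zeroʳ _

  private
    square-diff : ∀ {f : ℕ → ℚ} → Nonneg f → (∀ i → f (suc i) ≤ f i) → ∀ j → 0# ≤ f j * f j - f (suc j) * f (suc j)
    square-diff f≥0 dec j = 0≤y-x (*-mono-≤ (f≥0 (suc j)) (f≥0 (suc j)) (dec j) (dec j))

  module _ (T : ℕ) (1≤T : 1 N.≤ T) where
    private instance
      _ : NonZero T
      _ = N.>-nonZero 1≤T

    y : ℕ → ℚ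
    y r = sum (suc M) (λ j → nat (b j) * χ (T N.^ j) r)

    -- The least c with r ≤ T^c, or N + 1 if there is none: the cutoffs at powers of T see r only
    -- through c.
    cell : ∀ r N → ∃[ c ] c N.≤ suc N × (∀ j → j N.≤ N → χ (T N.^ j) r ≡ ind (c N.≤? j))
    cell r zero with r N.≤? 1
    ... | yes p = 0 , z≤n , λ { zero z≤n → ind-yes (r N.≤? 1) p }
    ... | no ¬p = 1 , N.≤-refl , λ { zero z≤n → ind-no (r N.≤? 1) ¬p }
    cell r (suc N) with cell r N
    ... | c , c≤ , h with c N.≤? N
    ...   | yes c≤N = c , N.m≤n⇒m≤1+n c≤ , λ j j≤ → case j j≤
      where
      r≤ : r N.≤ T N.^ N
      r≤ with r N.≤? T N.^ N | h N N.≤-refl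
      ... | yes p | _ = p
      ... | no _  | eq = ⊥-elim (<⇒≱ 0<1 (≡⇒≤ (sym (eq · ind-yes (c N.≤? N) c≤N))))
      case : ∀ j → j N.≤ suc N → χ (T N.^ j) r ≡ ind (c N.≤? j)
      case j j≤ with j N.≤? N
      ... | yes j≤N = h j j≤N
      ... | no j≰N with refl ← N.≤-antisym j≤ (N.≰⇒> j≰N) = ind-yes (r N.≤? T N.^ suc N) (r≤ ◃ N.m≤n*m (T N.^ N) T) · sym (ind-yes (c N.≤? suc N) c≤)
    ...   | no c≰N with refl ← N.≤-antisym c≤ (N.≰⇒> c≰N) with r N.≤? T N.^ suc N
    ...     | yes r≤ = suc N , N.n≤1+n _ , case
      where
      case : ∀ j → j N.≤ suc N → χ (T N.^ j) r ≡ ind (suc N N.≤? j)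
      case j j≤ with j N.≤? N
      ... | yes j≤N = h j j≤N
      ... | no j≰N with refl ← N.≤-antisym j≤ (N.≰⇒> j≰N) = ind-yes (r N.≤? T N.^ suc N) r≤ · sym (ind-yes (suc N N.≤? suc N) N.≤-refl)
    ...     | no r≰ = suc (suc N) , N.≤-refl , case
      where
      case : ∀ j → j N.≤ suc N → χ (T N.^ j) r ≡ ind (suc (suc N) N.≤? j)
      case j j≤ with j N.≤? N
      ... | yes j≤N = h j j≤N · ind-no (suc N N.≤? j) (N.<⇒≱ (s≤s j≤N)) · sym (ind-no (suc (suc N) N.≤? j) (N.<⇒≱ (s≤s j≤)))
      ... | no j≰N with refl ← N.≤-antisym j≤ (N.≰⇒> j≰N) = ind-no (r N.≤? T N.^ suc N) r≰ · sym (ind-no (suc (suc N) N.≤? suc N) (N.<⇒≱ N.≤-refl))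

    layer-cake : ∀ r c (f : ℕ → ℚ) → c N.≤ suc M → (∀ j → j N.≤ M → χ (T N.^ j) r ≡ ind (c N.≤? j)) → f (suc M) ≡ 0# →
      sum (suc M) (λ j → (f j - f (suc j)) * χ (T N.^ j) r) ≡ f c
    layer-cake r c f c≤ h end = (sum-cong (suc M) λ j j< → cong ((f j - f (suc j)) *_) (h j (N.≤-pred j<))) ·
      telescope (suc M) c f c≤ · cong (λ s → f c - s) end · solve 1 (λ a → a :- # 0 := a) refl (f c)

    y≡Y : ∀ r c → (∀ j → j N.≤ M → χ (T N.^ j) r ≡ ind (c N.≤? j)) → y r ≡ Y c
    y≡Y r c h = sum-cong (suc M) λ j j< → cong (nat (b j) *_) (h j (N.≤-pred j<))

    y≥0 : Nonneg y
    y≥0 r = sum-nonneg (suc M) λ j _ → *-nonneg (0≤nat (b j)) (χ≥0 (T N.^ j) r)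

    y-antitone : Antitone y
    y-antitone p r 1≤p = sum-mono (suc M) λ j _ → *-monoˡ-≤ (0≤nat (b j)) (χ-antitone (T N.^ j) p r 1≤p)

    ∣y∣≤ : ∀ r → ∣ y r ∣ ≤ Y 0 * χ (T N.^ M) r
    ∣y∣≤ r = ≡⇒≤ (∣-∣-nonneg (y≥0 r)) ◂ ≤-trans
      (sum-mono (suc M) λ j j< → *-monoˡ-≤ (0≤nat (b j)) (χ-mono (N.^-monoʳ-≤ T (N.≤-pred j<)) r) ◂
         ≡⇒≤ (cong (_* χ (T N.^ M) r) (sym (*-identityʳ _) · cong (nat (b j) *_) (sym (ind-yes (0 N.≤? j) z≤n)))))
      (≡⇒≤ (sum-*ʳ (suc M) (χ (T N.^ M) r) (λ j → nat (b j) * ind (0 N.≤? j))))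

    y² : ∀ r → y r * y r ≡ sum (suc M) (λ j → (Y j * Y j - Y (suc j) * Y (suc j)) * χ (T N.^ j) r)
    y² r with cell r M
    ... | c , c≤ , h = cong₂ _*_ (y≡Y r c h) (y≡Y r c h) ·
      sym (layer-cake r c (λ j → Y j * Y j) c≤ h (cong₂ _*_ Y-end Y-end · *-zeroʳ _))

  module Bounds (D t' n k' : ℕ) (2≤D : 2 N.≤ D) (2k≤D : 2 N.* suc k' N.≤ D)
    (b0 : b 0 ≡ 0) where
    open Mesh D t' 2≤D
    open Masses D t' n 2≤D
    open Densities k'
    private
      y' = y T 1≤T
      instance
        _ : NonZero T
        _ = N.>-nonZero 1≤T
      C : ℚ
      C = nat (2 N.* k N.* k)
      k≤D : k N.≤ D
      k≤D = N.m≤n*m k 2 ◃ 2k≤D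
      primes : All (λ p → Prime p × D N.< p) P
      primes = primesFrom-All D n
      big : ∀ {p} → D N.< p → 2 N.* k N.< p
      big D<p = N.≤-<-trans 2k≤D D<p
      g≥0 : Nonneg g
      g≥0 = overShifted≥0 k k
      ε≥0 : Nonneg ε
      ε≥0 p = *-nonneg (*-nonneg (0≤nat k) (0≤inv p)) (*-nonneg (0≤nat k) (0≤inv (p N.∸ k)))

    -- Replacing g by k / p costs an Euler product over primes beyond D, and this product times 1 -
    -- C / D is at most 1.
    first-moment-≤ : 0# ≤ 1# - C * inv D →
      (1# - C * inv D) * S P g (λ r → y' r * y' r) ≤ h⁺ ^ k * layers Y (U k)
    first-moment-≤ small = begin
      η * S P g (λ r → y' r * y' r) ≡⟨ cong (η *_) (S-cong P g (y² T 1≤T) · S-sum P g (suc M) _ · (sum-cong (suc M) λ j _ → S-* P g (d j) (χ (T N.^ j)))) ⟩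
      η * sum (suc M) (λ j → d j * S P g (χ (T N.^ j))) ≡⟨ sym (sum-*ˡ (suc M) η _) ⟩
      sum (suc M) (λ j → η * (d j * S P g (χ (T N.^ j)))) ≤⟨ sum-mono (suc M) (λ j _ → term j) ⟩
      sum (suc M) (λ j → h⁺ ^ k * (d j * nat (U k j))) ≡⟨ sum-*ˡ (suc M) (h⁺ ^ k) _ ⟩
      h⁺ ^ k * layers Y (U k) ∎
      where
      open ≤-Reasoning
      η = 1# - C * inv D
      d : ℕ → ℚ
      d j = Y j * Y j - Y (suc j) * Y (suc j)
      mass : ∀ j → η * S P g (χ (T N.^ suc j)) ≤ h⁺ ^ k * nat (U k (suc j))
      mass j = begin
        η * S P g (χ (T N.^ suc j)) ≤⟨ *-monoˡ-≤ small (S-perturb g≥0 (over≥0 k) ε≥0 (χ≥0 (T N.^ suc j)) (χ-antitone (T N.^ suc j)) pos (All.map (λ { (_ , lt) → g≤π+ε (big lt) }) primes)) ⟩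
        η * (∏[1+ ε ] P * S P (over k) (χ (T N.^ suc j))) ≡⟨ sym (*-assoc _ _ _) ⟩
        η * ∏[1+ ε ] P * S P (over k) (χ (T N.^ suc j)) ≤⟨ *-monoʳ-≤ (S-nonneg P (over≥0 k) (χ≥0 (T N.^ suc j)))
               (∏-telescope C D n ε≥0 (s≤s z≤n ◃ 2≤D) small (0≤nat (2 N.* k N.* k)) λ p _ lt → ε-telescopes (big lt)) ⟩
        1# * S P (over k) (χ (T N.^ suc j)) ≡⟨ *-identityˡ _ ⟩
        S P (over k) (χ (T N.^ suc j)) ≤⟨ S-over-≤ k j ⟩
        h⁺ ^ k * nat (U k (suc j)) ∎
      term : ∀ j → η * (d j * S P g (χ (T N.^ j))) ≤ h⁺ ^ k * (d j * nat (U k j))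
      -- The mass up to T^0 is not 0, although `U k 0` is. The term vanishes because y has no jump
      -- at T^0.
      term zero = ≡⇒≤ (cong (λ s → η * (s * S P g (χ 1))) d0 · (solve 3 (λ a b c → a :* (# 0 :* b) := c :* (# 0 :* # 0)) refl η _ (h⁺ ^ k) ·
        cong (λ s → h⁺ ^ k * (s * 0#)) (sym d0)))
        where
        Y01 : Y 0 ≡ Y 1
        Y01 = sum-cong (suc M) λ { zero _ → cong (λ s → nat s * 1#) b0 · *-zeroˡ _ · sym (cong (λ s → nat s * 0#) b0 · *-zeroˡ _)
                                 ; (suc j) _ → cong (nat (b (suc j)) *_) (ind-yes (0 N.≤? suc j) z≤n · sym (ind-yes (1 N.≤? suc j) (s≤s z≤n))) }
        d0 : d 0 ≡ 0#
        d0 = cong (λ s → s * s - Y 1 * Y 1) Y01 · +-inverseʳ _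
      term (suc j) = begin
        η * (d (suc j) * S P g (χ (T N.^ suc j))) ≡⟨ solve 3 (λ a b c → a :* (b :* c) := b :* (a :* c)) refl η (d (suc j)) _ ⟩
        d (suc j) * (η * S P g (χ (T N.^ suc j))) ≤⟨ *-monoˡ-≤ (square-diff Y≥0 Y-decreasing (suc j)) (mass j) ⟩
        d (suc j) * (h⁺ ^ k * nat (U k (suc j))) ≡⟨ solve 3 (λ a b c → a :* (b :* c) := b :* (a :* c)) refl (d (suc j)) (h⁺ ^ k) _ ⟩
        h⁺ ^ k * (d (suc j) * nat (U k (suc j))) ∎

    -- For r ≤ T^c the cutoff r m ≤ T^j holds for all m ≤ T^(j - c), whose mass is at least (j - c)
    -- h⁻.
    inner-≥ : ∀ r c → T N.^ M N.≤ D N.+ n → (∀ j → j N.≤ M → χ (T N.^ j) r ≡ ind (c N.≤? j)) → h⁻ * V c ≤ S P e (shift y' r)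
    inner-≥ r c le h = begin
      h⁻ * V c ≡⟨ sym (sum-*ˡ (suc M) h⁻ _) ⟩
      sum (suc M) (λ j → h⁻ * (nat (b j) * nat (j N.∸ c))) ≤⟨ sum-mono (suc M) (λ j j< → ≡⇒≤ (solve 3 (λ a b c → a :* (b :* c) := b :* (a :* c)) refl h⁻ (nat (b j)) _) ◂ *-monoˡ-≤ (0≤nat (b j)) (mass j (N.≤-pred j<))) ⟩
      sum (suc M) (λ j → nat (b j) * S P e (λ m → χ (T N.^ j) (r N.* m))) ≡⟨ sym (S-sum P e (suc M) _ · (sum-cong (suc M) λ j _ → S-* P e (nat (b j)) _)) ⟩
      S P e (shift y' r) ∎
      where
      open ≤-Reasoning
      e≥0 : Nonneg e
      e≥0 p = 0≤inv (p N.∸ 1)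
      L1 : ∀ j → nat (L 1 j) ≡ nat j
      L1 zero = refl
      L1 (suc j) = nat-+ (L 1 j) 1 · cong (_+ 1#) (L1 j) · sym (nat-suc j)
      e≡ : ∀ P ψ → S P (overShifted 1 1) ψ ≡ S P e ψ
      e≡ []      ψ = refl
      e≡ (p ∷ P) ψ = cong₂ _+_ (e≡ P ψ) (cong₂ _*_ (*-identityˡ _) (e≡ P (shift ψ p)))
      mass : ∀ j → j N.≤ M → h⁻ * nat (j N.∸ c) ≤ S P e (λ m → χ (T N.^ j) (r N.* m))
      mass j j≤M with c N.≤? j
      ... | no c≰j = ≡⇒≤ (cong (λ s → h⁻ * nat s) (N.m≤n⇒m∸n≡0 (N.<⇒≤ (N.≰⇒> c≰j))) · *-zeroʳ _) ◂
             (S-nonneg P e≥0 λ m → χ≥0 (T N.^ j) (r N.* m))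
      ... | yes c≤j = begin
        h⁻ * nat (j N.∸ c) ≡⟨ sym (cong₂ _*_ (*-identityʳ h⁻) (L1 (j N.∸ c))) ⟩
        h⁻ ^ 1 * nat (L 1 (j N.∸ c)) ≤⟨ S-overShifted-≥ 1 (s≤s z≤n ◃ 2≤D) 1 (j N.∸ c) N.≤-refl (N.^-monoʳ-≤ T (N.m∸n≤m j c ◃ j≤M) ◃ le) ⟩
        S P (overShifted 1 1) (χ (T N.^ (j N.∸ c))) ≡⟨ e≡ P _ ⟩
        S P e (χ (T N.^ (j N.∸ c))) ≤⟨ S-mono P e≥0 (λ m → ind-mono (m N.≤? T N.^ (j N.∸ c)) (r N.* m N.≤? T N.^ j) λ m≤ → N.*-mono-≤ r≤ m≤ ◃
               N.≤-reflexive (sym (N.^-distribˡ-+-* T c (j N.∸ c)) · cong (T N.^_) (N.m+[n∸m]≡n c≤j))) ⟩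
        S P e (λ m → χ (T N.^ j) (r N.* m)) ∎
        where
        r≤ : r N.≤ T N.^ c
        r≤ with r N.≤? T N.^ c | h c (c≤j ◃ j≤M)
        ... | yes p | _ = p
        ... | no _  | eq = ⊥-elim (<⇒≱ 0<1 (≡⇒≤ (sym (eq · ind-yes (c N.≤? c) N.≤-refl))))

    second-moment-≥ : T N.^ M N.≤ D N.+ n →
      h⁻ * h⁻ * (h⁻ ^ k' * layers V (L k')) ≤ S P γ (λ r → S P e (shift y' r) * S P e (shift y' r))
    second-moment-≥ le = begin
      h⁻ * h⁻ * (h⁻ ^ k' * layers V (L k')) ≡⟨ cong (h⁻ * h⁻ *_) (sym (sum-*ˡ (suc M) (h⁻ ^ k') _)) ⟩
      h⁻ * h⁻ * sum (suc M) (λ j → h⁻ ^ k' * (d j * nat (L k' j))) ≤⟨ *-monoˡ-≤ h²≥0 (sum-mono (suc M) λ j j< → ≡⇒≤ (solve 3 (λ a b c → a :* (b :* c) := b :* (a :* c)) refl (h⁻ ^ k') (d j) _) ◂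
             *-monoˡ-≤ (square-diff V≥0 V-decreasing j) (S-overShifted-≥ k k≤D k' j (N.n≤1+n k') (N.^-monoʳ-≤ T (N.≤-pred j<) ◃ le))) ⟩
      h⁻ * h⁻ * sum (suc M) (λ j → d j * S P γ (χ (T N.^ j))) ≡⟨ cong (h⁻ * h⁻ *_) (sym (S-sum P γ (suc M) _ · (sum-cong (suc M) λ j _ → S-* P γ (d j) (χ (T N.^ j))))) ⟩
      h⁻ * h⁻ * S P γ (λ r → sum (suc M) (λ j → d j * χ (T N.^ j) r)) ≡⟨ sym (S-* P γ (h⁻ * h⁻) _) ⟩
      S P γ (λ r → h⁻ * h⁻ * sum (suc M) (λ j → d j * χ (T N.^ j) r)) ≤⟨ S-mono P (overShifted≥0 k k') bound ⟩
      S P γ (λ r → S P e (shift y' r) * S P e (shift y' r)) ∎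
      where
      open ≤-Reasoning
      d : ℕ → ℚ
      d j = V j * V j - V (suc j) * V (suc j)
      h²≥0 = *-nonneg 0≤h⁻ 0≤h⁻
      bound : ∀ r → h⁻ * h⁻ * sum (suc M) (λ j → d j * χ (T N.^ j) r) ≤ S P e (shift y' r) * S P e (shift y' r)
      bound r with cell T 1≤T r M
      ... | c , c≤ , h = begin
        h⁻ * h⁻ * sum (suc M) (λ j → d j * χ (T N.^ j) r) ≡⟨ cong (h⁻ * h⁻ *_) (layer-cake T 1≤T r c (λ j → V j * V j) c≤ h (cong₂ _*_ V-end V-end · *-zeroʳ _)) ⟩
        h⁻ * h⁻ * (V c * V c) ≡⟨ solve 2 (λ a b → a :* a :* (b :* b) := (a :* b) :* (a :* b)) refl h⁻ (V c) ⟩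
        h⁻ * V c * (h⁻ * V c) ≤⟨ *-mono-≤ hV≥0 hV≥0 (inner-≥ r c le h) (inner-≥ r c le h) ⟩
        S P e (shift y' r) * S P e (shift y' r) ∎
        where hV≥0 = *-nonneg 0≤h⁻ (V≥0 c)

-- Sieve sums over arithmetic progressions

ι : List ℕ → ℕ → ℕ → ℚ
ι hs n p = sumL hs (λ h → ind (p ∣? n N.+ h))

ι-zero : ∀ hs n p → All (λ h → ¬ p ∣ n N.+ h) hs → ι hs n p ≡ 0#
ι-zero []       n p _ = refl
ι-zero (h ∷ hs) n p (¬d ∷ l) = cong₂ _+_ (ind-no (p ∣? n N.+ h) ¬d) (ι-zero hs n p l) · +-identityʳ 0#

-- A modulus above all the distinct h divides at most one of the n + h, so the count `ι` is 0 or 1.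
ι-idempotent : ∀ {hs} n p → Unique hs → All (N._< p) hs → ι hs n p * ι hs n p ≡ ι hs n p
ι-idempotent {[]}     n p _ _ = *-zeroˡ 0#
ι-idempotent {h ∷ hs} n p (≢s ∷ u) (h<p ∷ l) with p ∣? n N.+ h
... | no _ = cong₂ _*_ (+-identityˡ _) (+-identityˡ _) · ι-idempotent n p u l · sym (+-identityˡ _)
... | yes d = trans (cong (λ s → (1# + s) * (1# + s)) rest≡0) (solve 0 ((# 1 :+ # 0) :* (# 1 :+ # 0) := # 1 :+ # 0) refl · cong (1# +_) (sym rest≡0))
  where
  rest≡0 : ι hs n p ≡ 0#
  rest≡0 = ι-zero hs n p (All.tabulate λ {h'} h'∈ d' → All.lookup ≢s h'∈
    (≡mod-< {h} {h'} h<p (All.lookup l h'∈) (≡mod-unshift {h} {h'} n (subst₂ (_≡_[mod p ]) (N.+-comm n h) (N.+-comm n h') (both {n N.+ h} {n N.+ h'} d d')))))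
    where
    both : ∀ {a b q} → q ∣ a → q ∣ b → a ≡ b [mod q ]
    both {q = q} (divides x refl) (divides y refl) = divides N.∣ x - y ∣ (sym (N.*-distribʳ-∣-∣ q x y))

-- The primes of U are distinct and do not divide q, where q accumulates the modulus as the primes
-- are imposed one by one.
Good : ℕ → List ℕ → Set
Good q [] = ⊤
Good q (p ∷ U) = Prime p × Coprime p q × Good (p N.* q) U

good : ∀ {U} D n q → (∀ p → Prime p → D N.< p → Coprime p q) → U ⊆ primesFrom D n → Good q U
good D zero    q h [] = tt
good D (suc n) q h U⊆ with prime? (suc D)
... | no _ = good (suc D) n q (λ p pp lt → h p pp (N.<-trans N.≤-refl lt)) U⊆
good D (suc n) q h (_ ∷ʳ U⊆)   | yes pp = good (suc D) n q (λ p pp lt → h p pp (N.<-trans N.≤-refl lt)) U⊆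
good D (suc n) q h (refl ∷ U⊆) | yes pp = pp , h (suc D) pp N.≤-refl , good (suc D) n (suc D N.* q)
  (λ p pp' lt → cop-*ʳ (distinct pp pp' lt) (h p pp' (N.<-trans N.≤-refl lt))) U⊆
  where
  distinct : ∀ {p p'} → Prime p → Prime p' → p N.< p' → Coprime p' p
  distinct pp pp' lt = Coprime.sym (prime-∤⇒cop pp' λ d → N.<⇒≱ lt (∣⇒≤ {{prime⇒nonZero pp}} d))

-- One scheme for all sums of the sieve: s is 1, a weighted prime indicator or λ on the window,
-- `main q` its expected sum over a class modulo q and `E q` the error. `Adm` selects the classes
-- for which this expectation is right: all of them, or for primes the reduced ones.
module _ (D X : ℕ) (s : ℕ → ℚ) (hs : List ℕ) (Adm : ℕ → ℕ → Set) (main E : ℕ → ℚ)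
  (class : ∀ q a → 1 N.≤ q → Adm q a → ∣ sum X (λ n → s n * ind (n ≡? a [mod q ])) - main q ∣ ≤ E q)
  (extend : ∀ q a c p h → Prime p → D N.< p → h ∈ hs → Adm q a → c ≡ a [mod q ] → p ∣ c N.+ h → Adm (p N.* q) c)
  where

  private
    κ : ℚ
    κ = nat (length hs)

  moment : ℕ → ℕ → List ℕ → ℚ
  moment q a U = sum X (λ n → s n * (ind (n ≡? a [mod q ]) * ∏ (ι hs n) U))

  -- Each ι(p) is a sum over h, so by the Chinese remainder theorem the moment is a sum over κ^∣U∣
  -- classes modulo q times the product of U.
  moment-approx : ∀ U q a → 1 N.≤ q → Good q U → All (D N.<_) U → Adm q a →
    ∣ moment q a U - κ ^ length U * main (q N.* product U) ∣ ≤ κ ^ length U * E (q N.* product U)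
  moment-approx [] q a 1≤q _ _ adm = subst₂ _≤_
    (cong ∣_∣ (cong₂ _-_ (sum-cong X λ n _ → cong (s n *_) (sym (*-identityʳ _))) (cong main (sym (N.*-identityʳ q)) · sym (*-identityˡ _))))
    (cong E (sym (N.*-identityʳ q)) · sym (*-identityˡ _))
    (class q a 1≤q adm)
  moment-approx (p ∷ U) q a 1≤q (pp , cop , gd) (D<p ∷ ls) adm = begin
    ∣ moment q a (p ∷ U) - κ * κ ^ length U * main Q ∣ ≡⟨ cong ∣_∣ (cong₂ _-_ split (*-assoc _ _ _ · sym (sumL-const hs _))) ⟩
    ∣ sumL hs (λ h → moment (p N.* q) (c h) U) - sumL hs (λ h → κ ^ length U * main Q) ∣ ≡⟨ cong ∣_∣ (sym (sumL-+ hs _ _ · cong (sumL hs (λ h → moment (p N.* q) (c h) U) +_)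
           ((sumL-cong hs λ _ _ → neg _) · sumL-*ˡ hs (- 1#) _ · sym (neg _)))) ⟩
    ∣ sumL hs (λ h → moment (p N.* q) (c h) U - κ ^ length U * main Q) ∣ ≤⟨ sumL-∣-∣ hs _ ⟩
    sumL hs (λ h → ∣ moment (p N.* q) (c h) U - κ ^ length U * main Q ∣) ≤⟨ sumL-mono hs (λ h h∈ → subst (λ t → ∣ moment (p N.* q) (c h) U - κ ^ length U * main t ∣ ≤ κ ^ length U * E t) assoc
           (moment-approx U (p N.* q) (c h) (N.*-mono-≤ (1≤prime pp) 1≤q) gd ls (extend q a (c h) p h pp D<p h∈ adm (c≡a h) (p∣c h)))) ⟩
    sumL hs (λ h → κ ^ length U * E Q) ≡⟨ sumL-const hs _ · sym (*-assoc _ _ _) ⟩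
    κ * κ ^ length U * E Q ∎
    where
    open ≤-Reasoning
    Q : ℕ
    Q = q N.* product (p ∷ U)
    neg : ∀ x → - x ≡ - 1# * x
    neg = solve 1 (λ x → :- x := :- # 1 :* x) refl
    assoc : p N.* q N.* product U ≡ Q
    assoc = cong (N._* product U) (N.*-comm p q) · N.*-assoc q p (product U)
    residue : ∀ h → ∃[ c ] c ≡ h N.* (p N.∸ 1) [mod p ] × c ≡ a [mod q ]
    -- The natural number h (p - 1) is -h modulo p.
    residue h = crt (h N.* (p N.∸ 1)) a cop (1≤prime pp) 1≤q
    c : ℕ → ℕ
    c h = proj₁ (residue h)
    c≡a : ∀ h → c h ≡ a [mod q ]
    c≡a h = proj₂ (proj₂ (residue h))
    p∣b : ∀ h → p ∣ h N.* (p N.∸ 1) N.+ h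
    p∣b h = divides h (cong (h N.* (p N.∸ 1) N.+_) (sym (N.*-identityʳ h)) · sym (N.*-distribˡ-+ h (p N.∸ 1) 1) · cong (h N.*_) (N.m∸n+n≡m (1≤prime pp)))
    p∣c : ∀ h → p ∣ c h N.+ h
    p∣c h = ≡mod-∣ {h N.* (p N.∸ 1) N.+ h} {c h N.+ h} (≡mod-sym {c h N.+ h} {h N.* (p N.∸ 1) N.+ h} (≡mod-shift {c h} {h N.* (p N.∸ 1)} h (proj₁ (proj₂ (residue h))))) (p∣b h)
    both : ∀ {a b q} → q ∣ a → q ∣ b → a ≡ b [mod q ]
    both {q = q} (divides x refl) (divides y refl) = divides N.∣ x - y ∣ (sym (N.*-distribʳ-∣-∣ q x y))
    combine-ind : ∀ n h → ind (n ≡? a [mod q ]) * ind (p ∣? n N.+ h) ≡ ind (n ≡? c h [mod p N.* q ])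
    combine-ind n h with n ≡? a [mod q ] | p ∣? n N.+ h
    ... | yes n≡a | yes p∣ = *-identityˡ _ · sym (ind-yes (n ≡? c h [mod p N.* q ])
            (crt-unique {p} {q} {n} {c h} cop (≡mod-unshift {n} {c h} h (both {n N.+ h} {c h N.+ h} p∣ (p∣c h)))
               (≡mod-trans {n} {a} {c h} n≡a (≡mod-sym {c h} {a} (c≡a h)))))
    ... | no n≢a | _ = *-zeroˡ _ · sym (ind-no (n ≡? c h [mod p N.* q ]) λ n≡c →
            n≢a (≡mod-trans {n} {c h} {a} (≡mod-∣mod {n} {c h} (n∣m*n p) n≡c) (c≡a h)))
    ... | yes _ | no p∤ = *-zeroʳ _ · sym (ind-no (n ≡? c h [mod p N.* q ]) λ n≡c →
            p∤ (≡mod-∣ {c h N.+ h} {n N.+ h} (≡mod-sym {n N.+ h} {c h N.+ h} (≡mod-shift {n} {c h} h (≡mod-∣mod {n} {c h} (m∣m*n q) n≡c))) (p∣c h)))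
    split : moment q a (p ∷ U) ≡ sumL hs (λ h → moment (p N.* q) (c h) U)
    split = (sum-cong X λ n _ → trans
        (solve 4 (λ s i j π → s :* (i :* (j :* π)) := j :* (s :* i :* π)) refl (s n) (ind (n ≡? a [mod q ])) (ι hs n p) (∏ (ι hs n) U))
        (sym (sumL-*ʳ hs _ _) · (sumL-cong hs λ h _ → trans
          (solve 4 (λ j s i π → j :* (s :* i :* π) := s :* (i :* j :* π)) refl (ind (p ∣? n N.+ h)) (s n) (ind (n ≡? a [mod q ])) (∏ (ι hs n) U))
          (cong (λ t → s n * (t * ∏ (ι hs n) U)) (combine-ind n h))))) ·
      sum-sumL X hs _

  main-product : ∀ (m : ℕ → ℚ) → (∀ p q → Prime p → Coprime p q → 1 N.≤ q → main (p N.* q) ≡ main q * m p) →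
    ∀ U q → 1 N.≤ q → Good q U → κ ^ length U * main (q N.* product U) ≡ main q * ∏ (λ p → κ * m p) U
  main-product m h [] q 1≤q _ = *-identityˡ _ · cong main (N.*-identityʳ q) · sym (*-identityʳ _)
  main-product m h (p ∷ U) q 1≤q (pp , cop , gd) = begin
    κ * κ ^ length U * main (q N.* (p N.* product U)) ≡⟨ cong (λ t → κ * κ ^ length U * main t) (sym (N.*-assoc q p (product U)) · cong (N._* product U) (N.*-comm q p)) ⟩
    κ * κ ^ length U * main (p N.* q N.* product U) ≡⟨ *-assoc _ _ _ · cong (κ *_) (main-product m h U (p N.* q) (N.*-mono-≤ (1≤prime pp) 1≤q) gd) ⟩
    κ * (main (p N.* q) * ∏ (λ p → κ * m p) U) ≡⟨ cong (λ t → κ * (t * ∏ (λ p → κ * m p) U)) (h p q pp cop 1≤q) ⟩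
    κ * (main q * m p * ∏ (λ p → κ * m p) U) ≡⟨ solve 4 (λ κ a m π → κ :* (a :* m :* π) := a :* (κ :* m :* π)) refl κ (main q) (m p) _ ⟩
    main q * (κ * m p * ∏ (λ p → κ * m p) U) ∎
    where open ≡-Reasoning

  module _ {g : ℕ → ℚ} (n R W ν : ℕ) (m : ℕ → ℚ) (c : ℚ) (y : ℕ → ℚ)
    (unique : Unique hs) (hs≤D : All (N._≤ D) hs)
    (multiplicative : ∀ p q → Prime p → Coprime p q → 1 N.≤ q → main (p N.* q) ≡ main q * m p)
    (1≤W : 1 N.≤ W) (W-small : ∀ p → Prime p → D N.< p → Coprime p W) (admW : Adm W ν)
    (c≥0 : 0# ≤ c) (∣y∣≤ : ∀ r → ∣ y r ∣ ≤ c * χ R r) (E≥0 : Nonneg E)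
    (g≥0 : Nonneg g) (g≤1 : All (λ p → g p ≤ 1#) (primesFrom D n)) where

    private
      P : List ℕ
      P = primesFrom D n
      ψ : ℕ → ℚ
      ψ r = χ (R N.* R) r * E (W N.* r)
      model : List ℕ → ℚ
      model U = main W * ∏ (λ p → κ * m p) U
      all⊆ : ∀ {U P : List ℕ} → U ⊆ P → All (D N.<_) P → All (D N.<_) U
      all⊆ []         [] = []
      all⊆ (_ ∷ʳ s)   (_ ∷ l) = all⊆ s l
      all⊆ (refl ∷ s) (p ∷ l) = p ∷ all⊆ s l

    -- The weighted sum of Λ² is the form `B` at the true moments. It differs from the model by the
    -- form at the difference, to which `B-bound` applies; only products up to R² matter as y lives
    -- on r ≤ R. The κ^∣U∣ classes and the factor 5^∣U∣ combine to (5 κ)^∣U∣.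
    sieve-sum-approx :
      ∣ sum X (λ n → s n * (ind (n ≡? ν [mod W ]) * (Λ P g (ι hs n) y * Λ P g (ι hs n) y)))
        - B P g (λ U → main W * ∏ (λ p → κ * m p) U) y y ∣
      ≤ c * c * (S P g (χ R) * S P g (χ R) * Z (nat 5 * κ) P (λ U → χ (R N.* R) (product U) * E (W N.* product U)))
    sieve-sum-approx = begin
      ∣ sum X (λ n → s n * (ind (n ≡? ν [mod W ]) * (Λ P g (ι hs n) y * Λ P g (ι hs n) y))) - B P g model y y ∣ ≡⟨ cong (λ t → ∣ t - B P g model y y ∣) actual ⟩
      ∣ B P g (moment W ν) y y - B P g model y y ∣ ≡⟨ cong ∣_∣ (solve 2 (λ a b → a :- b := a :+ :- # 1 :* b) refl _ _) ⟩
      ∣ B P g (moment W ν) y y + - 1# * B P g model y y ∣ ≡⟨ cong ∣_∣ (sym (B-linear P (- 1#) (moment W ν) model y y)) ⟩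
      ∣ B P g Δ y y ∣ ≤⟨ B-bound R R {E = E'} c≥0 c≥0 ∣y∣≤ ∣y∣≤ E'≥0 bound g≥0 g≤1 (primesFrom-positive D n) ⟩
      c * c * (S P g (χ R) * S P g (χ R) * Z (nat 5) P E') ≡⟨ cong (λ t → c * c * (S P g (χ R) * S P g (χ R) * t)) (Z-power (nat 5) κ P _) ⟩
      c * c * (S P g (χ R) * S P g (χ R) * Z (nat 5 * κ) P (λ U → ψ (product U))) ∎
      where
      open ≤-Reasoning
      Δ E' : List ℕ → ℚ
      Δ U = moment W ν U + - 1# * model U
      E' U = κ ^ length U * ψ (product U)
      κ≥0 = 0≤nat (length hs)
      E'≥0 : Nonneg E'
      E'≥0 U = *-nonneg (^-nonneg (length U) κ≥0) (*-nonneg (χ≥0 (R N.* R) (product U)) (E≥0 (W N.* product U)))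
      bound : ∀ U → U ⊆ P → χ (R N.* R) (product U) * ∣ Δ U ∣ ≤ E' U
      bound U U⊆ = begin
        χ (R N.* R) (product U) * ∣ Δ U ∣ ≡⟨ cong (λ t → χ (R N.* R) (product U) * ∣ t ∣) (cong (λ t → moment W ν U + - 1# * t) (sym (main-product m multiplicative U W 1≤W gd)) ·
               solve 2 (λ a b → a :+ :- # 1 :* b := a :- b) refl _ _) ⟩
        χ (R N.* R) (product U) * ∣ moment W ν U - κ ^ length U * main (W N.* product U) ∣ ≤⟨ *-monoˡ-≤ (χ≥0 (R N.* R) (product U)) (moment-approx U W ν 1≤W gd (all⊆ U⊆ (All.map proj₂ (primesFrom-All D n))) admW) ⟩
        χ (R N.* R) (product U) * (κ ^ length U * E (W N.* product U)) ≡⟨ solve 3 (λ a b c → a :* (b :* c) := b :* (a :* c)) refl _ _ _ ⟩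
        E' U ∎
        where
        gd : Good W U
        gd = good D n W W-small U⊆
      idem : ∀ n' → All (λ p → ι hs n' p * ι hs n' p ≡ ι hs n' p) P
      idem n' = All.map (λ { {p} (_ , D<p) → ι-idempotent n' p unique (All.map (λ h≤ → N.≤-<-trans h≤ D<p) hs≤D) }) (primesFrom-All D n)
      actual : sum X (λ n → s n * (ind (n ≡? ν [mod W ]) * (Λ P g (ι hs n) y * Λ P g (ι hs n) y))) ≡ B P g (moment W ν) y y
      actual = (sum-cong X λ n' _ → sym (*-assoc _ _ _) · sym (B-Λ (s n' * ind (n' ≡? ν [mod W ])) (ι hs n') y y (idem n'))) ·
        sym (B-sum P X _ y y) · B-cong P (λ U → sum-cong X λ n' _ → *-assoc _ _ _) (λ _ → refl) (λ _ → refl)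

S-over-const : ∀ P c ψ → S P (λ p → c * inv p) ψ ≡ S P (λ _ → c) (λ r → inv r * ψ r)
S-over-const [] c ψ = sym (*-identityˡ (ψ 1)) · cong (_* ψ 1) (sym inv-1)
S-over-const (p ∷ P) c ψ = cong₂ _+_ (S-over-const P c ψ) (begin
  c * inv p * S P (λ p → c * inv p) (shift ψ p) ≡⟨ cong (c * inv p *_) (S-over-const P c (shift ψ p)) · *-assoc _ _ _ ⟩
  c * (inv p * S P (λ _ → c) (λ r → inv r * ψ (p N.* r))) ≡⟨ cong (c *_) (sym (S-* P _ (inv p) _)) ⟩
  c * S P (λ _ → c) (λ r → inv p * (inv r * ψ (p N.* r))) ≡⟨ cong (c *_) (S-cong P _ (λ r → sym (*-assoc _ _ _) · cong (_* ψ (p N.* r)) (sym (inv-* p r)))) ⟩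
  c * S P (λ _ → c) (λ r → inv (p N.* r) * ψ (p N.* r)) ∎)
  where open ≡-Reasoning

sum-multiples-≤ : ∀ W x {f : ℕ → ℚ} → 1 N.≤ W → Nonneg f → sum x (λ i → f (W N.* suc i)) ≤ sum (x N.* W) (f ∘ suc)
sum-multiples-≤ W zero    1≤W f≥0 = ≤-refl
sum-multiples-≤ W@(suc w) (suc x) {f} 1≤W f≥0 = ≤-trans (+-mono-≤ (sum-multiples-≤ W x 1≤W f≥0) last)
  (≡⇒≤ (sym (cong (λ t → sum t (f ∘ suc)) (N.+-comm W (x N.* W)) · sum-append (x N.* W) W (f ∘ suc))))
  where
  last : f (W N.* suc x) ≤ sum W (λ i → f (suc (x N.* W N.+ i)))
  last = ≤-add (sum w (λ i → f (suc (x N.* W N.+ i)))) (sum-nonneg w λ i _ → f≥0 (suc (x N.* W N.+ i)))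
    (+-comm _ _ · cong (λ t → sum w (λ i → f (suc (x N.* W N.+ i))) + f t)
      (N.*-comm W (suc x) · N.+-comm W (x N.* W) · N.+-suc (x N.* W) w))

module ErrorSums (D n : ℕ) (2≤D : 2 N.≤ D) (x : ℕ) where
  private
    P : List ℕ
    P = primesFrom D n

  error-divisors : ∀ K {τ} → 0# ≤ τ → Z (nat K) P (λ U → χ x (product U) * (τ * inv (product U))) ≤ τ * H x ^ K
  error-divisors K {τ} τ≥0 = begin
    Z (nat K) P (λ U → χ x (product U) * (τ * inv (product U))) ≡⟨ Z≡S P (λ r → χ x r * (τ * inv r)) ⟩
    S P (λ _ → nat K) (λ r → χ x r * (τ * inv r)) ≡⟨ (S-cong P _ λ r → solve 3 (λ a b c → a :* (b :* c) := b :* (c :* a)) refl (χ x r) τ (inv r)) · S-* P _ τ _ ⟩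
    τ * S P (λ _ → nat K) (λ r → inv r * χ x r) ≡⟨ cong (τ *_) (sym (S-over-const P (nat K) (χ x))) ⟩
    τ * S P (over K) (χ x) ≤⟨ *-monoˡ-≤ τ≥0 (S-over-H D n 2≤D K x) ⟩
    τ * H x ^ K ∎
    where open ≤-Reasoning

  -- A level of distribution controls moduli of weight 1 only. The weights K^ω are split as b + K^(2
  -- ω) / b, so that the second part can be paid for by the trivial bound. The last factor 2 of the
  -- exponent comes from the 2^∣U∣ in that bound.
  error-level : ∀ K W b b⁻¹ {τ} {E : ℕ → ℚ} → b * b⁻¹ ≡ 1# → 0# ≤ b → 0# ≤ b⁻¹ → 0# ≤ τ → 1 N.≤ W → Nonneg E →
    (∀ U → U ⊆ P → product U N.≤ x → E (W N.* product U) ≤ nat 2 ^ length U * (τ * inv (product U))) →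
    Z (nat K) P (λ U → χ x (product U) * E (W N.* product U))
      ≤ b * sum (x N.* W) (E ∘ suc) + b⁻¹ * (τ * H x ^ (K N.* K N.* 2))
  error-level K W b b⁻¹ {τ} {E} eq b≥0 b⁻¹≥0 τ≥0 1≤W E≥0 pointwise = begin
    Z (nat K) P E' ≡⟨ sym (*-identityˡ _) ⟩
    1# * Z (nat K) P E' ≤⟨ Z-split b b⁻¹ 1# P eq b≥0 b⁻¹≥0 E'≥0 ⟩
    b * Z 1# P E' + b⁻¹ * (1# * 1# * Z (nat K * nat K) P E') ≤⟨ +-mono-≤ (*-monoˡ-≤ b≥0 first) (*-monoˡ-≤ b⁻¹≥0 (≡⇒≤ (cong (_* Z (nat K * nat K) P E') (*-identityˡ 1#) · *-identityˡ _) ◂ second)) ⟩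
    b * sum (x N.* W) (E ∘ suc) + b⁻¹ * (τ * H x ^ (K N.* K N.* 2)) ∎
    where
    open ≤-Reasoning
    E' : List ℕ → ℚ
    E' U = χ x (product U) * E (W N.* product U)
    E'≥0 : Nonneg E'
    E'≥0 U = *-nonneg (χ≥0 x (product U)) (E≥0 (W N.* product U))
    first : Z 1# P E' ≤ sum (x N.* W) (E ∘ suc)
    first = begin
      Z 1# P E' ≡⟨ Z≡S P (λ r → χ x r * E (W N.* r)) ⟩
      S P (λ _ → 1#) (λ r → χ x r * E (W N.* r)) ≤⟨ S≤F D n x _ 2≤D (λ r → *-nonneg (χ≥0 x r) (E≥0 (W N.* r)))
             (λ m x<m → cong (_* E (W N.* m)) (ind-no (m N.≤? x) (N.<⇒≱ x<m)) · *-zeroˡ _) ⟩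
      F D x (λ r → χ x r * E (W N.* r)) ≤⟨ sum-mono x (λ i _ → *-monoʳ-≤ (*-nonneg (χ≥0 x (suc i)) (E≥0 (W N.* suc i))) (ind≤1 (coprime? (suc i) (D !))) ◂
             ≡⇒≤ (*-identityˡ _) ◂ *-monoʳ-≤ (E≥0 (W N.* suc i)) (ind≤1 (suc i N.≤? x)) ◂ ≡⇒≤ (*-identityˡ _)) ⟩
      sum x (λ i → E (W N.* suc i)) ≤⟨ sum-multiples-≤ W x 1≤W E≥0 ⟩
      sum (x N.* W) (E ∘ suc) ∎
    second : Z (nat K * nat K) P E' ≤ τ * H x ^ (K N.* K N.* 2)
    second = begin
      Z (nat K * nat K) P E' ≤⟨ Z-mono P (*-nonneg (0≤nat K) (0≤nat K)) (λ U U⊆ → bound U U⊆) ⟩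
      Z (nat K * nat K) P (λ U → nat 2 ^ length U * (χ x (product U) * (τ * inv (product U)))) ≡⟨ Z-power (nat K * nat K) (nat 2) P _ ⟩
      Z (nat K * nat K * nat 2) P (λ U → χ x (product U) * (τ * inv (product U))) ≡⟨ cong (λ t → Z t P (λ U → χ x (product U) * (τ * inv (product U)))) (sym (nat-* (K N.* K) 2 · cong (_* nat 2) (nat-* K K))) ⟩
      Z (nat (K N.* K N.* 2)) P (λ U → χ x (product U) * (τ * inv (product U))) ≤⟨ error-divisors (K N.* K N.* 2) τ≥0 ⟩
      τ * H x ^ (K N.* K N.* 2) ∎
      where
      bound : ∀ U → U ⊆ P → E' U ≤ nat 2 ^ length U * (χ x (product U) * (τ * inv (product U)))
      bound U U⊆ with product U N.≤? x
      ... | yes le = ≡⇒≤ (*-identityˡ _) ◂ pointwise U U⊆ le ◂ ≡⇒≤ (cong (nat 2 ^ length U *_) (sym (*-identityˡ _)))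
      ... | no _ = ≡⇒≤ (solve 4 (λ a b c d → # 0 :* a := b :* (# 0 :* (c :* d))) refl _ (nat 2 ^ length U) τ (inv (product U)))

-- Levels of distribution over a window

primeClassSum : (ℕ → ℚ) → (N q a : ℕ) → ℚ
primeClassSum ℓ N q a = sum N (λ i → ℓ (suc i) * (ind (prime? (suc i)) * ind (suc i ≡? a [mod q ])))

λ-classSum : (y q a : ℕ) → ℚ
λ-classSum y q a = sum y (λ i → int (liouville (suc i)) * ind (suc i ≡? a [mod q ]))

-- The level of distribution num/den at N, with ℓ a rational approximation of the logarithm.
record PrimeLevel (num den A C N : ℕ) : Set where
  field
    ℓ        : ℕ → ℚ
    ℓ≥0      : Nonneg ℓ
    ℓ≤H      : ∀ n → n N.≤ N → ℓ n ≤ H N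
    E        : ℕ → ℚ
    E≥0      : Nonneg E
    class    : ∀ q a → 1 N.≤ q → Coprime a q → ∣ primeClassSum ℓ N q a - nat N * inv (φ q) ∣ ≤ E q
    -- E must not exceed the true discrepancy, so that the trivial bound for a single modulus
    -- applies to it.
    attained : ∀ q → 1 N.≤ q → ∃[ a ] E q ≤ ∣ primeClassSum ℓ N q a - nat N * inv (φ q) ∣
    -- The premise says Q ≤ N^(num / den) without roots.
    total    : ∀ Q → Q N.^ den N.≤ N N.^ num → sum Q (E ∘ suc) * H N ^ A ≤ nat C * nat N

record LiouvilleLevel (num den A C N : ℕ) : Set where
  field
    E        : ℕ → ℚ
    E≥0      : Nonneg E
    class    : ∀ q a y → 1 N.≤ q → y N.≤ N → ∣ λ-classSum y q a ∣ ≤ E q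
    attained : ∀ q → 1 N.≤ q → ∃[ a ] ∃[ y ] y N.≤ N × E q ≤ ∣ λ-classSum y q a ∣
    total    : ∀ Q → Q N.^ den N.≤ N N.^ num → sum Q (E ∘ suc) * H N ^ A ≤ nat C * nat N

liouville-±1 : ∀ n → int (liouville n) ≡ 1# ⊎ int (liouville n) ≡ - 1#
liouville-±1 n = power (Ω n)
  where
  power : ∀ k → int (Z.-1ℤ Z.^ k) ≡ 1# ⊎ int (Z.-1ℤ Z.^ k) ≡ - 1#
  power zero = inj₁ refl
  power (suc k) with power k
  ... | inj₁ eq = inj₂ (int-* Z.-1ℤ _ · cong₂ _*_ (int-neg (Z.+ 1)) eq · *-identityʳ _)
  ... | inj₂ eq = inj₁ (int-* Z.-1ℤ _ · (cong₂ _*_ (int-neg (Z.+ 1)) eq ·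
        solve 0 (:- # 1 :* :- # 1 := # 1) refl))

∣liouville∣ : ∀ n → ∣ int (liouville n) ∣ ≡ 1#
∣liouville∣ n with liouville-±1 n
... | inj₁ eq = cong ∣_∣ eq · ∣-∣-nonneg 0≤1
... | inj₂ eq = cong ∣_∣ eq · ∣-∣-neg 1# · ∣-∣-nonneg 0≤1

count-≤ : ∀ a q x L → 1 N.≤ q → sum L (λ i → ind ((x N.+ i) ≡? a [mod q ])) ≤ nat L * inv q + 1#
count-≤ a q x L 1≤q = ≤-add (1# - (C - nat L * inv q)) (0≤y-x (x≤∣x∣ _ ◂ class-count a q x L 1≤q))
  (solve 2 (λ c l → c :+ (# 1 :- (c :- l)) := l :+ # 1) refl C (nat L * inv q))
  where C = sum L (λ i → ind ((x N.+ i) ≡? a [mod q ]))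

window-sum : ∀ b L (f : ℕ → ℚ) → sum (b N.+ L) (λ n → ind (b N.≤? n) * f n) ≡ sum L (λ i → f (b N.+ i))
window-sum b L f = sum-append b L _ · cong₂ _+_
  (sum-zero b λ i i<b → cong (_* f i) (ind-no (b N.≤? i) (N.<⇒≱ i<b)) · *-zeroˡ _)
  (sum-cong L λ i _ → cong (_* f (b N.+ i)) (ind-yes (b N.≤? b N.+ i) (N.m≤m+n b i)) · *-identityˡ _) · +-identityˡ _

shift-class : ∀ n a c q → ind (n ≡? a [mod q ]) ≡ ind ((n N.+ c) ≡? (a N.+ c) [mod q ])
shift-class n a c q = ind-cong (n ≡? a [mod q ]) ((n N.+ c) ≡? (a N.+ c) [mod q ]) (≡mod-shift {n} {a} c) (≡mod-unshift {n} {a} c)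

-- The window R < n ≤ R + L, at distance c from N.
module Window (R L c N : ℕ) (N≡ : R N.+ L N.+ suc c ≡ N) where

  X : ℕ
  X = suc R N.+ L

  X+c≡N : X N.+ c ≡ N
  X+c≡N = sym (N.+-suc (R N.+ L) c) · N≡

  inside : ℕ → ℚ
  inside n = ind (suc R N.≤? n)

  class-integers : ∀ q a → 1 N.≤ q →
    ∣ sum X (λ n → inside n * ind (n ≡? a [mod q ])) - nat N * inv q ∣ ≤ nat (suc R N.+ c) * inv q + 1#
  class-integers q a 1≤q = begin
    ∣ sum X (λ n → inside n * ind (n ≡? a [mod q ])) - nat N * inv q ∣ ≡⟨ cong (λ t → ∣ t - nat N * inv q ∣) (window-sum (suc R) L _) ⟩
    ∣ C - nat N * inv q ∣ ≡⟨ cong ∣_∣ (cong (λ t → C - t * inv q) N≡' · (solve 4 (λ c l m i → c :- (l :+ m) :* i := c :- l :* i :+ :- (m :* i)) refl C (nat L) (nat (suc R N.+ c)) (inv q))) ⟩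
    ∣ C - nat L * inv q + - (nat (suc R N.+ c) * inv q) ∣ ≤⟨ ∣-∣-triangle _ _ ⟩
    ∣ C - nat L * inv q ∣ + ∣ - (nat (suc R N.+ c) * inv q) ∣ ≤⟨ +-mono-≤ (class-count a q (suc R) L 1≤q) (≡⇒≤ (∣-∣-neg _ · ∣-∣-nonneg (*-nonneg (0≤nat (suc R N.+ c)) (0≤inv q)))) ⟩
    1# + nat (suc R N.+ c) * inv q ≡⟨ +-comm _ _ ⟩
    nat (suc R N.+ c) * inv q + 1# ∎
    where
    open ≤-Reasoning
    C = sum L (λ i → ind ((suc R N.+ i) ≡? a [mod q ]))
    N≡' : nat N ≡ nat L + nat (suc R N.+ c)
    N≡' = cong nat (sym X+c≡N · cong (N._+ c) (N.+-comm (suc R) L) · N.+-assoc L (suc R) c) · nat-+ L (suc R N.+ c)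

  module Primes {num den A C} (level : PrimeLevel num den A C N) where
    open PrimeLevel level

    primeWeight : ℕ → ℕ → ℚ
    primeWeight h n = inside n * (ℓ (n N.+ h) * ind (prime? (n N.+ h)))

    -- The primes n + h with n in the window are the primes up to N without a head of length R + h
    -- and a tail of length at most c + 1, both of which are bounded trivially.
    class-primes : ∀ h → h N.≤ c → ∀ q a → 1 N.≤ q → Coprime (a N.+ h) q →
      ∣ sum X (λ n → primeWeight h n * ind (n ≡? a [mod q ])) - nat N * inv (φ q) ∣
        ≤ E q + H N * (nat (R N.+ c) * inv q + nat (suc (suc c)))
    class-primes h h≤c q a 1≤q cop = begin
      ∣ sum X (λ n → primeWeight h n * ind (n ≡? a [mod q ])) - M ∣ ≡⟨ cong (λ t → ∣ t - M ∣) ((sum-cong X λ n _ → *-assoc _ _ _) · window-sum (suc R) L _ · (sum-cong L λ i _ → middle i)) ⟩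
      ∣ mid - M ∣ ≡⟨ cong ∣_∣ (solve 4 (λ h m t M → m :- M := h :+ m :+ t :- M :+ :- (h :+ t)) refl head mid tail M · cong (λ t → t - M + - (head + tail)) (sym total')) ⟩
      ∣ primeClassSum ℓ N q (a N.+ h) - M + - (head + tail) ∣ ≤⟨ ∣-∣-triangle _ _ ◂ +-mono-≤ (class q (a N.+ h) 1≤q cop) (≡⇒≤ (∣-∣-neg _ · ∣-∣-nonneg (+-nonneg head≥0 tail≥0))) ⟩
      E q + (head + tail) ≤⟨ +-mono-≤ ≤-refl (+-mono-≤ head≤ tail≤) ⟩
      E q + (H N * (nat (R N.+ c) * inv q + 1#) + nat (suc c) * H N) ≡⟨ cong (E q +_) (solve 3 (λ h x n → h :* (x :+ # 1) :+ n :* h := h :* (x :+ (n :+ # 1))) refl (H N) (nat (R N.+ c) * inv q) (nat (suc c)) ·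
             cong (λ t → H N * (nat (R N.+ c) * inv q + t)) (sym (nat-suc (suc c)))) ⟩
      E q + H N * (nat (R N.+ c) * inv q + nat (suc (suc c))) ∎
      where
      open ≤-Reasoning
      M = nat N * inv (φ q)
      term : ℕ → ℚ
      term i = ℓ (suc i) * (ind (prime? (suc i)) * ind (suc i ≡? (a N.+ h) [mod q ]))
      rest = suc c N.∸ h
      head mid tail : ℚ
      head = sum (R N.+ h) term
      mid = sum L (λ i → term (R N.+ h N.+ i))
      tail = sum rest (λ i → term (R N.+ h N.+ L N.+ i))
      N-split : N ≡ R N.+ h N.+ L N.+ rest
      N-split = sym N≡ · cong (R N.+ L N.+_) (sym (N.m+[n∸m]≡n (N.m≤n⇒m≤1+n h≤c))) ·
        sym (N.+-assoc (R N.+ L) h rest) · cong (N._+ rest) (N.+-assoc R L h · cong (R N.+_) (N.+-comm L h) · sym (N.+-assoc R h L))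
      total' : primeClassSum ℓ N q (a N.+ h) ≡ head + mid + tail
      total' = cong (λ t → sum t term) N-split · sum-append (R N.+ h N.+ L) rest term · cong (_+ tail) (sum-append (R N.+ h) L term)
      place : ∀ i → suc R N.+ i N.+ h ≡ suc (R N.+ h N.+ i)
      place i = cong suc (N.+-assoc R i h · cong (R N.+_) (N.+-comm i h) · sym (N.+-assoc R h i))
      middle : ∀ i → ℓ (suc R N.+ i N.+ h) * ind (prime? (suc R N.+ i N.+ h)) * ind ((suc R N.+ i) ≡? a [mod q ]) ≡ term (R N.+ h N.+ i)
      middle i = cong₂ (λ t u → ℓ t * ind (prime? t) * u) (place i) (shift-class (suc R N.+ i) a h q · cong (λ t → ind (t ≡? (a N.+ h) [mod q ])) (place i)) · *-assoc _ _ _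
      term≥0 : ∀ i → 0# ≤ term i
      term≥0 i = *-nonneg (ℓ≥0 (suc i)) (*-nonneg (0≤ind (prime? (suc i))) (0≤ind (suc i ≡? (a N.+ h) [mod q ])))
      head≥0 : 0# ≤ head
      head≥0 = sum-nonneg (R N.+ h) λ i _ → term≥0 i
      tail≥0 : 0# ≤ tail
      tail≥0 = sum-nonneg rest λ i _ → term≥0 (R N.+ h N.+ L N.+ i)
      term≤ : ∀ i → suc i N.≤ N → term i ≤ H N * ind (suc i ≡? (a N.+ h) [mod q ])
      term≤ i i<N = *-mono-≤ (ℓ≥0 (suc i)) (*-nonneg (0≤ind (prime? (suc i))) (0≤ind (suc i ≡? (a N.+ h) [mod q ]))) (ℓ≤H (suc i) i<N)
        (*-monoʳ-≤ (0≤ind (suc i ≡? (a N.+ h) [mod q ])) (ind≤1 (prime? (suc i))) ◂ ≡⇒≤ (*-identityˡ _))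
      head≤ : head ≤ H N * (nat (R N.+ c) * inv q + 1#)
      head≤ = begin
        head ≤⟨ sum-mono (R N.+ h) (λ i i< → term≤ i (i< ◃ subst (R N.+ h N.≤_) (sym N-split) (N.m≤m+n (R N.+ h) L ◃ N.m≤m+n _ rest))) ⟩
        sum (R N.+ h) (λ i → H N * ind (suc i ≡? (a N.+ h) [mod q ])) ≡⟨ sum-*ˡ (R N.+ h) (H N) _ ⟩
        H N * sum (R N.+ h) (λ i → ind ((1 N.+ i) ≡? (a N.+ h) [mod q ])) ≤⟨ *-monoˡ-≤ (0≤H N) (count-≤ (a N.+ h) q 1 (R N.+ h) 1≤q ◂ +-mono-≤ (*-monoʳ-≤ (0≤inv q) (nat-mono (N.+-monoʳ-≤ R h≤c))) ≤-refl) ⟩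
        H N * (nat (R N.+ c) * inv q + 1#) ∎
      tail≤ : tail ≤ nat (suc c) * H N
      tail≤ = begin
        tail ≤⟨ sum-mono rest (λ i i< → term≤ (R N.+ h N.+ L N.+ i) (subst (suc (R N.+ h N.+ L N.+ i) N.≤_) (sym N-split) (N.+-monoʳ-< (R N.+ h N.+ L) i<)) ◂
               *-monoˡ-≤ (0≤H N) (ind≤1 (suc (R N.+ h N.+ L N.+ i) ≡? (a N.+ h) [mod q ])) ◂ ≡⇒≤ (*-identityʳ _)) ⟩
        sum rest (λ _ → H N) ≡⟨ sum-const rest _ ⟩
        nat rest * H N ≤⟨ *-monoʳ-≤ (0≤H N) (nat-mono (N.m∸n≤m (suc c) h)) ⟩
        nat (suc c) * H N ∎

    prime-trivial : ∀ q → 1 N.≤ q → E q ≤ H N * (nat N * inv q + 1#) + nat N * inv (φ q)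
    prime-trivial q 1≤q with attained q 1≤q
    ... | a , le = le ◂ ∣-∣-triangle _ _ ◂ +-mono-≤
      (≡⇒≤ (∣-∣-nonneg (sum-nonneg N λ i _ → *-nonneg (ℓ≥0 (suc i)) (*-nonneg (0≤ind (prime? (suc i))) (0≤ind (suc i ≡? a [mod q ]))))) ◂
        (sum-mono N λ i i<N → *-mono-≤ (ℓ≥0 (suc i)) (*-nonneg (0≤ind (prime? (suc i))) (0≤ind (suc i ≡? a [mod q ]))) (ℓ≤H (suc i) i<N)
            (*-monoʳ-≤ (0≤ind (suc i ≡? a [mod q ])) (ind≤1 (prime? (suc i))) ◂ ≡⇒≤ (*-identityˡ _))) ◂
          ≡⇒≤ (sum-*ˡ N (H N) _) ◂ *-monoˡ-≤ (0≤H N) (count-≤ a q 1 N 1≤q))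
      (≡⇒≤ (∣-∣-neg _ · ∣-∣-nonneg (*-nonneg (0≤nat N) (0≤inv (φ q)))))

  module Liouville {num den A C} (level : LiouvilleLevel num den A C N) where
    open LiouvilleLevel level

    liouvilleWeight : ℕ → ℕ → ℚ
    liouvilleWeight r n = inside n * int (liouville (n N.+ r))

    -- The window is a difference of two initial segments up to N. This is where the maximum over y
    -- in condition (B) enters.
    class-liouville : ∀ r → r N.≤ c → ∀ q a → 1 N.≤ q →
      ∣ sum X (λ n → liouvilleWeight r n * ind (n ≡? a [mod q ])) - 0# ∣ ≤ nat 2 * E q
    class-liouville r r≤c q a 1≤q = begin
      ∣ sum X (λ n → liouvilleWeight r n * ind (n ≡? a [mod q ])) - 0# ∣ ≡⟨ cong (λ t → ∣ t - 0# ∣) ((sum-cong X λ n _ → *-assoc _ _ _) · window-sum (suc R) L _ · (sum-cong L λ i _ → middle i)) ⟩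
      ∣ sum L (λ i → term (R N.+ r N.+ i)) - 0# ∣ ≡⟨ cong ∣_∣ (solve 2 (λ s t → t :- # 0 := s :+ t :+ :- s) refl (sum (R N.+ r) term) _ · cong (_+ - sum (R N.+ r) term) (sym (sum-append (R N.+ r) L term))) ⟩
      ∣ λ-classSum (R N.+ r N.+ L) q (a N.+ r) + - λ-classSum (R N.+ r) q (a N.+ r) ∣ ≤⟨ ∣-∣-triangle _ _ ◂ +-mono-≤ (class q (a N.+ r) (R N.+ r N.+ L) 1≤q y≤N)
             (≡⇒≤ (∣-∣-neg _) ◂ class q (a N.+ r) (R N.+ r) 1≤q (N.m≤m+n _ L ◃ y≤N)) ⟩
      E q + E q ≡⟨ solve 1 (λ e → e :+ e := # 2 :* e) refl (E q) ⟩
      nat 2 * E q ∎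
      where
      open ≤-Reasoning
      term : ℕ → ℚ
      term i = int (liouville (suc i)) * ind (suc i ≡? (a N.+ r) [mod q ])
      place : ∀ i → suc R N.+ i N.+ r ≡ suc (R N.+ r N.+ i)
      place i = cong suc (N.+-assoc R i r · cong (R N.+_) (N.+-comm i r) · sym (N.+-assoc R r i))
      middle : ∀ i → int (liouville (suc R N.+ i N.+ r)) * ind ((suc R N.+ i) ≡? a [mod q ]) ≡ term (R N.+ r N.+ i)
      middle i = cong₂ (λ t u → int (liouville t) * u) (place i) (shift-class (suc R N.+ i) a r q · cong (λ t → ind (t ≡? (a N.+ r) [mod q ])) (place i))
      y≤N : R N.+ r N.+ L N.≤ N
      y≤N = subst (R N.+ r N.+ L N.≤_) ((cong (R N.+ suc c N.+_) refl · N.+-assoc R (suc c) L · cong (R N.+_) (N.+-comm (suc c) L) · sym (N.+-assoc R L (suc c))) · N≡)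
        (N.+-monoˡ-≤ L (N.+-monoʳ-≤ R (N.m≤n⇒m≤1+n r≤c)))

    liouville-trivial : ∀ q → 1 N.≤ q → E q ≤ nat N * inv q + 1#
    liouville-trivial q 1≤q with attained q 1≤q
    ... | a , y , y≤N , le = le ◂ sum-∣-∣ y _ ◂ ≡⇒≤ (sum-cong y λ i _ →
            (∣-∣-* _ _) · cong₂ _*_ (∣liouville∣ (suc i)) (∣-∣-nonneg (0≤ind (suc i ≡? a [mod q ]))) · *-identityˡ _) ◂
          count-≤ a q 1 y 1≤q ◂ +-mono-≤ (*-monoʳ-≤ (0≤inv q) (nat-mono y≤N)) ≤-refl

-- Each prime costs 1 / (p - 1) ≤ 2 / p.
φ-product-≤ : ∀ U q → Good q U → 1 N.≤ q → inv (φ (q N.* product U)) ≤ nat 2 ^ length U * (inv (φ q) * inv (product U))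
φ-product-≤ [] q _ _ = ≡⇒≤ (cong (λ t → inv (φ t)) (N.*-identityʳ q) · sym (*-identityˡ _ · cong (inv (φ q) *_) inv-1 · *-identityʳ _))
φ-product-≤ (p ∷ U) q (pp , cop , gd) 1≤q = begin
  inv (φ (q N.* (p N.* product U))) ≡⟨ cong (λ t → inv (φ t)) (sym (N.*-assoc q p (product U)) · cong (N._* product U) (N.*-comm q p)) ⟩
  inv (φ (p N.* q N.* product U)) ≤⟨ φ-product-≤ U (p N.* q) gd (N.*-mono-≤ (1≤prime pp) 1≤q) ⟩
  nat 2 ^ length U * (inv (φ (p N.* q)) * inv (product U)) ≡⟨ cong (λ t → nat 2 ^ length U * (t * inv (product U))) (cong inv φpq · inv-* (p N.∸ 1) (φ q)) ⟩
  nat 2 ^ length U * (inv (p N.∸ 1) * inv (φ q) * inv (product U)) ≤⟨ *-monoˡ-≤ (^-nonneg (length U) (0≤nat 2)) (*-monoʳ-≤ (0≤inv (product U)) (*-monoʳ-≤ (0≤inv (φ q)) half)) ⟩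
  nat 2 ^ length U * (nat 2 * inv p * inv (φ q) * inv (product U)) ≡⟨ solve 5 (λ a b c d e → a :* (b :* c :* d :* e) := b :* a :* (d :* (c :* e))) refl (nat 2 ^ length U) (nat 2) (inv p) (inv (φ q)) (inv (product U)) ⟩
  nat 2 * nat 2 ^ length U * (inv (φ q) * (inv p * inv (product U))) ≡⟨ cong (λ t → nat 2 * nat 2 ^ length U * (inv (φ q) * t)) (sym (inv-* p (product U))) ⟩
  nat 2 ^ length (p ∷ U) * (inv (φ q) * inv (product (p ∷ U))) ∎
  where
  open ≤-Reasoning
  φpq : φ (p N.* q) ≡ (p N.∸ 1) N.* φ q
  φpq = N.≤-antisym (nat-cancel (≡⇒≤ eq)) (nat-cancel (≡⇒≤ (sym eq)))
    where
    eq : nat (φ (p N.* q)) ≡ nat ((p N.∸ 1) N.* φ q)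
    eq = φ-prime-* q pp cop · cong (_* nat (φ q)) (sym (nat-∸ (1≤prime pp))) · sym (nat-* (p N.∸ 1) (φ q))
  half : inv (p N.∸ 1) ≤ nat 2 * inv p
  half = *-cancelˡ-≤ {nat p} (0<nat p {{prime⇒nonZero pp}}) (*-cancelˡ-≤ {nat (p N.∸ 1)} (0<nat (p N.∸ 1) {{p-1≢0}}) (subst₂ _≤_
    (sym (*-identityʳ _) · cong (nat p *_) (sym (natinv (p N.∸ 1) {{p-1≢0}})) · solve 3 (λ p m i → p :* (m :* i) := m :* (p :* i)) refl (nat p) (nat (p N.∸ 1)) _)
    ((nat-* 2 (p N.∸ 1) · sym (*-identityʳ _) · cong (nat 2 * nat (p N.∸ 1) *_) (sym (natinv p {{prime⇒nonZero pp}}))) · solve 4 (λ a m p i → a :* m :* (p :* i) := m :* (p :* (a :* i))) refl (nat 2) (nat (p N.∸ 1)) (nat p) (inv p))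
    (nat-mono (p≤2[p-1] (1<prime pp)))))
    where
    p-1≢0 : NonZero (p N.∸ 1)
    p-1≢0 = N.>-nonZero (N.m<n⇒0<n∸m (1<prime pp))
    p≤2[p-1] : ∀ {p} → 1 N.< p → p N.≤ 2 N.* (p N.∸ 1)
    p≤2[p-1] {suc (suc m)} (s≤s (s≤s _)) = subst (suc (suc m) N.≤_) (cong suc (sym (N.+-suc m (m N.+ 0) · refl))) (s≤s (s≤s (N.m≤m+n m (m N.+ 0))))

-- Comparison of the sieve sums

Λ-cong : ∀ {P g ι ι'} y → All (λ p → ι p ≡ ι' p) P → Λ P g ι y ≡ Λ P g ι' y
Λ-cong y [] = refl
Λ-cong {p ∷ P} {g} y (eq ∷ l) = cong₂ _+_ (Λ-cong y l) (cong₂ (λ t u → (g p - (1# + g p) * t) * u) eq (Λ-cong (shift y p) l))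

primesFrom-≤ : ∀ D n → All (N._≤ D N.+ n) (primesFrom D n)
primesFrom-≤ D zero = []
primesFrom-≤ D (suc n) with prime? (suc D)
... | yes _ = subst (suc D N.≤_) (sym (N.+-suc D n)) (s≤s (N.m≤m+n D n)) ∷ All.map (λ {p} → subst (p N.≤_) (sym (N.+-suc D n))) (primesFrom-≤ (suc D) n)
... | no  _ = All.map (λ {p} → subst (p N.≤_) (sym (N.+-suc D n))) (primesFrom-≤ (suc D) n)

remove : ∀ {x} (xs : List ℕ) → x ∈ xs → List ℕ
remove (x ∷ xs) (here _) = xs
remove (x ∷ xs) (there i) = x ∷ remove xs i

length-remove : ∀ {x xs} (i : x ∈ xs) → length xs ≡ suc (length (remove xs i))
length-remove (here _) = refl
length-remove (there i) = cong suc (length-remove i)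

sumL-remove : ∀ {x xs} (i : x ∈ xs) (f : ℕ → ℚ) → sumL xs f ≡ f x + sumL (remove xs i) f
sumL-remove (here refl) f = refl
sumL-remove {x} {z ∷ xs} (there i) f = cong (f z +_) (sumL-remove i f) ·
  solve 3 (λ a b c → a :+ (b :+ c) := b :+ (a :+ c)) refl (f z) (f x) _

remove-∈ : ∀ {x z xs} (i : x ∈ xs) → z ∈ remove xs i → z ∈ xs
remove-∈ (here _)  j = there j
remove-∈ (there i) (here eq) = here eq
remove-∈ (there i) (there j) = there (remove-∈ i j)

remove-Unique : ∀ {x xs} (i : x ∈ xs) → Unique xs → Unique (remove xs i)
remove-Unique (here _)  (_ ∷ u) = u
remove-Unique (there i) (≢s ∷ u) = All.tabulate (λ j → All.lookup ≢s (remove-∈ i j)) ∷ remove-Unique i u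

remove-≢ : ∀ {x z xs} (i : x ∈ xs) → Unique xs → z ∈ remove xs i → z ≢ x
remove-≢ (here refl) (≢s ∷ u) j           eq = All.lookup ≢s j (sym eq)
remove-≢ (there i)   (≢s ∷ u) (here refl) refl = All.lookup ≢s i refl
remove-≢ (there i)   (≢s ∷ u) (there j)   eq = remove-≢ i u j eq

^-monoʳ : ∀ {x m n} → 1# ≤ x → m N.≤ n → x ^ m ≤ x ^ n
^-monoʳ {x} {m} {n} 1≤x m≤n = subst (_≤ x ^ m * x ^ (n N.∸ m)) (*-identityʳ _) (*-monoˡ-≤ (^-nonneg m (0≤1 ◂ 1≤x)) (1≤^ (n N.∸ m) 1≤x)) ◂
  ≡⇒≤ (sym (^-+ x m (n N.∸ m)) · cong (x ^_) (N.m+[n∸m]≡n m≤n))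

-- The level of distribution is used with a saving of (log N)^e₂.
module Exponents (k : ℕ) where
  -- e₀ pays for the two factors `S P g (χ R)`, each at most (log N)^(2 k), and for two spare
  -- logarithms. e₁ is the exponent of the parameter b in `error-level`: it covers the divisor sum
  -- of exponent 2 (5 k)², the logarithm in the trivial bound, and e₀. e₃ is the cost of the errors
  -- from the ends of the window.
  e₀ e₁ e₂ e₃ : ℕ
  e₀ = 2 N.* k N.+ 2 N.* k N.+ 2
  e₁ = 5 N.* k N.* (5 N.* k) N.* 2 N.+ 1 N.+ e₀
  e₂ = e₁ N.+ e₀
  e₃ = 1 N.+ 5 N.* k N.+ e₀

-- The list of primes ends at R = T^M, so that for n > R a prime n + h is divisible by none of them.
-- `within-level` says R² W ≤ N^(num / den) for N = T^J. `room` leaves a further factor T, which by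
-- `T-large` exceeds the powers of log N in the remaining errors.
module Comparison (k' : ℕ) (hs : List ℕ) (length≡ : length hs ≡ suc k') (unique : Unique hs) (r c D t' M J ν n len : ℕ) (b : ℕ → ℕ)
  (hs≤c : All (N._≤ c) hs) (r≤c : r N.≤ c) (c≤D : c N.≤ D) (2≤D : 2 N.≤ D) (2k≤D : 2 N.* suc k' N.≤ D) (b0 : b 0 ≡ 0)
  (ν-cop : ∀ h → h ∈ hs → Coprime (ν N.+ h) (D !))
  (D+n≡R : D N.+ n ≡ Mesh.T D t' 2≤D N.^ M)
  (N≡ : Mesh.T D t' 2≤D N.^ M N.+ len N.+ suc c ≡ Mesh.T D t' 2≤D N.^ J)
  {num den Cp Cl : ℕ}
  (PL : PrimeLevel num den (Exponents.e₂ (suc k')) Cp (Mesh.T D t' 2≤D N.^ J))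
  (LL : LiouvilleLevel num den (Exponents.e₂ (suc k')) Cl (Mesh.T D t' 2≤D N.^ J))
  (within-level : (Mesh.T D t' 2≤D N.^ M N.* Mesh.T D t' 2≤D N.^ M N.* (D !)) N.^ den N.≤ (Mesh.T D t' 2≤D N.^ J) N.^ num)
  (room : Mesh.T D t' 2≤D N.^ M N.* Mesh.T D t' 2≤D N.^ M N.* Mesh.T D t' 2≤D N.≤ Mesh.T D t' 2≤D N.^ J)
  (T-large : H (Mesh.T D t' 2≤D N.^ J) ^ Exponents.e₃ (suc k') ≤ nat (Mesh.T D t' 2≤D))
  where

  open Mesh D t' 2≤D
  open Densities k'
  open Exponents k
  open StepFunction M b
  open Bounds D t' n k' 2≤D 2k≤D b0

  R N x : ℕ
  R = T N.^ M
  N = T N.^ J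
  x = R N.* R
  open Window R len c N N≡
  open Primes PL
  open Liouville LL

  P : List ℕ
  P = primesFrom D n

  y' : ℕ → ℚ
  y' = y T 1≤T

  h Q₁ : ℚ
  h = H N
  Q₁ = S P g (λ m → y' m * y' m)

  private
    instance
      _ : NonZero T
      _ = N.>-nonZero 1≤T
    1≤N : 1 N.≤ N
    1≤N = N.m^n>0 T J
    1≤R : 1 N.≤ R
    1≤R = N.m^n>0 T M
    1≤x : 1 N.≤ x
    1≤x = N.*-mono-≤ 1≤R 1≤R
    1≤h : 1# ≤ h
    1≤h = 1≤H N 1≤N
    0≤h : 0# ≤ h
    0≤h = 0≤1 ◂ 1≤h
    x≤N : x N.≤ N
    x≤N = N.m≤m*n x T ◃ room
    R≤x : R N.≤ x
    R≤x = N.m≤m*n R R {{N.>-nonZero 1≤R}}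
    primes : All (λ p → Prime p × D N.< p) P
    primes = primesFrom-All D n
    big : ∀ {p} → D N.< p → 2 N.* k N.< p
    big D<p = N.≤-<-trans 2k≤D D<p
    g≥0 : Nonneg g
    g≥0 = overShifted≥0 k k
    W-small : ∀ p → Prime p → D N.< p → Coprime p W
    W-small p pp D<p = prime-cop-! D pp D<p
    goodW : ∀ {U} → U ⊆ P → Good W U
    goodW = good D n W W-small
    U≥1 : ∀ {U} → U ⊆ P → 1 N.≤ product U
    U≥1 U⊆ = go U⊆ (primesFrom-positive D n)
      where
      go : ∀ {U P} → U ⊆ P → Positive P → 1 N.≤ product U
      go []         [] = N.≤-refl
      go (_ ∷ʳ s)   (_ ∷ l) = go s l
      go (refl ∷ s) (p ∷ l) = N.*-mono-≤ p (go s l)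

  module _ (κ : ℕ) (κ≤k : κ N.≤ k) where
    open ErrorSums D n 2≤D x
    private
      K = 5 N.* κ
      H^ : ∀ {m} → m N.≤ 5 N.* k → H x ^ m ≤ h ^ (5 N.* k)
      H^ {m} m≤ = ^-mono m (0≤H x) (H-mono x≤N) ◂ ^-monoʳ 1≤h m≤

    -- With b = (log N)^e₁ both terms of `error-level` keep a saving of (log N)^e₀: the first since
    -- e₂ = e₁ + e₀, the second since e₁ covers the divisor sum.
    level-error : ∀ {E : ℕ → ℚ} {C} → Nonneg E → (∀ Q → Q N.^ den N.≤ N N.^ num → sum Q (E ∘ suc) * h ^ e₂ ≤ nat C * nat N) →
      (∀ q → 1 N.≤ q → E q ≤ h * (nat N * inv q + 1#) + nat N * inv (φ q)) →
      Z (nat K) P (λ U → χ x (product U) * E (W N.* product U)) * h ^ e₀ ≤ nat (C N.+ 3) * nat N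
    level-error {E} {C} E≥0 total trivial = begin
      Z (nat K) P (λ U → χ x (product U) * E (W N.* product U)) * h ^ e₀ ≤⟨ *-monoʳ-≤ (^-nonneg e₀ 0≤h) (error-level K W β₁ β₁⁻¹ (*-recip β₁>0) (<⇒≤ β₁>0) (0≤recip β₁>0) τ≥0 1≤W E≥0 pointwise ◂
             +-mono-≤ ≤-refl (*-monoˡ-≤ (0≤recip β₁>0) (*-monoˡ-≤ τ≥0 H^²))) ⟩
      (β₁ * Σ + β₁⁻¹ * (τ * h ^ q₂)) * h ^ e₀ ≡⟨ solve 8 (λ a s i n hh q e t → (a :* s :+ i :* (# 3 :* hh :* n :* q)) :* e := s :* (a :* e) :+ # 3 :* n :* ((q :* hh :* e) :* i)) refl β₁ Σ β₁⁻¹ (nat N) h (h ^ q₂) (h ^ e₀) 0# ⟩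
      Σ * (β₁ * h ^ e₀) + nat 3 * nat N * (h ^ q₂ * h * h ^ e₀ * β₁⁻¹) ≡⟨ cong₂ (λ s t → Σ * s + nat 3 * nat N * (t * β₁⁻¹)) (sym (^-+ h e₁ e₀)) (sym β₁≡) ⟩
      Σ * h ^ e₂ + nat 3 * nat N * (β₁ * β₁⁻¹) ≤⟨ +-mono-≤ (total (x N.* W) within-level) (≡⇒≤ (cong (nat 3 * nat N *_) (*-recip β₁>0) · *-identityʳ _)) ⟩
      nat C * nat N + nat 3 * nat N ≡⟨ sym (*-distribʳ (nat N) _ _) · cong (_* nat N) (sym (nat-+ C 3)) ⟩
      nat (C N.+ 3) * nat N ∎
      where
      open ≤-Reasoning
      q₂ = 5 N.* k N.* (5 N.* k) N.* 2
      β₁ = h ^ e₁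
      β₁>0 : 0# < β₁
      β₁>0 = <-≤-trans 0<1 (1≤^ e₁ 1≤h)
      β₁⁻¹ = recip β₁>0
      β₁≡ : β₁ ≡ h ^ q₂ * h * h ^ e₀
      β₁≡ = (^-+ h (q₂ N.+ 1) e₀) · cong (_* h ^ e₀) ((^-+ h q₂ 1) · cong (h ^ q₂ *_) (*-identityʳ h))
      Σ = sum (x N.* W) (E ∘ suc)
      τ = nat 3 * h * nat N
      τ≥0 : 0# ≤ τ
      τ≥0 = *-nonneg (*-nonneg (0≤nat 3) 0≤h) (0≤nat N)
      H^² : H x ^ (K N.* K N.* 2) ≤ h ^ q₂
      H^² = ^-mono (K N.* K N.* 2) (0≤H x) (H-mono x≤N) ◂ ^-monoʳ 1≤h (N.*-monoˡ-≤ 2 (N.*-mono-≤ (N.*-monoʳ-≤ 5 κ≤k) (N.*-monoʳ-≤ 5 κ≤k)))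
      pointwise : ∀ U → U ⊆ P → product U N.≤ x → E (W N.* product U) ≤ nat 2 ^ length U * (τ * inv (product U))
      pointwise U U⊆ U≤x = begin
        E q ≤⟨ trivial q 1≤q ⟩
        h * (nat N * inv q + 1#) + nat N * inv (φ q) ≤⟨ +-mono-≤ (*-monoˡ-≤ 0≤h (+-mono-≤ (*-monoˡ-≤ (0≤nat N) inv-q≤) 1≤)) (*-monoˡ-≤ (0≤nat N) (φ-product-≤ U W (goodW U⊆) 1≤W ◂
               *-monoˡ-≤ (^-nonneg (length U) (0≤nat 2)) (*-monoʳ-≤ (0≤inv u) (inv≤1 (φ W)) ◂ ≡⇒≤ (*-identityˡ _)))) ⟩
        h * (nat N * inv u + nat N * inv u) + nat N * (nat 2 ^ length U * inv u) ≤⟨ ≤-add ((two - 1#) * (nat 2 * h * nat N * inv u) + (h - 1#) * (nat N * (two * inv u)))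
               (+-nonneg (*-nonneg (0≤y-x (1≤^ (length U) (nat-mono {1} {2} (s≤s z≤n)))) (*-nonneg (*-nonneg (*-nonneg (0≤nat 2) 0≤h) (0≤nat N)) (0≤inv u)))
                  (*-nonneg (0≤y-x 1≤h) (*-nonneg (0≤nat N) (*-nonneg (^-nonneg (length U) (0≤nat 2)) (0≤inv u)))))
               (solve 4 (λ h n i t → h :* (n :* i :+ n :* i) :+ n :* (t :* i) :+ ((t :- # 1) :* (# 2 :* h :* n :* i) :+ (h :- # 1) :* (n :* (t :* i)))
                    := t :* (# 3 :* h :* n :* i)) refl h (nat N) (inv u) two) ⟩
        two * (τ * inv u) ∎
        where
        u = product U
        two = nat 2 ^ length U
        q = W N.* u
        1≤u = U≥1 U⊆
        1≤q : 1 N.≤ q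
        1≤q = N.*-mono-≤ 1≤W 1≤u
        inv-q≤ : inv q ≤ inv u
        inv-q≤ = inv-anti {{N.>-nonZero 1≤u}} (N.m≤n*m u W {{N.>-nonZero 1≤W}})
        1≤ : 1# ≤ nat N * inv u
        1≤ = ≡⇒≤ (sym (natinv u {{N.>-nonZero 1≤u}})) ◂ *-monoʳ-≤ (0≤inv u) (nat-mono (U≤x ◃ x≤N))

    -- For products u ≤ R² errors of this shape are of size R² log N / u at most, and R² T ≤ N with
    -- T ≥ (log N)^e₃ absorbs them.
    constant-error : ∀ {E : ℕ → ℚ} {c₁ c₂ : ℕ} → c₁ N.≤ (c N.+ 2) N.* x → c₂ N.≤ c N.+ 2 → (∀ q → E q ≤ h * (nat c₁ * inv q + nat c₂)) →
      Z (nat K) P (λ U → χ x (product U) * E (W N.* product U)) * h ^ e₀ ≤ nat (2 N.* (c N.+ 2)) * nat N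
    constant-error {E} {c₁} {c₂} c₁≤ c₂≤ E≤ = begin
      Z (nat K) P (λ U → χ x (product U) * E (W N.* product U)) * h ^ e₀ ≤⟨ *-monoʳ-≤ (^-nonneg e₀ 0≤h) ((Z-mono P (0≤nat K) λ U U⊆ → pointwise U U⊆) ◂ error-divisors K τ≥0 ◂ *-monoˡ-≤ τ≥0 (H^ (N.*-monoʳ-≤ 5 κ≤k))) ⟩
      τ * h ^ (5 N.* k) * h ^ e₀ ≡⟨ solve 4 (λ h d a b → h :* d :* a :* b := d :* (h :* a :* b)) refl h (nat (d N.* x)) (h ^ (5 N.* k)) (h ^ e₀) ⟩
      nat (d N.* x) * (h ^ suc (5 N.* k) * h ^ e₀) ≡⟨ cong (nat (d N.* x) *_) (sym (^-+ h (suc (5 N.* k)) e₀)) ⟩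
      nat (d N.* x) * h ^ e₃ ≤⟨ *-monoˡ-≤ (0≤nat (d N.* x)) T-large ⟩
      nat (d N.* x) * nat T ≡⟨ sym (nat-* (d N.* x) T) · cong nat (N.*-assoc d x T) ⟩
      nat (d N.* (x N.* T)) ≤⟨ nat-mono (N.*-monoʳ-≤ d room) ⟩
      nat (d N.* N) ≡⟨ nat-* d N ⟩
      nat d * nat N ∎
      where
      open ≤-Reasoning
      d = 2 N.* (c N.+ 2)
      τ = h * nat (d N.* x)
      τ≥0 : 0# ≤ τ
      τ≥0 = *-nonneg 0≤h (0≤nat (d N.* x))
      pointwise : ∀ U → U ⊆ P → χ x (product U) * E (W N.* product U) ≤ χ x (product U) * (τ * inv (product U))
      pointwise U U⊆ with product U N.≤? x
      ... | no _ = ≡⇒≤ (*-zeroˡ _ · sym (*-zeroˡ _))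
      ... | yes u≤x = *-monoˡ-≤ 0≤1 (begin
        E q ≤⟨ E≤ q ⟩
        h * (nat c₁ * inv q + nat c₂) ≤⟨ *-monoˡ-≤ 0≤h (+-mono-≤ (*-mono-≤ (0≤nat c₁) (0≤inv q) (nat-mono c₁≤) inv-q≤) (nat-mono c₂≤ ◂ c₂≤')) ⟩
        h * (nat ((c N.+ 2) N.* x) * inv u + nat ((c N.+ 2) N.* x) * inv u) ≡⟨ solve 3 (λ h a i → h :* (a :* i :+ a :* i) := h :* (# 2 :* a) :* i) refl h (nat ((c N.+ 2) N.* x)) (inv u) ·
               cong (λ t → h * t * inv u) (sym (nat-* 2 ((c N.+ 2) N.* x)) · cong nat (sym (N.*-assoc 2 (c N.+ 2) x))) ⟩
        τ * inv u ∎)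
        where
        u = product U
        q = W N.* u
        1≤u = U≥1 U⊆
        inv-q≤ : inv q ≤ inv u
        inv-q≤ = inv-anti {{N.>-nonZero 1≤u}} (N.m≤n*m u W {{N.>-nonZero 1≤W}})
        c₂≤' : nat (c N.+ 2) ≤ nat ((c N.+ 2) N.* x) * inv u
        c₂≤' = begin
          nat (c N.+ 2) ≡⟨ sym (cong (nat (c N.+ 2) *_) (natinv u {{N.>-nonZero 1≤u}}) · *-identityʳ _) ⟩
          nat (c N.+ 2) * (nat u * inv u) ≤⟨ *-monoˡ-≤ (0≤nat (c N.+ 2)) (*-monoʳ-≤ (0≤inv u) (nat-mono u≤x)) ⟩
          nat (c N.+ 2) * (nat x * inv u) ≡⟨ sym (*-assoc _ _ _) · cong (_* inv u) (sym (nat-* (c N.+ 2) x)) ⟩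
          nat ((c N.+ 2) N.* x) * inv u ∎

  private
    G : ℚ
    G = S P g (χ R)
    G≤ : G ≤ h ^ (2 N.* k)
    G≤ = begin
      S P g (χ R) ≤⟨ S-weight-mono g≥0 (All.map (λ { (_ , lt) → g≤2k/p (big lt) }) primes) (χ≥0 R) ⟩
      S P (over (2 N.* k)) (χ R) ≤⟨ S-over-H D n 2≤D (2 N.* k) R ⟩
      H R ^ (2 N.* k) ≤⟨ ^-mono (2 N.* k) (0≤H R) (H-mono (R≤x ◃ x≤N)) ⟩
      h ^ (2 N.* k) ∎
      where open ≤-Reasoning
    G≥0 : 0# ≤ G
    G≥0 = S-nonneg P g≥0 (χ≥0 R)
    g≤1s : All (λ p → g p ≤ 1#) P
    g≤1s = All.map (λ { (_ , lt) → g≤1 (big lt) }) primes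

    5κ : ∀ κ → nat 5 * nat κ ≡ nat (5 N.* κ)
    5κ κ = sym (nat-* 5 κ)

    -- The weights contribute at most (log N)^{4k}.
    total-error : ∀ {Zs C} → 0# ≤ Zs → Zs * h ^ e₀ ≤ C * nat N → Y 0 * Y 0 * (G * G * Zs) * (h * h) ≤ Y 0 * Y 0 * C * nat N
    total-error {Zs} {C} Z≥0 le = begin
      Y 0 * Y 0 * (G * G * Zs) * (h * h) ≤⟨ *-monoʳ-≤ (*-nonneg 0≤h 0≤h) (*-monoˡ-≤ Y²≥0 (*-monoʳ-≤ Z≥0 (*-mono-≤ G≥0 G≥0 G≤ G≤))) ⟩
      Y 0 * Y 0 * (h ^ (2 N.* k) * h ^ (2 N.* k) * Zs) * (h * h) ≡⟨ solve 5 (λ y a b s hh → y :* (a :* b :* s) :* hh := y :* (s :* (a :* b :* hh))) refl (Y 0 * Y 0) (h ^ (2 N.* k)) (h ^ (2 N.* k)) Zs (h * h) ⟩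
      Y 0 * Y 0 * (Zs * (h ^ (2 N.* k) * h ^ (2 N.* k) * (h * h))) ≡⟨ cong (λ t → Y 0 * Y 0 * (Zs * t)) (sym ((^-+ h (2 N.* k N.+ 2 N.* k) 2) · cong₂ _*_ (^-+ h (2 N.* k) (2 N.* k)) (cong (h *_) (*-identityʳ h)))) ⟩
      Y 0 * Y 0 * (Zs * h ^ e₀) ≤⟨ *-monoˡ-≤ Y²≥0 le ⟩
      Y 0 * Y 0 * (C * nat N) ≡⟨ sym (*-assoc _ _ _) ⟩
      Y 0 * Y 0 * C * nat N ∎
      where
      open ≤-Reasoning
      Y²≥0 = *-nonneg (Y≥0 0) (Y≥0 0)

    D≤ : ∀ {us : List ℕ} → All (N._≤ c) us → All (N._≤ D) us
    D≤ = All.map (λ le → le ◃ c≤D)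

    hs-κ : nat (length hs) ≡ nat k
    hs-κ = cong nat length≡

    w : ℕ → ℚ
    w m = ind (m ≡? ν [mod W ]) * (Λ P g (ι hs m) y' * Λ P g (ι hs m) y')

    w≥0 : ∀ m → 0# ≤ w m
    w≥0 m = *-nonneg (0≤ind (m ≡? ν [mod W ])) (sq-nonneg (Λ P g (ι hs m) y'))

    Err : ℕ → (ℕ → ℚ) → ℚ
    Err κ E = Y 0 * Y 0 * (G * G * Z (nat (5 N.* κ)) P (λ U → χ x (product U) * E (W N.* product U)))

    E₁ E₂ E₃ : ℕ → ℚ
    E₁ q = nat (suc R N.+ c) * inv q + 1#
    E₂ q = PrimeLevel.E PL q + h * (nat (R N.+ c) * inv q + nat (suc (suc c)))
    E₃ q = nat 2 * LiouvilleLevel.E LL q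

    E₁≥0 : Nonneg E₁
    E₁≥0 q = +-nonneg (*-nonneg (0≤nat (suc R N.+ c)) (0≤inv q)) 0≤1
    E₂≥0 : Nonneg E₂
    E₂≥0 q = +-nonneg (PrimeLevel.E≥0 PL q) (*-nonneg 0≤h (+-nonneg (*-nonneg (0≤nat (R N.+ c)) (0≤inv q)) (0≤nat (suc (suc c)))))
    E₃≥0 : Nonneg E₃
    E₃≥0 q = *-nonneg (0≤nat 2) (LiouvilleLevel.E≥0 LL q)

    Z≥0 : ∀ κ {E : ℕ → ℚ} → Nonneg E → 0# ≤ Z (nat (5 N.* κ)) P (λ U → χ x (product U) * E (W N.* product U))
    Z≥0 κ E≥0 = Z-nonneg P (0≤nat (5 N.* κ)) λ U → *-nonneg (χ≥0 x (product U)) (E≥0 (W N.* product U))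

    c₁-bound : ∀ {m} → m N.≤ suc R N.+ c → m N.≤ (c N.+ 2) N.* x
    c₁-bound {m} m≤ = m≤ ◃ (N.+-mono-≤ (N.+-mono-≤ 1≤x R≤x) (N.m≤m*n c x {{N.>-nonZero 1≤x}}) ◃
      N.≤-reflexive (N.+-comm (x N.+ x) (c N.* x) · cong (c N.* x N.+_) (cong (x N.+_) (sym (N.+-identityʳ x))) · sym (N.*-distribʳ-+ x c 2)))

    error₁ : Err k E₁ * (h * h) ≤ Y 0 * Y 0 * nat (2 N.* (c N.+ 2)) * nat N
    error₁ = total-error (Z≥0 k E₁≥0) (constant-error k N.≤-refl {E₁} (c₁-bound N.≤-refl) (s≤s z≤n ◃ N.m≤n+m 2 c)
      (λ q → ≡⇒≤ (sym (*-identityˡ _)) ◂ *-monoʳ-≤ (E₁≥0 q) 1≤h))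

    error₂ : ∀ κ → κ N.≤ k → Err κ E₂ * (h * h) ≤ Y 0 * Y 0 * (nat (Cp N.+ 3) + nat (2 N.* (c N.+ 2))) * nat N
    error₂ κ κ≤k = total-error (Z≥0 κ E₂≥0) (begin
      Z (nat (5 N.* κ)) P (λ U → χ x (product U) * E₂ (W N.* product U)) * h ^ e₀ ≡⟨ cong (_* h ^ e₀) (cong-Z (λ U → *-distribˡ (χ x (product U)) _ _) · Z-+ (nat (5 N.* κ)) P _ _) ⟩
      (Z (nat (5 N.* κ)) P (λ U → χ x (product U) * PrimeLevel.E PL (W N.* product U)) + Z (nat (5 N.* κ)) P (λ U → χ x (product U) * E'' (W N.* product U))) * h ^ e₀ ≡⟨ *-distribʳ (h ^ e₀) _ _ ⟩
      Z (nat (5 N.* κ)) P (λ U → χ x (product U) * PrimeLevel.E PL (W N.* product U)) * h ^ e₀ + Z (nat (5 N.* κ)) P (λ U → χ x (product U) * E'' (W N.* product U)) * h ^ e₀ ≤⟨ +-mono-≤ (level-error κ κ≤k {C = Cp} (PrimeLevel.E≥0 PL) (PrimeLevel.total PL) prime-trivial)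
             (constant-error κ κ≤k {E''} (c₁-bound (N.n≤1+n _)) (N.≤-reflexive (N.+-comm 2 c)) (λ q → ≤-refl)) ⟩
      nat (Cp N.+ 3) * nat N + nat (2 N.* (c N.+ 2)) * nat N ≡⟨ sym (*-distribʳ (nat N) _ _) ⟩
      (nat (Cp N.+ 3) + nat (2 N.* (c N.+ 2))) * nat N ∎)
      where
      open ≤-Reasoning
      E'' : ℕ → ℚ
      E'' q = h * (nat (R N.+ c) * inv q + nat (suc (suc c)))
      cong-Z : ∀ {E E' : List ℕ → ℚ} → (∀ U → E U ≡ E' U) → Z (nat (5 N.* κ)) P E ≡ Z (nat (5 N.* κ)) P E'
      cong-Z eq = ≤-antisym (Z-mono P (0≤nat (5 N.* κ)) λ U _ → ≡⇒≤ (eq U)) (Z-mono P (0≤nat (5 N.* κ)) λ U _ → ≡⇒≤ (sym (eq U)))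

    error₃ : Err k E₃ * (h * h) ≤ Y 0 * Y 0 * (nat 2 * nat (Cl N.+ 3)) * nat N
    error₃ = total-error (Z≥0 k E₃≥0) (begin
      Z (nat (5 N.* k)) P (λ U → χ x (product U) * E₃ (W N.* product U)) * h ^ e₀ ≡⟨ cong (_* h ^ e₀) (cong-Z (λ U → solve 3 (λ a b c → a :* (b :* c) := b :* (a :* c)) refl (χ x (product U)) (nat 2) _) · Z-* (nat (5 N.* k)) P (nat 2) _) ⟩
      nat 2 * Z (nat (5 N.* k)) P (λ U → χ x (product U) * LiouvilleLevel.E LL (W N.* product U)) * h ^ e₀ ≡⟨ *-assoc _ _ _ ⟩
      nat 2 * (Z (nat (5 N.* k)) P (λ U → χ x (product U) * LiouvilleLevel.E LL (W N.* product U)) * h ^ e₀) ≤⟨ *-monoˡ-≤ (0≤nat 2) (level-error k N.≤-refl {C = Cl} (LiouvilleLevel.E≥0 LL) (LiouvilleLevel.total LL)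
             (λ q 1≤q → liouville-trivial q 1≤q ◂ ((≡⇒≤ (sym (*-identityˡ _)) ◂ *-monoʳ-≤ (+-nonneg (*-nonneg (0≤nat N) (0≤inv q)) 0≤1) 1≤h) ◂
                ≤-add _ (*-nonneg (0≤nat N) (0≤inv (φ q))) refl))) ⟩
      nat 2 * (nat (Cl N.+ 3) * nat N) ≡⟨ sym (*-assoc _ _ _) ⟩
      nat 2 * nat (Cl N.+ 3) * nat N ∎)
      where
      open ≤-Reasoning
      cong-Z : ∀ {E E' : List ℕ → ℚ} → (∀ U → E U ≡ E' U) → Z (nat (5 N.* k)) P E ≡ Z (nat (5 N.* k)) P E'
      cong-Z eq = ≤-antisym (Z-mono P (0≤nat (5 N.* k)) λ U _ → ≡⇒≤ (eq U)) (Z-mono P (0≤nat (5 N.* k)) λ U _ → ≡⇒≤ (sym (eq U)))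

    S₁ S₃ : ℚ
    S₁ = sum X (λ m → inside m * w m)
    S₃ = sum X (λ m → liouvilleWeight r m * w m)
    S₂ : ℕ → ℚ
    S₂ j = sum X (λ m → primeWeight j m * w m)

    upper : ∀ {a b e} → ∣ a - b ∣ ≤ e → a ≤ b + e
    upper {a} {b} {e} le = ≤-add (e - (a - b)) (0≤y-x (x≤∣x∣ _ ◂ le)) (solve 3 (λ a b e → a :+ (e :- (a :- b)) := b :+ e) refl a b e)

    lower : ∀ {a b e} → ∣ a - b ∣ ≤ e → b ≤ a + e
    lower {a} {b} {e} le = ≤-add (e - - (a - b)) (0≤y-x (-x≤∣x∣ _ ◂ le)) (solve 3 (λ a b e → b :+ (e :- :- (a :- b)) := a :+ e) refl a b e)

    inv-prime : ∀ p q → Prime p → Coprime p q → 1 N.≤ q → nat N * inv (p N.* q) ≡ nat N * inv q * inv p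
    inv-prime p q _ _ _ = cong (nat N *_) (inv-* p q · *-comm _ _) · sym (*-assoc _ _ _)

    φ-prime : ∀ p q → Prime p → Coprime p q → 1 N.≤ q → nat N * inv (φ (p N.* q)) ≡ nat N * inv (φ q) * inv (p N.∸ 1)
    φ-prime p q pp cop 1≤q = trans (cong (λ t → nat N * inv t) φpq) (cong (nat N *_) (inv-* (p N.∸ 1) (φ q) · *-comm _ _) · sym (*-assoc _ _ _))
      where
      φpq : φ (p N.* q) ≡ (p N.∸ 1) N.* φ q
      φpq = N.≤-antisym (nat-cancel (≡⇒≤ eq)) (nat-cancel (≡⇒≤ (sym eq)))
        where
        eq : nat (φ (p N.* q)) ≡ nat ((p N.∸ 1) N.* φ q)
        eq = φ-prime-* q pp cop · cong (_* nat (φ q)) (sym (nat-∸ (1≤prime pp))) · sym (nat-* (p N.∸ 1) (φ q))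

    sum₁ : S₁ ≤ nat N * inv W * Q₁ + Err k E₁
    sum₁ = ≤-trans (upper estimate) (≡⇒≤ (cong (_+ Err k E₁) (B-orthogonal _ _ y' y'
        (All.map (λ { {p} (_ , lt) → cong (λ t → (1# + g p) * (t * inv p)) hs-κ · ([1+g]π≡g (big lt)) }) primes))))
      where
      estimate : ∣ S₁ - B P g (λ U → nat N * inv W * ∏ (λ p → nat (length hs) * inv p) U) y' y' ∣ ≤ Err k E₁
      estimate = subst (λ t → ∣ S₁ - B P g (λ U → nat N * inv W * ∏ (λ p → nat (length hs) * inv p) U) y' y' ∣
          ≤ Y 0 * Y 0 * (G * G * Z t P (λ U → χ x (product U) * E₁ (W N.* product U)))) (cong (nat 5 *_) hs-κ · 5κ k)
        (sieve-sum-approx D X inside hs (λ _ _ → ⊤) (λ q → nat N * inv q) E₁ (λ q a 1≤q _ → class-integers q a 1≤q) (λ _ _ _ _ _ _ _ _ _ _ _ → tt)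
          n R W ν inv (Y 0) y' unique (D≤ hs≤c) inv-prime 1≤W W-small tt (Y≥0 0) (∣y∣≤ T 1≤T) E₁≥0 g≥0 g≤1s)

    sum₃ : S₃ ≤ Err k E₃
    sum₃ = ≤-trans (upper estimate) (≡⇒≤ (cong (_+ Err k E₃) (B-scale P 0# (∏ (λ p → nat (length hs) * 0#)) y' y' · *-zeroˡ _) · +-identityˡ _))
      where
      estimate : ∣ S₃ - B P g (λ U → 0# * ∏ (λ p → nat (length hs) * 0#) U) y' y' ∣ ≤ Err k E₃
      estimate = subst (λ t → ∣ S₃ - B P g (λ U → 0# * ∏ (λ p → nat (length hs) * 0#) U) y' y' ∣
          ≤ Y 0 * Y 0 * (G * G * Z t P (λ U → χ x (product U) * E₃ (W N.* product U)))) (cong (nat 5 *_) hs-κ · 5κ k)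
        (sieve-sum-approx D X (liouvilleWeight r) hs (λ _ _ → ⊤) (λ _ → 0#) E₃ (λ q a 1≤q _ → class-liouville r r≤c q a 1≤q) (λ _ _ _ _ _ _ _ _ _ _ _ → tt)
          n R W ν (λ _ → 0#) (Y 0) y' unique (D≤ hs≤c) (λ _ _ _ _ _ → sym (*-zeroˡ _)) 1≤W W-small tt (Y≥0 0) (∣y∣≤ T 1≤T) E₃≥0 g≥0 g≤1s)

    sum₂ : ∀ j (i : j ∈ hs) → nat N * inv (φ W) * (h⁻ * h⁻ * (h⁻ ^ k' * layers V (L k'))) ≤ S₂ j + Err k' E₂
    sum₂ j i = ≤-trans (*-monoˡ-≤ M≥0 (second-moment-≥ (N.≤-reflexive (sym D+n≡R))) ◂
        B-lower M₀ (λ p → nat (length us) * inv (p N.∸ 1)) y' M≥0 (λ p → 0≤inv (p N.∸ 1)) (overShifted≥0 k k') (y≥0 T 1≤T) (y-antitone T 1≤T) (primesFrom-positive D n)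
          (All.map (λ { {p} (_ , lt) → cong (λ t → g p - (1# + g p) * (t * inv (p N.∸ 1))) us-κ · mean (big lt) }) primes)
          (All.map (λ { {p} (_ , lt) → cong (λ t → g p * g p + (1# - g p * g p) * (t * inv (p N.∸ 1))) us-κ · second-moment (big lt) }) primes))
      (lower estimate)
      where
      us : List ℕ
      us = remove hs i
      us-length : length us ≡ k'
      us-length = N.suc-injective (sym (length-remove i) · length≡)
      us-κ : nat (length us) ≡ nat k'
      us-κ = cong nat us-length
      M₀ = nat N * inv (φ W)
      M≥0 : 0# ≤ M₀
      M≥0 = *-nonneg (0≤nat N) (0≤inv (φ W))
      j≤c = All.lookup hs≤c i
      Adm : ℕ → ℕ → Set
      Adm q a = Coprime (a N.+ j) q
      extend : ∀ q a c p h → Prime p → D N.< p → h ∈ us → Adm q a → c ≡ a [mod q ] → p ∣ c N.+ h → Adm (p N.* q) c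
      extend q a c' p h' pp D<p h∈ adm c≡a p∣ = cop-*ʳ (prime-∤⇒cop pp p∤) (cop-≡mod {a N.+ j} {c' N.+ j} (≡mod-shift {a} {c'} j (≡mod-sym {c'} {a} c≡a)) adm)
        where
        both : ∀ {a b q} → q ∣ a → q ∣ b → a ≡ b [mod q ]
        both {q = q} (divides x refl) (divides y refl) = divides N.∣ x - y ∣ (sym (N.*-distribʳ-∣-∣ q x y))
        -- A prime p > D cannot divide c' + h' and c' + j for distinct h' and j up to c ≤ D.
        p∤ : ¬ p ∣ c' N.+ j
        p∤ p∣' = remove-≢ i unique h∈ (≡mod-< (N.≤-<-trans (All.lookup hs≤c (remove-∈ i h∈) ◃ c≤D) D<p) (N.≤-<-trans (j≤c ◃ c≤D) D<p)
          (≡mod-unshift {h'} {j} c' (subst₂ (_≡_[mod p ]) (N.+-comm c' h') (N.+-comm c' j) (both {c' N.+ h'} {c' N.+ j} p∣ p∣'))))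
      same : S₂ j ≡ sum X (λ m → primeWeight j m * (ind (m ≡? ν [mod W ]) * (Λ P g (ι us m) y' * Λ P g (ι us m) y')))
      same = sum-cong X λ m _ → pointwise m
        where
        pointwise : ∀ m → primeWeight j m * w m ≡ primeWeight j m * (ind (m ≡? ν [mod W ]) * (Λ P g (ι us m) y' * Λ P g (ι us m) y'))
        pointwise m with suc R N.≤? m | prime? (m N.+ j)
        ... | no _  | _ = (cong (_* w m) (*-zeroˡ _) · *-zeroˡ _) · sym (cong (_* (ind (m ≡? ν [mod W ]) * (Λ P g (ι us m) y' * Λ P g (ι us m) y'))) (*-zeroˡ _) · *-zeroˡ _)
        ... | yes _ | no _ = trans (cong (_* w m) zero₂ · *-zeroˡ _) (sym (cong (_* (ind (m ≡? ν [mod W ]) * (Λ P g (ι us m) y' * Λ P g (ι us m) y'))) zero₂ · *-zeroˡ _))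
          where
          zero₂ : ∀ {ℓ} → 1# * (ℓ * 0#) ≡ 0#
          zero₂ {ℓ} = *-identityˡ _ · *-zeroʳ ℓ
        ... | yes R<m | yes pp = cong (λ t → 1# * (PrimeLevel.ℓ PL (m N.+ j) * 1#) * (ind (m ≡? ν [mod W ]) * (t * t))) (Λ-cong y' (All.zipWith eq (primes , primesFrom-≤ D n)))
          where
          eq : ∀ {p} → (Prime p × D N.< p) × p N.≤ D N.+ n → ι hs m p ≡ ι us m p
          eq {p} ((pp' , _) , p≤) = trans (sumL-remove i _) (cong (_+ ι us m p) (ind-no (p ∣? m N.+ j) p∤) · +-identityˡ _)
            where
            p∤ : ¬ p ∣ m N.+ j
            p∤ d with prime⇒irreducible pp d
            ... | inj₁ p≡1 = N.<⇒≢ (1<prime pp') (sym p≡1)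
            ... | inj₂ p≡ = N.<⇒≱ (N.<-≤-trans R<m (N.m≤m+n m j)) (subst (N._≤ R) p≡ (p≤ ◃ N.≤-reflexive D+n≡R))
      estimate : ∣ S₂ j - B P g (λ U → M₀ * ∏ (λ p → nat (length us) * inv (p N.∸ 1)) U) y' y' ∣ ≤ Err k' E₂
      estimate = subst₂ (λ s t → ∣ s - B P g (λ U → M₀ * ∏ (λ p → nat (length us) * inv (p N.∸ 1)) U) y' y' ∣
          ≤ Y 0 * Y 0 * (G * G * Z t P (λ U → χ x (product U) * E₂ (W N.* product U)))) (sym same) (cong (nat 5 *_) us-κ · 5κ k')
        (sieve-sum-approx D X (primeWeight j) us Adm (λ q → nat N * inv (φ q)) E₂ (class-primes j j≤c) extend
          n R W ν (λ p → inv (p N.∸ 1)) (Y 0) y' (remove-Unique i unique) (D≤ (All.tabulate λ u∈ → All.lookup hs≤c (remove-∈ i u∈))) φ-prime 1≤W W-small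
          (ν-cop j i) (Y≥0 0) (∣y∣≤ T 1≤T) E₂≥0 g≥0 g≤1s)

    ε₁≥0 : ∀ κ {E : ℕ → ℚ} → Nonneg E → 0# ≤ Err κ E
    ε₁≥0 κ E≥0 = *-nonneg (*-nonneg (Y≥0 0) (Y≥0 0)) (*-nonneg (*-nonneg G≥0 G≥0) (Z≥0 κ E≥0))

  errorConstant : ℚ
  errorConstant = Y 0 * Y 0 * (nat (2 N.* k) * (nat (Cp N.+ 3) + nat (2 N.* (c N.+ 2))) + nat (2 N.* (c N.+ 2)) + nat 2 * nat (Cl N.+ 3))

  module _ (log-large : nat (φ W) * errorConstant ≤ h)
    (parity : ∀ m → R N.< m → nat 2 * sumL hs (λ j → ind (prime? (m N.+ j))) ≤ 1# + int (liouville (m N.+ r))) where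

    private
      F₀ : ℚ
      F₀ = nat (φ W)
      F₀>0 : 0# < F₀
      F₀>0 = 0<nat (φ W) {{N.>-nonZero (φ>0 W 1≤W)}}
      Q₂ : ℚ
      Q₂ = h⁻ * h⁻ * (h⁻ ^ k' * layers V (L k'))
      Errs : ℚ
      Errs = h * (Err k E₁ + Err k E₃) + nat (2 N.* k) * Err k' E₂

      -- The approximate logarithms in the prime weights are at most h, so h times the parity
      -- inequality dominates them pointwise in m.
      swap : nat 2 * sumL hs S₂ ≤ h * (S₁ + S₃)
      swap = begin
        nat 2 * sumL hs S₂ ≡⟨ cong (nat 2 *_) (sym (sum-sumL X hs _)) ⟩
        nat 2 * sum X (λ m → sumL hs (λ j → primeWeight j m * w m)) ≡⟨ sym (sum-*ˡ X (nat 2) _) ⟩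
        sum X (λ m → nat 2 * sumL hs (λ j → primeWeight j m * w m)) ≤⟨ sum-mono X (λ m m<X → pointwise m m<X) ⟩
        sum X (λ m → h * (inside m * w m + liouvilleWeight r m * w m)) ≡⟨ sum-*ˡ X h _ · cong (h *_) (sum-+ X _ _) ⟩
        h * (S₁ + S₃) ∎
        where
        open ≤-Reasoning
        pointwise : ∀ m → m N.< X → nat 2 * sumL hs (λ j → primeWeight j m * w m) ≤ h * (inside m * w m + liouvilleWeight r m * w m)
        pointwise m m<X with suc R N.≤? m
        ... | no _ = ≡⇒≤ (cong (nat 2 *_) ((sumL-cong hs λ j _ → cong (_* w m) (*-zeroˡ _) · *-zeroˡ _) · sumL-const hs 0# · *-zeroʳ _) ·
              solve 3 (λ h w l → # 2 :* # 0 := h :* (# 0 :* w :+ # 0 :* l :* w)) refl h (w m) (int (liouville (m N.+ r))))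
        ... | yes R<m = begin
          nat 2 * sumL hs (λ j → 1# * (PrimeLevel.ℓ PL (m N.+ j) * ind (prime? (m N.+ j))) * w m) ≤⟨ *-monoˡ-≤ (0≤nat 2) (sumL-mono hs λ j j∈ → *-monoʳ-≤ (w≥0 m) (≡⇒≤ (*-identityˡ _) ◂
                 *-monoʳ-≤ (0≤ind (prime? (m N.+ j))) (PrimeLevel.ℓ≤H PL (m N.+ j) (m+j≤N j (All.lookup hs≤c j∈))))) ⟩
          nat 2 * sumL hs (λ j → h * ind (prime? (m N.+ j)) * w m) ≡⟨ cong (nat 2 *_) (sumL-*ʳ hs (w m) _ · cong (_* w m) (sumL-*ˡ hs h _)) ⟩
          nat 2 * (h * sumL hs (λ j → ind (prime? (m N.+ j))) * w m) ≡⟨ solve 4 (λ a h s w → a :* (h :* s :* w) := h :* (a :* s) :* w) refl (nat 2) h _ (w m) ⟩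
          h * (nat 2 * sumL hs (λ j → ind (prime? (m N.+ j)))) * w m ≤⟨ *-monoʳ-≤ (w≥0 m) (*-monoˡ-≤ 0≤h (parity m R<m)) ⟩
          h * (1# + int (liouville (m N.+ r))) * w m ≡⟨ solve 3 (λ h l w → h :* (# 1 :+ l) :* w := h :* (# 1 :* w :+ # 1 :* l :* w)) refl h (int (liouville (m N.+ r))) (w m) ⟩
          h * (1# * w m + 1# * int (liouville (m N.+ r)) * w m) ∎
          where
          m+j≤N : ∀ j → j N.≤ c → m N.+ j N.≤ N
          m+j≤N j j≤c = subst (m N.+ j N.≤_) X+c≡N (N.+-mono-≤ (N.<⇒≤ m<X) j≤c)

      combined : nat (2 N.* k) * (nat N * inv (φ W) * Q₂) ≤ h * (nat N * inv W * Q₁) + Errs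
      combined = begin
        nat (2 N.* k) * (M₀ * Q₂) ≡⟨ cong (_* (M₀ * Q₂)) (nat-* 2 k) · *-assoc _ _ _ ⟩
        nat 2 * (nat k * (M₀ * Q₂)) ≤⟨ *-monoˡ-≤ (0≤nat 2) (begin
               nat k * (M₀ * Q₂) ≡⟨ cong (_* (M₀ * Q₂)) (sym hs-κ) · sym (sumL-const hs _) ⟩
               sumL hs (λ _ → M₀ * Q₂) ≤⟨ sumL-mono hs sum₂ ⟩
               sumL hs (λ j → S₂ j + Err k' E₂) ≡⟨ sumL-+ hs S₂ _ · cong (sumL hs S₂ +_) (sumL-const hs _ · cong (_* Err k' E₂) hs-κ) ⟩
               sumL hs S₂ + nat k * Err k' E₂ ∎) ⟩
        nat 2 * (sumL hs S₂ + nat k * Err k' E₂) ≡⟨ *-distribˡ _ _ _ · cong (nat 2 * sumL hs S₂ +_) (sym (*-assoc _ _ _) · cong (_* Err k' E₂) (sym (nat-* 2 k))) ⟩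
        nat 2 * sumL hs S₂ + nat (2 N.* k) * Err k' E₂ ≤⟨ +-mono-≤ (swap ◂ *-monoˡ-≤ 0≤h (+-mono-≤ sum₁ sum₃)) ≤-refl ⟩
        h * (nat N * inv W * Q₁ + Err k E₁ + Err k E₃) + nat (2 N.* k) * Err k' E₂ ≡⟨ solve 5 (λ h a b c d → h :* (a :+ b :+ c) :+ d := h :* a :+ (h :* (b :+ c) :+ d)) refl h _ (Err k E₁) (Err k E₃) _ ⟩
        h * (nat N * inv W * Q₁) + Errs ∎
        where
        open ≤-Reasoning
        M₀ = nat N * inv (φ W)

      -- The bounds for the errors contain two spare logarithms: one pays for the factor h in
      -- `Errs`, the other beats the constant by `log-large`.
      errors : F₀ * Errs ≤ nat N
      errors = *-cancelˡ-≤ (<-≤-trans 0<1 1≤h) (begin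
        h * (F₀ * Errs) ≤⟨ ≤-add (F₀ * (nat (2 N.* k) * Err k' E₂) * (h * (h - 1#))) (*-nonneg (*-nonneg (0≤nat (φ W)) (*-nonneg (0≤nat (2 N.* k)) (ε₁≥0 k' E₂≥0))) (*-nonneg 0≤h (0≤y-x 1≤h)))
               (solve 6 (λ h f a b k e → h :* (f :* (h :* (a :+ b) :+ k :* e)) :+ f :* (k :* e) :* (h :* (h :- # 1))
                  := f :* (k :* (e :* (h :* h)) :+ a :* (h :* h) :+ b :* (h :* h))) refl h F₀ (Err k E₁) (Err k E₃) (nat (2 N.* k)) (Err k' E₂)) ⟩
        F₀ * (nat (2 N.* k) * (Err k' E₂ * (h * h)) + Err k E₁ * (h * h) + Err k E₃ * (h * h)) ≤⟨ *-monoˡ-≤ (0≤nat (φ W)) (+-mono-≤ (+-mono-≤ (*-monoˡ-≤ (0≤nat (2 N.* k)) (error₂ k' (N.n≤1+n k'))) error₁) error₃) ⟩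
        F₀ * (nat (2 N.* k) * (Y 0 * Y 0 * (nat (Cp N.+ 3) + nat (2 N.* (c N.+ 2))) * nat N) + Y 0 * Y 0 * nat (2 N.* (c N.+ 2)) * nat N + Y 0 * Y 0 * (nat 2 * nat (Cl N.+ 3)) * nat N) ≡⟨ solve 7 (λ f k y p c l n → f :* (k :* (y :* (p :+ c) :* n) :+ y :* c :* n :+ y :* l :* n) := f :* (y :* (k :* (p :+ c) :+ c :+ l)) :* n) refl
               F₀ (nat (2 N.* k)) (Y 0 * Y 0) (nat (Cp N.+ 3)) (nat (2 N.* (c N.+ 2))) (nat 2 * nat (Cl N.+ 3)) (nat N) ⟩
        F₀ * errorConstant * nat N ≤⟨ *-monoʳ-≤ (0≤nat N) log-large ⟩
        h * nat N ∎)
        where open ≤-Reasoning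

    sieve-inequality : nat (2 N.* k) * Q₂ ≤ h * β * Q₁ + 1#
    sieve-inequality = *-cancelˡ-≤ (0<nat N {{N.>-nonZero 1≤N}}) (begin
      nat N * (nat (2 N.* k) * Q₂) ≡⟨ (cong (λ t → nat N * (nat (2 N.* k) * Q₂) * t) (sym (natinv (φ W) {{N.>-nonZero (φ>0 W 1≤W)}})) ∘' sym (*-identityʳ _)) ·
             solve 5 (λ n k q f i → n :* (k :* q) :* (f :* i) := f :* (k :* (n :* i :* q))) refl (nat N) (nat (2 N.* k)) Q₂ F₀ (inv (φ W)) ⟩
      F₀ * (nat (2 N.* k) * (nat N * inv (φ W) * Q₂)) ≤⟨ *-monoˡ-≤ (0≤nat (φ W)) combined ⟩
      F₀ * (h * (nat N * inv W * Q₁) + Errs) ≡⟨ *-distribˡ _ _ _ ⟩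
      F₀ * (h * (nat N * inv W * Q₁)) + F₀ * Errs ≤⟨ +-mono-≤ ≤-refl errors ⟩
      F₀ * (h * (nat N * inv W * Q₁)) + nat N ≡⟨ solve 5 (λ f h n i q → f :* (h :* (n :* i :* q)) :+ n := n :* (h :* (f :* i) :* q :+ # 1)) refl F₀ h (nat N) (inv W) Q₁ ⟩
      nat N * (h * β * Q₁ + 1#) ∎)
      where
      open ≤-Reasoning
      _∘'_ : ∀ {a b c : ℚ} → b ≡ c → a ≡ b → a ≡ c
      p ∘' q = q · p

-- Choice of the parameters and the contradiction

-- One allowed residue for each prime up to D, glued by the Chinese remainder theorem.
coprime-residue : ∀ hs → (∀ p → Prime p → ∃[ a ] ∀ h → h ∈ hs → ¬ p ∣ a N.+ h) →
  ∀ D → ∃[ ν ] ∀ h → h ∈ hs → Coprime (ν N.+ h) (D !)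
coprime-residue hs adm zero = 0 , λ h _ → Coprime.sym (Coprime.1-coprimeTo _)
coprime-residue hs adm (suc zero) = 0 , λ h _ → Coprime.sym (Coprime.1-coprimeTo _)
coprime-residue hs adm (suc D@(suc _)) with coprime-residue hs adm D | prime? (suc D)
... | ν , cop | no ¬p = ν , λ h h∈ → cop-composite D (s≤s z≤n) ¬p (cop h h∈)
... | ν , cop | yes pp with adm (suc D) pp
...   | a , ∤ with crt {suc D} {D !} a ν (prime-cop-! D pp N.≤-refl) (s≤s z≤n) (N.n≢0⇒n>0 (N.≢-nonZero⁻¹ (D !) {{N._!≢0 D}}))
...     | ν' , ≡a , ≡ν = ν' , λ h h∈ → cop-*ʳ
            (prime-∤⇒cop pp λ d → ∤ h h∈ (≡mod-∣ {ν' N.+ h} {a N.+ h} (≡mod-shift {ν'} {a} h ≡a) d))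
            (cop-≡mod {ν N.+ h} {ν' N.+ h} (≡mod-shift {ν} {ν'} h (≡mod-sym {ν'} {ν} ≡ν)) (cop h h∈))

-- A converse to Bernoulli's inequality for 0 ≤ ζ ≤ 1; the subtracted ζ makes the induction close.
bernoulli : ∀ m {ζ} → 0# ≤ ζ → ζ ≤ 1# → (1# + ζ) ^ m ≤ 1# + nat (2 N.^ m) * ζ - ζ
bernoulli zero {ζ} _ _ = ≡⇒≤ (solve 1 (λ z → # 1 := # 1 :+ # 1 :* z :- z) refl ζ)
bernoulli (suc m) {ζ} ζ≥0 ζ≤1 = begin
  (1# + ζ) * (1# + ζ) ^ m ≤⟨ *-monoˡ-≤ (+-nonneg 0≤1 ζ≥0) (bernoulli m ζ≥0 ζ≤1) ⟩
  (1# + ζ) * (1# + q * ζ - ζ) ≤⟨ ≤-add ((q - 1#) * ζ * (1# - ζ)) (*-nonneg (*-nonneg (0≤y-x (nat-mono (N.m^n>0 2 m))) ζ≥0) (0≤y-x ζ≤1))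
         (solve 2 (λ z q → (# 1 :+ z) :* (# 1 :+ q :* z :- z) :+ (q :- # 1) :* z :* (# 1 :- z)
            := # 1 :+ # 2 :* q :* z :- z) refl ζ q) ⟩
  1# + nat 2 * q * ζ - ζ ≡⟨ cong (λ t → 1# + t * ζ - ζ) (sym (nat-* 2 (2 N.^ m))) ⟩
  1# + nat (2 N.^ suc m) * ζ - ζ ∎
  where
  open ≤-Reasoning
  q = nat (2 N.^ m)

-- Since η (a + 1) ≥ a + 1/2 and replacing v by u costs at most u^m / 4, the last inequality gives
-- (a + 1/2) u^m ≤ (a + 1/4) u^m + 1, that is u^m ≤ 4.
endgame : ∀ m {a η ζ u v : ℚ} → 0# ≤ a → nat 4 * a + nat 2 ≤ nat 4 * η * (a + 1#) → 0# ≤ ζ → ζ ≤ 1# → nat 4 * a * nat (2 N.^ m) * ζ ≤ 1# →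
  0# ≤ u → 0# ≤ v → v ≤ u * (1# + ζ) → nat 5 ≤ u ^ m → η * (a + 1#) * u ^ m ≤ a * v ^ m + 1# → ⊥
endgame m {a} {η} {ζ} {u} {v} a≥0 η-large ζ≥0 ζ≤1 ζ-small u≥0 v≥0 v≤ large main = <⇒≱ 0<1 (step ◂ ≡⇒≤ refl)
  where
  open ≤-Reasoning
  x = u ^ m
  x≥0 = ^-nonneg m u≥0
  q = nat (2 N.^ m)
  chain : (nat 4 * a + nat 2) * x ≤ nat 4 * a * x + x + nat 4
  chain = begin
    (nat 4 * a + nat 2) * x ≤⟨ *-monoʳ-≤ x≥0 η-large ⟩
    nat 4 * η * (a + 1#) * x ≡⟨ solve 4 (λ f e a x → f :* e :* a :* x := f :* (e :* a :* x)) refl (nat 4) η (a + 1#) x ⟩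
    nat 4 * (η * (a + 1#) * x) ≤⟨ *-monoˡ-≤ (0≤nat 4) main ⟩
    nat 4 * (a * v ^ m + 1#) ≤⟨ *-monoˡ-≤ (0≤nat 4) (+-mono-≤ (*-monoˡ-≤ a≥0 (begin
           v ^ m                    ≤⟨ ^-mono m v≥0 v≤ ⟩
           (u * (1# + ζ)) ^ m       ≡⟨ ^-distrib u (1# + ζ) m ⟩
           x * (1# + ζ) ^ m         ≤⟨ *-monoˡ-≤ x≥0 (bernoulli m ζ≥0 ζ≤1 ◂ ≤-add ζ ζ≥0 (solve 2 (λ q z → # 1 :+ q :* z :- z :+ z := # 1 :+ q :* z) refl q ζ)) ⟩
           x * (1# + q * ζ)         ∎)) ≤-refl) ⟩
    nat 4 * (a * (x * (1# + q * ζ)) + 1#) ≡⟨ solve 4 (λ a x q z → # 4 :* (a :* (x :* (# 1 :+ q :* z)) :+ # 1) := # 4 :* a :* x :+ (# 4 :* a :* q :* z) :* x :+ # 4) refl a x q ζ ⟩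
    nat 4 * a * x + (nat 4 * a * q * ζ) * x + nat 4 ≤⟨ +-mono-≤ (+-mono-≤ ≤-refl (*-monoʳ-≤ x≥0 ζ-small ◂ ≡⇒≤ (*-identityˡ x))) ≤-refl ⟩
    nat 4 * a * x + x + nat 4 ∎
  step : 1# ≤ 0#
  step = begin
    1# ≤⟨ ≤-add (x - nat 5 + (nat 4 * a * x + x + nat 4 - (nat 4 * a + nat 2) * x)) (+-nonneg (0≤y-x large) (0≤y-x chain))
           (solve 2 (λ a x → # 1 :+ (x :- # 5 :+ (# 4 :* a :* x :+ x :+ # 4 :- (# 4 :* a :+ # 2) :* x)) := # 0) refl a x) ⟩
    0# ∎

-- The gap of 1 between a ≥ J 𝒰 and a + 1 ≤ 2 k 𝒱 is the whole margin; D and then T are chosen so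
-- large that all losses stay below it.
module _ (k' : ℕ) (hs : List ℕ) (length≡ : length hs ≡ suc k') (unique : Unique hs) (r M J a num den : ℕ) (b : ℕ → ℕ)
  (b0 : b 0 ≡ 0) (1≤M : 1 N.≤ M)
  (within-level : (2 N.* M N.+ 1) N.* den N.≤ J N.* num) (room : 2 N.* M N.+ 2 N.≤ J)
  (numeric-𝒰 : nat J * StepFunction.layers M b (StepFunction.Y M b) (U (suc k')) ≤ nat a)
  (numeric-𝒱 : nat (suc a) ≤ nat (2 N.* suc k') * StepFunction.layers M b (StepFunction.V M b) (L k'))
  (adm : ∀ p → Prime p → ∃[ a ] ∀ h → h ∈ hs → ¬ p ∣ a N.+ h)
  (PLs : ∀ A → ∃[ C ] ∃[ N₀ ] ∀ N → N₀ N.≤ N → PrimeLevel num den A C N)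
  (LLs : ∀ A → ∃[ C ] ∃[ N₀ ] ∀ N → N₀ N.≤ N → LiouvilleLevel num den A C N)
  (n₀ : ℕ) (parity : ∀ m → n₀ N.< m → nat 2 * sumL hs (λ j → ind (prime? (m N.+ j))) ≤ 1# + int (liouville (m N.+ r)))
  where

  private
    k = suc k'
    open Exponents k
    open StepFunction M b
    c C₀ D : ℕ
    c = foldr N._+_ r hs
    C₀ = 2 N.* k N.* k
    -- Above all the shifts, and so large that C₀ / D ≤ 1 / (2 (a + 1)).
    D = 2 N.+ (2 N.* k N.+ (c N.+ 2 N.* (C₀ N.* suc a)))
    hs≤ : ∀ hs → All (N._≤ foldr N._+_ r hs) hs
    hs≤ [] = []
    hs≤ (h ∷ hs) = N.m≤m+n h _ ∷ All.map (λ le → le ◃ N.m≤n+m _ h) (hs≤ hs)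
    r≤ : ∀ hs → r N.≤ foldr N._+_ r hs
    r≤ [] = N.≤-refl
    r≤ (h ∷ hs) = r≤ hs ◃ N.m≤n+m _ h
    2≤D : 2 N.≤ D
    2≤D = N.m≤m+n 2 _
    2k≤D : 2 N.* k N.≤ D
    2k≤D = N.m≤m+n (2 N.* k) _ ◃ N.m≤n+m _ 2
    c+2≤D : c N.+ 2 N.≤ D
    c+2≤D = subst (N._≤ D) (N.+-comm 2 c) (N.+-monoʳ-≤ 2 (N.m≤m+n c _ ◃ N.m≤n+m _ (2 N.* k)))
    c≤D : c N.≤ D
    c≤D = N.m≤m+n c 2 ◃ c+2≤D
    C₀≤D : 2 N.* (C₀ N.* suc a) N.≤ D
    C₀≤D = N.m≤n+m _ c ◃ N.m≤n+m _ (2 N.* k) ◃ N.m≤n+m _ 2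
    W : ℕ
    W = D !
    1≤W : 1 N.≤ W
    1≤W = N.n≢0⇒n>0 (N.≢-nonZero⁻¹ W {{N._!≢0 D}})
    Cp Np Cl Nl : ℕ
    Cp = proj₁ (PLs e₂)
    Np = proj₁ (proj₂ (PLs e₂))
    Cl = proj₁ (LLs e₂)
    Nl = proj₁ (proj₂ (LLs e₂))
    -- This is `errorConstant`, written out because u has to be chosen before the comparison can be
    -- set up.
    ec : ℚ
    ec = Y 0 * Y 0 * (nat (2 N.* k) * (nat (Cp N.+ 3) + nat (2 N.* (c N.+ 2))) + nat (2 N.* (c N.+ 2)) + nat 2 * nat (Cl N.+ 3))
    ν = proj₁ (coprime-residue hs adm D)
    Zc cW : ℕ
    -- The reciprocal of `Zc` is the ζ of `endgame`, and `cW` bounds h⁺ - h⁻.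
    Zc = suc (4 N.* a N.* 2 N.^ suc k)
    cW = suc (2 N.* W)
    n₁ n₂ u s : ℕ
    n₁ = proj₁ (H-unbounded (nat (φ W) * ec))
    n₂ = proj₁ (H-unbounded (nat (5 N.+ cW N.* Zc) * nat W + 1#))
    s = suc e₃
    -- u exceeds all the thresholds, and `t₀` is such that T = (W u)^s is a perfect power. Then H(N)
    -- ≤ J s W u by the crude bound H(n) ≤ n, and the power e₃ of this is at most T because s = e₃ +
    -- 1 and (J s)^e₃ ≤ u.
    u = suc ((J N.* s) N.^ e₃ N.+ (Np N.+ Nl) N.+ (n₀ N.+ D) N.+ (n₁ N.+ n₂))
    t₀ : ℕ
    t₀ = W N.^ e₃ N.* u N.^ s
    1≤t₀ : 1 N.≤ t₀
    1≤t₀ = N.*-mono-≤ (N.m^n>0 W {{N.>-nonZero 1≤W}} e₃) (N.m^n>0 u s)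
    t' : ℕ
    t' = N.pred t₀
    t≡ : suc t' ≡ t₀
    t≡ = N.suc-pred t₀ {{N.>-nonZero 1≤t₀}}

    open Mesh D t' 2≤D hiding (W; 1≤W)
    instance
      _ : NonZero T
      _ = N.>-nonZero 1≤T

    T≡ : T ≡ (W N.* u) N.^ s
    T≡ = begin
      suc t' N.* W                    ≡⟨ cong (N._* W) t≡ ⟩
      W N.^ e₃ N.* u N.^ s N.* W      ≡⟨ N.*-comm _ W · sym (N.*-assoc W (W N.^ e₃) (u N.^ s)) ⟩
      W N.^ s N.* u N.^ s             ≡⟨ sym (power-* W u s) ⟩
      (W N.* u) N.^ s                 ∎
      where
      open ≡-Reasoning
      power-* : ∀ m n o → (m N.* n) N.^ o ≡ m N.^ o N.* n N.^ o
      power-* m n zero = refl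
      power-* m n (suc o) = cong (m N.* n N.*_) (power-* m n o) ·
        +-*-Solver.solve 4 (λ a b c d → (a +-*-Solver.:* b) +-*-Solver.:* (c +-*-Solver.:* d) +-*-Solver.:= (a +-*-Solver.:* c) +-*-Solver.:* (b +-*-Solver.:* d)) refl m n (m N.^ o) (n N.^ o)

    u≤t : u N.≤ suc t'
    u≤t = subst (u N.≤_) (sym t≡) (N.m≤m*n u (u N.^ e₃) {{N.m^n≢0 u e₃}} ◃ N.m≤n*m (u N.^ s) (W N.^ e₃) {{N.m^n≢0 W e₃ {{N.>-nonZero 1≤W}}}})
    t≤T : suc t' N.≤ T
    t≤T = N.m≤m*n (suc t') W {{N.>-nonZero 1≤W}}
    u≤T : u N.≤ T
    u≤T = u≤t ◃ t≤T
    W≤T : W N.≤ T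
    W≤T = N.m≤n*m W (suc t')
    T≤^ : ∀ {j} → 1 N.≤ j → T N.≤ T N.^ j
    T≤^ {suc j} _ = N.m≤m*n T (T N.^ j) {{N.m^n≢0 T j}}
    R N : ℕ
    R = T N.^ M
    N = T N.^ J
    1≤J : 1 N.≤ J
    1≤J = (s≤s z≤n ◃ N.m≤n+m 2 (2 N.* M)) ◃ room
    rest₁ : (J N.* s) N.^ e₃ N.≤ u
    rest₁ = N.m≤m+n _ (Np N.+ Nl) ◃ N.m≤m+n _ (n₀ N.+ D) ◃ N.m≤m+n _ (n₁ N.+ n₂) ◃ N.n≤1+n _
    rest₂ : Np N.+ Nl N.≤ u
    rest₂ = N.m≤n+m _ ((J N.* s) N.^ e₃) ◃ N.m≤m+n _ (n₀ N.+ D) ◃ N.m≤m+n _ (n₁ N.+ n₂) ◃ N.n≤1+n _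
    rest₃ : n₀ N.+ D N.≤ u
    rest₃ = N.m≤n+m _ ((J N.* s) N.^ e₃ N.+ (Np N.+ Nl)) ◃ N.m≤m+n _ (n₁ N.+ n₂) ◃ N.n≤1+n _
    rest₄ : n₁ N.+ n₂ N.≤ u
    rest₄ = N.m≤n+m _ ((J N.* s) N.^ e₃ N.+ (Np N.+ Nl) N.+ (n₀ N.+ D)) ◃ N.n≤1+n _
    u≤N : u N.≤ N
    u≤N = u≤T ◃ T≤^ 1≤J
    u≤R : u N.≤ R
    u≤R = u≤T ◃ T≤^ 1≤M
    D≤R : D N.≤ R
    D≤R = (N.m≤n+m D n₀ ◃ rest₃) ◃ u≤R
    2≤T : 2 N.≤ T
    2≤T = 2≤D ◃ (N.m≤n+m D n₀ ◃ rest₃) ◃ u≤T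
    power-room : R N.* R N.* T N.≤ N
    power-room = N.≤-reflexive (cong (N._* T) (sym (N.^-distribˡ-+-* T M M)) · N.*-comm _ T · cong (λ e → T N.^ suc (M N.+ e)) (sym (N.+-identityʳ M))) ◃
      N.^-monoʳ-≤ T ((N.n≤1+n _ ◃ N.≤-reflexive (N.+-comm 2 (2 N.* M))) ◃ room)
    fits : R N.+ suc c N.≤ N
    fits = (N.+-monoʳ-≤ R ((N.≤-reflexive (N.+-comm 1 c) ◃ N.+-monoʳ-≤ c (s≤s z≤n)) ◃ c+2≤D ◃ D≤R) ◃
        N.≤-reflexive (cong (R N.+_) (sym (N.+-identityʳ R)) · N.*-comm 2 R) ◃ N.*-monoʳ-≤ R 2≤T) ◃
      N.*-monoˡ-≤ T (N.m≤m*n R R {{N.m^n≢0 T M}}) ◃ power-room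
    len : ℕ
    len = N N.∸ (R N.+ suc c)
    N≡ : R N.+ len N.+ suc c ≡ N
    N≡ = (N.+-assoc R len (suc c) · cong (R N.+_) (N.+-comm len (suc c)) · sym (N.+-assoc R (suc c) len)) · (N.m+[n∸m]≡n fits)
    level : (R N.* R N.* W) N.^ den N.≤ N N.^ num
    level = N.^-monoˡ-≤ den (N.*-monoʳ-≤ (R N.* R) W≤T ◃
        N.≤-reflexive (cong (N._* T) (sym (N.^-distribˡ-+-* T M M)) · N.*-comm _ T · cong (λ e → T N.^ e) (cong (λ e → suc (M N.+ e)) (sym (N.+-identityʳ M)) · N.+-comm 1 (2 N.* M)))) ◃
      N.≤-reflexive (N.^-*-assoc T (2 N.* M N.+ 1) den) ◃ N.^-monoʳ-≤ T within-level ◃ N.≤-reflexive (sym (N.^-*-assoc T J num))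


    H-power : ∀ T j → 1 N.≤ T → 1 N.≤ j → H (T N.^ j) ≤ nat j * H T
    H-power T (suc j) 1≤T _ = H-^ T j 1≤T

    T-large : H N ^ e₃ ≤ nat T
    T-large = begin
      H N ^ e₃ ≤⟨ ^-mono e₃ (0≤H N) (H-power T J 1≤T 1≤J ◂ *-monoˡ-≤ (0≤nat J) (≡⇒≤ (cong H T≡) ◂
             H-power (W N.* u) s (N.*-mono-≤ 1≤W (s≤s z≤n)) (s≤s z≤n) ◂ *-monoˡ-≤ (0≤nat s) (H≤n (W N.* u)))) ⟩
      (nat J * (nat s * nat (W N.* u))) ^ e₃ ≡⟨ cong (_^ e₃) (sym (*-assoc _ _ _) · cong (_* nat (W N.* u)) (sym (nat-* J s))) ⟩
      (nat (J N.* s) * nat (W N.* u)) ^ e₃ ≡⟨ ^-distrib _ _ e₃ · cong₂ _*_ (sym (nat-^ (J N.* s) e₃)) (sym (nat-^ (W N.* u) e₃)) ⟩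
      nat ((J N.* s) N.^ e₃) * nat ((W N.* u) N.^ e₃) ≤⟨ *-monoʳ-≤ (0≤nat ((W N.* u) N.^ e₃)) (nat-mono (rest₁ ◃ N.m≤n*m u W {{N.>-nonZero 1≤W}})) ⟩
      nat (W N.* u) * nat ((W N.* u) N.^ e₃) ≡⟨ sym (nat-* (W N.* u) _) · cong nat (sym T≡) ⟩
      nat T ∎
      where open ≤-Reasoning

    module C = Comparison k' hs length≡ unique r c D t' M J ν (R N.∸ D) len b (hs≤ hs) (r≤ hs) c≤D 2≤D 2k≤D b0
      (proj₂ (coprime-residue hs adm D)) (N.m+[n∸m]≡n D≤R) N≡
      (proj₂ (proj₂ (PLs e₂)) N ((N.m≤m+n Np Nl ◃ rest₂) ◃ u≤N))
      (proj₂ (proj₂ (LLs e₂)) N ((N.m≤n+m Nl Np ◃ rest₂) ◃ u≤N))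
      level power-room T-large

    sieve : nat (2 N.* k) * (h⁻ * h⁻ * (h⁻ ^ k' * layers V (L k'))) ≤ H N * β * C.Q₁ + 1#
    sieve = C.sieve-inequality
      (proj₂ (proj₂ (H-unbounded (nat (φ W) * ec))) ◂ H-mono ((N.m≤m+n n₁ n₂ ◃ rest₄) ◃ u≤N))
      (λ m R<m → parity m (N.≤-<-trans ((N.m≤m+n n₀ D ◃ rest₃) ◃ u≤R) R<m))

    η : ℚ
    η = 1# - nat C₀ * inv D
    instance
      D≢0 : NonZero D
      D≢0 = _
    C/D≤ : nat 2 * (nat C₀ * nat (suc a)) * inv D ≤ 1#
    C/D≤ = *-monoʳ-≤ (0≤inv D) (≡⇒≤ (sym (nat-* 2 (C₀ N.* suc a) · cong (nat 2 *_) (nat-* C₀ (suc a)))) ◂ nat-mono C₀≤D) ◂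
      ≡⇒≤ (natinv D)
    C/D≥0 : 0# ≤ nat C₀ * inv D
    C/D≥0 = *-nonneg (0≤nat C₀) (0≤inv D)
    η≥0 : 0# ≤ η
    η≥0 = 0≤y-x (≤-add (nat C₀ * inv D + nat 2 * (nat C₀ * inv D) * nat a) (+-nonneg C/D≥0 (*-nonneg (*-nonneg (0≤nat 2) C/D≥0) (0≤nat a)))
      (solve 3 (λ c i a → c :* i :+ (c :* i :+ # 2 :* (c :* i) :* a) := # 2 :* (c :* (a :+ # 1)) :* i) refl (nat C₀) (inv D) (nat a) ·
        cong (λ s → nat 2 * (nat C₀ * s) * inv D) (sym (nat-suc a))) ◂ C/D≤)
    η-large : nat 4 * nat a + nat 2 ≤ nat 4 * η * (nat a + 1#)
    η-large = ≤-add (nat 2 * (1# - nat 2 * (nat C₀ * nat (suc a)) * inv D)) (*-nonneg (0≤nat 2) (0≤y-x C/D≤))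
      (cong (λ s → nat 4 * nat a + nat 2 + nat 2 * (1# - nat 2 * (nat C₀ * s) * inv D)) (nat-suc a) ·
        solve 3 (λ a c i → # 4 :* a :+ # 2 :+ # 2 :* (# 1 :- # 2 :* (c :* (a :+ # 1)) :* i)
           := # 4 :* (# 1 :- c :* i) :* (a :+ # 1)) refl (nat a) (nat C₀) (inv D))

    F₀ = nat (φ W)
    1≤F₀ : 1# ≤ F₀
    1≤F₀ = nat-mono (φ>0 W 1≤W)
    βW : β * nat W ≡ F₀
    βW = *-assoc _ _ _ · cong (F₀ *_) (invnat W {{N.>-nonZero 1≤W}}) · *-identityʳ _
    β≤1 : β ≤ 1#
    β≤1 = *-monoʳ-≤ (0≤inv W) (≡⇒≤ (φ-sum W) ◂ (sum-mono W λ i _ → ind≤1 (coprime? i W)) ◂ ≡⇒≤ (sum-const W 1# · *-identityʳ _)) ◂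
      ≡⇒≤ (natinv W {{N.>-nonZero 1≤W}})
    big : nat (5 N.+ cW N.* Zc) ≤ h⁻
    big = begin
      b₀ ≤⟨ ≡⇒≤ (sym (*-identityʳ b₀)) ◂ *-monoˡ-≤ (0≤nat (5 N.+ cW N.* Zc)) 1≤F₀ ⟩
      b₀ * F₀ ≡⟨ cong (b₀ *_) (sym βW) · solve 3 (λ b x w → b :* (x :* w) := x :* (b :* w :+ # 1 :- # 1)) refl b₀ β (nat W) ⟩
      β * (b₀ * nat W + 1# - 1#) ≤⟨ *-monoˡ-≤ 0≤β (+-mono-≤ (proj₂ (proj₂ (H-unbounded (b₀ * nat W + 1#))) ◂ H-mono ((N.m≤n+m n₂ n₁ ◃ rest₄) ◃ u≤t)) ≤-refl) ⟩
      h⁻ ∎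
      where
      open ≤-Reasoning
      b₀ = nat (5 N.+ cW N.* Zc)
    ζ : ℚ
    ζ = inv Zc
    -- From H(t W) ≤ W + H(t) the difference h⁺ - h⁻ is at most 2 W + 1, independently of t, and h⁻
    -- is at least `cW` times `Zc`.
    h⁺≤ : h⁺ ≤ h⁻ * (1# + ζ)
    h⁺≤ = begin
      β * H T + nat W ≤⟨ +-mono-≤ (*-monoˡ-≤ 0≤β (H-* t' W 1≤W ◂ +-mono-≤ (H≤n W) ≤-refl)) ≤-refl ⟩
      β * (nat W + H (suc t')) + nat W ≡⟨ solve 3 (λ b w h → b :* (w :+ h) :+ w := b :* (h :- # 1) :+ b :* (w :+ # 1) :+ w) refl β (nat W) (H (suc t')) ⟩
      h⁻ + β * (nat W + 1#) + nat W ≤⟨ +-mono-≤ (+-mono-≤ (≤-refl {h⁻}) (*-monoʳ-≤ (+-nonneg (0≤nat W) 0≤1) β≤1)) ≤-refl ⟩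
      h⁻ + 1# * (nat W + 1#) + nat W ≡⟨ solve 2 (λ h w → h :+ # 1 :* (w :+ # 1) :+ w := h :+ (# 2 :* w :+ # 1)) refl h⁻ (nat W) ·
             cong (h⁻ +_) (cong (_+ 1#) (sym (nat-* 2 W)) · sym (nat-suc (2 N.* W))) ⟩
      h⁻ + nat cW ≡⟨ cong (h⁻ +_) (sym (*-assoc _ _ _ · cong (nat cW *_) (natinv Zc) · *-identityʳ _)) ⟩
      h⁻ + nat cW * nat Zc * ζ ≤⟨ +-mono-≤ (≤-refl {h⁻}) (*-monoʳ-≤ (0≤inv Zc) (≡⇒≤ (sym (nat-* cW Zc)) ◂ nat-mono (N.m≤n+m (cW N.* Zc) 5) ◂ big)) ⟩
      h⁻ + h⁻ * ζ ≡⟨ solve 2 (λ h z → h :+ h :* z := h :* (# 1 :+ z)) refl h⁻ ζ ⟩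
      h⁻ * (1# + ζ) ∎
      where open ≤-Reasoning
    ζ-small : nat 4 * nat a * nat (2 N.^ suc k) * ζ ≤ 1#
    ζ-small = *-monoʳ-≤ (0≤inv Zc) (≡⇒≤ (sym (nat-* (4 N.* a) (2 N.^ suc k) · cong (_* nat (2 N.^ suc k)) (nat-* 4 a))) ◂ nat-mono (N.n≤1+n _)) ◂
      ≡⇒≤ (natinv Zc)
    5≤h⁻ : nat 5 ≤ h⁻
    5≤h⁻ = nat-mono (N.m≤m+n 5 (cW N.* Zc)) ◂ big
    5≤power : nat 5 ≤ h⁻ ^ suc k
    5≤power = 5≤h⁻ ◂ ≡⇒≤ (sym (*-identityʳ h⁻)) ◂ *-monoˡ-≤ 0≤h⁻ (1≤^ k (nat-mono {1} {5} (s≤s z≤n) ◂ 5≤h⁻))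
    main : η * (nat a + 1#) * h⁻ ^ suc k ≤ nat a * h⁺ ^ suc k + 1#
    main = begin
      η * (nat a + 1#) * h⁻ ^ suc k ≤⟨ *-monoʳ-≤ (^-nonneg (suc k) 0≤h⁻) (*-monoˡ-≤ η≥0 (≡⇒≤ (sym (nat-suc a)) ◂ numeric-𝒱)) ⟩
      η * (nat (2 N.* k) * layers V (L k')) * h⁻ ^ suc k ≡⟨ solve 5 (λ e k v h p → e :* (k :* v) :* (h :* (h :* p)) := e :* (k :* (h :* h :* (p :* v)))) refl η (nat (2 N.* k)) (layers V (L k')) h⁻ (h⁻ ^ k') ⟩
      η * (nat (2 N.* k) * (h⁻ * h⁻ * (h⁻ ^ k' * layers V (L k')))) ≤⟨ *-monoˡ-≤ η≥0 sieve ⟩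
      η * (H N * β * C.Q₁ + 1#) ≤⟨ ≤-add (nat C₀ * inv D) C/D≥0 (solve 4 (λ c h b q → (# 1 :- c) :* (h :* b :* q :+ # 1) :+ c := h :* b :* ((# 1 :- c) :* q) :+ # 1) refl (nat C₀ * inv D) (H N) β C.Q₁) ⟩
      H N * β * (η * C.Q₁) + 1# ≤⟨ +-mono-≤ (*-monoˡ-≤ (*-nonneg (0≤H N) 0≤β) first ◂ *-monoʳ-≤ hU≥0 HNβ) ≤-refl ⟩
      nat J * h⁺ * (h⁺ ^ k * layers Y (U k)) + 1# ≡⟨ cong (_+ 1#) (solve 4 (λ j h p u → j :* h :* (p :* u) := j :* u :* (h :* p)) refl (nat J) h⁺ (h⁺ ^ k) (layers Y (U k))) ⟩
      nat J * layers Y (U k) * h⁺ ^ suc k + 1# ≤⟨ +-mono-≤ (*-monoʳ-≤ (^-nonneg (suc k) 0≤h⁺) numeric-𝒰) ≤-refl ⟩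
      nat a * h⁺ ^ suc k + 1# ∎
      where
      open ≤-Reasoning
      first : η * C.Q₁ ≤ h⁺ ^ k * layers Y (U k)
      first = Bounds.first-moment-≤ D t' (R N.∸ D) k' 2≤D 2k≤D b0 η≥0
      layers≥0 : 0# ≤ layers Y (U k)
      layers≥0 = sum-nonneg (suc M) λ j _ → *-nonneg (0≤y-x (*-mono-≤ (Y≥0 (suc j)) (Y≥0 (suc j)) (Y-decreasing j) (Y-decreasing j))) (0≤nat (U k j))
      hU≥0 = *-nonneg (^-nonneg k 0≤h⁺) layers≥0
      HNβ : H N * β ≤ nat J * h⁺
      HNβ = *-monoʳ-≤ 0≤β (H-power T J 1≤T 1≤J) ◂ ≤-add (nat J * nat W) (*-nonneg (0≤nat J) (0≤nat W))
        (solve 4 (λ j h b w → j :* h :* b :+ j :* w := j :* (b :* h :+ w)) refl (nat J) (H T) β (nat W))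

  contradiction : ⊥
  contradiction = endgame (suc k) (0≤nat a) η-large (0≤inv Zc) (inv≤1 Zc) ζ-small 0≤h⁻ 0≤h⁺ h⁺≤ 5≤power main

-- Order and arithmetic of real numbers through their approximants

Eventually : (ℕ → Set) → Set
Eventually P = ∃[ n₀ ] ∀ n → n₀ N.≤ n → P n

Eventually-× : ∀ {P Q} → Eventually P → Eventually Q → Eventually (λ n → P n × Q n)
Eventually-× (m , p) (n , q) = m N.⊔ n , λ o le →
  p o (N.m≤m⊔n m n ◃ le) , q o (N.m≤n⊔m m n ◃ le)

Eventually-map : ∀ {P Q : ℕ → Set} → (∀ n → P n → Q n) → Eventually P → Eventually Q
Eventually-map f (m , p) = m , λ n le → f n (p n le)

Eventually-∃ : ∀ {P : ℕ → Set} → Eventually P → ∃ P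
Eventually-∃ (m , p) = m , p m N.≤-refl

Cauchy : (ℕ → ℚ) → Set
Cauchy s = ∀ ε → 0# < ε → ∃[ n₀ ] ∀ m n → n₀ N.≤ m → n₀ N.≤ n → ∣ s m - s n ∣ ≤ ε

half : ℚ → ℚ
half ε = inv 2 * ε

half+half : ∀ ε → half ε + half ε ≡ ε
half+half ε = solve 2 (λ i e → i :* e :+ i :* e := # 2 :* i :* e) refl (inv 2) ε · cong (_* ε) (natinv 2) · *-identityˡ ε

0<inv : ∀ n → 0# < inv (suc n)
0<inv n = ≰⇒> λ le → <⇒≱ 0<1 (≡⇒≤ (sym (natinv (suc n))) ◂ *-monoˡ-≤ (0≤nat (suc n)) le ◂ ≡⇒≤ (*-zeroʳ _))

*-pos : ∀ {a b} → 0# < a → 0# < b → 0# < a * b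
*-pos {a} {b} a>0 b>0 = subst (_< a * b) (*-zeroʳ a) (*-monoˡ-< a>0 b>0)

half>0 : ∀ {ε} → 0# < ε → 0# < half ε
half>0 = *-pos (0<inv 1)

half<  : ∀ {ε} → 0# < ε → half ε < ε
half< {ε} ε>0 = subst₂ _<_ (+-identityˡ (half ε)) (half+half ε) (+-mono-<-≤ (half>0 ε>0) ≤-refl)

opaque
  unfolding int _+_ _*_ -_ _≤_ _<_ ∣_∣

  mkReal : (s : ℕ → ℚ) → Cauchy s → ℝ
  mkReal s c = mkℝ s λ ε ε>0 → let (n₀ , h) = c (half ε) (half>0 ε>0) in n₀ , λ m n p q → ≤-<-trans (h m n p q) (half< ε>0)

  approx-mkReal : ∀ s c n → at (mkReal s c) n ≡ s n
  approx-mkReal s c n = refl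

  cauchy : ∀ x → Cauchy (at x)
  cauchy x ε ε>0 = let (n₀ , h) = R.cauchy x ε ε>0 in n₀ , λ m n p q → <⇒≤ (h m n p q)

  approx-+ : ∀ x y n → at (x R.+ y) n ≡ at x n + at y n
  approx-+ x y n = refl

  approx-* : ∀ x y n → at (x R.* y) n ≡ at x n * at y n
  approx-* x y n = refl

  approx-neg : ∀ x n → at (R.- x) n ≡ - at x n
  approx-neg x n = refl

  approx-ℕ : ∀ k n → at (fromℕ k) n ≡ nat k
  approx-ℕ k n = refl

  approx-ℤ : ∀ k n → at (fromℤ k) n ≡ int k
  approx-ℤ k n = refl

  ≈⇒close : ∀ {x y} → x ≈ y → ∀ ε → 0# < ε → Eventually (λ n → ∣ at x n - at y n ∣ ≤ ε)
  ≈⇒close h ε ε>0 = Eventually-map (λ _ → <⇒≤) (h ε ε>0)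

  close⇒≈ : ∀ {x y} → (∀ ε → 0# < ε → Eventually (λ n → ∣ at x n - at y n ∣ ≤ ε)) → x ≈ y
  close⇒≈ h ε ε>0 = Eventually-map (λ _ le → ≤-<-trans le (half< ε>0)) (h (half ε) (half>0 ε>0))

  <⇒gap : ∀ {x y} → x R.< y → ∃[ ε ] 0# < ε × Eventually (λ n → at x n + ε ≤ at y n)
  <⇒gap h = h

  gap⇒< : ∀ {x y} → ∃[ ε ] 0# < ε × Eventually (λ n → at x n + ε ≤ at y n) → x R.< y
  gap⇒< h = h

infix 4 _≼_
-- The positive form of `R._≤_`, which is defined as a negation. Estimates of approximants compose
-- directly in this form.
_≼_ : ℝ → ℝ → Set
x ≼ y = ∀ ε → 0# < ε → Eventually (λ n → at x n ≤ at y n + ε)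

∣a-b∣≤⇒ : ∀ {a b e} → ∣ a - b ∣ ≤ e → a ≤ b + e
∣a-b∣≤⇒ {a} {b} {e} le = ≤-add (e - (a - b)) (0≤y-x (x≤∣x∣ _ ◂ le)) (solve 3 (λ a b e → a :+ (e :- (a :- b)) := b :+ e) refl a b e)

∣a-b∣≤⇒' : ∀ {a b e} → ∣ a - b ∣ ≤ e → b ≤ a + e
∣a-b∣≤⇒' {a} {b} {e} le = ≤-add (e - - (a - b)) (0≤y-x (-x≤∣x∣ _ ◂ le)) (solve 3 (λ a b e → b :+ (e :- :- (a :- b)) := a :+ e) refl a b e)

⇒∣a-b∣≤ : ∀ {a b e} → a ≤ b + e → b ≤ a + e → ∣ a - b ∣ ≤ e
⇒∣a-b∣≤ {a} {b} {e} p q = ∣-∣≤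
  (≤-add (b + e - a) (0≤y-x p) (solve 3 (λ a b e → a :- b :+ (b :+ e :- a) := e) refl a b e))
  (≤-add (a + e - b) (0≤y-x q) (solve 3 (λ a b e → :- (a :- b) :+ (a :+ e :- b) := e) refl a b e))

≼⇒≤ : ∀ {x y} → x ≼ y → x R.≤ y
≼⇒≤ {x} {y} h y<x with <⇒gap {y} {x} y<x
... | ε , ε>0 , gap with Eventually-∃ (Eventually-× gap (h (half ε) (half>0 ε>0)))
...   | n , p , q = <⇒≱ (half< ε>0) (≤-add (at x n - (at y n + ε) + (at y n + half ε - at x n)) (+-nonneg (0≤y-x p) (0≤y-x q))
        (solve 4 (λ x y e h → e :+ (x :- (y :+ e) :+ (y :+ h :- x)) := h) refl (at x n) (at y n) ε (half ε)))

-- By the Cauchy property a rational comparison at one late index either gives x ≤ y + ε from there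
-- on or exhibits y < x.
≤⇒≼ : ∀ {x y} → x R.≤ y → x ≼ y
≤⇒≼ {x} {y} h ε ε>0 = decide (at x o ≤? (at y o + (d + d)))
  where
  open ≤-Reasoning
  d : ℚ
  d = half (half ε)
  d>0 : 0# < d
  d>0 = half>0 (half>0 ε>0)
  ε≡ : d + d + (d + d) ≡ ε
  ε≡ = cong₂ _+_ (half+half (half ε)) (half+half (half ε)) · half+half ε
  m₀ n₀ o : ℕ
  m₀ = proj₁ (cauchy x (half d) (half>0 d>0))
  n₀ = proj₁ (cauchy y (half d) (half>0 d>0))
  o = m₀ N.⊔ n₀
  cx : ∀ m n → o N.≤ m → o N.≤ n → at x m ≤ at x n + half d
  cx m n p q = ∣a-b∣≤⇒ (proj₂ (cauchy x (half d) (half>0 d>0)) m n (N.m≤m⊔n m₀ n₀ ◃ p) (N.m≤m⊔n m₀ n₀ ◃ q))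
  cy : ∀ m n → o N.≤ m → o N.≤ n → at y m ≤ at y n + half d
  cy m n p q = ∣a-b∣≤⇒ (proj₂ (cauchy y (half d) (half>0 d>0)) m n (N.m≤n⊔m m₀ n₀ ◃ p) (N.m≤n⊔m m₀ n₀ ◃ q))
  decide : Dec (at x o ≤ at y o + (d + d)) → Eventually (λ n → at x n ≤ at y n + ε)
  decide (yes le) = o , λ n p → begin
    at x n ≤⟨ cx n o p N.≤-refl ⟩
    at x o + half d ≤⟨ +-mono-≤ le ≤-refl ⟩
    at y o + (d + d) + half d ≤⟨ +-mono-≤ (+-mono-≤ (cy o n N.≤-refl p) ≤-refl) ≤-refl ⟩
    at y n + half d + (d + d) + half d ≤⟨ ≤-add d (<⇒≤ d>0) (solve 3 (λ y h d → y :+ h :+ (d :+ d) :+ h :+ d := y :+ ((h :+ h) :+ d :+ (d :+ d))) refl (at y n) (half d) d ·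
           cong (at y n +_) (cong (λ t → t + d + (d + d)) (half+half d) · ε≡)) ⟩
    at y n + ε ∎
  decide (no ¬le) = ⊥-elim (h (gap⇒< {y} {x} (d , d>0 , o , λ n p → begin
    at y n + d ≤⟨ +-mono-≤ (cy n o p N.≤-refl) ≤-refl ⟩
    at y o + half d + d ≤⟨ ≤-add (at x o - (at y o + (d + d))) (0≤y-x (<⇒≤ (≰⇒> ¬le)))
           (cong (λ t → at y o + half d + t + (at x o - (at y o + (t + t)))) (sym (half+half d)) ·
             solve 3 (λ y h x → y :+ h :+ (h :+ h) :+ (x :- (y :+ (h :+ h :+ (h :+ h)))) := x :- h) refl (at y o) (half d) (at x o)) ⟩
    at x o - half d ≤⟨ ≤-add (at x n + half d - at x o) (0≤y-x (cx o n N.≤-refl p)) (solve 3 (λ a b h → a :- h :+ (b :+ h :- a) := b) refl (at x o) (at x n) (half d)) ⟩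
    at x n ∎)))

≼-refl : ∀ {x} → x ≼ x
≼-refl ε ε>0 = 0 , λ n _ → ≤-add ε (<⇒≤ ε>0) refl

≼-trans : ∀ {x y z} → x ≼ y → y ≼ z → x ≼ z
≼-trans {x} {y} {z} p q ε ε>0 = Eventually-map
  (λ n (a , b) → a ◂ +-mono-≤ b ≤-refl ◂ ≡⇒≤ (+-assoc _ _ _ · cong (at z n +_) (half+half ε)))
  (Eventually-× (p (half ε) (half>0 ε>0)) (q (half ε) (half>0 ε>0)))

≈⇒≼ : ∀ {x y} → x ≈ y → x ≼ y
≈⇒≼ {x} {y} h ε ε>0 = Eventually-map (λ _ → ∣a-b∣≤⇒) (≈⇒close {x} {y} h ε ε>0)

≈⇒≽ : ∀ {x y} → x ≈ y → y ≼ x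
≈⇒≽ {x} {y} h ε ε>0 = Eventually-map (λ _ → ∣a-b∣≤⇒') (≈⇒close {x} {y} h ε ε>0)

≼-antisym : ∀ {x y} → x ≼ y → y ≼ x → x ≈ y
≼-antisym {x} {y} p q = close⇒≈ {x} {y} λ ε ε>0 → Eventually-map (λ _ (a , b) → ⇒∣a-b∣≤ a b) (Eventually-× (p ε ε>0) (q ε ε>0))

≈-sym : ∀ {x y} → x ≈ y → y ≈ x
≈-sym {x} {y} h = ≼-antisym {y} {x} (≈⇒≽ {x} {y} h) (≈⇒≼ {x} {y} h)

≈-trans : ∀ {x y z} → x ≈ y → y ≈ z → x ≈ z
≈-trans {x} {y} {z} p q = ≼-antisym {x} {z} (≼-trans {x} {y} {z} (≈⇒≼ {x} {y} p) (≈⇒≼ {y} {z} q)) (≼-trans {z} {y} {x} (≈⇒≽ {y} {z} q) (≈⇒≽ {x} {y} p))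

pointwise-≼ : ∀ {x y} → (∀ n → at x n ≤ at y n) → x ≼ y
pointwise-≼ h ε ε>0 = 0 , λ n _ → h n ◂ ≤-add ε (<⇒≤ ε>0) refl

pointwise-≈ : ∀ {x y} → (∀ n → at x n ≡ at y n) → x ≈ y
pointwise-≈ {x} {y} h = ≼-antisym {x} {y} (pointwise-≼ {x} {y} λ n → ≡⇒≤ (h n)) (pointwise-≼ {y} {x} λ n → ≡⇒≤ (sym (h n)))

≈-refl : ∀ {x} → x ≈ x
≈-refl {x} = pointwise-≈ {x} {x} λ _ → refl

opaque
  unfolding int _+_ _*_ -_ _≤_ _<_ ∣_∣

  approx-minus : ∀ x y n → at (x R.- y) n ≡ at x n - at y n
  approx-minus x y n = refl

  fromℕ-mono : ∀ {m n} → m N.≤ n → fromℕ m ≼ fromℕ n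
  fromℕ-mono {m} {n} le = pointwise-≼ {fromℕ m} {fromℕ n} λ _ → nat-mono le

  fromℕ≈ : ∀ n → fromℕ n ≈ ρ (nat n)
  fromℕ≈ n = pointwise-≈ {fromℕ n} {ρ (nat n)} λ _ → refl

  fromℚ-+ : ∀ p q → ρ (p + q) ≈ (ρ p R.+ ρ q)
  fromℚ-+ p q = pointwise-≈ {ρ (p + q)} {ρ p R.+ ρ q} λ _ → refl

  fromℚ-* : ∀ p q → ρ (p * q) ≈ (ρ p R.* ρ q)
  fromℚ-* p q = pointwise-≈ {ρ (p * q)} {ρ p R.* ρ q} λ _ → refl

  fromℕ*fromℚ : ∀ n q → (fromℕ n R.* ρ q) ≈ ρ (nat n * q)
  fromℕ*fromℚ n q = pointwise-≈ {fromℕ n R.* ρ q} {ρ (nat n * q)} λ _ → refl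

  fromℕ*fromℕ : ∀ m n → (fromℕ m R.* fromℕ n) ≈ ρ (nat m * nat n)
  fromℕ*fromℕ m n = pointwise-≈ {fromℕ m R.* fromℕ n} {ρ (nat m * nat n)} λ _ → refl

  fromℚ-neg : ∀ p → ρ (- p) ≈ (R.- ρ p)
  fromℚ-neg p = pointwise-≈ {ρ (- p)} {R.- ρ p} λ _ → refl

  -0≈0 : (R.- 0ℝ) ≈ 0ℝ
  -0≈0 = pointwise-≈ {R.- 0ℝ} {0ℝ} λ _ → solve 0 (:- # 0 := # 0) refl

  1*x≈x : ∀ x → (1ℝ R.* x) ≈ x
  1*x≈x x = pointwise-≈ {1ℝ R.* x} {x} λ n → *-identityˡ (at x n)

  x*1≈x : ∀ x → (x R.* 1ℝ) ≈ x
  x*1≈x x = pointwise-≈ {x R.* 1ℝ} {x} λ n → *-identityʳ (at x n)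

  x+0≈x : ∀ x → (x R.+ 0ℝ) ≈ x
  x+0≈x x = pointwise-≈ {x R.+ 0ℝ} {x} λ n → +-identityʳ (at x n)

  x-x≈0 : ∀ x → (x R.- x) ≈ 0ℝ
  x-x≈0 x = pointwise-≈ {x R.- x} {0ℝ} λ n → +-inverseʳ (at x n)

  y-x+x≈y : ∀ x y → (y R.- x R.+ x) ≈ y
  y-x+x≈y x y = pointwise-≈ {y R.- x R.+ x} {y} λ n → solve 2 (λ x y → y :- x :+ x := y) refl (at x n) (at y n)

infix  1 chain_
infixr 2 _≼⟨_⟩_ _⊴⟨_⟩_ _≐⟨_⟩_ _∼⟨_⟩_ _∼˘⟨_⟩_
infix  3 _□

-- `_≼_` unfolds to a statement about approximants, from which x and y cannot be inferred. The
-- wrapper keeps the two ends of a chain visible.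
data _↝_ (x y : ℝ) : Set where
  linked : x ≼ y → x ↝ y

chain_ : ∀ {x y} → x ↝ y → x ≼ y
chain linked p = p

_≼⟨_⟩_ : ∀ x {y z} → x ≼ y → y ↝ z → x ↝ z
_≼⟨_⟩_ x {y} {z} p (linked q) = linked (≼-trans {x} {y} {z} p q)

_⊴⟨_⟩_ : ∀ x {y z} → (∀ n → at x n ≤ at y n) → y ↝ z → x ↝ z
_⊴⟨_⟩_ x {y} p q = x ≼⟨ pointwise-≼ {x} {y} p ⟩ q

_≐⟨_⟩_ : ∀ x {y z} → (∀ n → at x n ≡ at y n) → y ↝ z → x ↝ z
_≐⟨_⟩_ x p q = x ⊴⟨ (λ n → ≡⇒≤ (p n)) ⟩ q

_∼⟨_⟩_ : ∀ x {y z} → x ≈ y → y ↝ z → x ↝ z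
_∼⟨_⟩_ x {y} p q = x ≼⟨ ≈⇒≼ {x} {y} p ⟩ q

_∼˘⟨_⟩_ : ∀ x {y z} → y ≈ x → y ↝ z → x ↝ z
_∼˘⟨_⟩_ x {y} p q = x ≼⟨ ≈⇒≽ {y} {x} p ⟩ q

_□ : ∀ x → x ↝ x
x □ = linked (≼-refl {x})

ℚ-≼ : ∀ {p q} → p ≤ q → ρ p ≼ ρ q
ℚ-≼ {p} {q} le = pointwise-≼ {ρ p} {ρ q} λ _ → le

≼-ℚ : ∀ {p q} → ρ p ≼ ρ q → p ≤ q
≼-ℚ {p} {q} h with p ≤? q
... | yes le = le
... | no ¬le = ⊥-elim (<⇒≱ (half< d>0) (≤-add (q + half (p - q) - p) (0≤y-x (proj₂ (Eventually-∃ (h (half (p - q)) (half>0 d>0)))))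
    (solve 3 (λ p q h → p :- q :+ (q :+ h :- p) := h) refl p q (half (p - q)))))
  where
  d>0 : 0# < p - q
  d>0 = ≰⇒> λ le → ¬le (0≤y-x⇒x≤y (subst (0# ≤_) (solve 2 (λ p q → :- (p :- q) := q :- p) refl p q) (subst (_≤ - (p - q)) (solve 0 (:- # 0 := # 0) refl) (neg-mono-≤ le))))

+-mono-≼ : ∀ {x y u v} → x ≼ y → u ≼ v → (x R.+ u) ≼ (y R.+ v)
+-mono-≼ {x} {y} {u} {v} p q ε ε>0 = Eventually-map (λ n (a , b) → begin
    at (x R.+ u) n                                 ≡⟨ approx-+ x u n ⟩
    at x n + at u n                            ≤⟨ +-mono-≤ a b ⟩
    at y n + half ε + (at v n + half ε)        ≡⟨ solve 3 (λ y v h → y :+ h :+ (v :+ h) := y :+ v :+ (h :+ h)) refl (at y n) (at v n) (half ε) ⟩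
    at y n + at v n + (half ε + half ε)        ≡⟨ cong₂ _+_ (sym (approx-+ y v n)) (half+half ε) ⟩
    at (y R.+ v) n + ε                             ∎)
  (Eventually-× (p (half ε) (half>0 ε>0)) (q (half ε) (half>0 ε>0)))
  where open ≤-Reasoning

neg-mono-≼ : ∀ {x y} → x ≼ y → (R.- y) ≼ (R.- x)
neg-mono-≼ {x} {y} p ε ε>0 = Eventually-map (λ n a → subst₂ (λ s t → s ≤ t + ε) (sym (approx-neg y n)) (sym (approx-neg x n))
    (≤-add (at y n + ε - at x n) (0≤y-x a) (solve 3 (λ x y e → :- y :+ (y :+ e :- x) := :- x :+ e) refl (at x n) (at y n) ε)))
  (p ε ε>0)

bounded : ∀ x → ∃[ B ] Eventually (λ n → ∣ at x n ∣ ≤ nat B)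
bounded x with cauchy x 1# 0<1
... | n₀ , h = ceiling (∣ at x n₀ ∣ + 1#) , n₀ , λ n p → begin
    ∣ at x n ∣ ≡⟨ cong ∣_∣ (solve 2 (λ a b → a := b :+ (a :- b)) refl (at x n) (at x n₀)) ⟩
    ∣ at x n₀ + (at x n - at x n₀) ∣ ≤⟨ ∣-∣-triangle _ _ ◂ +-mono-≤ ≤-refl (h n n₀ p N.≤-refl) ⟩
    ∣ at x n₀ ∣ + 1# ≤⟨ ≤-ceiling _ ⟩
    nat (ceiling (∣ at x n₀ ∣ + 1#)) ∎
  where open ≤-Reasoning

-- Approximants of nonnegative reals may be slightly negative. Adding δ to both makes them
-- nonnegative, and multiplying out costs at most δ (A + C + 1).
0≼* : ∀ {x y} → 0ℝ ≼ x → 0ℝ ≼ y → 0ℝ ≼ (x R.* y)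
0≼* {x} {y} p q ε ε>0 with bounded x | bounded y
... | A , bx | C , by = Eventually-map bound (Eventually-× (Eventually-× bx by) (Eventually-× (p δ δ>0) (q δ δ>0)))
  where
  open ≤-Reasoning
  K : ℕ
  K = suc (A N.+ C)
  -- δ ≤ 1 and δ (A + C + 1) ≤ ε
  δ : ℚ
  δ = ε * inv (suc (ceiling ε)) * inv K
  δ>0 : 0# < δ
  δ>0 = *-pos (*-pos ε>0 (0<inv (ceiling ε))) (0<inv (A N.+ C))
  ε/⌈ε⌉≤1 : ε * inv (suc (ceiling ε)) ≤ 1#
  ε/⌈ε⌉≤1 = *-monoʳ-≤ (0≤inv (suc (ceiling ε))) (≤-ceiling ε ◂ nat-mono (N.n≤1+n _)) ◂ ≡⇒≤ (natinv (suc (ceiling ε)))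
  δ≤1 : δ ≤ 1#
  δ≤1 = *-mono-≤ (<⇒≤ (*-pos ε>0 (0<inv (ceiling ε)))) (0≤inv K) ε/⌈ε⌉≤1 (inv≤1 K) ◂ ≡⇒≤ (*-identityˡ 1#)
  δK≤ε : δ * nat K ≤ ε
  δK≤ε = begin
    ε * inv (suc (ceiling ε)) * inv K * nat K ≡⟨ *-assoc _ _ _ · cong (ε * inv (suc (ceiling ε)) *_) (invnat K) · *-identityʳ _ ⟩
    ε * inv (suc (ceiling ε)) ≤⟨ *-monoˡ-≤ (<⇒≤ ε>0) (inv≤1 (suc (ceiling ε))) ◂ ≡⇒≤ (*-identityʳ ε) ⟩
    ε ∎
  bound : ∀ n → (∣ at x n ∣ ≤ nat A × ∣ at y n ∣ ≤ nat C) × (at 0ℝ n ≤ at x n + δ × at 0ℝ n ≤ at y n + δ) →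
    at 0ℝ n ≤ at (x R.* y) n + ε
  bound n ((xA , yC) , (x≥ , y≥)) = begin
    at 0ℝ n ≡⟨ approx-ℕ 0 n ⟩
    0# ≤⟨ *-nonneg (subst (_≤ X + δ) (approx-ℕ 0 n) x≥) (subst (_≤ Y + δ) (approx-ℕ 0 n) y≥) ⟩
    (X + δ) * (Y + δ) ≡⟨ solve 3 (λ x y d → (x :+ d) :* (y :+ d) := x :* y :+ d :* (x :+ y :+ d)) refl X Y δ ⟩
    X * Y + δ * (X + Y + δ) ≤⟨ +-mono-≤ (≤-refl {X * Y}) (*-monoˡ-≤ (<⇒≤ δ>0) (+-mono-≤ (+-mono-≤ (x≤∣x∣ X ◂ xA) (x≤∣x∣ Y ◂ yC)) δ≤1)) ⟩
    X * Y + δ * (nat A + nat C + 1#) ≡⟨ cong (λ t → X * Y + δ * t) (sym (nat-suc (A N.+ C) · cong (_+ 1#) (nat-+ A C))) ⟩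
    X * Y + δ * nat K ≤⟨ +-mono-≤ (≡⇒≤ (sym (approx-* x y n))) δK≤ε ⟩
    at (x R.* y) n + ε ∎
    where
    X = at x n
    Y = at y n

0≼y-x : ∀ {x y} → x ≼ y → 0ℝ ≼ (y R.- x)
0≼y-x {x} {y} p ε ε>0 = Eventually-map (λ n a → subst₂ (λ s t → s ≤ t + ε) (sym (approx-ℕ 0 n)) (sym (approx-+ y (R.- x) n · cong (at y n +_) (approx-neg x n)))
    (≤-add (at y n + ε - at x n - 0#) (subst (0# ≤_) (solve 1 (λ a → a := a :- # 0) refl _) (0≤y-x a)) (solve 3 (λ x y e → # 0 :+ (y :+ e :- x :- # 0) := y :- x :+ e) refl (at x n) (at y n) ε)))
  (p ε ε>0)

*-monoʳ-≼ : ∀ {x y z} → 0ℝ ≼ z → x ≼ y → (x R.* z) ≼ (y R.* z)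
*-monoʳ-≼ {x} {y} {z} z≥0 p ε ε>0 = Eventually-map (λ n a → 0≤y-x⇒x≤y (subst₂ _≤_ (approx-ℕ 0 n)
    (cong (_+ ε) (approx-* (y R.- x) z n · cong (_* at z n) (approx-+ y (R.- x) n · cong (at y n +_) (approx-neg x n))) ·
      (solve 4 (λ x y z e → (y :- x) :* z :+ e := y :* z :+ e :- x :* z) refl (at x n) (at y n) (at z n) ε ·
        cong₂ (λ s t → s + ε - t) (sym (approx-* y z n)) (sym (approx-* x z n)))) a))
  (0≼* {y R.- x} {z} (0≼y-x {x} {y} p) z≥0 ε ε>0)

*-comm-≈ : ∀ x y → (x R.* y) ≈ (y R.* x)
*-comm-≈ x y = pointwise-≈ {x R.* y} {y R.* x} λ n → approx-* x y n · *-comm _ _ · sym (approx-* y x n)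

*-mono-≼ : ∀ {x y u v} → 0ℝ ≼ u → 0ℝ ≼ y → x ≼ y → u ≼ v → (x R.* u) ≼ (y R.* v)
*-mono-≼ {x} {y} {u} {v} u≥0 y≥0 p q = ≼-trans {x R.* u} {y R.* u} {y R.* v} (*-monoʳ-≼ {x} {y} {u} u≥0 p)
  (≼-trans {y R.* u} {u R.* y} {y R.* v} (≈⇒≼ {y R.* u} {u R.* y} (*-comm-≈ y u))
    (≼-trans {u R.* y} {v R.* y} {y R.* v} (*-monoʳ-≼ {u} {v} {y} y≥0 q) (≈⇒≼ {v R.* y} {y R.* v} (*-comm-≈ v y))))

approximate : ∀ x ε → 0# < ε → ∃[ q ] ρ q ≼ x × x ≼ ρ (q + ε)
approximate x ε ε>0 with cauchy x (half ε) (half>0 ε>0)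
... | n₀ , h = at x n₀ - half ε ,
  (λ δ δ>0 → n₀ , λ n p → begin
    at x n₀ - half ε ≤⟨ ≤-add (at x n + half ε - at x n₀ + δ) (+-nonneg (0≤y-x (∣a-b∣≤⇒ (h n₀ n N.≤-refl p))) (<⇒≤ δ>0))
           (solve 4 (λ a b h d → a :- h :+ (b :+ h :- a :+ d) := b :+ d) refl (at x n₀) (at x n) (half ε) δ) ⟩
    at x n + δ ∎) ,
  (λ δ δ>0 → n₀ , λ n p → begin
    at x n ≤⟨ ∣a-b∣≤⇒ (h n n₀ p N.≤-refl) ⟩
    at x n₀ + half ε ≤⟨ ≤-add δ (<⇒≤ δ>0) (cong (_+ δ) (solve 2 (λ a h → a :+ h := a :- h :+ (h :+ h)) refl (at x n₀) (half ε) · cong (at x n₀ - half ε +_) (half+half ε))) ⟩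
    at x n₀ - half ε + ε + δ ∎)
  where open ≤-Reasoning

-- Partial sums of the exponential series

term : ℚ → ℕ → ℚ
term q k = q ^ k * inv (k !)

e : ℕ → ℚ → ℚ
e n q = sum n (term q)

private
  inv-suc! : ∀ k → nat (suc k) * inv (suc k !) ≡ inv (k !)
  inv-suc! k = cong (nat (suc k) *_) (inv-* (suc k) (k !)) · sym (*-assoc _ _ _) · cong (_* inv (k !)) (natinv (suc k)) · *-identityˡ _

suc*term : ∀ q k → nat (suc k) * term q (suc k) ≡ q * term q k
suc*term q k = solve 4 (λ n q p i → n :* (q :* p :* i) := q :* (p :* (n :* i))) refl (nat (suc k)) q (q ^ k) (inv (suc k !)) ·
  cong (λ t → q * (q ^ k * t)) (inv-suc! k)

∣^∣ : ∀ q k → ∣ q ^ k ∣ ≡ ∣ q ∣ ^ k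
∣^∣ q zero = ∣-∣-nonneg 0≤1
∣^∣ q (suc k) = (∣-∣-* q (q ^ k)) · cong (∣ q ∣ *_) (∣^∣ q k)

term-nonneg : ∀ {q} k → 0# ≤ q → 0# ≤ term q k
term-nonneg k q≥0 = *-nonneg (^-nonneg k q≥0) (0≤inv (k !))

∣term∣ : ∀ {q b} k → ∣ q ∣ ≤ b → ∣ term q k ∣ ≤ term b k
∣term∣ {q} k le = ≡⇒≤ ((∣-∣-* _ _) · cong₂ _*_ (∣^∣ q k) (∣-∣-nonneg (0≤inv (k !)))) ◂ *-monoʳ-≤ (0≤inv (k !)) (^-mono k (0≤∣-∣ q) le)

-- Both sides run over the triangle of pairs with i + j < n.
∏-sums : ∀ n (a b : ℕ → ℚ) → sum n (λ s → sum (suc s) (λ i → a i * b (s N.∸ i))) ≡ sum n (λ i → a i * sum (n N.∸ i) b)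
∏-sums zero    a b = refl
∏-sums (suc n) a b = sym (begin
  sum n (λ i → a i * sum (suc n N.∸ i) b) + a n * sum (suc n N.∸ n) b ≡⟨ cong₂ _+_ (sum-cong n λ i i<n → cong (λ m → a i * sum m b) (N.+-∸-assoc 1 (N.<⇒≤ i<n)) · *-distribˡ (a i) _ _)
         (cong (λ m → a n * sum m b) (N.+-∸-assoc 1 (N.≤-refl {n}) · cong suc (N.n∸n≡0 n))) ⟩
  sum n (λ i → a i * sum (n N.∸ i) b + a i * b (n N.∸ i)) + a n * (0# + b 0) ≡⟨ cong₂ _+_ (sum-+ n _ _) (cong (a n *_) (+-identityˡ _ · cong b (sym (N.n∸n≡0 n)))) ⟩
  sum n (λ i → a i * sum (n N.∸ i) b) + sum n (λ i → a i * b (n N.∸ i)) + a n * b (n N.∸ n) ≡⟨ +-assoc _ _ _ · cong (_+ sum (suc n) (λ i → a i * b (n N.∸ i))) (sym (∏-sums n a b)) ⟩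
  sum n (λ s → sum (suc s) (λ i → a i * b (s N.∸ i))) + sum (suc n) (λ i → a i * b (n N.∸ i)) ∎)
  where open ≡-Reasoning

-- The binomial theorem, from (s + 1) c(s + 1) = (q + r) c(s) for the convolution c.
binomial : ∀ q r s → sum (suc s) (λ i → term q i * term r (s N.∸ i)) ≡ term (q + r) s
binomial q r zero = +-identityˡ _ · cong (λ t → 1# * t * (1# * t)) inv-1 · solve 0 (# 1 :* # 1 :* (# 1 :* # 1) := # 1 :* # 1) refl · cong (1# *_) (sym inv-1)
binomial q r (suc s) = *-cancel-≡ (<-suc s) (begin
  nat (suc s) * sum (suc (suc s)) c ≡⟨ sym (sum-*ˡ (suc (suc s)) (nat (suc s)) c) ⟩
  sum (suc (suc s)) (λ i → nat (suc s) * c i) ≡⟨ sum-cong (suc (suc s)) split · sum-+ (suc (suc s)) _ _ ⟩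
  sum (suc (suc s)) (λ i → nat i * c i) + sum (suc (suc s)) (λ i → nat (suc s N.∸ i) * c i) ≡⟨ cong₂ _+_ left right ⟩
  q * d + r * d ≡⟨ sym (*-distribʳ d q r) ⟩
  (q + r) * d ≡⟨ cong ((q + r) *_) (binomial q r s) ⟩
  (q + r) * term (q + r) s ≡⟨ sym (suc*term (q + r) s) ⟩
  nat (suc s) * term (q + r) (suc s) ∎)
  where
  open ≡-Reasoning
  c : ℕ → ℚ
  c i = term q i * term r (suc s N.∸ i)
  d = sum (suc s) (λ i → term q i * term r (s N.∸ i))
  split : ∀ i → i N.< suc (suc s) → nat (suc s) * c i ≡ nat i * c i + nat (suc s N.∸ i) * c i
  split i i≤ = cong (_* c i) (cong nat (sym (N.m+[n∸m]≡n (N.≤-pred i≤))) · nat-+ i _) · *-distribʳ (c i) _ _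
  left : sum (suc (suc s)) (λ i → nat i * c i) ≡ q * d
  left = sum-shift (suc s) _ · cong (_+ sum (suc s) (λ i → nat (suc i) * c (suc i))) (*-zeroˡ (c 0)) · +-identityˡ _ ·
    (sum-cong (suc s) λ i _ → sym (*-assoc _ _ _) · cong (_* term r (s N.∸ i)) (suc*term q i) · *-assoc _ _ _) · sum-*ˡ (suc s) q _
  right : sum (suc (suc s)) (λ i → nat (suc s N.∸ i) * c i) ≡ r * d
  right = trans (cong₂ _+_ (sum-cong (suc s) λ i i≤ → step i (N.≤-pred i≤)) (cong (λ m → nat m * c (suc s)) (N.n∸n≡0 (suc s)) · *-zeroˡ _))
    (+-identityʳ _ · sum-*ˡ (suc s) r _)
    where
    step : ∀ i → i N.≤ s → nat (suc s N.∸ i) * c i ≡ r * (term q i * term r (s N.∸ i))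
    step i i≤s = cong (λ m → nat m * (term q i * term r m)) (N.+-∸-assoc 1 i≤s) · trans
      (solve 3 (λ n a b → n :* (a :* b) := a :* (n :* b)) refl (nat (suc (s N.∸ i))) (term q i) _)
      (cong (term q i *_) (suc*term r (s N.∸ i)) · solve 3 (λ a r b → a :* (r :* b) := r :* (a :* b)) refl (term q i) r _)

e-+ : ∀ n q r → e n (q + r) ≡ sum n (λ i → term q i * e (n N.∸ i) r)
e-+ n q r = (sum-cong n λ s _ → sym (binomial q r s)) · ∏-sums n (term q) (term r)

e-mono-n : ∀ {m n q} → 0# ≤ q → m N.≤ n → e m q ≤ e n q
e-mono-n {q = q} q≥0 le = sum-mono-n (term q) le (λ k → term-nonneg k q≥0)

1+q≤e : ∀ n {q} → 0# ≤ q → 1# + q ≤ e (2 N.+ n) q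
1+q≤e n {q} q≥0 = ≡⇒≤ (sym (cong₂ (λ s t → 0# + 1# * s + q * 1# * t) inv-1 inv-1 ·
    solve 1 (λ q → # 0 :+ # 1 :* # 1 :+ q :* # 1 :* # 1 := # 1 :+ q) refl q)) ◂
  e-mono-n {2} q≥0 (N.m≤m+n 2 n)

-- Comparison with the geometric series. This is the upper bound 1 / (1 - q) for the exponential, to
-- go with the lower bound 1 + q.
e-geometric : ∀ n {q} → 0# ≤ q → q ≤ 1# → (1# - q) * e n q ≤ 1#
e-geometric n {q} q≥0 q≤1 = begin
  (1# - q) * e n q ≤⟨ *-monoˡ-≤ (0≤y-x q≤1) (sum-mono n λ k _ → *-monoˡ-≤ (^-nonneg k q≥0) (inv≤1 (k !)) ◂ ≡⇒≤ (*-identityʳ _)) ⟩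
  (1# - q) * sum n (q ^_) ≤⟨ geometric n ⟩
  1# ∎
  where
  open ≤-Reasoning
  geometric : ∀ n → (1# - q) * sum n (q ^_) ≤ 1#
  geometric n = ≤-add (q ^ n) (^-nonneg n q≥0) (exact n)
    where
    exact : ∀ n → (1# - q) * sum n (q ^_) + q ^ n ≡ 1#
    exact zero = solve 1 (λ q → (# 1 :- q) :* # 0 :+ # 1 := # 1) refl q
    exact (suc n) = solve 3 (λ q s p → (# 1 :- q) :* (s :+ p) :+ q :* p := (# 1 :- q) :* s :+ p) refl q (sum n (q ^_)) (q ^ n) · exact n

module _ (B : ℕ) (1≤B : 1 N.≤ B) where

  private
    b M : ℚ
    b = nat B
    M = b ^ B
    b≥0 = 0≤nat B
    1≤b : 1# ≤ b
    1≤b = nat-mono 1≤B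

  -- For k ≤ B the factorial is dropped; beyond B each further term is multiplied by B / k ≤ 1.
  term≤ : ∀ k → term b k ≤ M
  term≤ zero = ≡⇒≤ (cong (1# *_) inv-1 · *-identityˡ 1#) ◂ 1≤^ B 1≤b
  term≤ (suc k) with suc k N.≤? B
  ... | yes le = ≤-trans (*-monoˡ-≤ (^-nonneg (suc k) b≥0) (inv≤1 (suc k !))) (≡⇒≤ (*-identityʳ _) ◂ grow le)
    where
    grow : ∀ {m n} → m N.≤ n → b ^ m ≤ b ^ n
    grow {m} {n} m≤n = (≡⇒≤ (sym (*-identityʳ _)) ◂ *-monoˡ-≤ (^-nonneg m b≥0) (1≤^ (n N.∸ m) 1≤b)) ◂
      ≡⇒≤ (sym (^-+ b m (n N.∸ m)) · cong (b ^_) (N.m+[n∸m]≡n m≤n))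
  ... | no ¬le = *-cancelˡ-≤ (<-suc k) (begin
    nat (suc k) * term b (suc k)  ≡⟨ suc*term b k ⟩
    b * term b k                  ≤⟨ *-mono-≤ b≥0 (term-nonneg k b≥0) (nat-mono (N.<⇒≤ (N.≰⇒> ¬le))) (term≤ k) ⟩
    nat (suc k) * M               ∎)
    where open ≤-Reasoning

  tailConstant : ℚ
  tailConstant = b * b * M

  tailConstant≥0 : 0# ≤ tailConstant
  tailConstant≥0 = *-nonneg (*-nonneg b≥0 b≥0) (^-nonneg B b≥0)

  -- Two steps of the recursion for the terms leave the factor 1 / ((k + 1) (k + 2)).
  term-telescopes : ∀ k → term b (2 N.+ k) ≤ tailConstant * (inv (suc k) - inv (2 N.+ k))
  term-telescopes k = *-cancelˡ-≤ (<-suc (suc k)) (*-cancelˡ-≤ (<-suc k) (begin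
    nat (suc k) * (nat (2 N.+ k) * term b (2 N.+ k)) ≡⟨ cong (nat (suc k) *_) (suc*term b (suc k)) · solve 3 (λ n b t → n :* (b :* t) := b :* (n :* t)) refl (nat (suc k)) b _ · cong (b *_) (suc*term b k) ⟩
    b * (b * term b k) ≤⟨ *-monoˡ-≤ b≥0 (*-monoˡ-≤ b≥0 (term≤ k)) ⟩
    b * (b * M) ≡⟨ solve 2 (λ b m → b :* (b :* m) := b :* b :* m :* (# 1 :+ # 0)) refl b M ⟩
    tailConstant * (1# + 0#) ≡⟨ cong (tailConstant *_) (sym (cong₂ (λ s t → s * 1# - t * 1#) refl refl · cong (λ t → t * 1# - nat (suc k) * 1#) (nat-suc (suc k)) · solve 1 (λ n → (n :+ # 1) :* # 1 :- n :* # 1 := # 1 :+ # 0) refl (nat (suc k)))) ⟩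
    tailConstant * (nat (2 N.+ k) * 1# - nat (suc k) * 1#) ≡⟨ cong₂ (λ s t → tailConstant * (nat (2 N.+ k) * s - nat (suc k) * t)) (sym (natinv (suc k))) (sym (natinv (2 N.+ k))) ⟩
    tailConstant * (nat (2 N.+ k) * (nat (suc k) * inv (suc k)) - nat (suc k) * (nat (2 N.+ k) * inv (2 N.+ k))) ≡⟨ solve 5 (λ K n m i j → K :* (m :* (n :* i) :- n :* (m :* j)) := n :* (m :* (K :* (i :- j)))) refl tailConstant (nat (suc k)) (nat (2 N.+ k)) (inv (suc k)) (inv (2 N.+ k)) ⟩
    nat (suc k) * (nat (2 N.+ k) * (tailConstant * (inv (suc k) - inv (2 N.+ k)))) ∎))
    where open ≤-Reasoning

  tail-≤ : ∀ n j → sum j (λ i → term b (2 N.+ n N.+ i)) ≤ tailConstant * inv (suc n)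
  tail-≤ n j = ≤-trans (telescoped j) (*-monoˡ-≤ tailConstant≥0 (≤-add (inv (suc n N.+ j)) (0≤inv (suc n N.+ j)) (solve 2 (λ a b → a :- b :+ b := a) refl _ _)))
    where
    telescoped : ∀ j → sum j (λ i → term b (2 N.+ n N.+ i)) ≤ tailConstant * (inv (suc n) - inv (suc n N.+ j))
    telescoped zero = ≡⇒≤ (sym (cong (λ m → tailConstant * (inv (suc n) - inv (suc m))) (N.+-identityʳ n) · cong (tailConstant *_) (+-inverseʳ _) · *-zeroʳ _))
    telescoped (suc j) = +-mono-≤ (telescoped j) (term-telescopes (n N.+ j)) ◂
      ≡⇒≤ (solve 4 (λ K a b c → K :* (a :- b) :+ K :* (b :- c) := K :* (a :- c)) refl tailConstant (inv (suc n)) (inv (suc n N.+ j)) (inv (2 N.+ (n N.+ j))) ·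
        cong (λ m → tailConstant * (inv (suc n) - inv (suc m))) (sym (N.+-suc n j)))

  e-tail : ∀ n j {q} → ∣ q ∣ ≤ b → ∣ e (2 N.+ n N.+ j) q - e (2 N.+ n) q ∣ ≤ tailConstant * inv (suc n)
  e-tail n j {q} le = begin
    ∣ e (2 N.+ n N.+ j) q - e (2 N.+ n) q ∣ ≡⟨ cong ∣_∣ (cong (_- e (2 N.+ n) q) (sum-append (2 N.+ n) j (term q)) · solve 2 (λ a b → a :+ b :- a := b) refl _ _) ⟩
    ∣ sum j (λ i → term q (2 N.+ n N.+ i)) ∣ ≤⟨ sum-∣-∣ j _ ◂ (sum-mono j λ i _ → ∣term∣ (2 N.+ n N.+ i) le) ⟩
    sum j (λ i → term b (2 N.+ n N.+ i)) ≤⟨ tail-≤ n j ⟩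
    tailConstant * inv (suc n) ∎
    where open ≤-Reasoning

  boundConstant : ℚ
  boundConstant = M + M + tailConstant

  boundConstant≥0 : 0# ≤ boundConstant
  boundConstant≥0 = +-nonneg (+-nonneg (^-nonneg B b≥0) (^-nonneg B b≥0)) tailConstant≥0

  e≤ : ∀ n → e n b ≤ boundConstant
  e≤ n = e-mono-n b≥0 (N.m≤n+m n 2) ◂ (≡⇒≤ (sum-append 2 n (term b)) ◂
    +-mono-≤ (+-mono-≤ (≡⇒≤ (+-identityˡ _) ◂ term≤ 0) (term≤ 1))
      (tail-≤ 0 n ◂ *-monoˡ-≤ tailConstant≥0 (inv≤1 1) ◂ ≡⇒≤ (*-identityʳ _)))

  -- The derivative of a term is the preceding term, so a bound for the series serves as its
  -- Lipschitz constant.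
  e-lipschitz : ∀ n {q r} → ∣ q ∣ ≤ b → ∣ r ∣ ≤ b → ∣ e n q - e n r ∣ ≤ ∣ q - r ∣ * boundConstant
  e-lipschitz zero {q} {r} _ _ = ≡⇒≤ (cong ∣_∣ (+-inverseʳ 0#) · ∣-∣-nonneg ≤-refl) ◂ *-nonneg (0≤∣-∣ (q - r)) boundConstant≥0
  e-lipschitz (suc n) {q} {r} q≤ r≤ = begin
    ∣ e (suc n) q - e (suc n) r ∣ ≡⟨ cong ∣_∣ (cong₂ _-_ (sum-shift n (term q)) (sum-shift n (term r)) ·
           (solve 3 (λ a x y → a :+ x :- (a :+ y) := x :+ :- # 1 :* y) refl (term q 0) (sum n (term q ∘ suc)) (sum n (term r ∘ suc)) ·
             sym (sum-+ n _ _ · cong (sum n (term q ∘ suc) +_) (sum-*ˡ n (- 1#) _)))) ⟩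
    ∣ sum n (λ k → term q (suc k) + - 1# * term r (suc k)) ∣ ≤⟨ sum-∣-∣ n _ ◂ (sum-mono n λ k _ → each k) ⟩
    sum n (λ k → d * term b k) ≡⟨ sum-*ˡ n d _ ⟩
    d * e n b ≤⟨ *-monoˡ-≤ (0≤∣-∣ (q - r)) (e≤ n) ⟩
    d * boundConstant ∎
    where
    open ≤-Reasoning
    d = ∣ q - r ∣
    powers : ∀ k → ∣ q ^ suc k - r ^ suc k ∣ ≤ nat (suc k) * (d * b ^ k)
    powers zero = ≡⇒≤ (cong ∣_∣ (solve 2 (λ q r → q :* # 1 :- r :* # 1 := q :- r) refl q r) · solve 1 (λ d → d := # 1 :* (d :* # 1)) refl d)
    powers (suc k) = begin
      ∣ q * q ^ suc k - r * r ^ suc k ∣ ≡⟨ cong ∣_∣ (solve 4 (λ q r x y → q :* x :- r :* y := q :* (x :- y) :+ (q :- r) :* y) refl q r (q ^ suc k) (r ^ suc k)) ⟩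
      ∣ q * (q ^ suc k - r ^ suc k) + (q - r) * r ^ suc k ∣ ≤⟨ ∣-∣-triangle _ _ ◂ +-mono-≤ (≡⇒≤ (∣-∣-* _ _)) (≡⇒≤ ((∣-∣-* _ _) · cong (d *_) (∣^∣ r (suc k)))) ⟩
      ∣ q ∣ * ∣ q ^ suc k - r ^ suc k ∣ + d * ∣ r ∣ ^ suc k ≤⟨ +-mono-≤ (*-mono-≤ (0≤∣-∣ q) (0≤∣-∣ _) q≤ (powers k)) (*-monoˡ-≤ (0≤∣-∣ (q - r)) (^-mono (suc k) (0≤∣-∣ r) r≤)) ⟩
      b * (nat (suc k) * (d * b ^ k)) + d * (b * b ^ k) ≡⟨ solve 4 (λ b n d p → b :* (n :* (d :* p)) :+ d :* (b :* p) := (n :+ # 1) :* (d :* (b :* p))) refl b (nat (suc k)) d (b ^ k) · cong (_* (d * (b * b ^ k))) (sym (nat-suc (suc k))) ⟩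
      nat (2 N.+ k) * (d * b ^ suc k) ∎
    each : ∀ k → ∣ term q (suc k) + - 1# * term r (suc k) ∣ ≤ d * term b k
    each k = begin
      ∣ q ^ suc k * i + - 1# * (r ^ suc k * i) ∣ ≡⟨ cong ∣_∣ (solve 3 (λ x y i → x :* i :+ :- # 1 :* (y :* i) := (x :- y) :* i) refl (q ^ suc k) (r ^ suc k) i) · (∣-∣-* _ _) · cong (∣ q ^ suc k - r ^ suc k ∣ *_) (∣-∣-nonneg (0≤inv (suc k !))) ⟩
      ∣ q ^ suc k - r ^ suc k ∣ * i ≤⟨ *-monoʳ-≤ (0≤inv (suc k !)) (powers k) ⟩
      nat (suc k) * (d * b ^ k) * i ≡⟨ solve 4 (λ n d p i → n :* (d :* p) :* i := d :* (p :* (n :* i))) refl (nat (suc k)) d (b ^ k) i · cong (λ t → d * (b ^ k * t)) (inv-suc! k) ⟩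
      d * term b k ∎
      where i = inv (suc k !)

-- The discrepancy is dominated by that of e(n, b)² and e(n, 2b), which lies below e(2n, 2b).
e-* : ∀ B (1≤B : 1 N.≤ B) n {q r} → ∣ q ∣ ≤ nat B → ∣ r ∣ ≤ nat B →
  ∣ e (2 N.+ n) q * e (2 N.+ n) r - e (2 N.+ n) (q + r) ∣ ≤ tailConstant (B N.+ B) (1≤B ◃ N.m≤m+n B B) * inv (suc n)
e-* B 1≤B n {q} {r} q≤ r≤ = begin
  ∣ e N q * e N r - e N (q + r) ∣ ≡⟨ cong ∣_∣ (cong₂ _-_ (sym (sum-*ʳ N (e N r) (term q))) (e-+ N q r) · difference q r) ⟩
  ∣ sum N (λ i → term q i * (e N r - e (N N.∸ i) r)) ∣ ≤⟨ sum-∣-∣ N _ ◂ (sum-mono N λ i _ → ≡⇒≤ (∣-∣-* _ _) ◂ *-mono-≤ (0≤∣-∣ _) (0≤∣-∣ _) (∣term∣ i q≤) (tails i)) ⟩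
  sum N (λ i → term b i * (e N b - e (N N.∸ i) b)) ≡⟨ sym (difference b b) ⟩
  sum N (λ i → term b i * e N b) - sum N (λ i → term b i * e (N N.∸ i) b) ≤⟨ +-mono-≤ square (≡⇒≤ (cong (-_) (sym (e-+ N b b)))) ⟩
  e (N N.+ N) (b + b) - e N (b + b) ≤⟨ x≤∣x∣ _ ◂ e-tail (B N.+ B) 1≤2B n N 2b≤ ⟩
  tailConstant (B N.+ B) 1≤2B * inv (suc n) ∎
  where
  open ≤-Reasoning
  N = 2 N.+ n
  b = nat B
  b≥0 = 0≤nat B
  1≤2B : 1 N.≤ B N.+ B
  1≤2B = 1≤B ◃ N.m≤m+n B B
  2b≤ : ∣ b + b ∣ ≤ nat (B N.+ B)
  2b≤ = ≡⇒≤ (∣-∣-nonneg (+-nonneg b≥0 b≥0) · sym (nat-+ B B))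
  difference : ∀ q r → sum N (λ i → term q i * e N r) - sum N (λ i → term q i * e (N N.∸ i) r) ≡ sum N (λ i → term q i * (e N r - e (N N.∸ i) r))
  difference q r = solve 2 (λ a b → a :- b := a :+ :- # 1 :* b) refl _ _ · cong (sum N (λ i → term q i * e N r) +_) (sym (sum-*ˡ N (- 1#) _)) ·
    sym (sum-+ N _ _) · (sum-cong N λ i _ → solve 3 (λ a x y → a :* x :+ :- # 1 :* (a :* y) := a :* (x :- y)) refl (term q i) (e N r) (e (N N.∸ i) r))
  tails : ∀ i → ∣ e N r - e (N N.∸ i) r ∣ ≤ e N b - e (N N.∸ i) b
  tails i = begin
    ∣ e N r - e m r ∣ ≡⟨ cong ∣_∣ (gap r) ⟩
    ∣ sum (N N.∸ m) (λ j → term r (m N.+ j)) ∣ ≤⟨ sum-∣-∣ (N N.∸ m) _ ◂ (sum-mono (N N.∸ m) λ j _ → ∣term∣ (m N.+ j) r≤) ⟩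
    sum (N N.∸ m) (λ j → term b (m N.+ j)) ≡⟨ sym (gap b) ⟩
    e N b - e m b ∎
    where
    m = N N.∸ i
    gap : ∀ q → e N q - e m q ≡ sum (N N.∸ m) (λ j → term q (m N.+ j))
    gap q = cong (_- e m q) (cong (λ t → sum t (term q)) (sym (N.m+[n∸m]≡n (N.m∸n≤m N i))) · sum-append m (N N.∸ m) (term q)) · solve 2 (λ a b → a :+ b :- a := b) refl _ _
  square : sum N (λ i → term b i * e N b) ≤ e (N N.+ N) (b + b)
  square = begin
    sum N (λ i → term b i * e N b) ≤⟨ sum-mono N (λ i i<N → *-monoˡ-≤ (term-nonneg i b≥0) (e-mono-n b≥0 (N.m≤m+n N (N N.∸ i) ◃ N.≤-reflexive (sym (N.+-∸-assoc N (N.<⇒≤ i<N)))))) ⟩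
    sum N (λ i → term b i * e (N N.+ N N.∸ i) b) ≤⟨ sum-mono-n _ (N.m≤m+n N N) (λ i → *-nonneg (term-nonneg i b≥0) (sum-nonneg (N N.+ N N.∸ i) λ k _ → term-nonneg k b≥0)) ⟩
    sum (N N.+ N) (λ i → term b i * e (N N.+ N N.∸ i) b) ≡⟨ sym (e-+ (N N.+ N) b b) ⟩
    e (N N.+ N) (b + b) ∎

-- The exponential function on the reals

shrink : ∀ K {δ} → 0# < δ → ∃[ δ' ] 0# < δ' × δ' * K ≤ δ
shrink K {δ} δ>0 = δ * inv (suc (ceiling K)) , *-pos δ>0 (0<inv (ceiling K)) , (begin
  δ * inv (suc (ceiling K)) * K ≤⟨ *-monoˡ-≤ (*-nonneg (<⇒≤ δ>0) (0≤inv (suc (ceiling K)))) (≤-ceiling K ◂ nat-mono (N.n≤1+n _)) ⟩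
  δ * inv (suc (ceiling K)) * nat (suc (ceiling K)) ≡⟨ *-assoc _ _ _ · cong (δ *_) (invnat (suc (ceiling K))) · *-identityʳ δ ⟩
  δ ∎)
  where open ≤-Reasoning

vanish : ∀ {K δ} → 0# ≤ K → 0# < δ → Eventually (λ n → K * inv (suc n) ≤ δ)
vanish {K} {δ} K≥0 δ>0 = n₀ , λ n le → ≤-trans (*-monoˡ-≤ K≥0 (inv-anti (s≤s le))) base
  where
  n₀ = ceiling (K * recip δ>0)
  base : K * inv (suc n₀) ≤ δ
  base = begin
    K * inv (suc n₀) ≡⟨ sym (*-identityʳ _) · cong (K * inv (suc n₀) *_) (sym (*-recip δ>0)) · solve 4 (λ K i d r → K :* i :* (d :* r) := d :* ((K :* r) :* i)) refl K (inv (suc n₀)) δ (recip δ>0) ⟩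
    δ * (K * recip δ>0 * inv (suc n₀)) ≤⟨ *-monoˡ-≤ (<⇒≤ δ>0) (*-monoʳ-≤ (0≤inv (suc n₀)) (≤-ceiling _ ◂ nat-mono (N.n≤1+n n₀))) ⟩
    δ * (nat (suc n₀) * inv (suc n₀)) ≡⟨ cong (δ *_) (natinv (suc n₀)) · *-identityʳ δ ⟩
    δ ∎
    where open ≤-Reasoning

e-tail' : ∀ B₀ (1≤B : 1 N.≤ B₀) n m {q} → 2 N.+ n N.≤ m → ∣ q ∣ ≤ nat B₀ → ∣ e m q - e (2 N.+ n) q ∣ ≤ tailConstant B₀ 1≤B * inv (suc n)
e-tail' B₀ 1≤B n m {q} le q≤ = subst (λ k → ∣ e k q - e (2 N.+ n) q ∣ ≤ tailConstant B₀ 1≤B * inv (suc n)) (N.m+[n∸m]≡n le) (e-tail B₀ 1≤B n (m N.∸ (2 N.+ n)) q≤)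

bound⁺ : ∀ x → ∃[ B₀ ] 1 N.≤ B₀ × Eventually (λ n → ∣ at x n ∣ ≤ nat B₀)
bound⁺ x with bounded x
... | B₀ , h = suc B₀ , s≤s z≤n , Eventually-map (λ _ le → le ◂ nat-mono (N.n≤1+n B₀)) h

≼-bound⁺ : ∀ x → x ≼ ρ (nat (proj₁ (bound⁺ x)))
≼-bound⁺ x ε ε>0 = Eventually-map (λ n le → x≤∣x∣ _ ◂ le ◂ ≤-add ε (<⇒≤ ε>0) refl) (proj₂ (proj₂ (bound⁺ x)))

common-bound : ∀ x y → ∃[ B₀ ] 1 N.≤ B₀ × Eventually (λ n → ∣ at x n ∣ ≤ nat B₀ × ∣ at y n ∣ ≤ nat B₀)
common-bound x y with bound⁺ x | bound⁺ y
... | A , 1≤A , hx | C , 1≤C , hy = A N.+ C , 1≤A ◃ (N.m≤m+n A C) , Eventually-map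
  (λ _ (p , q) → p ◂ nat-mono (N.m≤m+n A C) , q ◂ nat-mono (N.m≤n+m C A)) (Eventually-× hx hy)

-- The index m is both the precision of the argument and the length of the series. Comparison at a
-- fixed length N separates the two: tails on either side, the Lipschitz bound in between.
X-cauchy : ∀ x → Cauchy (λ m → e m (at x m))
X-cauchy x ε ε>0 = n₀ , close
  where
  open ≤-Reasoning
  B₀ n n₁ n₂ N n₀ : ℕ
  B₀ = proj₁ (bound⁺ x)
  1≤B : 1 N.≤ B₀
  1≤B = proj₁ (proj₂ (bound⁺ x))
  n₁ = proj₁ (proj₂ (proj₂ (bound⁺ x)))
  bd : ∀ n → n₁ N.≤ n → ∣ at x n ∣ ≤ nat B₀
  bd = proj₂ (proj₂ (proj₂ (bound⁺ x)))
  K : ℚ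
  K = boundConstant B₀ 1≤B
  n = proj₁ (vanish (tailConstant≥0 B₀ 1≤B) (half>0 (half>0 ε>0)))
  small : tailConstant B₀ 1≤B * inv (suc n) ≤ half (half ε)
  small = proj₂ (vanish (tailConstant≥0 B₀ 1≤B) (half>0 (half>0 ε>0))) n N.≤-refl
  δ : ℚ
  δ = proj₁ (shrink K (half>0 ε>0))
  δ>0 : 0# < δ
  δ>0 = proj₁ (proj₂ (shrink K (half>0 ε>0)))
  δ≤ : δ * K ≤ half ε
  δ≤ = proj₂ (proj₂ (shrink K (half>0 ε>0)))
  n₂ = proj₁ (cauchy x δ δ>0)
  cx : ∀ m m' → n₂ N.≤ m → n₂ N.≤ m' → ∣ at x m - at x m' ∣ ≤ δ
  cx = proj₂ (cauchy x δ δ>0)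
  N = 2 N.+ n
  n₀ = N N.+ (n₁ N.+ n₂)
  n₁≤ : ∀ {m} → n₀ N.≤ m → n₁ N.≤ m
  n₁≤ p = (N.m≤m+n n₁ n₂ ◃ N.m≤n+m _ N) ◃ p
  n₂≤ : ∀ {m} → n₀ N.≤ m → n₂ N.≤ m
  n₂≤ p = (N.m≤n+m n₂ n₁ ◃ N.m≤n+m _ N) ◃ p
  tail : ∀ m → n₀ N.≤ m → ∣ e m (at x m) - e N (at x m) ∣ ≤ half (half ε)
  tail m p = e-tail' B₀ 1≤B n m (N.m≤m+n N _ ◃ p) (bd m (n₁≤ p)) ◂ small
  triangle : ∀ a b c d → ∣ a - d ∣ ≤ ∣ a - b ∣ + ∣ b - c ∣ + ∣ d - c ∣
  triangle a b c d = begin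
    ∣ a - d ∣ ≡⟨ cong ∣_∣ (solve 4 (λ a b c d → a :- d := (a :- b) :+ (b :- c) :+ :- (d :- c)) refl a b c d) ⟩
    ∣ a - b + (b - c) + - (d - c) ∣ ≤⟨ ∣-∣-triangle _ _ ◂ +-mono-≤ (∣-∣-triangle _ _) (≡⇒≤ (∣-∣-neg _)) ⟩
    ∣ a - b ∣ + ∣ b - c ∣ + ∣ d - c ∣ ∎
  close : ∀ m m' → n₀ N.≤ m → n₀ N.≤ m' → ∣ e m (at x m) - e m' (at x m') ∣ ≤ ε
  close m m' p p' = begin
    ∣ e m (at x m) - e m' (at x m') ∣ ≤⟨ triangle (e m (at x m)) (e N (at x m)) (e N (at x m')) (e m' (at x m')) ⟩
    ∣ e m (at x m) - e N (at x m) ∣ + ∣ e N (at x m) - e N (at x m') ∣ + ∣ e m' (at x m') - e N (at x m') ∣ ≤⟨ +-mono-≤ (+-mono-≤ (tail m p) (e-lipschitz B₀ 1≤B N (bd m (n₁≤ p)) (bd m' (n₁≤ p')) ◂ *-monoʳ-≤ (boundConstant≥0 B₀ 1≤B) (cx m m' (n₂≤ p) (n₂≤ p')) ◂ δ≤)) (tail m' p') ⟩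
    half (half ε) + half ε + half (half ε) ≡⟨ solve 2 (λ a b → a :+ b :+ a := a :+ a :+ b) refl (half (half ε)) (half ε) · cong (_+ half ε) (half+half (half ε)) · half+half ε ⟩
    ε ∎

opaque
  X : ℝ → ℝ
  X x = mkReal (λ m → e m (at x m)) (X-cauchy x)

  approx-X : ∀ x m → at (X x) m ≡ e m (at x m)
  approx-X x m = approx-mkReal (λ m → e m (at x m)) (X-cauchy x) m

X-lipschitz : ∀ {x y} B₀ (1≤B : 1 N.≤ B₀) {δ} → Eventually (λ n → ∣ at x n ∣ ≤ nat B₀ × ∣ at y n ∣ ≤ nat B₀) →
  Eventually (λ n → ∣ at x n - at y n ∣ ≤ δ) → Eventually (λ n → ∣ at (X x) n - at (X y) n ∣ ≤ δ * boundConstant B₀ 1≤B)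
X-lipschitz {x} {y} B₀ 1≤B {δ} bd cl = Eventually-map (λ n ((p , q) , d) → subst₂ (λ s t → ∣ s - t ∣ ≤ δ * boundConstant B₀ 1≤B) (sym (approx-X x n)) (sym (approx-X y n))
    (e-lipschitz B₀ 1≤B n p q ◂ *-monoʳ-≤ (boundConstant≥0 B₀ 1≤B) d))
  (Eventually-× bd cl)

X-cong : ∀ {x y} → x ≈ y → X x ≈ X y
X-cong {x} {y} h = close⇒≈ {X x} {X y} λ ε ε>0 →
  let (B₀ , 1≤B , bd) = common-bound x y
      (δ , δ>0 , δ≤) = shrink (boundConstant B₀ 1≤B) ε>0
  in Eventually-map (λ _ le → le ◂ δ≤) (X-lipschitz {x} {y} B₀ 1≤B bd (≈⇒close {x} {y} h δ δ>0))

X-+ : ∀ x y → X (x R.+ y) ≈ (X x R.* X y)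
X-+ x y = ≈-sym {X x R.* X y} {X (x R.+ y)} (close⇒≈ {X x R.* X y} {X (x R.+ y)} λ ε ε>0 →
  let (B₀ , 1≤B , bd) = common-bound x y
      (n₀ , small) = vanish (tailConstant≥0 (B₀ N.+ B₀) (1≤B ◃ N.m≤m+n B₀ B₀)) ε>0
      shifted : Eventually (λ m → ∃[ n ] m ≡ 2 N.+ n × n₀ N.≤ n)
      shifted = 2 N.+ n₀ , λ m le → m N.∸ 2 , sym (N.m+[n∸m]≡n (N.m≤m+n 2 n₀ ◃ le)) , N.≤-reflexive (sym (N.m+n∸m≡n 2 n₀)) ◃ N.∸-monoˡ-≤ 2 le
  in Eventually-map (λ { m ((p , q) , (n , refl , le)) →
       subst₂ (λ s t → ∣ s - t ∣ ≤ ε) (sym (approx-* (X x) (X y) m · cong₂ _*_ (approx-X x m) (approx-X y m))) (sym (approx-X (x R.+ y) m · cong (e m) (approx-+ x y m)))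
         (e-* B₀ 1≤B n p q ◂ small n le) })
     (Eventually-× bd shifted))

X-geometric : ∀ {q} → 0# ≤ q → q ≤ 1# → (ρ (1# - q) R.* X (ρ q)) ≼ 1ℝ
X-geometric {q} q≥0 q≤1 = pointwise-≼ {ρ (1# - q) R.* X (ρ q)} {1ℝ} λ n →
  subst₂ _≤_ (sym (approx-* (ρ (1# - q)) (X (ρ q)) n · cong ((1# - q) *_) (approx-X (ρ q) n))) (sym (approx-ℕ 1 n)) (e-geometric n q≥0 q≤1)

X-0 : X 0ℝ ≈ 1ℝ
X-0 = close⇒≈ {X 0ℝ} {1ℝ} λ ε ε>0 → 1 , λ { (suc m) _ → ≡⇒≤ (cong ∣_∣ (cong₂ _-_ (approx-X 0ℝ (suc m) · cong (e (suc m)) (approx-ℕ 0 (suc m)) · e0 m) (approx-ℕ 1 (suc m)) · +-inverseʳ 1#) · ∣-∣-nonneg ≤-refl) ◂ (<⇒≤ ε>0) }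
  where
  e0 : ∀ m → e (suc m) 0# ≡ 1#
  e0 m = sum-shift m (term 0#) · cong₂ _+_ (cong (1# *_) inv-1 · *-identityˡ 1#) (sum-zero m λ k _ → cong (_* inv (suc k !)) (*-zeroˡ _) · *-zeroˡ _) · +-identityʳ 1#

≼-eps : ∀ {x y} → (∀ δ → 0# < δ → x ≼ (y R.+ ρ δ)) → x ≼ y
≼-eps {x} {y} h ε ε>0 = Eventually-map (λ n le → le ◂ ≡⇒≤ (cong (_+ half ε) (approx-+ y (ρ (half ε)) n) · +-assoc _ _ _ · cong (at y n +_) (half+half ε)))
  (h (half ε) (half>0 ε>0) (half ε) (half>0 ε>0))

-- For nonnegative x one cannot apply 1 + q ≤ e(n, q) to the approximants, which may be slightly negative.
1+x≼X : ∀ {x} → 0ℝ ≼ x → (1ℝ R.+ x) ≼ X x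
1+x≼X {x} x≥0 ε ε>0 with bound⁺ x
... | B₀ , 1≤B , bd with shrink (boundConstant (suc B₀) (s≤s z≤n)) (half>0 ε>0) | half>0 ε>0
...   | δ , δ>0 , δ≤ | h>0 = Eventually-map step (Eventually-× (Eventually-× bd (x≥0 d d>0)) (2 , λ n le → le))
  where
  open ≤-Reasoning
  d : ℚ
  d = δ * inv (suc (ceiling δ))
  d>0 : 0# < d
  d>0 = *-pos δ>0 (0<inv (ceiling δ))
  d≤δ : d ≤ δ
  d≤δ = *-monoˡ-≤ (<⇒≤ δ>0) (inv≤1 (suc (ceiling δ))) ◂ ≡⇒≤ (*-identityʳ δ)
  d≤1 : d ≤ 1#
  d≤1 = *-monoʳ-≤ (0≤inv (suc (ceiling δ))) (≤-ceiling δ ◂ nat-mono (N.n≤1+n _)) ◂ ≡⇒≤ (natinv (suc (ceiling δ)))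
  main : ∀ m q → ∣ q ∣ ≤ nat B₀ → 0# ≤ q + d → 1# + q ≤ e (2 N.+ m) q + ε
  main m q q≤B q+d≥0 = begin
    1# + q ≤⟨ ≤-add d (<⇒≤ d>0) (+-assoc 1# q d) ⟩
    1# + (q + d) ≤⟨ 1+q≤e m q+d≥0 ⟩
    e (2 N.+ m) (q + d) ≤⟨ ∣a-b∣≤⇒ (e-lipschitz (suc B₀) (s≤s z≤n) (2 N.+ m) q+d≤ (q≤B ◂ nat-mono (N.n≤1+n B₀))) ⟩
    e (2 N.+ m) q + ∣ q + d - q ∣ * boundConstant (suc B₀) (s≤s z≤n) ≡⟨ cong (λ t → e (2 N.+ m) q + t * boundConstant (suc B₀) (s≤s z≤n)) (cong ∣_∣ (solve 2 (λ q d → q :+ d :- q := d) refl q d) · ∣-∣-nonneg (<⇒≤ d>0)) ⟩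
    e (2 N.+ m) q + d * boundConstant (suc B₀) (s≤s z≤n) ≤⟨ +-mono-≤ (≤-refl {e (2 N.+ m) q}) (*-monoʳ-≤ (boundConstant≥0 (suc B₀) (s≤s z≤n)) d≤δ ◂ δ≤ ◂ (<⇒≤ (half< ε>0))) ⟩
    e (2 N.+ m) q + ε ∎
    where
    q+d≤ : ∣ q + d ∣ ≤ nat (suc B₀)
    q+d≤ = ∣-∣-triangle q d ◂ +-mono-≤ q≤B (≡⇒≤ (∣-∣-nonneg (<⇒≤ d>0)) ◂ d≤1) ◂ ≡⇒≤ (sym (nat-suc B₀))
  step : ∀ n → (∣ at x n ∣ ≤ nat B₀ × at 0ℝ n ≤ at x n + d) × 2 N.≤ n → at (1ℝ R.+ x) n ≤ at (X x) n + ε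
  step n ((x≤B , x≥-d) , 2≤n) = subst₂ (λ s t → s ≤ t + ε) (sym (approx-+ 1ℝ x n · cong (_+ at x n) (approx-ℕ 1 n))) (sym (approx-X x n))
    (subst (λ m → 1# + at x n ≤ e m (at x n) + ε) (N.m+[n∸m]≡n 2≤n) (main (n N.∸ 2) (at x n) x≤B (subst (_≤ at x n + d) (approx-ℕ 0 n) x≥-d)))

opaque
  unfolding int _+_ _*_ -_ _≤_ _<_ ∣_∣

  halves : ∀ x → (ρ (inv 2) R.* x R.+ ρ (inv 2) R.* x) ≈ x
  halves x = pointwise-≈ {ρ (inv 2) R.* x R.+ ρ (inv 2) R.* x} {x} λ n → half+half (at x n)

  0≼square : ∀ x → 0ℝ ≼ (x R.* x)
  0≼square x = pointwise-≼ {0ℝ} {x R.* x} λ n → sq-nonneg (at x n)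

-- X x is the square of X (x / 2).
0≼X : ∀ x → 0ℝ ≼ X x
0≼X x = chain 0ℝ ≼⟨ square ⟩ X y R.* X y ∼˘⟨ X-+ y y ⟩ X (y R.+ y) ∼⟨ X-cong {y R.+ y} {x} y+y≈x ⟩ X x □
  where
  y : ℝ
  y = ρ (inv 2) R.* x
  y+y≈x : (y R.+ y) ≈ x
  y+y≈x = halves x
  square : 0ℝ ≼ (X y R.* X y)
  square = 0≼square (X y)

X-mono : ∀ {x y} → x ≼ y → X x ≼ X y
X-mono {x} {y} le = chain
  X x ∼˘⟨ 1*x≈x (X x) ⟩
  1ℝ R.* X x ≼⟨ *-monoʳ-≼ {1ℝ} {X d} {X x} (0≼X x) (chain 1ℝ ∼˘⟨ x+0≈x 1ℝ ⟩ 1ℝ R.+ 0ℝ ≼⟨ +-mono-≼ {1ℝ} {1ℝ} {0ℝ} {d} (≼-refl {1ℝ}) d≥0 ⟩ 1ℝ R.+ d ≼⟨ 1+x≼X {d} d≥0 ⟩ X d □) ⟩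
  X d R.* X x ∼˘⟨ X-+ d x ⟩
  X (d R.+ x) ∼⟨ X-cong {d R.+ x} {y} (y-x+x≈y x y) ⟩
  X y □
  where
  d : ℝ
  d = y R.- x
  d≥0 = 0≼y-x {x} {y} le

-- If x ≰ y, then X(x) X(−y) ≈ X(x − y) exceeds 1 ≈ X(y) X(−y) by the gap.
X-cancel : ∀ {x y} → X x ≼ X y → x ≼ y
X-cancel {x} {y} le = ≤⇒≼ {x} {y} λ y<x → impossible (<⇒gap {y} {x} y<x)
  where
  d : ℝ
  d = x R.- y
  Xd≼1 : X d ≼ 1ℝ
  Xd≼1 = chain
    X d ∼⟨ X-+ x (R.- y) ⟩
    X x R.* X (R.- y) ≼⟨ *-monoʳ-≼ {X x} {X y} {X (R.- y)} (0≼X (R.- y)) le ⟩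
    X y R.* X (R.- y) ∼˘⟨ X-+ y (R.- y) ⟩
    X (y R.- y) ∼⟨ X-cong {y R.- y} {0ℝ} (x-x≈0 y) ⟩
    X 0ℝ ∼⟨ X-0 ⟩
    1ℝ □
  impossible : ∃[ ε ] 0# < ε × Eventually (λ n → at y n + ε ≤ at x n) → ⊥
  impossible (ε , ε>0 , gap) = <⇒≱ ε>0 (≼-ℚ {ε} {0#} (chain ρ ε ≼⟨ ε≼d ⟩ d ≼⟨ d≼0 ⟩ ρ 0# □))
    where
    ε≼d : ρ ε ≼ d
    ε≼d δ δ>0 = Eventually-map (λ n g → subst (λ t → ε ≤ t + δ) (sym (approx-minus x y n))
      (≤-add (at x n - (at y n + ε) + δ) (+-nonneg (0≤y-x g) (<⇒≤ δ>0)) (solve 4 (λ e x y d → e :+ (x :- (y :+ e) :+ d) := x :- y :+ d) refl ε (at x n) (at y n) δ))) gap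
    d≥0 : 0ℝ ≼ d
    d≥0 = chain 0ℝ ⊴⟨ (λ n → ≡⇒≤ (approx-ℕ 0 n) ◂ (<⇒≤ ε>0)) ⟩ ρ ε ≼⟨ ε≼d ⟩ d □
    d≼0 : d ≼ ρ 0#
    d≼0 δ δ>0 = Eventually-map (λ n le → ≤-add (1# + δ - (1# + at d n)) (0≤y-x (subst₂ (λ s t → s ≤ t + δ) (approx-+ 1ℝ d n · cong (_+ at d n) (approx-ℕ 1 n)) (approx-ℕ 1 n) le))
        (solve 2 (λ a d → a :+ (# 1 :+ d :- (# 1 :+ a)) := # 0 :+ d) refl (at d n) δ))
      ((chain 1ℝ R.+ d ≼⟨ 1+x≼X {d} d≥0 ⟩ X d ≼⟨ Xd≼1 ⟩ 1ℝ □) δ δ>0)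

*-cong-≈ : ∀ {x y u v} → x ≈ y → u ≈ v → (x R.* u) ≈ (y R.* v)
*-cong-≈ {x} {y} {u} {v} p q = close⇒≈ {x R.* u} {y R.* v} λ ε ε>0 →
  let (A , _ , ux) = bound⁺ u
      (C , _ , vy) = bound⁺ y
      (δ , δ>0 , δ≤) = shrink (nat A + nat C) ε>0
  in Eventually-map (λ n ((u≤ , y≤) , (a , b)) → begin
       ∣ at (x R.* u) n - at (y R.* v) n ∣ ≡⟨ cong ∣_∣ (cong₂ _-_ (approx-* x u n) (approx-* y v n) · solve 4 (λ x y u v → x :* u :- y :* v := (x :- y) :* u :+ y :* (u :- v)) refl (at x n) (at y n) (at u n) (at v n)) ⟩
       ∣ (at x n - at y n) * at u n + at y n * (at u n - at v n) ∣ ≤⟨ ∣-∣-triangle _ _ ◂ +-mono-≤ (≡⇒≤ (∣-∣-* _ _)) (≡⇒≤ (∣-∣-* _ _)) ⟩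
       ∣ at x n - at y n ∣ * ∣ at u n ∣ + ∣ at y n ∣ * ∣ at u n - at v n ∣ ≤⟨ +-mono-≤ (*-mono-≤ (0≤∣-∣ _) (0≤∣-∣ _) a u≤) (*-mono-≤ (0≤∣-∣ _) (0≤∣-∣ _) y≤ b) ⟩
       δ * nat A + nat C * δ ≡⟨ solve 3 (λ d a c → d :* a :+ c :* d := d :* (a :+ c)) refl δ (nat A) (nat C) ⟩
       δ * (nat A + nat C) ≤⟨ δ≤ ⟩
       ε ∎)
     (Eventually-× (Eventually-× ux vy) (Eventually-× (≈⇒close {x} {y} p δ δ>0) (≈⇒close {u} {v} q δ δ>0)))
  where open ≤-Reasoning

opaque
  unfolding int _+_ _*_ -_ _≤_ _<_ ∣_∣

  fromℕ-suc : ∀ n → fromℕ (suc n) ≈ (1ℝ R.+ fromℕ n)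
  fromℕ-suc n = pointwise-≈ {fromℕ (suc n)} {1ℝ R.+ fromℕ n} λ _ → nat-+ 1 n

  [1+a]*x : ∀ a x → ((1ℝ R.+ a) R.* x) ≈ (x R.+ a R.* x)
  [1+a]*x a x = pointwise-≈ {(1ℝ R.+ a) R.* x} {x R.+ a R.* x} λ m → solve 2 (λ a x → (# 1 :+ a) :* x := x :+ a :* x) refl (at a m) (at x m)

  0*x : ∀ x → (fromℕ 0 R.* x) ≈ 0ℝ
  0*x x = pointwise-≈ {fromℕ 0 R.* x} {0ℝ} λ m → *-zeroˡ (at x m)

X-step : ∀ a b x y → b ≈ (1ℝ R.+ a) → X (a R.* x) ≈ y → X (b R.* x) ≈ (X x R.* y)
X-step a b x y eq h = ≈-trans {X (b R.* x)} {X (x R.+ a R.* x)} {X x R.* y}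
  (X-cong {b R.* x} {x R.+ a R.* x} (≈-trans {b R.* x} {(1ℝ R.+ a) R.* x} {x R.+ a R.* x} (*-cong-≈ {b} {1ℝ R.+ a} {x} {x} eq (≈-refl {x})) ([1+a]*x a x)))
  (≈-trans {X (x R.+ a R.* x)} {X x R.* X (a R.* x)} {X x R.* y} (X-+ x (a R.* x))
    (*-cong-≈ {X x} {X x} {X (a R.* x)} {y} (≈-refl {X x}) h))

X-zero : ∀ x → X (fromℕ 0 R.* x) ≈ 1ℝ
X-zero x = ≈-trans {X (fromℕ 0 R.* x)} {X 0ℝ} {1ℝ} (X-cong {fromℕ 0 R.* x} {0ℝ} (0*x x)) X-0

ℕ-rec : (P : ℕ → Set) → P 0 → (∀ n → P n → P (suc n)) → ∀ n → P n
ℕ-rec P p₀ p₁ zero = p₀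
ℕ-rec P p₀ p₁ (suc n) = p₁ n (ℕ-rec P p₀ p₁ n)

X-power : ∀ n x → X (fromℕ n R.* x) ≈ (X x R.^ℕ n)
X-power n x = ℕ-rec (λ n → X (fromℕ n R.* x) ≈ (X x R.^ℕ n)) (X-zero x)
  (λ n → X-step (fromℕ n) (fromℕ (suc n)) x (X x R.^ℕ n) (fromℕ-suc n)) n

0≼fromℚ : ∀ {q} → 0# ≤ q → 0ℝ ≼ ρ q
0≼fromℚ {q} q≥0 = pointwise-≼ {0ℝ} {ρ q} λ m → ≡⇒≤ (approx-ℕ 0 m) ◂ q≥0

-- z is the real with approximants t, up to equality.
record Represents (z : ℝ) (t : ℕ → ℚ) : Set where
  constructor represents
  field within : ∀ ε → 0# < ε → Eventually (λ m → ∣ at z m - t m ∣ ≤ ε)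

open Represents

represents-exact : ∀ {z t} → (∀ m → at z m ≡ t m) → Represents z t
represents-exact {z} {t} h = represents λ ε ε>0 → 0 , λ m _ → ≡⇒≤ (cong (λ s → ∣ s - t m ∣) (h m) · cong ∣_∣ (+-inverseʳ (t m)) · ∣-∣-nonneg ≤-refl) ◂ (<⇒≤ ε>0)

represents-≈ : ∀ {z w t} → z ≈ w → (∀ m → at w m ≡ t m) → Represents z t
represents-≈ {z} {w} {t} h eq = represents λ ε ε>0 → Eventually-map (λ m le → subst (λ s → ∣ at z m - s ∣ ≤ ε) (eq m) le) (≈⇒close {z} {w} h ε ε>0)

represents-+ : ∀ {z w s t} → Represents z s → Represents w t → Represents (z R.+ w) (λ m → s m + t m)
represents-+ {z} {w} {s} {t} p q = represents λ ε ε>0 → Eventually-map (step ε) (Eventually-× (within p (half ε) (half>0 ε>0)) (within q (half ε) (half>0 ε>0)))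
  where
  step : ∀ ε m → ∣ at z m - s m ∣ ≤ half ε × ∣ at w m - t m ∣ ≤ half ε → ∣ at (z R.+ w) m - (s m + t m) ∣ ≤ ε
  step ε m (a , b) = ≡⇒≤ (cong ∣_∣ (cong (_- (s m + t m)) (approx-+ z w m) · solve 4 (λ z w s t → z :+ w :- (s :+ t) := (z :- s) :+ (w :- t)) refl (at z m) (at w m) (s m) (t m))) ◂
    ∣-∣-triangle _ _ ◂ +-mono-≤ a b ◂ ≡⇒≤ (half+half ε)

-- Keeping the operation abstract prevents Agda from comparing reals through their Cauchy moduli.
fold-induction : {A B : Set} (_·_ : B → B → B) (e : B) (fold : List B → B) → fold ≡ foldr _·_ e → (f : A → B) (P : B → List A → Set) →
  P e [] → (∀ x xs z → P z xs → P (f x · z) (x ∷ xs)) → ∀ xs → P (fold (map f xs)) xs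
fold-induction _·_ e _ refl f P p q [] = p
fold-induction _·_ e _ refl f P p q (x ∷ xs) = q x xs (foldr _·_ e (map f xs)) (fold-induction _·_ e _ refl f P p q xs)

sum-induction : {A : Set} (f : A → ℝ) (P : ℝ → List A → Set) → P 0ℝ [] → (∀ x xs z → P z xs → P (f x R.+ z) (x ∷ xs)) → ∀ xs → P (R.sum (map f xs)) xs
sum-induction = fold-induction R._+_ 0ℝ R.sum refl

represents-sum : {A : Set} (f : A → ℝ) (t : A → ℕ → ℚ) → (∀ a → Represents (f a) (t a)) →
  ∀ xs → Represents (R.sum (map f xs)) (λ m → sumL xs (λ a → t a m))
represents-sum f t h = sum-induction f (λ z xs → Represents z (λ m → sumL xs (λ a → t a m)))
  (represents-exact {0ℝ} (λ m → approx-ℕ 0 m)) (λ x xs z → represents-+ {f x} {z} {t x} {λ m → sumL xs (λ a → t a m)} (h x))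

^ℕ-approx : ∀ x k m → at (x R.^ℕ k) m ≡ at x m ^ k
^ℕ-approx x zero    m = approx-ℕ 1 m
^ℕ-approx x (suc k) m = approx-* x (x R.^ℕ k) m · cong (at x m *_) (^ℕ-approx x k m)

<⇒≼ : ∀ {x y} → x R.< y → x ≼ y
<⇒≼ {x} {y} h δ δ>0 with <⇒gap {x} {y} h
... | ε , ε>0 , gap = Eventually-map (λ n le → ≤-add ε (<⇒≤ ε>0) refl ◂ le ◂ ≤-add δ (<⇒≤ δ>0) refl) gap

0<⇒ : ∀ {z} → 0ℝ R.< z → ∃[ δ ] 0# < δ × ρ δ ≼ z
0<⇒ {z} h with <⇒gap {0ℝ} {z} h
... | ε , ε>0 , gap = ε , ε>0 , λ δ δ>0 → Eventually-map (λ n le → ≡⇒≤ (sym (cong (_+ ε) (approx-ℕ 0 n) · +-identityˡ ε)) ◂ le ◂ ≤-add δ (<⇒≤ δ>0) refl) gap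

⇒< : ∀ {z w p q} → p < q → z ≼ ρ p → ρ q ≼ w → z R.< w
⇒< {z} {w} {p} {q} p<q a b = gap⇒< {z} {w} (half d , half>0 d>0 , Eventually-map step (Eventually-× (a (half (half d)) (half>0 (half>0 d>0))) (b (half (half d)) (half>0 (half>0 d>0)))))
  where
  open ≤-Reasoning
  d : ℚ
  d = q - p
  d>0 : 0# < d
  d>0 = ≰⇒> λ le → <⇒≱ p<q (0≤y-x⇒x≤y (subst₂ _≤_ (solve 0 (:- # 0 := # 0) refl) (solve 2 (λ p q → :- (q :- p) := p :- q) refl p q) (neg-mono-≤ le)))
  quarter = half (half d)
  step : ∀ n → at z n ≤ p + quarter × q ≤ at w n + quarter → at z n + half d ≤ at w n
  step n (u , v) = ≤-add (p + quarter - at z n + (at w n + quarter - q)) (+-nonneg (0≤y-x u) (0≤y-x v))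
    (solve 6 (λ z w p q c h → z :+ h :+ (p :+ c :- z :+ (w :+ c :- q)) := w :+ (c :+ c :+ h) :- (q :- p)) refl (at z n) (at w n) p q quarter (half d) ·
      cong (λ t → at w n + (t + half d) - d) (half+half (half d)) · cong (λ t → at w n + t - d) (half+half d) · solve 2 (λ w d → w :+ d :- d := w) refl (at w n) d)

x-y≼⇒ : ∀ {x y δ} → (x R.- y) ≼ ρ δ → x ≼ (y R.+ ρ δ)
x-y≼⇒ {x} {y} {δ} h ε ε>0 = Eventually-map step (h ε ε>0)
  where
  step : ∀ n → at (x R.- y) n ≤ δ + ε → at x n ≤ at (y R.+ ρ δ) n + ε
  step n le = subst (λ t → at x n ≤ t + ε) (sym (approx-+ y (ρ δ) n)) (≤-add (δ + ε - (at x n - at y n))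
    (0≤y-x (subst (_≤ δ + ε) (approx-minus x y n) le))
    (solve 4 (λ x y d e → x :+ (d :+ e :- (x :- y)) := y :+ d :+ e) refl (at x n) (at y n) δ ε))

neg-x-y≼⇒ : ∀ {x y δ} → (R.- (x R.- y)) ≼ ρ δ → y ≼ (x R.+ ρ δ)
neg-x-y≼⇒ {x} {y} {δ} h ε ε>0 = Eventually-map step (h ε ε>0)
  where
  step : ∀ n → at (R.- (x R.- y)) n ≤ δ + ε → at y n ≤ at (x R.+ ρ δ) n + ε
  step n le = subst (λ t → at y n ≤ t + ε) (sym (approx-+ x (ρ δ) n)) (≤-add (δ + ε - - (at x n - at y n))
    (0≤y-x (subst (_≤ δ + ε) (approx-neg (x R.- y) n · cong (λ s → - s) (approx-minus x y n)) le))
    (solve 4 (λ x y d e → y :+ (d :+ e :- :- (x :- y)) := x :+ d :+ e) refl (at x n) (at y n) δ ε))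

series-represents : ∀ (f : ℕ → ℝ) (t : ℕ → ℕ → ℚ) n → (∀ k → Represents (f k) (t k)) → Represents (R.sum (map f (upTo n))) (λ m → sum n (λ k → t k m))
series-represents f t n each = represents λ ε ε>0 → Eventually-map (step ε) (within (represents-sum f t each (upTo n)) ε ε>0)
  where
  step : ∀ ε m → ∣ at (R.sum (map f (upTo n))) m - sumL (upTo n) (λ k → t k m) ∣ ≤ ε → ∣ at (R.sum (map f (upTo n))) m - sum n (λ k → t k m) ∣ ≤ ε
  step ε m = subst (λ s → ∣ at (R.sum (map f (upTo n))) m - s ∣ ≤ ε) (sumL-applyUpTo id (λ k → t k m) n)


-- Existence of logarithms

0ℝ≼fromℚ0 : 0ℝ ≼ ρ 0#
0ℝ≼fromℚ0 = pointwise-≼ {0ℝ} {ρ 0#} λ n → ≡⇒≤ (approx-ℕ 0 n)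

-- For each n the points j / (n + 1) up to B₀ are searched for one with X below x and X above x at
-- its successor; B₀ suffices since x ≤ B₀ ≤ X(B₀). X reflects the order, so the points found for
-- different n are compatible and form a Cauchy sequence.
module Preimage (total : ∀ x y → x ≼ y ⊎ y ≼ x) (x : ℝ) (1≼x : 1ℝ ≼ x) where

  B₀ : ℕ
  B₀ = proj₁ (bound⁺ x)

  x≼B : x ≼ ρ (nat B₀)
  x≼B = ≼-bound⁺ x

  q≼X : ∀ q → 0# ≤ q → ρ q ≼ X (ρ q)
  q≼X q q≥0 = chain
    ρ q ⊴⟨ (λ n → ≤-add 1# (<⇒≤ 0<1) (+-comm q 1#) ◂ ≡⇒≤ (sym (approx-+ 1ℝ (ρ q) n · cong (_+ q) (approx-ℕ 1 n)))) ⟩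
    1ℝ R.+ ρ q ≼⟨ 1+x≼X {ρ q} (0≼fromℚ q≥0) ⟩
    X (ρ q) □

  x≼XB : x ≼ X (ρ (nat B₀))
  x≼XB = chain x ≼⟨ x≼B ⟩ ρ (nat B₀) ≼⟨ q≼X (nat B₀) (0≤nat B₀) ⟩ X (ρ (nat B₀)) □

  Bracket : ℕ → ℚ → Set
  Bracket n q = (0# ≤ q × q ≤ nat B₀) × (X (ρ q) ≼ x × x ≼ X (ρ (q + inv (suc n))))

  point : ℕ → ℕ → ℚ
  point n j = nat j * inv (suc n)

  point-suc : ∀ n j → point n (suc j) ≡ point n j + inv (suc n)
  point-suc n j = cong (_* inv (suc n)) (nat-suc j) · solve 2 (λ j i → (j :+ # 1) :* i := j :* i :+ i) refl (nat j) (inv (suc n))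

  top : ∀ n → point n (B₀ N.* suc n) ≡ nat B₀
  top n = cong (_* inv (suc n)) (nat-* B₀ (suc n)) · *-assoc _ _ _ · cong (nat B₀ *_) (natinv (suc n)) · *-identityʳ _

  point≤ : ∀ n {j} → j N.≤ B₀ N.* suc n → point n j ≤ nat B₀
  point≤ n le = *-monoʳ-≤ (0≤inv (suc n)) (nat-mono le) ◂ ≡⇒≤ (top n)

  search : ∀ n j → j N.≤ B₀ N.* suc n → ∃ (Bracket n) ⊎ X (ρ (point n j)) ≼ x
  search n = ℕ-rec (λ j → j N.≤ B₀ N.* suc n → ∃ (Bracket n) ⊎ X (ρ (point n j)) ≼ x)
    (λ _ → inj₂ (chain
      X (ρ (point n 0)) ≼⟨ X-mono {ρ (point n 0)} {0ℝ} (pointwise-≼ {ρ (point n 0)} {0ℝ} λ m → ≡⇒≤ (*-zeroˡ _ · sym (approx-ℕ 0 m))) ⟩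
      X 0ℝ ∼⟨ X-0 ⟩
      1ℝ ≼⟨ 1≼x ⟩
      x □))
    (λ j ih le → [ inj₁ , next j le ]′ (ih (N.n≤1+n j ◃ le)))
    where
    next : ∀ j → suc j N.≤ B₀ N.* suc n → X (ρ (point n j)) ≼ x → ∃ (Bracket n) ⊎ X (ρ (point n (suc j))) ≼ x
    next j le below = [ inj₂ , (λ above → inj₁ (point n j , (*-nonneg (0≤nat j) (0≤inv (suc n)) , point≤ n (N.n≤1+n j ◃ le)) , below ,
      subst (λ q → x ≼ X (ρ q)) (point-suc n j) above)) ]′ (total (X (ρ (point n (suc j)))) x)

  bracket : ∀ n → ∃ (Bracket n)
  bracket n = [ id , last ]′ (search n (B₀ N.* suc n) N.≤-refl)
    where
    last : X (ρ (point n (B₀ N.* suc n))) ≼ x → ∃ (Bracket n)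
    last below = nat B₀ , (0≤nat B₀ , ≤-refl) , subst (λ q → X (ρ q) ≼ x) (top n) below ,
      (chain
        x ≼⟨ x≼XB ⟩
        X (ρ (nat B₀)) ≼⟨ X-mono {ρ (nat B₀)} {ρ (nat B₀ + inv (suc n))} (ℚ-≼ {nat B₀} {nat B₀ + inv (suc n)} (≤-add (inv (suc n)) (0≤inv (suc n)) refl)) ⟩
        X (ρ (nat B₀ + inv (suc n))) □)

  q : ℕ → ℚ
  q n = proj₁ (bracket n)

  q≥0 : ∀ n → 0# ≤ q n
  q≥0 n = proj₁ (proj₁ (proj₂ (bracket n)))

  q≤B : ∀ n → q n ≤ nat B₀
  q≤B n = proj₂ (proj₁ (proj₂ (bracket n)))

  below : ∀ n → X (ρ (q n)) ≼ x
  below n = proj₁ (proj₂ (proj₂ (bracket n)))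

  above : ∀ n → x ≼ X (ρ (q n + inv (suc n)))
  above n = proj₂ (proj₂ (proj₂ (bracket n)))

  q-≤ : ∀ m n → q m ≤ q n + inv (suc n)
  q-≤ m n = ≼-ℚ {q m} {q n + inv (suc n)} (X-cancel {ρ (q m)} {ρ (q n + inv (suc n))}
    (chain X (ρ (q m)) ≼⟨ below m ⟩ x ≼⟨ above n ⟩ X (ρ (q n + inv (suc n))) □))

  q-cauchy : Cauchy q
  q-cauchy ε ε>0 = n₀ , λ m n p r → ⇒∣a-b∣≤ (q-≤ m n ◂ +-mono-≤ ≤-refl (small n r)) (q-≤ n m ◂ +-mono-≤ ≤-refl (small m p))
    where
    n₀ : ℕ
    n₀ = proj₁ (vanish {1#} (<⇒≤ 0<1) ε>0)
    small : ∀ n → n₀ N.≤ n → inv (suc n) ≤ ε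
    small n le = ≡⇒≤ (sym (*-identityˡ _)) ◂ proj₂ (vanish {1#} (<⇒≤ 0<1) ε>0) n le

  y : ℝ
  y = mkReal q q-cauchy

  approx-y : ∀ m → at y m ≡ q m
  approx-y m = approx-mkReal q q-cauchy m

  within-B : ∀ r → 0# ≤ r → r ≤ nat B₀ + 1# → ∣ r ∣ ≤ nat (suc B₀)
  within-B r r≥0 le = ≡⇒≤ (∣-∣-nonneg r≥0) ◂ le ◂ ≡⇒≤ (sym (nat-suc B₀))

  close : ∀ n → Eventually (λ m → ∣ q m - q n ∣ ≤ inv (suc n))
  close n = n , λ m le → ⇒∣a-b∣≤ (q-≤ m n) (q-≤ n m ◂ +-mono-≤ ≤-refl (inv-anti (s≤s le)))

  close⁺ : ∀ n → Eventually (λ m → ∣ q m - (q n + inv (suc n)) ∣ ≤ inv (suc n) + inv (suc n))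
  close⁺ n = Eventually-map (λ m le → ≡⇒≤ (cong ∣_∣ (solve 3 (λ a b i → a :- (b :+ i) := (a :- b) :+ :- i) refl (q m) (q n) (inv (suc n)))) ◂
    ∣-∣-triangle _ _ ◂ +-mono-≤ le (≡⇒≤ (∣-∣-neg _ · ∣-∣-nonneg (0≤inv (suc n))))) (close n)

  K : ℚ
  K = boundConstant (suc B₀) (s≤s z≤n)

  K≥0 : 0# ≤ K
  K≥0 = boundConstant≥0 (suc B₀) (s≤s z≤n)

  X-close : ∀ r {δ} → 0# ≤ r → r ≤ nat B₀ + 1# → Eventually (λ m → ∣ q m - r ∣ ≤ δ) → Eventually (λ m → ∣ at (X y) m - at (X (ρ r)) m ∣ ≤ δ * K)
  X-close r {δ} r≥0 r≤ cl = X-lipschitz {y} {ρ r} (suc B₀) (s≤s z≤n) {δ}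
    (0 , λ m _ → subst (λ t → ∣ t ∣ ≤ nat (suc B₀)) (sym (approx-y m)) (within-B (q m) (q≥0 m) (q≤B m ◂ ≤-add 1# (<⇒≤ 0<1) refl)) , within-B r r≥0 r≤)
    (Eventually-map (λ m le → subst (λ t → ∣ t - r ∣ ≤ δ) (sym (approx-y m)) le) cl)

  close⇒≼ : ∀ z w {δ} → Eventually (λ m → ∣ at z m - at w m ∣ ≤ δ) → z ≼ (w R.+ ρ δ)
  close⇒≼ z w {δ} cl ε ε>0 = Eventually-map (λ m le → ∣a-b∣≤⇒ le ◂ ≡⇒≤ (sym (approx-+ w (ρ δ) m)) ◂ ≤-add ε (<⇒≤ ε>0) refl) cl

  close⇒≽ : ∀ z w {δ} → Eventually (λ m → ∣ at z m - at w m ∣ ≤ δ) → w ≼ (z R.+ ρ δ)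
  close⇒≽ z w {δ} cl ε ε>0 = Eventually-map (λ m le → ∣a-b∣≤⇒' le ◂ ≡⇒≤ (sym (approx-+ z (ρ δ) m)) ◂ ≤-add ε (<⇒≤ ε>0) refl) cl

  index : ∀ {δ} → 0# < δ → ℕ
  index δ>0 = proj₁ (vanish {K + K} (+-nonneg K≥0 K≥0) δ>0)

  index-≤ : ∀ {δ} (δ>0 : 0# < δ) → (inv (suc (index δ>0)) + inv (suc (index δ>0))) * K ≤ δ
  index-≤ δ>0 = ≡⇒≤ (solve 2 (λ i k → (i :+ i) :* k := (k :+ k) :* i) refl (inv (suc (index δ>0))) K) ◂ proj₂ (vanish {K + K} (+-nonneg K≥0 K≥0) δ>0) (index δ>0) N.≤-refl

  Xy≼x : X y ≼ x
  Xy≼x = ≼-eps {X y} {x} λ δ δ>0 → chain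
    X y ≼⟨ close⇒≼ (X y) (X (ρ (q (index δ>0)))) {δ} (Eventually-map (λ m le → le ◂ *-monoʳ-≤ K≥0 (≤-add _ (0≤inv (suc (index δ>0))) refl) ◂ index-≤ δ>0) (X-close (q (index δ>0)) (q≥0 (index δ>0)) (q≤B (index δ>0) ◂ ≤-add 1# (<⇒≤ 0<1) refl) (close (index δ>0)))) ⟩
    X (ρ (q (index δ>0))) R.+ ρ δ ≼⟨ +-mono-≼ {X (ρ (q (index δ>0)))} {x} {ρ δ} {ρ δ} (below (index δ>0)) (≼-refl {ρ δ}) ⟩
    x R.+ ρ δ □

  x≼Xy : x ≼ X y
  x≼Xy = ≼-eps {x} {X y} λ δ δ>0 → chain
    x ≼⟨ above (index δ>0) ⟩
    X (ρ (r δ>0)) ≼⟨ close⇒≽ (X y) (X (ρ (r δ>0))) {δ} (Eventually-map (λ m le → le ◂ index-≤ δ>0) (X-close (r δ>0) (+-nonneg (q≥0 (index δ>0)) (0≤inv (suc (index δ>0)))) (+-mono-≤ (q≤B (index δ>0)) (inv≤1 (suc (index δ>0)))) (close⁺ (index δ>0)))) ⟩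
    X y R.+ ρ δ □
    where
    r : ∀ {δ} → 0# < δ → ℚ
    r δ>0 = q (index δ>0) + inv (suc (index δ>0))

  Xy≈x : X y ≈ x
  Xy≈x = ≼-antisym {X y} {x} Xy≼x x≼Xy

-- Logarithms and harmonic sums

0≼fromℕ : ∀ n → 0ℝ ≼ fromℕ n
0≼fromℕ n = fromℕ-mono {0} {n} z≤n

X-+ℚ : ∀ p q → X (ρ (p + q)) ≈ (X (ρ p) R.* X (ρ q))
X-+ℚ p q = ≈-trans {X (ρ (p + q))} {X (ρ p R.+ ρ q)} {X (ρ p) R.* X (ρ q)}
  (X-cong {ρ (p + q)} {ρ p R.+ ρ q} (fromℚ-+ p q))
  (X-+ (ρ p) (ρ q))

opaque
  unfolding int _+_ _*_ -_ _≤_ _<_ ∣_∣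

  suc-split : ∀ n → fromℕ (suc (suc n)) ≈ (fromℕ (suc n) R.* (1ℝ R.+ ρ (inv (suc n))))
  suc-split n = pointwise-≈ {fromℕ (suc (suc n))} {fromℕ (suc n) R.* (1ℝ R.+ ρ (inv (suc n)))} λ _ →
    nat-suc (suc n) · sym (solve 2 (λ n i → n :* (# 1 :+ i) := n :+ n :* i) refl (nat (suc n)) (inv (suc n)) · cong (λ t → nat (suc n) + t) (natinv (suc n)))

  0≼1+inv : ∀ n → 0ℝ ≼ (1ℝ R.+ ρ (inv (suc n)))
  0≼1+inv n = pointwise-≼ {0ℝ} {1ℝ R.+ ρ (inv (suc n))} λ _ → +-nonneg 0≤1 (0≤inv (suc n))

  n*x≈ : ∀ n x → (fromℕ n R.* x) ≈ ((ρ (1# - inv (suc n)) R.* x) R.* fromℕ (suc n))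
  n*x≈ n x = pointwise-≈ {fromℕ n R.* x} {(ρ (1# - inv (suc n)) R.* x) R.* fromℕ (suc n)} λ m →
    sym (solve 3 (λ i s x → (# 1 :- i) :* x :* s := (s :- i :* s) :* x) refl (inv (suc n)) (nat (suc n)) (at x m) ·
      cong (_* at x m) (cong₂ _-_ (nat-suc n) (invnat (suc n)) · solve 1 (λ n → n :+ # 1 :- # 1 := n) refl (nat n)))

  divide-out : ∀ d x → 1 N.≤ d → x ≈ ((fromℕ d R.* x) R.* ρ (inv d))
  divide-out d x 1≤d = pointwise-≈ {x} {(fromℕ d R.* x) R.* ρ (inv d)} λ m →
    sym (solve 3 (λ d a i → d :* a :* i := i :* d :* a) refl (nat d) (at x m) (inv d) · cong (_* at x m) (invnat d {{N.>-nonZero 1≤d}}) · *-identityˡ _)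

  n*inv≈1 : ∀ n → 1 N.≤ n → (fromℕ n R.* ρ (inv n)) ≈ 1ℝ
  n*inv≈1 n 1≤n = pointwise-≈ {fromℕ n R.* ρ (inv n)} {1ℝ} λ _ → natinv n {{N.>-nonZero 1≤n}}

  x+half+half≈ : ∀ x δ → (x R.+ ρ (half δ) R.+ ρ (half δ)) ≈ (x R.+ ρ δ)
  x+half+half≈ x δ = pointwise-≈ {x R.+ ρ (half δ) R.+ ρ (half δ)} {x R.+ ρ δ} λ m → +-assoc (at x m) (half δ) (half δ) · cong (λ t → at x m + t) (half+half δ)

  1≼H-1 : ∀ N → nat 2 ≤ H N → 1ℝ ≼ ρ (H N - 1#)
  1≼H-1 N 2≤H = pointwise-≼ {1ℝ} {ρ (H N - 1#)} λ m → ≤-add (H N - nat 2) (0≤y-x 2≤H)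
    (cong (λ s → 1# + (H N - s)) (nat-suc 1) · solve 1 (λ h → # 1 :+ (h :- (# 1 :+ # 1)) := h :- # 1) refl (H N))

  x*y*i≈ : ∀ n i x → ((fromℕ n R.* x) R.* ρ i) ≈ (ρ (nat n * i) R.* x)
  x*y*i≈ n i x = pointwise-≈ {(fromℕ n R.* x) R.* ρ i} {ρ (nat n * i) R.* x} λ m → solve 3 (λ n b i → n :* b :* i := n :* i :* b) refl (nat n) (at x m) i

  regroup : ∀ C n w v → ((C R.* (n R.* w)) R.* v) ≈ ((C R.* n) R.* (v R.* w))
  regroup C n w v = pointwise-≈ {(C R.* (n R.* w)) R.* v} {(C R.* n) R.* (v R.* w)} λ m →
    solve 4 (λ c n w v → c :* (n :* w) :* v := c :* n :* (v :* w)) refl (at C m) (at n m) (at w m) (at v m)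

  fromℚ-^ : ∀ q n → (ρ q R.^ℕ n) ≈ ρ (q ^ n)
  fromℚ-^ q n = pointwise-≈ {ρ q R.^ℕ n} {ρ (q ^ n)} λ m → ^ℕ-approx (ρ q) n m

  fromℕ-^ : ∀ n k → (fromℕ n R.^ℕ k) ≈ fromℕ (n N.^ k)
  fromℕ-^ n k = pointwise-≈ {fromℕ n R.^ℕ k} {fromℕ (n N.^ k)} λ m → ^ℕ-approx (fromℕ n) k m · sym (nat-^ n k)

  0<y-x : ∀ {x y} → x R.< y → 0ℝ R.< (y R.- x)
  0<y-x {x} {y} (δ , δ>0 , gap) = δ , δ>0 , Eventually-map (λ m le →
    ≤-add (at y m - (at x m + δ)) (0≤y-x le) (solve 3 (λ t s d → # 0 :+ d :+ (t :- (s :+ d)) := t :- s) refl (at y m) (at x m) δ)) gap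

  y-[y-x]≈x : ∀ x y → (y R.- (y R.- x)) ≈ x
  y-[y-x]≈x x y = pointwise-≈ {y R.- (y R.- x)} {x} λ m → solve 2 (λ t s → t :- (t :- s) := s) refl (at y m) (at x m)

  0<fromℕ-suc : ∀ A → 0ℝ R.< fromℕ (suc A)
  0<fromℕ-suc A = 1# , 0<1 , 0 , λ _ _ → ≡⇒≤ (+-identityˡ 1#) ◂ nat-mono {1} {suc A} (s≤s z≤n)

inverse-ℕ : ∀ n {w} → 1 N.≤ n → (fromℕ n R.* w) ≈ 1ℝ → w ≈ ρ (inv n)
inverse-ℕ n {w} 1≤n h = ≈-trans {w} {fromℕ n R.* w R.* i} {i} (divide-out n w 1≤n)
  (≈-trans {fromℕ n R.* w R.* i} {1ℝ R.* i} {i} (*-cong-≈ {fromℕ n R.* w} {1ℝ} {i} {i} h (≈-refl {i})) (1*x≈x i))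
  where
  i : ℝ
  i = ρ (inv n)

-- By n + 2 = (n + 1) (1 + 1 / (n + 1)) and 1 + q ≤ X(q); it yields log n ≤ H(n).
suc≼X-H : ∀ n → fromℕ (suc n) ≼ X (ρ (H n))
suc≼X-H = ℕ-rec (λ n → fromℕ (suc n) ≼ X (ρ (H n)))
  (chain fromℕ 1 ∼˘⟨ X-0 ⟩ X 0ℝ ≼⟨ X-mono {0ℝ} {ρ (H 0)} (0≼fromℚ {H 0} ≤-refl) ⟩ X (ρ (H 0)) □)
  (λ n ih → chain
    fromℕ (suc (suc n)) ∼⟨ suc-split n ⟩
    fromℕ (suc n) R.* (1ℝ R.+ ρ (inv (suc n))) ≼⟨ *-mono-≼ {fromℕ (suc n)} {X (ρ (H n))} {1ℝ R.+ ρ (inv (suc n))} {X (ρ (inv (suc n)))} (0≼1+inv n) (0≼X (ρ (H n))) ih (1+x≼X {ρ (inv (suc n))} (0≼fromℚ (0≤inv (suc n)))) ⟩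
    X (ρ (H n)) R.* X (ρ (inv (suc n))) ∼˘⟨ X-+ℚ (H n) (inv (suc n)) ⟩
    X (ρ (H (suc n))) □)

n*X≼ : ∀ n → (fromℕ n R.* X (ρ (inv (suc n)))) ≼ fromℕ (suc n)
n*X≼ n = chain
  fromℕ n R.* x ∼⟨ n*x≈ n x ⟩
  (ρ (1# - inv (suc n)) R.* x) R.* fromℕ (suc n) ≼⟨ *-monoʳ-≼ {ρ (1# - inv (suc n)) R.* x} {1ℝ} {fromℕ (suc n)} (0≼fromℕ (suc n)) (X-geometric {inv (suc n)} (0≤inv (suc n)) (inv≤1 (suc n))) ⟩
  1ℝ R.* fromℕ (suc n) ∼⟨ 1*x≈x (fromℕ (suc n)) ⟩
  fromℕ (suc n) □
  where
  x : ℝ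
  x = X (ρ (inv (suc n)))

-- By (1 - q) X(q) ≤ 1 at q = 1 / (n + 1), in the form of `n*X≼`; it yields H(n) - 1 ≤ log n.
X-H-1≼ : ∀ n → X (ρ (H (suc n) - 1#)) ≼ fromℕ (suc n)
X-H-1≼ = ℕ-rec (λ n → X (ρ (H (suc n) - 1#)) ≼ fromℕ (suc n))
  (chain
    X (ρ (H 1 - 1#)) ≼⟨ X-mono {ρ (H 1 - 1#)} {0ℝ} (pointwise-≼ {ρ (H 1 - 1#)} {0ℝ} λ m → ≡⇒≤ ((cong (_- 1#) (+-identityˡ (inv 1) · inv-1) · +-inverseʳ 1#) · sym (approx-ℕ 0 m))) ⟩
    X 0ℝ ∼⟨ X-0 ⟩
    1ℝ □)
  (λ n ih → chain
    X (ρ (H (suc (suc n)) - 1#)) ≼⟨ subst (λ t → X (ρ t) ≼ (X (ρ (H (suc n) - 1#)) R.* X (ρ (inv (suc (suc n)))))) (solve 2 (λ h i → h :- # 1 :+ i := h :+ i :- # 1) refl (H (suc n)) (inv (suc (suc n)))) (≈⇒≼ {X (ρ (H (suc n) - 1# + inv (suc (suc n))))} {X (ρ (H (suc n) - 1#)) R.* X (ρ (inv (suc (suc n))))} (X-+ℚ (H (suc n) - 1#) (inv (suc (suc n))))) ⟩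
    X (ρ (H (suc n) - 1#)) R.* X (ρ (inv (suc (suc n)))) ≼⟨ *-monoʳ-≼ {X (ρ (H (suc n) - 1#))} {fromℕ (suc n)} {X (ρ (inv (suc (suc n))))} (0≼X (ρ (inv (suc (suc n))))) ih ⟩
    fromℕ (suc n) R.* X (ρ (inv (suc (suc n)))) ≼⟨ n*X≼ (suc n) ⟩
    fromℕ (suc (suc n)) □)

module Logarithm {l : ℝ} {n : ℕ} (Xl≈n : X l ≈ fromℕ n) where

  log≼H : l ≼ ρ (H n)
  log≼H = X-cancel {l} {ρ (H n)} (chain
    X l ∼⟨ Xl≈n ⟩
    fromℕ n ≼⟨ fromℕ-mono {n} (N.n≤1+n n) ⟩
    fromℕ (suc n) ≼⟨ suc≼X-H n ⟩
    X (ρ (H n)) □)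

  H-1≼log : 1 N.≤ n → ρ (H n - 1#) ≼ l
  H-1≼log 1≤n = X-cancel {ρ (H n - 1#)} {l} (chain X (ρ (H n - 1#)) ≼⟨ subst (λ k → X (ρ (H k - 1#)) ≼ fromℕ k) (N.m+[n∸m]≡n 1≤n) (X-H-1≼ (n N.∸ 1)) ⟩ fromℕ n ∼˘⟨ Xl≈n ⟩ X l □)

  0≼log : 1 N.≤ n → 0ℝ ≼ l
  0≼log 1≤n = X-cancel {0ℝ} {l} (chain X 0ℝ ∼⟨ X-0 ⟩ 1ℝ ≼⟨ fromℕ-mono {1} 1≤n ⟩ fromℕ n ∼˘⟨ Xl≈n ⟩ X l □)

  log≼H' : ∀ N → n N.≤ N → l ≼ ρ (H N)
  log≼H' N n≤N = chain l ≼⟨ log≼H ⟩ ρ (H n) ≼⟨ ℚ-≼ {H n} {H N} (sum-mono-n (λ i → inv (suc i)) n≤N (λ i → 0≤inv (suc i))) ⟩ ρ (H N) □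

^ℕ-mono : ∀ {x y} n → 0ℝ ≼ x → x ≼ y → (x R.^ℕ n) ≼ (y R.^ℕ n)
^ℕ-mono {x} {y} n x≥0 x≼y = proj₂ (ℕ-rec (λ n → 0ℝ ≼ (x R.^ℕ n) × (x R.^ℕ n) ≼ (y R.^ℕ n))
  (0≼fromℕ 1 , ≼-refl {1ℝ})
  (λ n (p , q) → 0≼* {x} {x R.^ℕ n} x≥0 p , *-mono-≼ {x} {y} {x R.^ℕ n} {y R.^ℕ n} p (chain 0ℝ ≼⟨ x≥0 ⟩ x ≼⟨ x≼y ⟩ y □) x≼y q) n)

^ℕ-cong : ∀ {x y} n → x ≈ y → (x R.^ℕ n) ≈ (y R.^ℕ n)
^ℕ-cong {x} {y} n h = ℕ-rec (λ n → (x R.^ℕ n) ≈ (y R.^ℕ n)) (≈-refl {1ℝ}) (λ n → *-cong-≈ {x} {y} {x R.^ℕ n} {y R.^ℕ n} h) n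

X-power-ℕ : ∀ {l n} k → X l ≈ fromℕ n → X (fromℕ k R.* l) ≈ fromℕ (n N.^ k)
X-power-ℕ {l} {n} k h = ≈-trans {X (fromℕ k R.* l)} {X l R.^ℕ k} {fromℕ (n N.^ k)} (X-power k l)
  (≈-trans {X l R.^ℕ k} {fromℕ n R.^ℕ k} {fromℕ (n N.^ k)} (^ℕ-cong {X l} {fromℕ n} k h)
    (fromℕ-^ n k))

-- Logarithms turn Q^den ≤ N^num into den log Q ≤ num log N, and division by den brings in the real
-- exponent.
power-level : ∀ {a b s Q N} num den → 1 N.≤ den → X a ≈ fromℕ Q → X b ≈ fromℕ N → s ≈ ρ (nat num * inv den) → Q N.^ den N.≤ N N.^ num → fromℕ Q ≼ X (s R.* b)
power-level {a} {b} {s} {Q} {N} num den 1≤den Xa Xb s≈ le = chain fromℕ Q ∼˘⟨ Xa ⟩ X a ≼⟨ X-mono {a} {s R.* b} a≼ ⟩ X (s R.* b) □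
  where
  i : ℝ
  i = ρ (inv den)
  scaled : (fromℕ den R.* a) ≼ (fromℕ num R.* b)
  scaled = X-cancel {fromℕ den R.* a} {fromℕ num R.* b} (chain
    X (fromℕ den R.* a) ∼⟨ X-power-ℕ {a} {Q} den Xa ⟩
    fromℕ (Q N.^ den) ≼⟨ fromℕ-mono {Q N.^ den} le ⟩
    fromℕ (N N.^ num) ∼˘⟨ X-power-ℕ {b} {N} num Xb ⟩
    X (fromℕ num R.* b) □)
  a≼ : a ≼ (s R.* b)
  a≼ = chain
    a ∼⟨ divide-out den a 1≤den ⟩
    (fromℕ den R.* a) R.* i ≼⟨ *-monoʳ-≼ {fromℕ den R.* a} {fromℕ num R.* b} {i} (0≼fromℚ (0≤inv den)) scaled ⟩
    (fromℕ num R.* b) R.* i ∼⟨ x*y*i≈ num (inv den) b ⟩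
    ρ (nat num * inv den) R.* b ∼˘⟨ *-cong-≈ {s} {ρ (nat num * inv den)} {b} {b} s≈ (≈-refl {b}) ⟩
    s R.* b □

module PowerBounds {v t l : ℝ} (A : ℕ) (v≈ : v ≈ X (fromℕ A R.* t)) (Xt≈l : X t ≈ l) where

  v≈l^A : v ≈ (l R.^ℕ A)
  v≈l^A = ≈-trans {v} {X (fromℕ A R.* t)} {l R.^ℕ A} v≈ (≈-trans {X (fromℕ A R.* t)} {X t R.^ℕ A} {l R.^ℕ A} (X-power A t) (^ℕ-cong {X t} {l} A Xt≈l))

  power-≽ : ∀ {h} → 0# ≤ h → ρ h ≼ l → ρ (h ^ A) ≼ v
  power-≽ {h} h≥0 le = chain ρ (h ^ A) ∼˘⟨ fromℚ-^ h A ⟩ ρ h R.^ℕ A ≼⟨ ^ℕ-mono {ρ h} {l} A (0≼fromℚ h≥0) le ⟩ l R.^ℕ A ∼˘⟨ v≈l^A ⟩ v □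

  power-≼ : ∀ {h} → 0ℝ ≼ l → l ≼ ρ h → v ≼ ρ (h ^ A)
  power-≼ {h} l≥0 le = chain v ∼⟨ v≈l^A ⟩ l R.^ℕ A ≼⟨ ^ℕ-mono {l} {ρ h} A l≥0 le ⟩ ρ h R.^ℕ A ∼⟨ fromℚ-^ h A ⟩ ρ (h ^ A) □

  invertible : ∃[ w ] (v R.* w) ≈ 1ℝ
  invertible = X (R.- z) , ≈-trans {v R.* X (R.- z)} {X z R.* X (R.- z)} {1ℝ} (*-cong-≈ {v} {X z} {X (R.- z)} {X (R.- z)} v≈ (≈-refl {X (R.- z)}))
    (≈-trans {X z R.* X (R.- z)} {X (z R.- z)} {1ℝ} (≈-sym {X (z R.- z)} {X z R.* X (R.- z)} (X-+ z (R.- z)))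
      (≈-trans {X (z R.- z)} {X 0ℝ} {1ℝ} (X-cong {z R.- z} {0ℝ} (x-x≈0 z)) X-0))
    where
    z : ℝ
    z = fromℕ A R.* t

clear-denominator : ∀ {S C n v w} → 0ℝ ≼ v → (v R.* w) ≈ 1ℝ → S ≼ (C R.* (n R.* w)) → (S R.* v) ≼ (C R.* n)
clear-denominator {S} {C} {n} {v} {w} v≥0 vw h = chain
  S R.* v ≼⟨ *-monoʳ-≼ {S} {C R.* (n R.* w)} {v} v≥0 h ⟩
  (C R.* (n R.* w)) R.* v ∼⟨ regroup C n w v ⟩
  (C R.* n) R.* (v R.* w) ∼⟨ *-cong-≈ {C R.* n} {C R.* n} {v R.* w} {1ℝ} (≈-refl {C R.* n}) vw ⟩
  (C R.* n) R.* 1ℝ ∼⟨ x*1≈x (C R.* n) ⟩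
  C R.* n □

-- Maxima and approximation of sums from below

infixl 6 _⊔_
_⊔_ : ℚ → ℚ → ℚ
p ⊔ q with p ≤? q
... | yes _ = q
... | no  _ = p

p≤p⊔q : ∀ p q → p ≤ p ⊔ q
p≤p⊔q p q with p ≤? q
... | yes le = le
... | no  _ = ≤-refl

q≤p⊔q : ∀ p q → q ≤ p ⊔ q
q≤p⊔q p q with p ≤? q
... | yes _ = ≤-refl
... | no ¬le = <⇒≤ (≰⇒> ¬le)

⊔-elim : ∀ (P : ℚ → Set) p q → P p → P q → P (p ⊔ q)
⊔-elim P p q Pp Pq with p ≤? q
... | yes _ = Pq
... | no  _ = Pp

maximum : {A : Set} → List A → (A → ℚ) → ℚ
maximum []       f = 0#
maximum (x ∷ xs) f = f x ⊔ maximum xs f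

0≤maximum : {A : Set} (xs : List A) (f : A → ℚ) → 0# ≤ maximum xs f
0≤maximum []       f = ≤-refl
0≤maximum (x ∷ xs) f = 0≤maximum xs f ◂ q≤p⊔q (f x) _

≤-maximum : {A : Set} {xs : List A} (f : A → ℚ) {x : A} → x ∈ xs → f x ≤ maximum xs f
≤-maximum {xs = x ∷ xs} f (here refl) = p≤p⊔q (f x) _
≤-maximum {xs = y ∷ xs} f (there x∈) = ≤-maximum f x∈ ◂ q≤p⊔q (f y) _

maximum-attained : {A : Set} (xs : List A) (f : A → ℚ) → maximum xs f ≡ 0# ⊎ ∃[ x ] x ∈ xs × maximum xs f ≡ f x
maximum-attained []       f = inj₁ refl
maximum-attained (x ∷ xs) f with f x ≤? maximum xs f
... | no  _ = inj₂ (x , here refl , refl)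
... | yes _ with maximum-attained xs f
...   | inj₁ eq = inj₁ eq
...   | inj₂ (y , y∈ , eq) = inj₂ (y , there y∈ , eq)

sumL-filter : {A : Set} {P : Pred A 0ℓ} (P? : Decidable P) (f : A → ℚ) (xs : List A) → sumL (filter P? xs) f ≡ sumL xs (λ x → f x * ind (P? x))
sumL-filter P? f [] = refl
sumL-filter P? f (x ∷ xs) with P? x
... | yes _ = cong₂ _+_ (sym (*-identityʳ (f x))) (sumL-filter P? f xs)
... | no  _ = sumL-filter P? f xs · sym (cong (_+ sumL xs (λ x → f x * ind (P? x))) (*-zeroʳ (f x)) · +-identityˡ _)

sumL-[1⋯] : ∀ n f → sumL [1⋯ n ] f ≡ sum n (f ∘ suc)
sumL-[1⋯] n f = trans (sumL-map (upTo n)) (sumL-applyUpTo id (f ∘ suc) n)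
  where
  sumL-map : ∀ xs → sumL (map suc xs) f ≡ sumL xs (f ∘ suc)
  sumL-map [] = refl
  sumL-map (x ∷ xs) = cong (f (suc x) +_) (sumL-map xs)

length-[1⋯] : ∀ n → length [1⋯ n ] ≡ n
length-[1⋯] n = length-map suc (upTo n) · length-upTo n

-- The approximation is one-sided because the rational logarithms must stay below the true ones and
-- hence below H(N).
record Near (z : ℝ) (r δ : ℚ) : Set where
  constructor near
  field
    lower : ρ r ≼ z
    upper : z ≼ ρ (r + δ)

open Near

near-≼ : ∀ {z w r δ} → w ≼ z → z ≼ w → Near z r δ → Near w r δ
near-≼ {z} {w} {r} {δ} p q h = near (chain ρ r ≼⟨ lower h ⟩ z ≼⟨ q ⟩ w □) (chain w ≼⟨ p ⟩ z ≼⟨ upper h ⟩ ρ (r + δ) □)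

near-weaken : ∀ {z r δ ε} → δ ≤ ε → Near z r δ → Near z r ε
near-weaken {z} {r} {δ} {ε} le h = near (lower h) (chain z ≼⟨ upper h ⟩ ρ (r + δ) ≼⟨ ℚ-≼ {r + δ} {r + ε} (+-mono-≤ ≤-refl le) ⟩ ρ (r + ε) □)

fromℚ0≼0ℝ : ρ 0# ≼ 0ℝ
fromℚ0≼0ℝ = pointwise-≼ {ρ 0#} {0ℝ} λ m → ≡⇒≤ (sym (approx-ℕ 0 m))

near-sum : {A : Set} (f : A → ℝ) (g : A → ℚ) {δ : ℚ} (P : A → Set) → (∀ x → P x → Near (f x) (g x) δ) →
  ∀ xs → All P xs → Near (R.sum (map f xs)) (sumL xs g) (nat (length xs) * δ)
near-sum f g {δ} P h = sum-induction f (λ z xs → All P xs → Near z (sumL xs g) (nat (length xs) * δ))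
  (λ _ → near fromℚ0≼0ℝ (pointwise-≼ {0ℝ} {ρ (0# + nat 0 * δ)} λ m → ≡⇒≤ (approx-ℕ 0 m · sym (+-identityˡ _ · *-zeroˡ δ))))
  step
  where
  step : ∀ x xs z → (All P xs → Near z (sumL xs g) (nat (length xs) * δ)) → All P (x ∷ xs) → Near (f x R.+ z) (g x + sumL xs g) (nat (suc (length xs)) * δ)
  step x xs z ih (px ∷ pxs) = near
    (chain
      ρ (g x + sumL xs g) ∼⟨ fromℚ-+ (g x) (sumL xs g) ⟩
      ρ (g x) R.+ ρ (sumL xs g) ≼⟨ +-mono-≼ {ρ (g x)} {f x} {ρ (sumL xs g)} {z} (lower (h x px)) (lower (ih pxs)) ⟩
      f x R.+ z □)
    (chain
      f x R.+ z ≼⟨ +-mono-≼ {f x} {ρ (g x + δ)} {z} {ρ (sumL xs g + nat (length xs) * δ)} (upper (h x px)) (upper (ih pxs)) ⟩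
      ρ (g x + δ) R.+ ρ (sumL xs g + nat (length xs) * δ) ⊴⟨ (λ m → ≡⇒≤ (approx-+ (ρ (g x + δ)) (ρ (sumL xs g + nat (length xs) * δ)) m · solve 4 (λ g s n d → g :+ d :+ (s :+ n :* d) := g :+ s :+ (n :+ # 1) :* d) refl (g x) (sumL xs g) (nat (length xs)) δ · cong (λ t → g x + sumL xs g + t * δ) (sym (nat-suc (length xs))))) ⟩
      ρ (g x + sumL xs g + nat (suc (length xs)) * δ) □)

near-minus : ∀ {z y r s δ} → Near z r δ → y ≈ ρ s → Near (z R.- y) (r - s) δ
near-minus {z} {y} {r} {s} {δ} h y≈s = near
  (chain
    ρ (r - s) ∼⟨ fromℚ-+ r (- s) ⟩
    ρ r R.+ ρ (- s) ≼⟨ +-mono-≼ {ρ r} {z} {ρ (- s)} {R.- y} (lower h) -s≼-y ⟩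
    z R.- y □)
  (chain
    z R.- y ≼⟨ +-mono-≼ {z} {ρ (r + δ)} {R.- y} {ρ (- s)} (upper h) -y≼-s ⟩
    ρ (r + δ) R.+ ρ (- s) ≐⟨ (λ m → approx-+ (ρ (r + δ)) (ρ (- s)) m · solve 3 (λ r s d → r :+ d :+ :- s := r :- s :+ d) refl r s δ) ⟩
    ρ (r - s + δ) □)
  where
  -s≼-y : ρ (- s) ≼ (R.- y)
  -s≼-y = chain ρ (- s) ∼⟨ fromℚ-neg s ⟩ R.- ρ s ≼⟨ neg-mono-≼ {y} {ρ s} (≈⇒≼ {y} {ρ s} y≈s) ⟩ R.- y □
  -y≼-s : (R.- y) ≼ ρ (- s)
  -y≼-s = chain R.- y ≼⟨ neg-mono-≼ {ρ s} {y} (≈⇒≽ {y} {ρ s} y≈s) ⟩ R.- ρ s ∼˘⟨ fromℚ-neg s ⟩ ρ (- s) □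

-- a stands for the absolute value of z.
near-abs : ∀ {z a r δ} → 0# ≤ δ → z ≼ a → (R.- z) ≼ a → Near z r δ → ρ (∣ r ∣ - δ) ≼ a
near-abs {z} {a} {r} {δ} δ≥0 z≼a -z≼a h = cases
  where
  positive : ρ (r - δ) ≼ a
  positive = chain ρ (r - δ) ≼⟨ ℚ-≼ {r - δ} {r} (≤-add δ δ≥0 (solve 2 (λ r d → r :- d :+ d := r) refl r δ)) ⟩ ρ r ≼⟨ lower h ⟩ z ≼⟨ z≼a ⟩ a □
  negative : ρ (- r - δ) ≼ a
  negative = chain
    ρ (- r - δ) ≐⟨ (λ m → solve 2 (λ r d → :- r :- d := :- (r :+ d)) refl r δ · sym (approx-neg (ρ (r + δ)) m)) ⟩
    R.- ρ (r + δ) ≼⟨ neg-mono-≼ {z} {ρ (r + δ)} (upper h) ⟩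
    R.- z ≼⟨ -z≼a ⟩
    a □
  cases : ρ (∣ r ∣ - δ) ≼ a
  cases with 0# ≤? r
  ... | yes r≥0 = subst (λ t → ρ (t - δ) ≼ a) (sym (∣-∣-nonneg r≥0)) positive
  ... | no ¬r≥0 = subst (λ t → ρ (t - δ) ≼ a) (sym (∣-∣-nonneg (≡⇒≤ (solve 0 (# 0 := :- # 0) refl) ◂ neg-mono-≤ (<⇒≤ (≰⇒> ¬r≥0)))) · ∣-∣-neg r) negative

-- The hypotheses bound real maxima from above, so rational maxima need to be bounded by real ones
-- only; for this it suffices that the operation dominates both its arguments.
module Maximum (_·_ : ℝ → ℝ → ℝ) (max : List ℝ → ℝ) (max≡ : max ≡ foldr _·_ 0ℝ)
  (x≼x·y : ∀ x y → x ≼ (x · y)) (y≼x·y : ∀ x y → y ≼ (x · y)) where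

  0≼max : {A : Set} (f : A → ℝ) (xs : List A) → 0ℝ ≼ max (map f xs)
  0≼max {A} f = fold-induction _·_ 0ℝ max max≡ f (λ z xs → 0ℝ ≼ z) (≼-refl {0ℝ}) (λ x xs z ih → chain 0ℝ ≼⟨ ih ⟩ z ≼⟨ y≼x·y (f x) z ⟩ f x · z □)

  maximum-≼ : {A : Set} (f : A → ℝ) (g : A → ℚ) {δ : ℚ} → 0# ≤ δ → (∀ x → ρ (g x - δ) ≼ f x) → (xs : List A) → ρ (maximum xs g - δ) ≼ max (map f xs)
  maximum-≼ {A} f g {δ} δ≥0 h = fold-induction _·_ 0ℝ max max≡ f (λ z xs → ρ (maximum xs g - δ) ≼ z)
    (pointwise-≼ {ρ (0# - δ)} {0ℝ} λ m → ≤-add δ δ≥0 (solve 1 (λ d → # 0 :- d :+ d := # 0) refl δ) ◂ ≡⇒≤ (sym (approx-ℕ 0 m)))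
    (λ x xs z ih → ⊔-elim (λ t → ρ (t - δ) ≼ (f x · z)) (g x) (maximum xs g)
      (chain ρ (g x - δ) ≼⟨ h x ⟩ f x ≼⟨ x≼x·y (f x) z ⟩ f x · z □) (chain ρ (maximum xs g - δ) ≼⟨ ih ⟩ z ≼⟨ y≼x·y (f x) z ⟩ f x · z □))

-- Only the first Q of the M terms are bounded from below by something other than 0.
sum-lower : (F : ℕ → ℝ) (g : ℕ → ℚ) (δ : ℚ) → (∀ q → 0ℝ ≼ F q) → (∀ q → 1 N.≤ q → ρ (g q - δ) ≼ F q) →
  ∀ Q M → Q N.≤ M → ρ (sum Q (g ∘ suc) - nat Q * δ) ≼ R.sum (map F [1⋯ M ])
sum-lower F g δ F≥0 h Q M Q≤M = subst (λ t → ρ t ≼ R.sum (map F [1⋯ M ])) total (lemma [1⋯ M ])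
  where
  t' : (q : ℕ) → Dec (1 N.≤ q × q N.≤ Q) → ℚ
  t' q (yes _) = g q - δ
  t' q (no  _) = 0#
  range? : ∀ q → Dec (1 N.≤ q × q N.≤ Q)
  range? zero = no λ ()
  range? (suc q) with suc q N.≤? Q
  ... | yes p = yes (s≤s z≤n , p)
  ... | no ¬p = no λ (_ , p) → ¬p p
  t : ℕ → ℚ
  t q = t' q (range? q)
  bound : ∀ q (d : Dec (1 N.≤ q × q N.≤ Q)) → ρ (t' q d) ≼ F q
  bound q (yes (p , _)) = h q p
  bound q (no  _) = chain ρ 0# ≼⟨ fromℚ0≼0ℝ ⟩ 0ℝ ≼⟨ F≥0 q ⟩ F q □
  lemma : ∀ xs → ρ (sumL xs t) ≼ R.sum (map F xs)
  lemma = sum-induction F (λ z xs → ρ (sumL xs t) ≼ z) fromℚ0≼0ℝ (λ x xs z ih →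
    (chain
      ρ (t x + sumL xs t) ∼⟨ fromℚ-+ (t x) (sumL xs t) ⟩
      ρ (t x) R.+ ρ (sumL xs t) ≼⟨ +-mono-≼ {ρ (t x)} {F x} {ρ (sumL xs t)} {z} (bound x (range? x)) ih ⟩
      F x R.+ z □))
  t-below : ∀ i → i N.< Q → t (suc i) ≡ g (suc i) - δ
  t-below i i<Q with suc i N.≤? Q
  ... | yes _ = refl
  ... | no ¬p with () ← ¬p i<Q
  t-above : ∀ i → Q N.≤ i → t (suc i) ≡ 0#
  t-above i Q≤i with suc i N.≤? Q
  ... | yes p with () ← N.<⇒≱ p Q≤i
  ... | no _ = refl
  total : sumL [1⋯ M ] t ≡ sum Q (g ∘ suc) - nat Q * δ
  total = (sumL-[1⋯] M t) · sum-extend (t ∘ suc) Q≤M t-above · sum-cong Q t-below ·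
    sum-+ Q (g ∘ suc) (λ _ → - δ) · cong (sum Q (g ∘ suc) +_) (sum-const Q (- δ) · solve 2 (λ q d → q :* :- d := :- (q :* d)) refl (nat Q) δ)

opaque

  -- Rational form of the levels of distribution

  unfolding int _+_ _*_ -_ _≤_ _<_ ∣_∣

  add-back : ∀ s e v → (ρ s R.* v) ≈ (ρ (s - e) R.* v R.+ ρ e R.* v)
  add-back s e v = pointwise-≈ {ρ s R.* v} {ρ (s - e) R.* v R.+ ρ e R.* v} λ m →
    solve 3 (λ s e v → s :* v := (s :- e) :* v :+ e :* v) refl s e (at v m)

-- The rational form of a bound S ≼ C N / l ^ A, with S ≽ s − e and H(N) − 1 ≼ l ≼ H(N).
level-bound : ∀ {S C s e h c n} A {v w} → 0# ≤ s → 0# ≤ e → nat 2 ≤ h → ρ (s - e) ≼ S → ρ ((h - 1#) ^ A) ≼ v → v ≼ ρ (h ^ A) → C ≼ fromℕ c →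
  e * h ^ A ≤ nat n → (v R.* w) ≈ 1ℝ → S ≼ (C R.* (fromℕ n R.* w)) → s * h ^ A ≤ nat (2 N.^ A N.* suc c) * nat n
level-bound {S} {C} {s} {e} {h} {c} {n} A {v} {w} s≥0 e≥0 2≤h s-e≼S v≥ v≤ C≼c small vw S≼ = begin
  s * h ^ A ≤⟨ *-monoˡ-≤ s≥0 h^A≤ ⟩
  s * (nat (2 N.^ A) * (h - 1#) ^ A) ≡⟨ solve 3 (λ s t u → s :* (t :* u) := t :* (s :* u)) refl s (nat (2 N.^ A)) ((h - 1#) ^ A) ⟩
  nat (2 N.^ A) * (s * (h - 1#) ^ A) ≤⟨ *-monoˡ-≤ (0≤nat (2 N.^ A)) core ⟩
  nat (2 N.^ A) * (nat c * nat n + nat n) ≡⟨ solve 3 (λ t c n → t :* (c :* n :+ n) := t :* (c :+ # 1) :* n) refl (nat (2 N.^ A)) (nat c) (nat n) · cong (_* nat n) (cong (nat (2 N.^ A) *_) (sym (nat-suc c)) · sym (nat-* (2 N.^ A) (suc c))) ⟩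
  nat (2 N.^ A N.* suc c) * nat n ∎
  where
  open ≤-Reasoning
  h≥0 : 0# ≤ h
  h≥0 = 0≤nat 2 ◂ 2≤h
  h-1≥0 : 0# ≤ h - 1#
  h-1≥0 = 0≤y-x (nat-mono {1} {2} (s≤s z≤n) ◂ 2≤h)
  -- As h ≥ 2, h is at most 2 (h - 1). This is the origin of the factor 2^A.
  h^A≤ : h ^ A ≤ nat (2 N.^ A) * (h - 1#) ^ A
  h^A≤ = ≤-trans (^-mono A h≥0 (≤-add (h - nat 2) (0≤y-x 2≤h) (cong (λ t → h + (h - t)) two · solve 1 (λ h → h :+ (h :- # 2) := # 2 :* (h :- # 1)) refl h · cong (_* (h - 1#)) (sym two))))
    (≡⇒≤ (^-distrib (nat 2) (h - 1#) A · cong (_* (h - 1#) ^ A) (sym (nat-^ 2 A))))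
    where
    two : nat 2 ≡ int (Z.+ 2)
    two = refl
  v≥0 : 0ℝ ≼ v
  v≥0 = chain 0ℝ ≼⟨ 0≼fromℚ (^-nonneg A h-1≥0) ⟩ ρ ((h - 1#) ^ A) ≼⟨ v≥ ⟩ v □
  cleared : (S R.* v) ≼ (C R.* fromℕ n)
  cleared = clear-denominator {S} {C} {fromℕ n} {v} {w} v≥0 vw S≼
  Cn≼ : (C R.* fromℕ n) ≼ ρ (nat c * nat n)
  Cn≼ = chain
    C R.* fromℕ n ≼⟨ *-monoʳ-≼ {C} {fromℕ c} {fromℕ n} (0≼fromℕ n) C≼c ⟩
    fromℕ c R.* fromℕ n ∼⟨ fromℕ*fromℕ c n ⟩
    ρ (nat c * nat n) □
  sv≼ : (ρ s R.* v) ≼ ρ (nat c * nat n + nat n)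
  sv≼ = chain
    ρ s R.* v ∼⟨ add-back s e v ⟩
    (ρ (s - e) R.* v) R.+ (ρ e R.* v) ≼⟨ +-mono-≼ {ρ (s - e) R.* v} {ρ (nat c * nat n)} {ρ e R.* v} {ρ (nat n)} (chain ρ (s - e) R.* v ≼⟨ *-monoʳ-≼ {ρ (s - e)} {S} {v} v≥0 s-e≼S ⟩ S R.* v ≼⟨ cleared ⟩ C R.* fromℕ n ≼⟨ Cn≼ ⟩ ρ (nat c * nat n) □) (chain ρ e R.* v ≼⟨ *-mono-≼ {ρ e} {ρ e} {v} {ρ (h ^ A)} v≥0 (0≼fromℚ e≥0) (≼-refl {ρ e}) v≤ ⟩ ρ e R.* ρ (h ^ A) ⊴⟨ (λ m → ≡⇒≤ (approx-* (ρ e) (ρ (h ^ A)) m) ◂ small) ⟩ ρ (nat n) □) ⟩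
    ρ (nat c * nat n) R.+ ρ (nat n) ∼˘⟨ fromℚ-+ (nat c * nat n) (nat n) ⟩
    ρ (nat c * nat n + nat n) □
  core : s * (h - 1#) ^ A ≤ nat c * nat n + nat n
  core = ≼-ℚ {s * (h - 1#) ^ A} {nat c * nat n + nat n} (chain
    ρ (s * (h - 1#) ^ A) ∼⟨ fromℚ-* s ((h - 1#) ^ A) ⟩
    ρ s R.* ρ ((h - 1#) ^ A) ≼⟨ *-mono-≼ {ρ s} {ρ s} {ρ ((h - 1#) ^ A)} {v} (0≼fromℚ (^-nonneg A h-1≥0)) (0≼fromℚ s≥0) (≼-refl {ρ s}) v≥ ⟩
    ρ s R.* v ≼⟨ sv≼ ⟩
    ρ (nat c * nat n + nat n) □)

-- l = log N, t = log l, v = l ^ A with inverse w, and M is the integer part of N ^ ϑ.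
module AtLevel (num den A N c : ℕ) (C ϑ l t v w : ℝ) (M : ℕ) (1≤den : 1 N.≤ den) (1≤N : 1 N.≤ N) (2≤H : nat 2 ≤ H N) (C≼c : C ≼ fromℕ c)
  (ϑ≈ : ϑ ≈ ρ (nat num * inv den)) (Xl : X l ≈ fromℕ N) (Xt : X t ≈ l) (v≈ : v ≈ X (fromℕ A R.* t)) (vw : (v R.* w) ≈ 1ℝ)
  (log-exists : ∀ Q → 1 N.≤ Q → ∃[ a ] X a ≈ fromℕ Q) (≤M : ∀ Q → fromℕ Q ≼ X (ϑ R.* l) → Q N.≤ M) where

  open PowerBounds {v} {t} {l} A v≈ Xt

  bound : ∀ (F : ℕ → ℝ) (E : ℕ → ℚ) {δ} → 0# ≤ δ → Nonneg E → (∀ q → 0ℝ ≼ F q) → (∀ q → 1 N.≤ q → ρ (E q - δ) ≼ F q) →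
    R.sum (map F [1⋯ M ]) ≼ (C R.* (fromℕ N R.* w)) →
    ∀ Q → Q N.^ den N.≤ N N.^ num → nat Q * δ * H N ^ A ≤ nat N → sum Q (E ∘ suc) * H N ^ A ≤ nat (2 N.^ A N.* suc c) * nat N
  bound F E {δ} δ≥0 E≥0 F≥0 F≥ S≼ Q Q≤ small = level-bound {R.sum (map F [1⋯ M ])} {C} {sum Q (E ∘ suc)} {nat Q * δ} {H N} {c} {N} A {v} {w}
    (sum-nonneg Q λ i _ → E≥0 (suc i)) (*-nonneg (0≤nat Q) δ≥0) 2≤H
    (sum-lower F E δ F≥0 F≥ Q M (Q≤M Q Q≤))
    (power-≽ (0≤y-x (nat-mono {1} {2} (s≤s z≤n) ◂ 2≤H)) (Logarithm.H-1≼log {l} {N} Xl 1≤N))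
    (power-≼ (Logarithm.0≼log {l} {N} Xl 1≤N) (Logarithm.log≼H {l} {N} Xl))
    C≼c small vw S≼
    where
    Q≤M : ∀ Q → Q N.^ den N.≤ N N.^ num → Q N.≤ M
    Q≤M zero    _ = z≤n
    Q≤M (suc Q) le = let (a , Xa) = log-exists (suc Q) (s≤s z≤n) in ≤M (suc Q) (power-level {a} {l} {ϑ} {suc Q} {N} num den 1≤den Xa Xl ϑ≈ le)

-- With logarithms of precision 1 / (N^num N^A), the sums over primes are off by at most N times
-- that for each modulus. There are at most N^num moduli, and h^A ≤ N^A.
small-error : ∀ num den A N Q {h} → 1 N.≤ den → 1 N.≤ N → Q N.^ den N.≤ N N.^ num → 0# ≤ h → h ≤ nat N →
  nat Q * (nat N * inv (N N.^ num N.* N N.^ A)) * h ^ A ≤ nat N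
small-error num den A N Q {h} 1≤den 1≤N Q≤ h≥0 h≤N = begin
  nat Q * (nat N * inv K) * h ^ A ≤⟨ *-mono-≤ (*-nonneg (0≤nat Q) (*-nonneg (0≤nat N) (0≤inv K))) (^-nonneg A h≥0) (*-monoʳ-≤ (*-nonneg (0≤nat N) (0≤inv K)) (nat-mono (Q≤N^num Q den 1≤den Q≤))) (^-mono A h≥0 h≤N ◂ ≡⇒≤ (sym (nat-^ N A))) ⟩
  nat (N N.^ num) * (nat N * inv K) * nat (N N.^ A) ≡⟨ solve 4 (λ a n i b → a :* (n :* i) :* b := n :* (a :* b :* i)) refl (nat (N N.^ num)) (nat N) (inv K) (nat (N N.^ A)) ⟩
  nat N * (nat (N N.^ num) * nat (N N.^ A) * inv K) ≡⟨ cong (nat N *_) (cong (_* inv K) (sym (nat-* (N N.^ num) (N N.^ A))) · natinv K {{N.m*n≢0 (N N.^ num) (N N.^ A)}}) ⟩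
  nat N * 1# ≡⟨ *-identityʳ _ ⟩
  nat N ∎
  where
  open ≤-Reasoning
  instance
    _ = N.>-nonZero 1≤N
    _ = N.m^n≢0 N num
    _ = N.m^n≢0 N A
  K : ℕ
  K = N N.^ num N.* N N.^ A
  Q≤N^num : ∀ Q den → 1 N.≤ den → Q N.^ den N.≤ N N.^ num → Q N.≤ N N.^ num
  Q≤N^num zero    _         _ _ = z≤n
  Q≤N^num (suc Q) (suc den) _ le = N.m≤m*n (suc Q) (suc Q N.^ den) {{N.m^n≢0 (suc Q) den}} ◃ le

module LowerApproximation (z : ℝ) {η : ℚ} (η>0 : 0# < η) where

  approximant : ℚ
  approximant = 0# ⊔ proj₁ (approximate z η η>0)

  approximant≥0 : 0# ≤ approximant
  approximant≥0 = p≤p⊔q 0# _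

  approximant-≤ : ∀ {h} → 0# ≤ h → z ≼ ρ h → approximant ≤ h
  approximant-≤ {h} h≥0 z≼h = ⊔-elim (_≤ h) 0# _ h≥0 (≼-ℚ {proj₁ (approximate z η η>0)} {h}
    (chain ρ (proj₁ (approximate z η η>0)) ≼⟨ proj₁ (proj₂ (approximate z η η>0)) ⟩ z ≼⟨ z≼h ⟩ ρ h □))

  approximant-near : 0ℝ ≼ z → Near z approximant η
  approximant-near z≥0 = near (⊔-elim (λ t → ρ t ≼ z) 0# _ (chain ρ 0# ≼⟨ fromℚ0≼0ℝ ⟩ 0ℝ ≼⟨ z≥0 ⟩ z □) (proj₁ (proj₂ (approximate z η η>0))))
    (chain
      z ≼⟨ proj₂ (proj₂ (approximate z η η>0)) ⟩
      ρ (proj₁ (approximate z η η>0) + η) ≼⟨ ℚ-≼ {proj₁ (approximate z η η>0) + η} {approximant + η} (+-mono-≤ (q≤p⊔q 0# _) ≤-refl) ⟩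
      ρ (approximant + η) □)

ind-× : {P Q : Set} (d : Dec P) (e : Dec Q) → ind (d ×-dec e) ≡ ind d * ind e
ind-× (yes _) (yes _) = sym (*-identityˡ 1#)
ind-× (yes _) (no  _) = sym (*-identityˡ 0#)
ind-× (no  _) e = sym (*-zeroˡ (ind e))

class-cong : ∀ {a a' q} n → a ≡ a' [mod q ] → ind (n ≡? a [mod q ]) ≡ ind (n ≡? a' [mod q ])
class-cong {a} {a'} {q} n h = ind-cong (n ≡? a [mod q ]) (n ≡? a' [mod q ]) (λ p → ≡mod-trans {n} {a} {a'} p h) (λ p → ≡mod-trans {n} {a'} {a} p (≡mod-sym {a} {a'} h))

∈[1⋯]⇒ : ∀ {n N} → n ∈ [1⋯ N ] → 1 N.≤ n × n N.≤ N
∈[1⋯]⇒ n∈ with ∈-map⁻ suc n∈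
... | i , i∈ , refl = s≤s z≤n , ∈-upTo⁻ i∈

module PrimeMaximum (ℓ : ℕ → ℚ) (N : ℕ) where

  discrepancy : ℕ → ℕ → ℚ
  discrepancy q a = ∣ primeClassSum ℓ N q a - nat N * inv (φ q) ∣

  E : ℕ → ℚ
  E q = maximum (filter (λ a → coprime? a q) (upTo q)) (discrepancy q)

  E-class : ∀ q a → 1 N.≤ q → Coprime a q → discrepancy q a ≤ E q
  E-class q@(suc _) a 1≤q cop = ≡⇒≤ (cong (λ s → ∣ s - nat N * inv (φ q) ∣)
      (sum-cong N λ i _ → cong (λ t → ℓ (suc i) * (ind (prime? (suc i)) * t)) (class-cong {a} {a N.% q} (suc i) (%-≡mod a q)))) ◂
    ≤-maximum (discrepancy q) (∈-filter⁺ (λ a → coprime? a q) (∈-upTo⁺ (m%n<n a q)) (cop-≡mod {a} {a N.% q} {q} (%-≡mod a q) cop))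

  E-attained : ∀ q → 1 N.≤ q → ∃[ a ] E q ≤ discrepancy q a
  E-attained q _ with maximum-attained (filter (λ a → coprime? a q) (upTo q)) (discrepancy q)
  ... | inj₁ eq = 0 , ≡⇒≤ eq ◂ 0≤∣-∣ _
  ... | inj₂ (a , _ , eq) = a , ≡⇒≤ eq

  listSum : ∀ q a → sumL (filter (λ p → prime? p ×-dec p ≡? a [mod q ]) [1⋯ N ]) ℓ ≡ primeClassSum ℓ N q a
  listSum q a = (sumL-filter (λ p → prime? p ×-dec p ≡? a [mod q ]) ℓ [1⋯ N ]) ·
    (sumL-[1⋯] N (λ p → ℓ p * ind (prime? p ×-dec p ≡? a [mod q ]))) · (sum-cong N λ i _ → cong (ℓ (suc i) *_) (ind-× (prime? (suc i)) (suc i ≡? a [mod q ])))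

  positive : ∀ q a → All (1 N.≤_) (filter (λ p → prime? p ×-dec p ≡? a [mod q ]) [1⋯ N ])
  positive q a = All.tabulate λ p∈ → proj₁ (∈[1⋯]⇒ {N = N} (proj₁ (∈-filter⁻ (λ p → prime? p ×-dec p ≡? a [mod q ]) {xs = [1⋯ N ]} p∈)))

module LiouvilleMaximum (N : ℕ) where

  E : ℕ → ℚ
  E q = maximum [1⋯ N ] (λ y → maximum (upTo q) (λ a → ∣ λ-classSum y q a ∣))

  E-class : ∀ q a y → 1 N.≤ q → y N.≤ N → ∣ λ-classSum y q a ∣ ≤ E q
  E-class q       a zero    _   _ = ≡⇒≤ (∣-∣-nonneg ≤-refl) ◂ (0≤maximum [1⋯ N ] _)
  E-class q@(suc _) a (suc y) 1≤q y≤N = ≡⇒≤ (cong ∣_∣ (sum-cong (suc y) λ i _ → cong (int (liouville (suc i)) *_) (class-cong {a} {a N.% q} (suc i) (%-≡mod a q)))) ◂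
    (≤-maximum (λ a → ∣ λ-classSum (suc y) q a ∣) (∈-upTo⁺ (m%n<n a q)) ◂
      ≤-maximum (λ y → maximum (upTo q) (λ a → ∣ λ-classSum y q a ∣)) (∈-map⁺ suc (∈-upTo⁺ y≤N)))

  E-attained : ∀ q → 1 N.≤ q → ∃[ a ] ∃[ y ] y N.≤ N × E q ≤ ∣ λ-classSum y q a ∣
  E-attained q _ with maximum-attained [1⋯ N ] (λ y → maximum (upTo q) (λ a → ∣ λ-classSum y q a ∣))
  ... | inj₁ eq = 0 , 0 , z≤n , ≡⇒≤ eq ◂ 0≤∣-∣ _
  ... | inj₂ (y , y∈ , eq) with maximum-attained (upTo q) (λ a → ∣ λ-classSum y q a ∣)
  ...   | inj₁ eq' = 0 , 0 , z≤n , ≡⇒≤ (eq · eq') ◂ 0≤∣-∣ _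
  ...   | inj₂ (a , _ , eq') = a , y , proj₂ (∈[1⋯]⇒ {N = N} y∈) , ≡⇒≤ (eq · eq')

  listSum : ∀ y q a → sumL (filter (λ n → n ≡? a [mod q ]) [1⋯ y ]) (λ n → int (liouville n)) ≡ λ-classSum y q a
  listSum y q a = (sumL-filter (λ n → n ≡? a [mod q ]) (λ n → int (liouville n)) [1⋯ y ]) · (sumL-[1⋯] y (λ n → int (liouville n) * ind (n ≡? a [mod q ])))

-- Conditions (A) and (B) speak of positive exponents, so they are applied with A + 1 and the
-- surplus logarithm is dropped here.
weaken-exponent : ∀ {s x} A N → 0# ≤ s → 1 N.≤ N → s * H N ^ suc A ≤ x → s * H N ^ A ≤ x
weaken-exponent {s} {x} A N s≥0 1≤N le = *-monoˡ-≤ s≥0 (≡⇒≤ (sym (*-identityˡ _)) ◂ *-monoʳ-≤ (^-nonneg A (0≤H N)) (1≤H N 1≤N)) ◂ le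

-- The numerical inequality

total : ℕ → (ℕ → ℕ) → ℕ
total zero    f = 0
total (suc n) f = total n f N.+ f n

nat-total : ∀ n f → nat (total n f) ≡ sum n (nat ∘ f)
nat-total zero    f = refl
nat-total (suc n) f = nat-+ (total n f) (f n) · cong (_+ nat (f n)) (nat-total n f)

total-*ˡ : ∀ n c f → c N.* total n f ≡ total n (λ j → c N.* f j)
total-*ˡ zero    c f = N.*-zeroʳ c
total-*ˡ (suc n) c f = N.*-distribˡ-+ c (total n f) (f n) · cong (N._+ c N.* f n) (total-*ˡ n c f)

total-cong : ∀ n {f g} → (∀ j → f j ≡ g j) → total n f ≡ total n g
total-cong zero    h = refl
total-cong (suc n) h = cong₂ N._+_ (total-cong n h) (h n)

-- The products (j + 1) ... (j + κ) and j (j - 1) ... (j - κ + 1), which are κ ! times `U κ (suc j)`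
-- and `L κ j`. Unlike the recursions of `U` and `L` they evaluate quickly for j in the thousands.
rising falling : ℕ → ℕ → ℕ
rising zero    j = 1
rising (suc κ) j = rising κ j N.* (j N.+ suc κ)
falling zero    j = 1
falling (suc κ) zero = 0
falling (suc κ) (suc j) = suc j N.* falling κ j

rising-shift : ∀ κ j → rising (suc κ) j ≡ suc j N.* rising κ (suc j)
rising-shift zero    j = N.*-identityˡ (j N.+ 1) · N.+-comm j 1 · sym (N.*-identityʳ (suc j))
rising-shift (suc κ) j = cong (N._* (j N.+ suc (suc κ))) (rising-shift κ j) ·
  N.*-assoc (suc j) (rising κ (suc j)) _ · cong (λ t → suc j N.* (rising κ (suc j) N.* t)) (N.+-suc j (suc κ))

U-rising : ∀ κ j → κ ! N.* U κ (suc j) ≡ rising κ j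
U-rising zero    j = refl
U-rising (suc κ) zero = N.*-assoc (suc κ) (κ !) (U κ 1) · cong (suc κ N.*_) (U-rising κ 0) · N.*-comm (suc κ) (rising κ 0)
U-rising (suc κ) (suc j) = begin
  suc κ ! N.* (U (suc κ) (suc j) N.+ U κ (suc (suc j))) ≡⟨ N.*-distribˡ-+ (suc κ !) (U (suc κ) (suc j)) _ ⟩
  suc κ ! N.* U (suc κ) (suc j) N.+ suc κ ! N.* U κ (suc (suc j)) ≡⟨ cong₂ N._+_ (U-rising (suc κ) j · rising-shift κ j) (N.*-assoc (suc κ) (κ !) _ · cong (suc κ N.*_) (U-rising κ (suc j))) ⟩
  suc j N.* rising κ (suc j) N.+ suc κ N.* rising κ (suc j) ≡⟨ sym (N.*-distribʳ-+ (rising κ (suc j)) (suc j) (suc κ)) ⟩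
  (suc j N.+ suc κ) N.* rising κ (suc j) ≡⟨ N.*-comm (suc j N.+ suc κ) _ ⟩
  rising (suc κ) (suc j) ∎
  where open ≡-Reasoning

falling-step : ∀ κ j → falling (suc κ) j N.+ κ N.* falling κ j ≡ j N.* falling κ j
falling-step zero    zero = refl
falling-step zero    (suc j) = N.+-identityʳ _
falling-step (suc κ) zero = N.*-zeroʳ (suc κ)
falling-step (suc κ) (suc j) = begin
  suc j N.* falling (suc κ) j N.+ suc κ N.* (suc j N.* falling κ j) ≡⟨ collect j (falling (suc κ) j) κ (falling κ j) ⟩
  suc j N.* (falling (suc κ) j N.+ κ N.* falling κ j N.+ falling κ j) ≡⟨ cong (λ t → suc j N.* (t N.+ falling κ j)) (falling-step κ j) ⟩
  suc j N.* (j N.* falling κ j N.+ falling κ j) ≡⟨ cong (suc j N.*_) (N.+-comm (j N.* falling κ j) _) ⟩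
  suc j N.* falling (suc κ) (suc j) ∎
  where
  open ≡-Reasoning
  collect : ∀ j g κ f → suc j N.* g N.+ suc κ N.* (suc j N.* f) ≡ suc j N.* (g N.+ κ N.* f N.+ f)
  collect = solve-∀

L-falling : ∀ κ j → κ ! N.* L κ j ≡ falling κ j
L-falling zero    j = refl
L-falling (suc κ) zero = N.*-zeroʳ (suc κ !)
L-falling (suc κ) (suc j) = begin
  suc κ ! N.* (L (suc κ) j N.+ L κ j) ≡⟨ N.*-distribˡ-+ (suc κ !) (L (suc κ) j) _ ⟩
  suc κ ! N.* L (suc κ) j N.+ suc κ ! N.* L κ j ≡⟨ cong₂ N._+_ (L-falling (suc κ) j) (N.*-assoc (suc κ) (κ !) _ · cong (suc κ N.*_) (L-falling κ j)) ⟩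
  falling (suc κ) j N.+ (falling κ j N.+ κ N.* falling κ j) ≡⟨ cong (falling (suc κ) j N.+_) (N.+-comm (falling κ j) _) · sym (N.+-assoc (falling (suc κ) j) _ _) ⟩
  falling (suc κ) j N.+ κ N.* falling κ j N.+ falling κ j ≡⟨ cong (N._+ falling κ j) (falling-step κ j) · N.+-comm (j N.* falling κ j) _ ⟩
  suc j N.* falling κ j ∎
  where open ≡-Reasoning

abel : ∀ n (g N d : ℕ → ℚ) → (∀ j → N (suc j) ≡ N j + d j) → sum n (λ j → (g j - g (suc j)) * N j) + g n * N n ≡ g 0 * N 0 + sum n (λ j → g (suc j) * d j)
abel zero    g N d h = +-identityˡ _ · sym (+-identityʳ _)
abel (suc n) g N d h = begin
  sum n (λ j → (g j - g (suc j)) * N j) + (g n - g (suc n)) * N n + g (suc n) * N (suc n) ≡⟨ cong (λ t → sum n (λ j → (g j - g (suc j)) * N j) + (g n - g (suc n)) * N n + g (suc n) * t) (h n) ⟩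
  sum n (λ j → (g j - g (suc j)) * N j) + (g n - g (suc n)) * N n + g (suc n) * (N n + d n) ≡⟨ solve 5 (λ s g g' n d → s :+ (g :- g') :* n :+ g' :* (n :+ d) := s :+ g :* n :+ g' :* d) refl (sum n (λ j → (g j - g (suc j)) * N j)) (g n) (g (suc n)) (N n) (d n) ⟩
  sum n (λ j → (g j - g (suc j)) * N j) + g n * N n + g (suc n) * d n ≡⟨ cong (_+ g (suc n) * d n) (abel n g N d h) ⟩
  g 0 * N 0 + sum n (λ j → g (suc j) * d j) + g (suc n) * d n ≡⟨ +-assoc _ _ _ ⟩
  g 0 * N 0 + sum (suc n) (λ j → g (suc j) * d j) ∎
  where open ≡-Reasoning

-- The steps are b 1 = … = b (M − 1) = 1 and b M = e, so that Y j = e + M − j: a linear weight is close enough to optimal.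
module Linear (M' e : ℕ) where

  M : ℕ
  M = suc M'

  b : ℕ → ℕ
  b zero = 0
  b (suc j) with suc j N.≟ M
  ... | yes _ = e
  ... | no  _ = 1

  open StepFunction M b

  Y-step : ∀ i → i N.≤ M → Y i ≡ nat (b i) + Y (suc i)
  Y-step i i≤M = begin
    sum (suc M) (λ j → nat (b j) * ind (i N.≤? j)) ≡⟨ sum-cong (suc M) (λ j _ → split j) ⟩
    sum (suc M) (λ j → ind (j N.≟ i) * nat (b j) + nat (b j) * ind (suc i N.≤? j)) ≡⟨ sum-+ (suc M) _ _ ⟩
    sum (suc M) (λ j → ind (j N.≟ i) * nat (b j)) + Y (suc i) ≡⟨ cong (_+ Y (suc i)) (sum-single (suc M) i (λ j → nat (b j)) (s≤s i≤M)) ⟩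
    nat (b i) + Y (suc i) ∎
    where
    open ≡-Reasoning
    split : ∀ j → nat (b j) * ind (i N.≤? j) ≡ ind (j N.≟ i) * nat (b j) + nat (b j) * ind (suc i N.≤? j)
    split j with j N.≟ i
    ... | yes refl = cong (nat (b j) *_) (ind-yes (i N.≤? j) N.≤-refl) · (solve 1 (λ b → b :* # 1 := # 1 :* b :+ b :* # 0) refl (nat (b j)) ·
      cong (λ t → 1# * nat (b j) + nat (b j) * t) (sym (ind-no (suc i N.≤? j) (N.<⇒≱ N.≤-refl))))
    ... | no j≢i = cong (nat (b j) *_) (ind-cong (i N.≤? j) (suc i N.≤? j) (λ i≤j → N.≤∧≢⇒< i≤j (λ eq → j≢i (sym eq))) (N.≤-trans (N.n≤1+n i))) ·
      solve 2 (λ b i → b :* i := # 0 :* b :+ b :* i) refl (nat (b j)) (ind (suc i N.≤? j))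

  V-step : ∀ i → V i ≡ V (suc i) + Y (suc i)
  V-step i = trans (sum-cong (suc M) λ j _ → split j) (sum-+ (suc M) _ _)
    where
    ∸-step : ∀ i j → nat (j N.∸ i) ≡ nat (j N.∸ suc i) + ind (suc i N.≤? j)
    ∸-step i j with suc i N.≤? j
    ... | yes i<j = cong nat (N.+-∸-assoc 1 {j} {suc i} i<j) · nat-suc (j N.∸ suc i)
    ... | no  i≮j = cong nat (N.m≤n⇒m∸n≡0 (N.≮⇒≥ i≮j) · sym (N.m≤n⇒m∸n≡0 ((N.≮⇒≥ i≮j) ◃ N.n≤1+n i))) · sym (+-identityʳ _)
    split : ∀ j → nat (b j) * nat (j N.∸ i) ≡ nat (b j) * nat (j N.∸ suc i) + nat (b j) * ind (suc i N.≤? j)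
    split j = cong (nat (b j) *_) (∸-step i j) · *-distribˡ (nat (b j)) _ _

  b-last : b M ≡ e
  b-last with M N.≟ M
  ... | yes _ = refl
  ... | no M≢M with () ← M≢M refl

  b-1 : ∀ j → suc j ≢ M → b (suc j) ≡ 1
  b-1 j j≢ with suc j N.≟ M
  ... | yes eq with () ← j≢ eq
  ... | no _ = refl

  Y-linear : ∀ d i → suc i N.+ d ≡ M → Y (suc i) ≡ nat (e N.+ d)
  Y-linear zero i eq with refl ← trans (sym (N.+-identityʳ (suc i))) eq =
    Y-step M N.≤-refl · cong₂ (λ s t → nat s + t) b-last Y-end · +-identityʳ _ · cong nat (sym (N.+-identityʳ e))
  Y-linear (suc d) i eq = Y-step (suc i) (N.m≤m+n (suc i) (suc d) ◃ N.≤-reflexive eq) ·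
    cong₂ (λ s t → nat s + t) (b-1 i (λ eq' → N.m≢1+m+n (suc i) {d} (eq' · sym eq · N.+-suc (suc i) d))) (Y-linear d (suc i) (sym (N.+-suc (suc i) d) · eq)) ·
      sym (nat-+ 1 (e N.+ d)) · cong nat (sym (N.+-suc e d))

  -- Twice the sum e + (e + 1) + ... + (e + d - 1), doubled to stay in the natural numbers.
  twice : ℕ → ℕ
  twice zero = 0
  twice (suc d) = suc d N.* (2 N.* e N.+ d)

  V-quadratic : ∀ d i → suc i N.+ d ≡ M → nat 2 * V (suc i) ≡ nat (twice d)
  V-quadratic zero i eq with refl ← trans (sym (N.+-identityʳ (suc i))) eq =
    cong (nat 2 *_) (V-step M · cong₂ _+_ V-beyond Y-end · +-identityʳ 0#) · *-zeroʳ (nat 2)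
    where
    V-beyond : V (suc M) ≡ 0#
    V-beyond = V-end
  V-quadratic (suc d) i eq = begin
    nat 2 * V (suc i) ≡⟨ cong (nat 2 *_) (V-step (suc i)) · *-distribˡ (nat 2) _ _ ⟩
    nat 2 * V (suc (suc i)) + nat 2 * Y (suc (suc i)) ≡⟨ cong₂ (λ s t → s + nat 2 * t) (V-quadratic d (suc i) eq') (Y-linear d (suc i) eq') ⟩
    nat (twice d) + nat 2 * nat (e N.+ d) ≡⟨ cong (nat (twice d) +_) (sym (nat-* 2 (e N.+ d))) · sym (nat-+ (twice d) (2 N.* (e N.+ d))) ⟩
    nat (twice d N.+ 2 N.* (e N.+ d)) ≡⟨ cong nat (arith d) ⟩
    nat (twice (suc d)) ∎
    where
    open ≡-Reasoning
    eq' = sym (N.+-suc (suc i) d) · eq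
    base : ∀ e → 2 N.* (e N.+ 0) ≡ 1 N.* (2 N.* e N.+ 0)
    base = solve-∀
    step : ∀ e d → suc d N.* (2 N.* e N.+ d) N.+ 2 N.* (e N.+ suc d) ≡ suc (suc d) N.* (2 N.* e N.+ suc d)
    step = solve-∀
    arith : ∀ d → twice d N.+ 2 N.* (e N.+ d) ≡ twice (suc d)
    arith zero = base e
    arith (suc d) = step e d

  step² four-v² : ℕ → ℕ
  step² j = (e N.+ (M' N.∸ j)) N.* (e N.+ (M' N.∸ j))
  four-v² j = twice (M' N.∸ j) N.* twice (M' N.∸ j)

  𝒰 : ℕ → ℕ
  𝒰 k' = total M (λ j → step² j N.* U k' (suc j))

  four𝒱 : ℕ → ℕ
  four𝒱 k'' = total M (λ j → four-v² j N.* L k'' j)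

  distance : ∀ j → j N.< M → suc j N.+ (M' N.∸ j) ≡ M
  distance j j<M = cong suc (N.m+[n∸m]≡n (N.≤-pred j<M))

  -- This undoes the summation by parts: the increments of `U (suc k')` are values of `U k'`.
  layers-Y : ∀ k' → layers Y (U (suc k')) ≡ nat (𝒰 k')
  layers-Y k' = begin
    layers Y (U (suc k')) ≡⟨ sym (+-identityʳ _) · cong (layers Y (U (suc k')) +_) (sym (cong (_* nat (U (suc k') (suc M))) (cong (λ t → t * t) Y-end · *-zeroˡ 0#) · *-zeroˡ _)) ⟩
    layers Y (U (suc k')) + Y (suc M) * Y (suc M) * nat (U (suc k') (suc M)) ≡⟨ abel (suc M) (λ j → Y j * Y j) (λ j → nat (U (suc k') j)) (λ j → nat (U k' (suc j))) (λ j → nat-+ (U (suc k') j) (U k' (suc j))) ⟩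
    Y 0 * Y 0 * 0# + (sum M (λ j → Y (suc j) * Y (suc j) * nat (U k' (suc j))) + Y (suc M) * Y (suc M) * nat (U k' (suc M))) ≡⟨ cong₂ _+_ (*-zeroʳ _) (cong (sum M (λ j → Y (suc j) * Y (suc j) * nat (U k' (suc j))) +_) (cong (_* nat (U k' (suc M))) (cong (λ t → t * t) Y-end · *-zeroˡ 0#) · *-zeroˡ _)) ⟩
    0# + (sum M (λ j → Y (suc j) * Y (suc j) * nat (U k' (suc j))) + 0#) ≡⟨ +-identityˡ _ · +-identityʳ _ ⟩
    sum M (λ j → Y (suc j) * Y (suc j) * nat (U k' (suc j))) ≡⟨ sum-cong M (λ j j<M → cong (λ t → t * t * nat (U k' (suc j))) (Y-linear (M' N.∸ j) j (distance j j<M)) ·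
           sym (nat-* (step² j) (U k' (suc j)) · cong (_* nat (U k' (suc j))) (nat-* (e N.+ (M' N.∸ j)) (e N.+ (M' N.∸ j))))) ⟩
    sum M (λ j → nat (step² j N.* U k' (suc j))) ≡⟨ sym (nat-total M _) ⟩
    nat (𝒰 k') ∎
    where open ≡-Reasoning

  layers-V : ∀ k'' → nat 4 * layers V (L (suc k'')) ≡ nat (four𝒱 k'')
  layers-V k'' = begin
    nat 4 * layers V (L (suc k'')) ≡⟨ cong (nat 4 *_) ((sym (+-identityʳ _) · cong (layers V (L (suc k'')) +_) (sym (cong (_* nat (L (suc k'') (suc M))) (cong (λ t → t * t) V-end · *-zeroˡ 0#) · *-zeroˡ _))) ·
           abel (suc M) (λ j → V j * V j) (λ j → nat (L (suc k'') j)) (λ j → nat (L k'' j)) (λ j → nat-+ (L (suc k'') j) (L k'' j))) ⟩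
    nat 4 * (V 0 * V 0 * 0# + (sum M (λ j → V (suc j) * V (suc j) * nat (L k'' j)) + V (suc M) * V (suc M) * nat (L k'' M))) ≡⟨ cong (nat 4 *_) (cong₂ _+_ (*-zeroʳ _) (cong (sum M (λ j → V (suc j) * V (suc j) * nat (L k'' j)) +_) (cong (_* nat (L k'' M)) (cong (λ t → t * t) V-end · *-zeroˡ 0#) · *-zeroˡ _)) ·
           +-identityˡ _ · +-identityʳ _) ⟩
    nat 4 * sum M (λ j → V (suc j) * V (suc j) * nat (L k'' j)) ≡⟨ sym (sum-*ˡ M (nat 4) _) ⟩
    sum M (λ j → nat 4 * (V (suc j) * V (suc j) * nat (L k'' j))) ≡⟨ sum-cong M (λ j j<M → cong (_* (V (suc j) * V (suc j) * nat (L k'' j))) (nat-* 2 2) · (solve 3 (λ t v l → t :* t :* (v :* v :* l) := t :* v :* (t :* v) :* l) refl (nat 2) (V (suc j)) (nat (L k'' j)) ·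
           (cong (λ t → t * t * nat (L k'' j)) (V-quadratic (M' N.∸ j) j (distance j j<M)) ·
             sym (nat-* (four-v² j) (L k'' j) · cong (_* nat (L k'' j)) (nat-* (twice (M' N.∸ j)) (twice (M' N.∸ j))))))) ⟩
    sum M (λ j → nat (four-v² j N.* L k'' j)) ≡⟨ sym (nat-total M _) ⟩
    nat (four𝒱 k'') ∎
    where open ≡-Reasoning

  𝒰-computed 𝒱-computed : ℕ → ℕ
  𝒰-computed k' = total M (λ j → step² j N.* rising k' j)
  𝒱-computed k'' = total M (λ j → four-v² j N.* falling k'' j)

  private
    factor : ∀ c x y z → c N.* y ≡ z → c N.* (x N.* y) ≡ x N.* z
    factor c x y z eq = sym (N.*-assoc c x y) · cong (N._* y) (N.*-comm c x) · N.*-assoc x c y · cong (x N.*_) eq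

  𝒰-scaled : ∀ k' → k' ! N.* 𝒰 k' ≡ 𝒰-computed k'
  𝒰-scaled k' = total-*ˡ M (k' !) _ · (total-cong M λ j → factor (k' !) (step² j) (U k' (suc j)) (rising k' j) (U-rising k' j))

  𝒱-scaled : ∀ k'' → k'' ! N.* four𝒱 k'' ≡ 𝒱-computed k''
  𝒱-scaled k'' = total-*ˡ M (k'' !) _ · (total-cong M λ j → factor (k'' !) (four-v² j) (L k'' j) (falling k'' j) (L-falling k'' j))

  -- The comparison J 𝒰 + 1 ≤ 2 k 𝒱 is multiplied by 4 (k - 1)!, which makes both sides sums of
  -- products of natural numbers.
  numeric : ∀ k'' J → 4 N.* (J N.* 𝒰-computed (suc k'') N.+ suc k'' !) N.≤ 2 N.* suc (suc k'') N.* (suc k'' N.* 𝒱-computed k'') →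
    nat J * layers Y (U (suc (suc k''))) ≤ nat (J N.* 𝒰 (suc k'')) × nat (suc (J N.* 𝒰 (suc k''))) ≤ nat (2 N.* suc (suc k'')) * layers V (L (suc k''))
  numeric k'' J le = ≡⇒≤ (cong (nat J *_) (layers-Y (suc k'')) · sym (nat-* J (𝒰 (suc k'')))) , *-cancelˡ-≤ (0<nat 4) (begin
    nat 4 * nat (suc (J N.* 𝒰 (suc k''))) ≡⟨ sym (nat-* 4 (suc (J N.* 𝒰 (suc k'')))) ⟩
    nat (4 N.* suc (J N.* 𝒰 (suc k''))) ≤⟨ nat-mono (N.*-cancelˡ-≤ (suc k'' !) {{N._!≢0 (suc k'')}} le') ⟩
    nat (2 N.* suc (suc k'') N.* four𝒱 k'') ≡⟨ nat-* (2 N.* suc (suc k'')) (four𝒱 k'') · cong (nat (2 N.* suc (suc k'')) *_) (sym (layers-V k'')) ⟩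
    nat (2 N.* suc (suc k'')) * (nat 4 * layers V (L (suc k''))) ≡⟨ solve 3 (λ k f v → k :* (f :* v) := f :* (k :* v)) refl (nat (2 N.* suc (suc k''))) (nat 4) (layers V (L (suc k''))) ⟩
    nat 4 * (nat (2 N.* suc (suc k'')) * layers V (L (suc k''))) ∎)
    where
    open ≤-Reasoning
    left : ∀ f J u → f N.* (4 N.* suc (J N.* u)) ≡ 4 N.* (J N.* (f N.* u) N.+ f)
    left = solve-∀
    right : ∀ k κ f v → k N.* (κ N.* (f N.* v)) ≡ κ N.* f N.* (k N.* v)
    right = solve-∀
    le' : suc k'' ! N.* (4 N.* suc (J N.* 𝒰 (suc k''))) N.≤ suc k'' ! N.* (2 N.* suc (suc k'') N.* four𝒱 k'')
    le' = subst₂ N._≤_ (cong (λ t → 4 N.* (J N.* t N.+ suc k'' !)) (sym (𝒰-scaled (suc k''))) · sym (left (suc k'' !) J (𝒰 (suc k''))))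
      (cong (λ t → 2 N.* suc (suc k'') N.* (suc k'' N.* t)) (sym (𝒱-scaled k'')) · right (2 N.* suc (suc k'')) (suc k'') (k'' !) (four𝒱 k'')) le

numeric-check : ∀ M' e k'' J → Set
numeric-check M' e k'' J = Bool.T (4 N.* (J N.* Linear.𝒰-computed M' e (suc k'') N.+ suc k'' !) N.≤ᵇ 2 N.* suc (suc k'') N.* (suc k'' N.* Linear.𝒱-computed M' e k''))

-- The arguments are M - 1, e, k - 2 and J, where J is the least integer with (2 M + 1) / J ≤ ϑ₀.
-- The ratios e / M, about 0.80, 0.32, 0.18 and 0.11 in the four cases, are close to the optimum for
-- linear weights. In the limit of a fine mesh the inequality has a margin below one percent, which
-- is why M is so large.
check₂ : numeric-check 599 481 0 1648
check₂ = tt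
check₃ : numeric-check 2399 767 1 7794
check₃ = tt
check₄ : numeric-check 5599 990 2 20219
check₄ = tt
check₅ : numeric-check 6399 727 3 24857
check₅ = tt

-- From integer tuples to natural numbers

sumL-map : {A B : Set} (g : A → B) (f : B → ℚ) (xs : List A) → sumL (map g xs) f ≡ sumL xs (f ∘ g)
sumL-map g f [] = refl
sumL-map g f (x ∷ xs) = cong (λ t → f (g x) + t) (sumL-map g f xs)

at-most-one : {A : Set} {P : A → Set} (P? : ∀ x → Dec (P x)) → (∀ x y → x ≢ y → P x → ¬ P y) → ∀ xs → Unique xs →
  sumL xs (ind ∘ P?) ≡ 0# ⊎ ∃ P × sumL xs (ind ∘ P?) ≡ 1#
at-most-one P? h []       _ = inj₁ refl
at-most-one {P = P} P? h (x ∷ xs) (x∉ ∷ u) = step (P? x) (at-most-one P? h xs u)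
  where
  none : P x → ∀ ys → All (x ≢_) ys → sumL ys (ind ∘ P?) ≡ 0#
  none p []       _ = refl
  none p (y ∷ ys) (x≢y ∷ x∉) = cong₂ _+_ (ind-no (P? y) (h x y x≢y p)) (none p ys x∉) · +-identityʳ 0#
  step : (d : Dec (P x)) → sumL xs (ind ∘ P?) ≡ 0# ⊎ ∃ P × sumL xs (ind ∘ P?) ≡ 1# →
    ind d + sumL xs (ind ∘ P?) ≡ 0# ⊎ ∃ P × ind d + sumL xs (ind ∘ P?) ≡ 1#
  step (yes p) _ = inj₂ ((x , p) , cong (λ t → 1# + t) (none p xs x∉) · +-identityʳ 1#)
  step (no  _) (inj₁ eq) = inj₁ (+-identityˡ _ · eq)
  step (no  _) (inj₂ (some , eq)) = inj₂ (some , +-identityˡ _ · eq)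

-- The integers n are written m + c with m natural, where c is such that all the shifts c + h i and c + r = s are natural.
module Shifted {k : ℕ} (h : Fin k → ℕ) (inc : IsIncreasing h) (c s : ℕ) (r : ℤ) (c+r≡s : Z.+ c Z.+ r ≡ Z.+ s) where

  Desired : ℤ → Set
  Desired n = AtLeastTwoPrimes h n ⊎ ((∃[ i ] IsPrime (n Z.+ Z.+ h i)) × HasLiouville-1 (n Z.+ r))

  hs : List ℕ
  hs = map (λ i → c N.+ h i) (allFin k)

  h-injective : ∀ {i j} → h i ≡ h j → i ≡ j
  h-injective {i} {j} eq with Fin.<-cmp i j
  ... | tri< i<j _ _ = ⊥-elim (N.<⇒≢ (inc i<j) eq)
  ... | tri≈ _ i≡j _ = i≡j
  ... | tri> _ _ j<i = ⊥-elim (N.<⇒≢ (inc j<i) (sym eq))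

  hs-unique : Unique hs
  hs-unique = map⁺ (λ {i} {j} eq → h-injective (N.+-cancelˡ-≡ c (h i) (h j) eq)) (allFin⁺ k)

  hs-length : length hs ≡ k
  hs-length = length-map _ (allFin k) · length-tabulate id

  shift-h : ∀ m i → Z.+ (m N.+ c) Z.+ Z.+ h i ≡ Z.+ (m N.+ (c N.+ h i))
  shift-h m i = cong (λ t → Z.+ t) (N.+-assoc m c (h i))

  shift-r : ∀ m → Z.+ (m N.+ c) Z.+ r ≡ Z.+ (m N.+ s)
  shift-r m = Z.+-assoc (Z.+ m) (Z.+ c) r · cong (λ t → Z.+ m Z.+ t) c+r≡s

  module _ (m : ℕ) (bad : ¬ Desired (Z.+ (m N.+ c))) where

    P : Fin k → Set
    P i = Prime (m N.+ (c N.+ h i))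

    one-prime : ∀ i j → i ≢ j → P i → ¬ P j
    one-prime i j i≢j p q with Fin.<-cmp i j
    ... | tri< i<j _ _ = bad (inj₁ (i , j , i<j , (_ , shift-h m i , p) , (_ , shift-h m j , q)))
    ... | tri≈ _ i≡j _ = i≢j i≡j
    ... | tri> _ _ j<i = bad (inj₁ (j , i , j<i , (_ , shift-h m j , q) , (_ , shift-h m i , p)))

    λ≢-1 : ∃ P → liouville (m N.+ s) ≢ Z.-1ℤ
    λ≢-1 (i , p) eq = bad (inj₂ ((i , _ , shift-h m i , p) , m N.+ s , shift-r m , eq))

    -- Without primes the right side is at least 0. With one prime λ must be 1, as -1 would be the
    -- second alternative, and both sides are 2.
    parity : nat 2 * sumL hs (λ j → ind (prime? (m N.+ j))) ≤ 1# + int (liouville (m N.+ s))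
    parity = subst (λ t → nat 2 * t ≤ 1# + int (liouville (m N.+ s))) (sym (sumL-map (λ i → c N.+ h i) (λ j → ind (prime? (m N.+ j))) (allFin k)))
      (cases (at-most-one (λ i → prime? (m N.+ (c N.+ h i))) one-prime (allFin k) (allFin⁺ k)) (±1 (Ω (m N.+ s))))
      where
      count : ℚ
      count = sumL (allFin k) (λ i → ind (prime? (m N.+ (c N.+ h i))))
      ±1 : ∀ e → Z.-1ℤ Z.^ e ≡ Z.1ℤ ⊎ Z.-1ℤ Z.^ e ≡ Z.-1ℤ
      ±1 zero = inj₁ refl
      ±1 (suc e) with ±1 e
      ... | inj₁ eq = inj₂ (cong (Z.-1ℤ Z.*_) eq)
      ... | inj₂ eq = inj₁ (cong (Z.-1ℤ Z.*_) eq)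
      cases : count ≡ 0# ⊎ ∃ P × count ≡ 1# → liouville (m N.+ s) ≡ Z.1ℤ ⊎ liouville (m N.+ s) ≡ Z.-1ℤ → nat 2 * count ≤ 1# + int (liouville (m N.+ s))
      cases (inj₁ eq) (inj₁ λ≡) = subst₂ (λ s l → nat 2 * s ≤ 1# + int l) (sym eq) (sym λ≡) (≡⇒≤ (*-zeroʳ (nat 2)) ◂ +-nonneg 0≤1 0≤1)
      cases (inj₁ eq) (inj₂ λ≡) = subst₂ (λ s l → nat 2 * s ≤ 1# + int l) (sym eq) (sym λ≡) (≡⇒≤ (*-zeroʳ (nat 2) · sym (cong (λ t → 1# + t) (int-neg (Z.+ 1)) · +-inverseʳ 1#)))
      cases (inj₂ (some , eq)) (inj₁ λ≡) = subst₂ (λ s l → nat 2 * s ≤ 1# + int l) (sym eq) (sym λ≡) (≡⇒≤ (*-identityʳ (nat 2) · nat-+ 1 1))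
      cases (inj₂ (some , eq)) (inj₂ λ≡) = ⊥-elim (λ≢-1 some λ≡)

  module _ (lem : (A : Set) → Dec A) where

    -- If no h i lies in the class of a modulo p, the residue -(c + a) works: its sum with c + h i
    -- is h i - a modulo p.
    admissible : Admissible h → ∀ p → Prime p → ∃[ a ] ∀ x → x ∈ hs → ¬ p ∣ a N.+ x
    admissible adm p pp with lem (∃[ a ] ¬ (∃[ i ] h i ≡ a [mod p ]))
    ... | no none = ⊥-elim (adm p pp λ a → avoid a (lem (∃[ i ] h i ≡ a [mod p ])))
      where
      avoid : ∀ a → Dec (∃[ i ] h i ≡ a [mod p ]) → ∃[ i ] h i ≡ a [mod p ]
      avoid a (yes some) = some
      avoid a (no ¬some) = ⊥-elim (none (a , ¬some))
    ... | yes (a , ¬some) = a' , λ x x∈ p∣ → omitted x (∈-map⁻ (λ i → c N.+ h i) x∈) p∣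
      where
      -- a' + c + a ≡ 0 (mod p)
      a' : ℕ
      a' = N.pred p N.* (c N.+ a)
      multiple : (a' N.+ (c N.+ a)) ≡ 0 [mod p ]
      multiple = ≡mod-+ 0 (a' N.+ (c N.+ a)) (subst (p ∣_) (cong (N._* (c N.+ a)) (sym (N.suc-pred p {{p≢0}})) · N.+-comm (c N.+ a) a') (m∣m*n (c N.+ a)))
        where
        p≢0 = prime⇒nonZero pp
      omitted : ∀ x → ∃[ i ] i ∈ allFin k × x ≡ c N.+ h i → ¬ p ∣ a' N.+ x
      omitted x (i , _ , refl) p∣ = ¬some (i , ≡mod-unshift {h i} {a} {p} (a' N.+ c) (subst₂ (λ u v → u ≡ v [mod p ]) (swap a' c (h i)) (swap a' c a)
        (≡mod-trans {a' N.+ (c N.+ h i)} {0} {a' N.+ (c N.+ a)} (≡mod-+ 0 (a' N.+ (c N.+ h i)) p∣) (≡mod-sym {a' N.+ (c N.+ a)} {0} multiple))))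
        where
        swap : ∀ a c x → a N.+ (c N.+ x) ≡ x N.+ (a N.+ c)
        swap = solve-∀

    bound : List ℤ → ℕ
    bound = foldr (λ z n → Z.∣ z ∣ N.+ n) 0

    ∈⇒≤bound : ∀ {z} zs → z ∈ zs → Z.∣ z ∣ N.≤ bound zs
    ∈⇒≤bound (z ∷ zs) (here refl) = N.m≤m+n Z.∣ z ∣ _
    ∈⇒≤bound (y ∷ zs) (there z∈) = ∈⇒≤bound zs z∈ ◃ (N.m≤n+m _ Z.∣ y ∣)

    -- An m beyond the sum of the absolute values of ns yields an n = m + c outside ns. If no such n
    -- were as desired, the parity inequality would hold for all these m.
    infinitely-many : (∀ n₀ → (∀ m → n₀ N.< m → nat 2 * sumL hs (λ j → ind (prime? (m N.+ j))) ≤ 1# + int (liouville (m N.+ s))) → ⊥) →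
      ∀ (ns : List ℤ) → ∃[ n ] n ∉ ns × Desired n
    infinitely-many impossible ns with lem (∃[ n ] n ∉ ns × Desired n)
    ... | yes found = found
    ... | no none = ⊥-elim (impossible (bound ns) λ m m> → parity m λ good → none (Z.+ (m N.+ c) ,
          (λ n∈ → N.<⇒≱ m> (N.m≤m+n m c ◃ ∈⇒≤bound ns n∈)) , good))

Level : ℕ → ℕ → Set
Level num k = (∀ A → ∃[ C ] ∃[ N₀ ] ∀ N → N₀ N.≤ N → PrimeLevel num 1000 A C N) × (∀ A → ∃[ C ] ∃[ N₀ ] ∀ N → N₀ N.≤ N → LiouvilleLevel num 1000 A C N)

natural-shift : ∀ r → ∃[ c ] ∃[ s ] Z.+ c Z.+ r ≡ Z.+ s
natural-shift (Z.+ r) = 0 , r , refl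
natural-shift -[1+ r ] = suc r , 0 , Z.n⊖n≡0 (suc r)

conclude : (lem : (A : Set) → Dec A) → ∀ num M' e k'' J →
  numeric-check M' e k'' J → Bool.T ((2 N.* suc M' N.+ 1) N.* 1000 N.≤ᵇ J N.* num) → Bool.T (2 N.* suc M' N.+ 2 N.≤ᵇ J) → Level num (suc (suc k'')) →
  (h : Fin (suc (suc k'')) → ℕ) → IsIncreasing h → Admissible h → (r : ℤ) → ∀ (ns : List ℤ) →
  ∃[ n ] n ∉ ns × (AtLeastTwoPrimes h n ⊎ ((∃[ i ] IsPrime (n Z.+ Z.+ h i)) × HasLiouville-1 (n Z.+ r)))
conclude lem num M' e k'' J check within room (PLs , LLs) h inc adm r with natural-shift r
... | c , s , c+r≡s = infinitely-many lem λ n₀ parity →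
  contradiction (suc k'') hs hs-length hs-unique s (suc M') J (J N.* Linear.𝒰 M' e (suc k'')) num 1000 (Linear.b M' e) refl (s≤s z≤n)
    (N.≤ᵇ⇒≤ _ _ within) (N.≤ᵇ⇒≤ _ _ room) (proj₁ bounds) (proj₂ bounds) (admissible lem adm) PLs LLs n₀ parity
  where
  open Shifted h inc c s r c+r≡s
  bounds = Linear.numeric M' e k'' J (N.≤ᵇ⇒≤ _ _ check)

opaque
  unfolding int inv _*_

  ϑ₂ : Z.+ 729 Q./ 1000 ≡ nat 729 * inv 1000
  ϑ₂ = refl

  ϑ₃ : Z.+ 616 Q./ 1000 ≡ nat 616 * inv 1000
  ϑ₃ = refl

  ϑ₄ : Z.+ 554 Q./ 1000 ≡ nat 554 * inv 1000
  ϑ₄ = refl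

  ϑ₅ : Z.+ 515 Q./ 1000 ≡ nat 515 * inv 1000
  ϑ₅ = refl

-- The classical functions of the statement and the conclusion

module _ (em : ExcludedMiddle 0ℓ) where

  choose : {A : Set} → A → (A → Set) → A
  choose = R.choose em

  abs reciprocal exp log : ℝ → ℝ
  abs = R.∣_∣ em
  reciprocal = R._⁻¹ em
  exp = R.exp em
  log = R.log em

  divide power : ℝ → ℝ → ℝ
  divide = R._/_ em
  power = R._^_ em

  Converges : (ℕ → ℝ) → ℝ → Set
  Converges = R._⟶_ em

  lim : (ℕ → ℝ) → ℝ
  lim = R.lim em

  max : List ℝ → ℝ
  max = R.max em

  floor : ℝ → ℕ
  floor = R.⌊_⌋ em

  join : ℝ → ℝ → ℝ
  join = R._⊔_ em

  primeLogSum liouvilleSum : ℕ → ℕ → ℕ → ℝ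
  primeLogSum = R.primeLogSum em
  liouvilleSum = R.liouvilleSum em


  choose-spec : ∀ {A : Set} d (P : A → Set) → ∃ P → P (choose d P)
  choose-spec d P ex with em {P = ∃ P}
  ... | yes (x , p) = p
  ... | no ¬ex = ⊥-elim (¬ex ex)

  ∣-∣-elim : ∀ z (P : ℝ → Set) → P z → P (R.- z) → P (abs z)
  ∣-∣-elim z P p q with em {P = z R.< 0ℝ}
  ... | yes _ = q
  ... | no  _ = p

  ∣-∣≽ : ∀ z → z ≼ abs z × (R.- z) ≼ abs z
  ∣-∣≽ z with em {P = z R.< 0ℝ}
  ... | yes z<0 = (chain z ≼⟨ <⇒≼ {z} {0ℝ} z<0 ⟩ 0ℝ ∼˘⟨ -0≈0 ⟩ R.- 0ℝ ≼⟨ neg-mono-≼ {z} {0ℝ} (<⇒≼ {z} {0ℝ} z<0) ⟩ R.- z □) , ≼-refl {R.- z}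
  ... | no z≮0 = ≼-refl {z} , (chain R.- z ≼⟨ neg-mono-≼ {0ℝ} {z} (≤⇒≼ {0ℝ} {z} z≮0) ⟩ R.- 0ℝ ∼⟨ -0≈0 ⟩ 0ℝ ≼⟨ ≤⇒≼ {0ℝ} {z} z≮0 ⟩ z □)

  ≼-total : ∀ x y → x ≼ y ⊎ y ≼ x
  ≼-total x y with em {P = x R.≤ y}
  ... | yes le = inj₁ (≤⇒≼ {x} {y} le)
  ... | no ¬le = inj₂ (≤⇒≼ {y} {x} λ x<y → ¬le (≼⇒≤ {x} {y} (<⇒≼ {x} {y} x<y)))

  fromℕ⁻¹ : ∀ d → 1 N.≤ d → reciprocal (fromℕ d) ≈ ρ (inv d)
  fromℕ⁻¹ d 1≤d = inverse-ℕ d {reciprocal (fromℕ d)} 1≤d (choose-spec 0ℝ (λ y → (fromℕ d R.* y) ≈ 1ℝ) (ρ (inv d) , n*inv≈1 d 1≤d))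

  /≈* : ∀ x y → divide x y ≈ (x R.* reciprocal y)
  /≈* x y = pointwise-≈ {divide x y} {x R.* reciprocal y} λ _ → refl

  /-fromℕ : ∀ x d → 1 N.≤ d → divide x (fromℕ d) ≈ (x R.* ρ (inv d))
  /-fromℕ x d 1≤d = ≈-trans {divide x (fromℕ d)} {x R.* reciprocal (fromℕ d)} {x R.* ρ (inv d)} (/≈* x (fromℕ d))
    (*-cong-≈ {x} {x} {reciprocal (fromℕ d)} {ρ (inv d)} (≈-refl {x}) (fromℕ⁻¹ d 1≤d))

  /-represents : ∀ x d (t : ℕ → ℚ) → 1 N.≤ d → (∀ m → at x m ≡ t m) → Represents (divide x (fromℕ d)) (λ m → t m * inv d)
  /-represents x d t 1≤d h = represents-≈ {divide x (fromℕ d)} {x R.* ρ (inv d)} {λ m → t m * inv d} (/-fromℕ x d 1≤d)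
    (λ m → approx-* x (ρ (inv d)) m · cong (_* inv d) (h m))

  exp-represents : ∀ x n → Represents (R.sum (map (λ k → divide (x R.^ℕ k) (fromℕ (k !))) (upTo n))) (λ m → sum n (term (at x m)))
  exp-represents x n = series-represents (λ k → divide (x R.^ℕ k) (fromℕ (k !))) (λ k m → at x m ^ k * inv (k !)) n
    (λ k → /-represents (x R.^ℕ k) (k !) (λ m → at x m ^ k) (N.n≢0⇒n>0 (N.≢-nonZero⁻¹ (k !) {{N._!≢0 k}})) (^ℕ-approx x k))

  ⟶-near : ∀ {s l δ} → 0# < δ → Converges s l → Eventually (λ n → s n ≼ (l R.+ ρ δ) × l ≼ (s n R.+ ρ δ))
  ⟶-near {s} {l} {δ} δ>0 h = Eventually-map step (h (ρ δ) (⇒< {0ℝ} {ρ δ} δ>0 0ℝ≼fromℚ0 (≼-refl {ρ δ})))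
    where
    step : ∀ n → abs (s n R.- l) R.< ρ δ → s n ≼ (l R.+ ρ δ) × l ≼ (s n R.+ ρ δ)
    step n lt = x-y≼⇒ {s n} {l} (chain s n R.- l ≼⟨ proj₁ (∣-∣≽ (s n R.- l)) ⟩ abs (s n R.- l) ≼⟨ <⇒≼ {abs (s n R.- l)} {ρ δ} lt ⟩ ρ δ □) ,
      neg-x-y≼⇒ {s n} {l} (chain R.- (s n R.- l) ≼⟨ proj₂ (∣-∣≽ (s n R.- l)) ⟩ abs (s n R.- l) ≼⟨ <⇒≼ {abs (s n R.- l)} {ρ δ} lt ⟩ ρ δ □)

  ⟶-≼ : ∀ {s l l'} → Converges s l → Converges s l' → l ≼ l'
  ⟶-≼ {s} {l} {l'} h h' = ≼-eps {l} {l'} λ δ δ>0 →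
    let (n , ((_ , p) , (q , _))) = Eventually-∃ (Eventually-× (⟶-near {s} {l} (half>0 δ>0) h) (⟶-near {s} {l'} (half>0 δ>0) h'))
    in (chain
      l ≼⟨ p ⟩
      s n R.+ ρ (half δ) ≼⟨ +-mono-≼ {s n} {l' R.+ ρ (half δ)} {ρ (half δ)} {ρ (half δ)} q (≼-refl {ρ (half δ)}) ⟩
      (l' R.+ ρ (half δ)) R.+ ρ (half δ) ∼⟨ x+half+half≈ l' δ ⟩
      l' R.+ ρ δ □)

  -- Partial sums of fixed length converge to the diagonal real X x because the tail bound is
  -- uniform in the index of the approximants.
  ⟶-X : ∀ x (s : ℕ → ℝ) → (∀ n → Represents (s n) (λ m → sum n (term (at x m)))) → Converges s (X x)
  ⟶-X x s rep ε 0<ε = 2 N.+ n₀ , close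
    where
    open ≤-Reasoning
    δ : ℚ
    δ = proj₁ (0<⇒ {ε} 0<ε)
    δ>0 : 0# < δ
    δ>0 = proj₁ (proj₂ (0<⇒ {ε} 0<ε))
    B₀ n₀ : ℕ
    B₀ = proj₁ (bound⁺ x)
    1≤B : 1 N.≤ B₀
    1≤B = proj₁ (proj₂ (bound⁺ x))
    quarter : ℚ
    quarter = half (half δ)
    q>0 : 0# < quarter
    q>0 = half>0 (half>0 δ>0)
    n₀ = proj₁ (vanish (tailConstant≥0 B₀ 1≤B) q>0)
    small : ∀ n → n₀ N.≤ n → tailConstant B₀ 1≤B * inv (suc n) ≤ quarter
    small = proj₂ (vanish (tailConstant≥0 B₀ 1≤B) q>0)
    triangle : ∀ a b c → ∣ a - b ∣ ≤ quarter → ∣ c - b ∣ ≤ quarter → ∣ a - c ∣ ≤ half δ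
    triangle a b c p q = begin
      ∣ a - c ∣                       ≡⟨ cong ∣_∣ (solve 3 (λ a b c → a :- c := (a :- b) :+ :- (c :- b)) refl a b c) ⟩
      ∣ a - b + - (c - b) ∣           ≤⟨ ∣-∣-triangle _ _ ◂ +-mono-≤ p (≡⇒≤ (∣-∣-neg _) ◂ q) ⟩
      quarter + quarter               ≡⟨ half+half (half δ) ⟩
      half δ                          ∎
    eventuallyNear : ∀ n → 2 N.+ n₀ N.≤ n → Eventually (λ m → ∣ at (s n) m - at (X x) m ∣ ≤ half δ)
    eventuallyNear n le = Eventually-map step (Eventually-× (Eventually-× (Represents.within (rep n) quarter q>0) (proj₂ (proj₂ (bound⁺ x)))) (n , λ m p → p))
      where
      n' = n N.∸ 2
      n≡ : 2 N.+ n' ≡ n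
      n≡ = N.m+[n∸m]≡n (N.m≤m+n 2 n₀ ◃ le)
      n₀≤ : n₀ N.≤ n'
      n₀≤ = N.≤-reflexive (sym (N.m+n∸m≡n 2 n₀)) ◃ N.∸-monoˡ-≤ 2 le
      step : ∀ m → (∣ at (s n) m - e n (at x m) ∣ ≤ quarter × ∣ at x m ∣ ≤ nat B₀) × n N.≤ m → ∣ at (s n) m - at (X x) m ∣ ≤ half δ
      step m ((p , bd) , n≤m) = triangle (at (s n) m) (e n (at x m)) (at (X x) m) p
        (subst (λ t → ∣ t - e n (at x m) ∣ ≤ quarter) (sym (approx-X x m))
          (subst (λ k → ∣ e m (at x m) - e k (at x m) ∣ ≤ quarter) n≡
            (e-tail' B₀ 1≤B n' m (subst (N._≤ m) (sym n≡) n≤m) bd ◂ small n' n₀≤)))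
    close : ∀ n → 2 N.+ n₀ N.≤ n → abs (s n R.- X x) R.< ε
    close n le = ⇒< {abs z} {ε} (half< δ>0) (∣-∣-elim z (λ w → w ≼ ρ (half δ)) (below (λ m h → x≤∣x∣ _ ◂ h)) below') (proj₂ (proj₂ (0<⇒ {ε} 0<ε)))
      where
      z : ℝ
      z = s n R.- X x
      az : ∀ m → at z m ≡ at (s n) m - at (X x) m
      az m = approx-minus (s n) (X x) m
      below : (∀ m → ∣ at (s n) m - at (X x) m ∣ ≤ half δ → at (s n) m - at (X x) m ≤ half δ) → z ≼ ρ (half δ)
      below h ε' ε'>0 = Eventually-map (λ m p → ≡⇒≤ (az m) ◂ h m p ◂ ≤-add ε' (<⇒≤ ε'>0) refl) (eventuallyNear n le)
      below' : (R.- z) ≼ ρ (half δ)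
      below' ε' ε'>0 = Eventually-map (λ m p → ≡⇒≤ (approx-neg z m · cong (λ t → - t) (az m)) ◂ -x≤∣x∣ _ ◂ p ◂ ≤-add ε' (<⇒≤ ε'>0) refl) (eventuallyNear n le)


  -- The chosen element enters as a variable z with an equation, so that later goals mention z and
  -- not the choice itself. The other lemmas ending in `-any` follow the same pattern.
  choose-any : ∀ {A : Set} d (P : A → Set) z → z ≡ choose d P → ∃ P → P z
  choose-any d P z eq ex = subst P (sym eq) (choose-spec d P ex)

  limit-any : ∀ s {l} z → z ≡ choose 0ℝ (Converges s) → Converges s l → Converges s z
  limit-any s {l} z eq h = choose-any 0ℝ (Converges s) z eq (l , h)

  unique : ∀ s {l} {l'} → Converges s l → Converges s l' → l ≈ l'
  unique s {l} {l'} h h' = ≼-antisym {l} {l'} (⟶-≼ {s} {l} {l'} h h') (⟶-≼ {s} {l'} {l} h' h)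

  lim-any : ∀ s {l} z → z ≡ choose 0ℝ (Converges s) → Converges s l → z ≈ l
  lim-any s {l} z eq h = unique s {z} {l} (limit-any s {l} z eq h) h

  lim-spec : ∀ s {l} → Converges s l → lim s ≈ l
  lim-spec s {l} h = lim-any s {l} (lim s) refl h

  exp-any : ∀ x z (s : ℕ → ℝ) → (∀ n → Represents (s n) (λ m → sum n (term (at x m)))) → z ≡ lim s → z ≈ X x
  exp-any x z s rep z≡ = subst (_≈ X x) (sym z≡) (lim-spec s {X x} (⟶-X x s rep))

  divide-intro : (P : (ℝ → ℝ → ℝ) → Set) → P (R._/_ em) → P divide
  divide-intro P p = p

  exp-limit : ∀ x → exp x ≡ lim (λ n → R.sum (map (λ k → R._/_ em (x R.^ℕ k) (fromℕ (k !))) (upTo n)))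
  exp-limit x = refl

  exp≈X : ∀ x → exp x ≈ X x
  exp≈X x = exp-any x (exp x) (λ n → R.sum (map (λ k → divide (x R.^ℕ k) (fromℕ (k !))) (upTo n))) (exp-represents x)
    (divide-intro (λ d → exp x ≡ lim (λ n → R.sum (map (λ k → d (x R.^ℕ k) (fromℕ (k !))) (upTo n)))) (exp-limit x))

  exp-intro : (P : (ℝ → ℝ) → Set) → P (R.exp em) → P exp
  exp-intro P p = p

  log-choice : ∀ x → log x ≡ choose 0ℝ (λ y → R.exp em y ≈ x)
  log-choice x = refl

  log-any : ∀ x z → z ≡ choose 0ℝ (λ y → exp y ≈ x) → ∃[ y ] X y ≈ x → X z ≈ x
  log-any x z eq (y , Xy) = ≈-trans {X z} {exp z} {x} (≈-sym {exp z} {X z} (exp≈X z))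
    (choose-any 0ℝ (λ y → exp y ≈ x) z eq (y , ≈-trans {exp y} {X y} {x} (exp≈X y) Xy))

  log-spec : ∀ x → 1ℝ ≼ x → X (log x) ≈ x
  log-spec x 1≼x = log-any x (log x) (exp-intro (λ e → log x ≡ choose 0ℝ (λ y → e y ≈ x)) (log-choice x)) (Preimage.y ≼-total x 1≼x , Preimage.Xy≈x ≼-total x 1≼x)

  power-unfold : ∀ x y → power x y ≡ R.exp em (y R.* R.log em x)
  power-unfold x y = refl

  exp-log-intro : (P : (ℝ → ℝ) → (ℝ → ℝ) → Set) → P (R.exp em) (R.log em) → P exp log
  exp-log-intro P p = p

  power≈X : ∀ x y → power x y ≈ X (y R.* log x)
  power≈X x y = subst (_≈ X (y R.* log x)) (sym (exp-log-intro (λ exp log → power x y ≡ exp (y R.* log x)) (power-unfold x y))) (exp≈X (y R.* log x))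

  reciprocal-any : ∀ v z → z ≡ choose 0ℝ (λ y → (v R.* y) ≈ 1ℝ) → ∃[ w ] (v R.* w) ≈ 1ℝ → (v R.* z) ≈ 1ℝ
  reciprocal-any v z = choose-any 0ℝ (λ y → (v R.* y) ≈ 1ℝ) z

  reciprocal-spec : ∀ v → ∃[ w ] (v R.* w) ≈ 1ℝ → (v R.* reciprocal v) ≈ 1ℝ
  reciprocal-spec v = reciprocal-any v (reciprocal v) refl

  floor-spec : ∀ z → 0ℝ ≼ z → fromℕ (floor z) R.≤ z × z R.< fromℕ (suc (floor z))
  floor-spec z z≥0 = choose-any 0 (λ n → fromℕ n R.≤ z × z R.< fromℕ (suc n)) (floor z) refl exists
    where
    Floor : ℕ → Set
    Floor n = fromℕ n R.≤ z × z R.< fromℕ (suc n)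
    B₀ : ℕ
    B₀ = proj₁ (bound⁺ z)
    search : ∀ j → ∃ Floor ⊎ fromℕ j ≼ z
    search = ℕ-rec (λ j → ∃ Floor ⊎ fromℕ j ≼ z) (inj₂ z≥0) λ { j (inj₁ found) → inj₁ found ; j (inj₂ le) → step j le }
      where
      step : ∀ j → fromℕ j ≼ z → ∃ Floor ⊎ fromℕ (suc j) ≼ z
      step j le with em {P = z R.< fromℕ (suc j)}
      ... | yes z< = inj₁ (j , ≼⇒≤ {fromℕ j} {z} le , z<)
      ... | no  z≮ = inj₂ (≤⇒≼ {fromℕ (suc j)} {z} z≮)
    impossible : fromℕ (suc B₀) ≼ z → ⊥
    impossible le = N.<⇒≱ (N.n<1+n B₀) (nat-cancel (≼-ℚ {nat (suc B₀)} {nat B₀} (chain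
      ρ (nat (suc B₀)) ∼˘⟨ fromℕ≈ (suc B₀) ⟩
      fromℕ (suc B₀) ≼⟨ le ⟩
      z ≼⟨ ≼-bound⁺ z ⟩
      ρ (nat B₀) □)))
    exists : ∃ Floor
    exists with search (suc B₀)
    ... | inj₁ found = found
    ... | inj₂ le = ⊥-elim (impossible le)

  ≤-floor : ∀ Q z → fromℕ Q ≼ z → Q N.≤ floor z
  ≤-floor Q z le = N.≤-pred (N.≰⇒> λ 1+fl≤Q → ≼⇒≤ {fromℕ (suc (floor z))} {z}
    (chain fromℕ (suc (floor z)) ≼⟨ fromℕ-mono {suc (floor z)} 1+fl≤Q ⟩ fromℕ Q ≼⟨ le ⟩ z □)
    (proj₂ (floor-spec z (chain 0ℝ ≼⟨ 0≼fromℕ Q ⟩ fromℕ Q ≼⟨ le ⟩ z □))))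

  ≼-join : ∀ x y → x ≼ join x y × y ≼ join x y
  ≼-join x y with em {P = x R.≤ y}
  ... | yes x≤y = ≤⇒≼ {x} {y} x≤y , ≼-refl {y}
  ... | no  x≰y = ≼-refl {x} , [ (λ x≼y → ⊥-elim (x≰y (≼⇒≤ {x} {y} x≼y))) , id ]′ (≼-total x y)

  max-foldr : max ≡ foldr join 0ℝ
  max-foldr = refl

  open Maximum join max max-foldr (λ x y → proj₁ (≼-join x y)) (λ x y → proj₂ (≼-join x y))

  log-spec-ℕ : ∀ n → 1 N.≤ n → X (log (fromℕ n)) ≈ fromℕ n
  log-spec-ℕ n 1≤n = log-spec (fromℕ n) (fromℕ-mono {1} 1≤n)

  divide-≼ : ∀ {x C a v} → x ≼ (C R.* divide a v) → x ≼ (C R.* (a R.* reciprocal v))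
  divide-≼ {x} {C} {a} {v} h = chain x ≼⟨ h ⟩ C R.* divide a v ∼⟨ *-cong-≈ {C} {C} {divide a v} {a R.* reciprocal v} (≈-refl {C}) (/≈* a v) ⟩ C R.* (a R.* reciprocal v) □

  -- This puts log N into the range where its own logarithm is known to exist, as (log N)^A = X (A
  -- log log N) requires.
  1≼log : ∀ l N → 1 N.≤ N → nat 2 ≤ H N → X l ≈ fromℕ N → 1ℝ ≼ l
  1≼log l N 1≤N 2≤H Xl = chain
    1ℝ ≼⟨ 1≼H-1 N 2≤H ⟩
    ρ (H N - 1#) ≼⟨ Logarithm.H-1≼log {l} {N} Xl 1≤N ⟩
    l □

  inverse : ∀ l v A → 1ℝ ≼ l → v ≈ X (fromℕ A R.* log l) → (v R.* reciprocal v) ≈ 1ℝ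
  inverse l v A 1≼l v≈ = reciprocal-spec v (PowerBounds.invertible {v} {log l} {l} A v≈ (log-spec l 1≼l))

  bound-any : ∀ num den A N c C ϑ l v M → 1 N.≤ den → 1 N.≤ N → nat 2 ≤ H N → C ≼ fromℕ c → ϑ ≈ ρ (nat num * inv den) → X l ≈ fromℕ N → v ≈ X (fromℕ A R.* log l) →
    (∀ Q → fromℕ Q ≼ X (ϑ R.* l) → Q N.≤ M) →
    ∀ (worst : ℕ → ℝ) (E : ℕ → ℚ) {δ} → 0# ≤ δ → Nonneg E → (∀ q → 0ℝ ≼ worst q) → (∀ q → 1 N.≤ q → ρ (E q - δ) ≼ worst q) →
    abs (R.sum (map worst [1⋯ M ])) R.≤ (C R.* divide (fromℕ N) v) →
    ∀ Q → Q N.^ den N.≤ N N.^ num → nat Q * δ * H N ^ A ≤ nat N → sum Q (E ∘ suc) * H N ^ A ≤ nat (2 N.^ A N.* suc c) * nat N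
  bound-any num den A N c C ϑ l v M 1≤den 1≤N 2≤H C≼c ϑ≈ Xl v≈ ≤M worst E {δ} δ≥0 E≥0 F≥0 F≥ h =
    AtLevel.bound num den A N c C ϑ l (log l) v (reciprocal v) M 1≤den 1≤N 2≤H C≼c ϑ≈ Xl (log-spec l (1≼log l N 1≤N 2≤H Xl)) v≈
      (inverse l v A (1≼log l N 1≤N 2≤H Xl) v≈) (λ Q 1≤Q → log (fromℕ Q) , log-spec-ℕ Q 1≤Q) ≤M worst E {δ} δ≥0 E≥0 F≥0 F≥
      (divide-≼ {R.sum (map worst [1⋯ M ])} {C} {fromℕ N} {v} (chain
        R.sum (map worst [1⋯ M ]) ≼⟨ proj₁ (∣-∣≽ (R.sum (map worst [1⋯ M ]))) ⟩
        abs (R.sum (map worst [1⋯ M ])) ≼⟨ ≤⇒≼ {abs (R.sum (map worst [1⋯ M ]))} {C R.* divide (fromℕ N) v} h ⟩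
        C R.* divide (fromℕ N) v □))

  bound : ∀ num den A N c C ϑ → 1 N.≤ den → 1 N.≤ N → nat 2 ≤ H N → C ≼ fromℕ c → ϑ ≈ ρ (nat num * inv den) →
    ∀ (worst : ℕ → ℝ) (E : ℕ → ℚ) {δ} → 0# ≤ δ → Nonneg E → (∀ q → 0ℝ ≼ worst q) → (∀ q → 1 N.≤ q → ρ (E q - δ) ≼ worst q) →
    abs (R.sum (map worst [1⋯ floor (power (fromℕ N) ϑ) ])) R.≤ (C R.* divide (fromℕ N) (power (log (fromℕ N)) (fromℕ A))) →
    ∀ Q → Q N.^ den N.≤ N N.^ num → nat Q * δ * H N ^ A ≤ nat N → sum Q (E ∘ suc) * H N ^ A ≤ nat (2 N.^ A N.* suc c) * nat N
  bound num den A N c C ϑ 1≤den 1≤N 2≤H C≼c ϑ≈ =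
    bound-any num den A N c C ϑ (log (fromℕ N)) (power (log (fromℕ N)) (fromℕ A)) (floor (power (fromℕ N) ϑ)) 1≤den 1≤N 2≤H C≼c ϑ≈
      (log-spec-ℕ N 1≤N) (power≈X (log (fromℕ N)) (fromℕ A))
      (λ Q le → ≤-floor Q (power (fromℕ N) ϑ) (chain fromℕ Q ≼⟨ le ⟩ X (ϑ R.* log (fromℕ N)) ∼˘⟨ power≈X (fromℕ N) ϑ ⟩ power (fromℕ N) ϑ □))

  -- Condition (A) at fixed ε and A with the classical functions as parameters, so that all of them
  -- can be renamed at once by `bound-intro`.
  PrimeBound : (ℝ → ℝ) → (ℝ → ℝ → ℝ) → (List ℝ → ℝ) → (ℝ → ℕ) → (ℝ → ℝ → ℝ) → (ℝ → ℝ) → (ℕ → ℕ → ℕ → ℝ) → ℝ → ℝ → Set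
  PrimeBound abs divide max floor power log classSum ϑ A = ∃[ C ] ∃[ N₀ ] ∀ N → N₀ N.≤ N →
    abs (R.sum (map (λ q → max (map (λ a → abs (classSum N q a R.- divide (fromℕ N) (fromℕ (φ q)))) (filter (λ a → coprime? a q) (upTo q)))) [1⋯ floor (power (fromℕ N) ϑ) ]))
      R.≤ (C R.* divide (fromℕ N) (power (log (fromℕ N)) A))

  LiouvilleBound : (ℝ → ℝ) → (ℝ → ℝ → ℝ) → (List ℝ → ℝ) → (ℝ → ℕ) → (ℝ → ℝ → ℝ) → (ℝ → ℝ) → (ℕ → ℕ → ℕ → ℝ) → ℝ → ℝ → Set
  LiouvilleBound abs divide max floor power log classSum ϑ A = ∃[ C ] ∃[ N₀ ] ∀ N → N₀ N.≤ N →
    abs (R.sum (map (λ q → max (map (λ y → max (map (λ a → abs (classSum y q a)) (upTo q))) [1⋯ N ])) [1⋯ floor (power (fromℕ N) ϑ) ]))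
      R.≤ (C R.* divide (fromℕ N) (power (log (fromℕ N)) A))

  primes-bounded : ∀ ϑ → R.PrimesHaveLevel em ϑ → ∀ ε A → 0ℝ R.< ε → 0ℝ R.< A →
    PrimeBound (R.∣_∣ em) (R._/_ em) (R.max em) (R.⌊_⌋ em) (R._^_ em) (R.log em) (R.primeLogSum em) (ϑ R.- ε) A
  primes-bounded ϑ h = h

  liouville-bounded : ∀ ϑ → R.LiouvilleHasLevel em ϑ → ∀ ε A → 0ℝ R.< ε → 0ℝ R.< A →
    LiouvilleBound (R.∣_∣ em) (R._/_ em) (R.max em) (R.⌊_⌋ em) (R._^_ em) (R.log em) (R.liouvilleSum em) (ϑ R.- ε) A
  liouville-bounded ϑ h = h

  bound-intro : (P : (ℝ → ℝ) → (ℝ → ℝ → ℝ) → (List ℝ → ℝ) → (ℝ → ℕ) → (ℝ → ℝ → ℝ) → (ℝ → ℝ) → (ℕ → ℕ → ℕ → ℝ) → (ℕ → ℕ → ℕ → ℝ) → Set) →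
    P (R.∣_∣ em) (R._/_ em) (R.max em) (R.⌊_⌋ em) (R._^_ em) (R.log em) (R.primeLogSum em) (R.liouvilleSum em) →
    P abs divide max floor power log primeLogSum liouvilleSum
  bound-intro P p = p

  primes-bounded' : ∀ ϑ ε A → 0ℝ R.< ε → 0ℝ R.< A → R.PrimesHaveLevel em ϑ → PrimeBound abs divide max floor power log primeLogSum (ϑ R.- ε) A
  primes-bounded' ϑ ε A ε>0 A>0 h = bound-intro (λ abs divide max floor power log classSum _ → PrimeBound abs divide max floor power log classSum (ϑ R.- ε) A) (primes-bounded ϑ h ε A ε>0 A>0)

  liouville-bounded' : ∀ ϑ ε A → 0ℝ R.< ε → 0ℝ R.< A → R.LiouvilleHasLevel em ϑ → LiouvilleBound abs divide max floor power log liouvilleSum (ϑ R.- ε) A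
  liouville-bounded' ϑ ε A ε>0 A>0 h = bound-intro (λ abs divide max floor power log _ classSum → LiouvilleBound abs divide max floor power log classSum (ϑ R.- ε) A) (liouville-bounded ϑ h ε A ε>0 A>0)

  divide-near : ∀ n d → 1 N.≤ d → divide (fromℕ n) (fromℕ d) ≈ ρ (nat n * inv d)
  divide-near n d 1≤d = ≈-trans {divide (fromℕ n) (fromℕ d)} {fromℕ n R.* ρ (inv d)} {ρ (nat n * inv d)} (/-fromℕ (fromℕ n) d 1≤d)
    (fromℕ*fromℚ n (inv d))

  module PrimeSums (N : ℕ) {η : ℚ} (η>0 : 0# < η) where

    ℓ : ℕ → ℚ
    ℓ zero = 0#
    ℓ (suc n) = LowerApproximation.approximant (log (fromℕ (suc n))) η>0

    ℓ≥0 : Nonneg ℓ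
    ℓ≥0 zero = ≤-refl
    ℓ≥0 (suc n) = LowerApproximation.approximant≥0 (log (fromℕ (suc n))) η>0

    ℓ≤H : ∀ n → n N.≤ N → ℓ n ≤ H N
    ℓ≤H zero    _ = 0≤H N
    ℓ≤H (suc n) n≤N = LowerApproximation.approximant-≤ (log (fromℕ (suc n))) η>0 {H N} (0≤H N)
      (Logarithm.log≼H' {log (fromℕ (suc n))} {suc n} (log-spec-ℕ (suc n) (s≤s z≤n)) N n≤N)

    ℓ-near : ∀ n → 1 N.≤ n → Near (log (fromℕ n)) (ℓ n) η
    ℓ-near (suc n) 1≤n = LowerApproximation.approximant-near (log (fromℕ (suc n))) η>0 (Logarithm.0≼log {log (fromℕ (suc n))} {suc n} (log-spec-ℕ (suc n) 1≤n) 1≤n)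

    open PrimeMaximum ℓ N public

    primes : ℕ → ℕ → List ℕ
    primes q a = filter (λ p → prime? p ×-dec p ≡? a [mod q ]) [1⋯ N ]

    logSum : ℕ → ℕ → ℝ
    logSum q a = R.sum (map (λ p → log (fromℕ p)) (primes q a))

    list-near : ∀ q a → Near (logSum q a) (primeClassSum ℓ N q a) (nat N * η)
    list-near q a = subst (λ r → Near (logSum q a) r (nat N * η)) (listSum q a)
      (near-weaken (*-monoʳ-≤ (<⇒≤ η>0) (nat-mono ((length-filter (λ p → prime? p ×-dec p ≡? a [mod q ]) [1⋯ N ]) ◃ N.≤-reflexive (length-[1⋯] N))))
        (near-sum (λ p → log (fromℕ p)) ℓ {η} (1 N.≤_) ℓ-near (primes q a) (positive q a)))

    sum-near : ∀ q a → Near (primeLogSum N q a) (primeClassSum ℓ N q a) (nat N * η)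
    sum-near q a = near-≼ {logSum q a} {primeLogSum N q a}
      (pointwise-≼ {primeLogSum N q a} {logSum q a} λ m → ≡⇒≤ refl)
      (pointwise-≼ {logSum q a} {primeLogSum N q a} λ m → ≡⇒≤ refl)
      (list-near q a)

    δ≥0 : 0# ≤ nat N * η
    δ≥0 = *-nonneg (0≤nat N) (<⇒≤ η>0)

    abs-near : ∀ z q a → 1 N.≤ q → Near z (primeClassSum ℓ N q a) (nat N * η) → ρ (discrepancy q a - nat N * η) ≼ abs (z R.- divide (fromℕ N) (fromℕ (φ q)))
    abs-near z q a 1≤q h = near-abs {w} {abs w} δ≥0 (proj₁ (∣-∣≽ w)) (proj₂ (∣-∣≽ w)) (near-minus {z} {divide (fromℕ N) (fromℕ (φ q))} h (divide-near N (φ q) (φ>0 q 1≤q)))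
      where
      w : ℝ
      w = z R.- divide (fromℕ N) (fromℕ (φ q))

    worst : ℕ → ℝ
    worst q = max (map (λ a → abs (primeLogSum N q a R.- divide (fromℕ N) (fromℕ (φ q)))) (filter (λ a → coprime? a q) (upTo q)))

    F≥0 : ∀ q → 0ℝ ≼ worst q
    F≥0 q = 0≼max (λ a → abs (primeLogSum N q a R.- divide (fromℕ N) (fromℕ (φ q)))) (filter (λ a → coprime? a q) (upTo q))

    F≥ : ∀ q → 1 N.≤ q → ρ (E q - nat N * η) ≼ worst q
    F≥ q 1≤q = maximum-≼ (λ a → abs (primeLogSum N q a R.- divide (fromℕ N) (fromℕ (φ q)))) (discrepancy q) δ≥0
      (λ a → abs-near (primeLogSum N q a) q a 1≤q (sum-near q a)) (filter (λ a → coprime? a q) (upTo q))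

    E≥0 : Nonneg E
    E≥0 q = 0≤maximum (filter (λ a → coprime? a q) (upTo q)) (discrepancy q)

  module LiouvilleSums (N : ℕ) where

    open LiouvilleMaximum N public

    exact : ∀ n → Near (R.fromℤ (liouville n)) (int (liouville n)) 0#
    exact n = near (pointwise-≼ {ρ (int (liouville n))} {R.fromℤ (liouville n)} λ m → ≡⇒≤ (sym (approx-ℤ (liouville n) m)))
      (pointwise-≼ {R.fromℤ (liouville n)} {ρ (int (liouville n) + 0#)} λ m → ≡⇒≤ (approx-ℤ (liouville n) m · sym (+-identityʳ _)))

    members : ℕ → ℕ → ℕ → List ℕ
    members y q a = filter (λ n → n ≡? a [mod q ]) [1⋯ y ]

    listSum' : ℕ → ℕ → ℕ → ℝ
    listSum' y q a = R.sum (map (λ n → R.fromℤ (liouville n)) (members y q a))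

    list-near : ∀ y q a → Near (listSum' y q a) (λ-classSum y q a) 0#
    list-near y q a = subst (λ r → Near (listSum' y q a) r 0#) (listSum y q a)
      (near-weaken (≡⇒≤ (*-zeroʳ (nat (length (members y q a))))) (near-sum (λ n → R.fromℤ (liouville n)) (λ n → int (liouville n)) {0#} (λ _ → ⊤) (λ n _ → exact n) (members y q a) (All.universal (λ _ → tt) (members y q a))))

    sum-near : ∀ y q a → Near (liouvilleSum y q a) (λ-classSum y q a) 0#
    sum-near y q a = near-≼ {listSum' y q a} {liouvilleSum y q a}
      (pointwise-≼ {liouvilleSum y q a} {listSum' y q a} λ m → ≡⇒≤ refl)
      (pointwise-≼ {listSum' y q a} {liouvilleSum y q a} λ m → ≡⇒≤ refl)
      (list-near y q a)

    worst : ℕ → ℝ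
    worst q = max (map (λ y → max (map (λ a → abs (liouvilleSum y q a)) (upTo q))) [1⋯ N ])

    F≥0 : ∀ q → 0ℝ ≼ worst q
    F≥0 q = 0≼max (λ y → max (map (λ a → abs (liouvilleSum y q a)) (upTo q))) [1⋯ N ]

    F≥ : ∀ q → 1 N.≤ q → ρ (E q - 0#) ≼ worst q
    F≥ q _ = maximum-≼ (λ y → max (map (λ a → abs (liouvilleSum y q a)) (upTo q))) (λ y → maximum (upTo q) (λ a → ∣ λ-classSum y q a ∣)) ≤-refl
      (λ y → maximum-≼ (λ a → abs (liouvilleSum y q a)) (λ a → ∣ λ-classSum y q a ∣) ≤-refl
        (λ a → near-abs {liouvilleSum y q a} {abs (liouvilleSum y q a)} ≤-refl (proj₁ (∣-∣≽ (liouvilleSum y q a))) (proj₂ (∣-∣≽ (liouvilleSum y q a))) (sum-near y q a)) (upTo q)) [1⋯ N ]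

    E≥0 : Nonneg E
    E≥0 q = 0≤maximum [1⋯ N ] (λ y → maximum (upTo q) (λ a → ∣ λ-classSum y q a ∣))

  module Exponent (num den : ℕ) (1≤den : 1 N.≤ den) (ϑ : ℝ) (ϑ≈ : ϑ ≈ ρ (nat num * inv den)) where

    bounded-by : ∀ C → ∃[ c ] C ≼ fromℕ c
    bounded-by C = proj₁ (bound⁺ C) , (chain C ≼⟨ ≼-bound⁺ C ⟩ ρ (nat (proj₁ (bound⁺ C))) ∼˘⟨ fromℕ≈ (proj₁ (bound⁺ C)) ⟩ fromℕ (proj₁ (bound⁺ C)) □)

    N₁ : ℕ
    N₁ = proj₁ (H-unbounded (nat 2))

    1≤N : ∀ {N₀ N} → N₀ N.+ N₁ N.≤ N → 1 N.≤ N
    1≤N {N₀} le = proj₁ (proj₂ (H-unbounded (nat 2))) ◃ N.m≤n+m N₁ N₀ ◃ le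

    2≤H : ∀ {N₀ N} → N₀ N.+ N₁ N.≤ N → nat 2 ≤ H N
    2≤H {N₀} le = proj₂ (proj₂ (H-unbounded (nat 2))) ◂ H-mono (N.m≤n+m N₁ N₀ ◃ le)

    prime-level : ∀ A c C N → C ≼ fromℕ c → 1 N.≤ N → nat 2 ≤ H N →
      abs (R.sum (map (λ q → max (map (λ a → abs (primeLogSum N q a R.- divide (fromℕ N) (fromℕ (φ q)))) (filter (λ a → coprime? a q) (upTo q)))) [1⋯ floor (power (fromℕ N) ϑ) ]))
        R.≤ (C R.* divide (fromℕ N) (power (log (fromℕ N)) (fromℕ (suc A)))) →
      PrimeLevel num den A (2 N.^ suc A N.* suc c) N
    prime-level A c C N C≼c 1≤N 2≤H h = level (subst (λ k → 0# < inv k) (N.suc-pred K {{K≢0}}) (0<inv (N.pred K)))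
      where
      K : ℕ
      -- The rational logarithms have precision 1 / K, as fine as `small-error` asks.
      K = N N.^ num N.* N N.^ suc A
      K≢0 : NonZero K
      K≢0 = N.m*n≢0 (N N.^ num) (N N.^ suc A) {{N.m^n≢0 N num {{N.>-nonZero 1≤N}}}} {{N.m^n≢0 N (suc A) {{N.>-nonZero 1≤N}}}}
      level : 0# < inv K → PrimeLevel num den A (2 N.^ suc A N.* suc c) N
      level η>0 = record
        { ℓ = PrimeSums.ℓ N η>0 ; ℓ≥0 = PrimeSums.ℓ≥0 N η>0 ; ℓ≤H = PrimeSums.ℓ≤H N η>0
        ; E = PrimeMaximum.E (PrimeSums.ℓ N η>0) N ; E≥0 = PrimeSums.E≥0 N η>0
        ; class = PrimeMaximum.E-class (PrimeSums.ℓ N η>0) N ; attained = PrimeMaximum.E-attained (PrimeSums.ℓ N η>0) N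
        ; total = λ Q Q≤ → weaken-exponent A N (sum-nonneg Q λ i _ → PrimeSums.E≥0 N η>0 (suc i)) 1≤N
            (bound num den (suc A) N c C ϑ 1≤den 1≤N 2≤H C≼c ϑ≈
              (λ q → max (map (λ a → abs (primeLogSum N q a R.- divide (fromℕ N) (fromℕ (φ q)))) (filter (λ a → coprime? a q) (upTo q))))
              (PrimeMaximum.E (PrimeSums.ℓ N η>0) N) (PrimeSums.δ≥0 N η>0) (PrimeSums.E≥0 N η>0) (PrimeSums.F≥0 N η>0) (PrimeSums.F≥ N η>0)
              h Q Q≤ (small-error num den (suc A) N Q 1≤den 1≤N Q≤ (0≤H N) (H≤n N))) }

    liouville-level : ∀ A c C N → C ≼ fromℕ c → 1 N.≤ N → nat 2 ≤ H N →
      abs (R.sum (map (λ q → max (map (λ y → max (map (λ a → abs (liouvilleSum y q a)) (upTo q))) [1⋯ N ])) [1⋯ floor (power (fromℕ N) ϑ) ]))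
        R.≤ (C R.* divide (fromℕ N) (power (log (fromℕ N)) (fromℕ (suc A)))) →
      LiouvilleLevel num den A (2 N.^ suc A N.* suc c) N
    liouville-level A c C N C≼c 1≤N 2≤H h = record
      { E = LiouvilleMaximum.E N ; E≥0 = LiouvilleSums.E≥0 N ; class = LiouvilleMaximum.E-class N ; attained = LiouvilleMaximum.E-attained N
      ; total = λ Q Q≤ → weaken-exponent A N (sum-nonneg Q λ i _ → LiouvilleSums.E≥0 N (suc i)) 1≤N
          (bound num den (suc A) N c C ϑ 1≤den 1≤N 2≤H C≼c ϑ≈
            (λ q → max (map (λ y → max (map (λ a → abs (liouvilleSum y q a)) (upTo q))) [1⋯ N ]))
            (LiouvilleMaximum.E N) ≤-refl (LiouvilleSums.E≥0 N) (LiouvilleSums.F≥0 N) (LiouvilleSums.F≥ N)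
            h Q Q≤ (≡⇒≤ (cong (_* H N ^ suc A) (*-zeroʳ (nat Q)) · *-zeroˡ _) ◂ 0≤nat N)) }

    prime-levels : ∀ A → PrimeBound abs divide max floor power log primeLogSum ϑ (fromℕ (suc A)) → ∃[ C ] ∃[ N₀ ] ∀ N → N₀ N.≤ N → PrimeLevel num den A C N
    prime-levels A (C , N₀ , h) = 2 N.^ suc A N.* suc (proj₁ (bounded-by C)) , N₀ N.+ N₁ , λ N le →
      prime-level A (proj₁ (bounded-by C)) C N (proj₂ (bounded-by C)) (1≤N le) (2≤H le) (h N (N.m≤m+n N₀ N₁ ◃ le))

    liouville-levels : ∀ A → LiouvilleBound abs divide max floor power log liouvilleSum ϑ (fromℕ (suc A)) → ∃[ C ] ∃[ N₀ ] ∀ N → N₀ N.≤ N → LiouvilleLevel num den A C N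
    liouville-levels A (C , N₀ , h) = 2 N.^ suc A N.* suc (proj₁ (bounded-by C)) , N₀ N.+ N₁ , λ N le →
      liouville-level A (proj₁ (bounded-by C)) C N (proj₂ (bounded-by C)) (1≤N le) (2≤H le) (h N (N.m≤m+n N₀ N₁ ◃ le))

  prime-levels-from : ∀ num den ϑ ε A → 1 N.≤ den → 0ℝ R.< ε → 0ℝ R.< fromℕ (suc A) → (ϑ R.- ε) ≈ ρ (nat num * inv den) → R.PrimesHaveLevel em ϑ →
    ∃[ C ] ∃[ N₀ ] ∀ N → N₀ N.≤ N → PrimeLevel num den A C N
  prime-levels-from num den ϑ ε A 1≤den ε>0 A>0 ϑ≈ hyp = Exponent.prime-levels num den 1≤den (ϑ R.- ε) ϑ≈ A (primes-bounded' ϑ ε (fromℕ (suc A)) ε>0 A>0 hyp)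

  liouville-levels-from : ∀ num den ϑ ε A → 1 N.≤ den → 0ℝ R.< ε → 0ℝ R.< fromℕ (suc A) → (ϑ R.- ε) ≈ ρ (nat num * inv den) → R.LiouvilleHasLevel em ϑ →
    ∃[ C ] ∃[ N₀ ] ∀ N → N₀ N.≤ N → LiouvilleLevel num den A C N
  liouville-levels-from num den ϑ ε A 1≤den ε>0 A>0 ϑ≈ hyp = Exponent.liouville-levels num den 1≤den (ϑ R.- ε) ϑ≈ A (liouville-bounded' ϑ ε (fromℕ (suc A)) ε>0 A>0 hyp)

  -- With ε = ϑ − num / den the sums in the hypotheses run up to N ^ (num / den).
  prime-levels : ∀ num den ϑ → 1 N.≤ den → ρ (nat num * inv den) R.< ϑ → R.PrimesHaveLevel em ϑ → ∀ A → ∃[ C ] ∃[ N₀ ] ∀ N → N₀ N.≤ N → PrimeLevel num den A C N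
  prime-levels num den ϑ 1≤den ϑ> hyp A = prime-levels-from num den ϑ (ϑ R.- ρ (nat num * inv den)) A 1≤den
    (0<y-x {ρ (nat num * inv den)} {ϑ} ϑ>) (0<fromℕ-suc A) (y-[y-x]≈x (ρ (nat num * inv den)) ϑ) hyp

  liouville-levels : ∀ num den ϑ → 1 N.≤ den → ρ (nat num * inv den) R.< ϑ → R.LiouvilleHasLevel em ϑ → ∀ A → ∃[ C ] ∃[ N₀ ] ∀ N → N₀ N.≤ N → LiouvilleLevel num den A C N
  liouville-levels num den ϑ 1≤den ϑ> hyp A = liouville-levels-from num den ϑ (ϑ R.- ρ (nat num * inv den)) A 1≤den
    (0<y-x {ρ (nat num * inv den)} {ϑ} ϑ>) (0<fromℕ-suc A) (y-[y-x]≈x (ρ (nat num * inv den)) ϑ) hyp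

  level : ∀ num k ϑ₀ → ϑ₀ ≡ nat num * inv 1000 → ∃[ ϑ ] (ρ ϑ₀ R.< ϑ × R.PrimesHaveLevel em ϑ × R.LiouvilleHasLevel em ϑ) → Level num k
  level num k ϑ₀ refl (ϑ , ϑ> , primes , liouvilles) = prime-levels num 1000 ϑ (s≤s z≤n) ϑ> primes , liouville-levels num 1000 ϑ (s≤s z≤n) ϑ> liouvilles

  theorem : (ϑ₀ : ℚ) (k : ℕ) → (ϑ₀ , k) ∈ R.levelPairs →
    ∃[ ϑ ] (ρ ϑ₀ R.< ϑ × R.PrimesHaveLevel em ϑ × R.LiouvilleHasLevel em ϑ) →
    (h : Fin k → ℕ) → R.IsIncreasing h → R.Admissible h →
    (r : Z.ℤ) → r ≢ Z.0ℤ → (∀ i → r ≢ Z.+ h i) →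
    R.InfinitelyMany (λ n →
      R.AtLeastTwoPrimes h n ⊎
      ((∃[ i ] R.IsPrime (n Z.+ (Z.+ h i))) × R.HasLiouville-1 (n Z.+ r)))
  theorem _ _ (here refl) hyp h inc adm r _ _ =
    conclude (λ A → em {A}) 729 599 481 0 1648 check₂ tt tt (level 729 2 _ ϑ₂ hyp) h inc adm r
  theorem _ _ (there (here refl)) hyp h inc adm r _ _ =
    conclude (λ A → em {A}) 616 2399 767 1 7794 check₃ tt tt (level 616 3 _ ϑ₃ hyp) h inc adm r
  theorem _ _ (there (there (here refl))) hyp h inc adm r _ _ =
    conclude (λ A → em {A}) 554 5599 990 2 20219 check₄ tt tt (level 554 4 _ ϑ₄ hyp) h inc adm r
  theorem _ _ (there (there (there (here refl)))) hyp h inc adm r _ _ =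
    conclude (λ A → em {A}) 515 6399 727 3 24857 check₅ tt tt (level 515 5 _ ϑ₅ hyp) h inc adm r

theorem5 : (em : ExcludedMiddle 0ℓ) →
    (ϑ₀ : ℚ) (k : ℕ) → (ϑ₀ , k) ∈ R.levelPairs →
    ∃[ ϑ ] (R.fromℚ ϑ₀ R.< ϑ × R.PrimesHaveLevel em ϑ × R.LiouvilleHasLevel em ϑ) →
    (h : Fin k → ℕ) → IsIncreasing h → Admissible h →
    (r : ℤ) → r ≢ Z.0ℤ → (∀ i → r ≢ Z.+ h i) →
    R.InfinitelyMany (λ n →
      AtLeastTwoPrimes h n ⊎
      ((∃[ i ] IsPrime (n Z.+ (Z.+ h i))) × HasLiouville-1 (n Z.+ r)))
theorem5 = theorem
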